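{- Let $p$ be a prime and let $A$ be a multiset of elements of $\mathbb{Z}_p^2$ with $|A|=2p-2$ (counted with multiplicity). Let $m_1\geq m_2\geq m_3$ be the three largest multiplicities of elements occurring in $A$, and suppose $m_1\leq p-3$. Suppose moreover that at least one of the following holds: (1) $p\leq 23$; (2) $m_2\geq 2p/3$ and $m_1+m_2\geq 2p-14$; (3) $p\leq 37$ and $m_1+m_2+m_3\geq 2p-5$. Then $A$ contains a zero-sum. Moreover, the integers $8$, $9$ and $10$ satisfy property B.
   Context: $\mathbb{Z}_n=\mathbb{Z}/n\mathbb{Z}$. A multiset $A$ in an abelian group contains a zero-sum if there is a non-empty sub-multiset of $A$ whose elements sum to $0$, and is zero-sum free otherwise. A zero-sum free multiset $A\subseteq\mathbb{Z}_n^2$ is maximal if it has $2n-2$ elements (counted with multiplicity). An integer $n\geq 2$ satisfies property B if in every zero-sum free multiset of $2n-2$ elements of $\mathbb{Z}_n^2$ some element occurs with multiplicity at least $n-2$. -}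

module Defs where

open import Data.Nat using (ℕ; zero; suc; _+_; _∸_; _*_; _≤_)
open import Data.Nat.Divisibility using (_∣_)
open import Data.Fin using (Fin; toℕ; zero; suc)
open import Data.Fin.Properties using () renaming (_≟_ to _≟ᶠ_)
open import Data.Product using (_×_; _,_; proj₁; proj₂; ∃)
open import Data.Product.Properties using (≡-dec)
open import Data.Bool using (Bool; true; false)
open import Relation.Nullary using (¬_; yes; no)
open import Relation.Binary.PropositionalEquality using (_≡_)

Zn² : ℕ → Set
Zn² n = Fin n × Fin n

-- A multiset of k elements of ℤ_n², given as an indexed family (an enumeration
-- of the elements with repetition).
Multiset : ℕ → ℕ → Set
Multiset n k = Fin k → Zn² n

-- A sub-multiset is a selection of indices.
Selection : ℕ → Set
Selection k = Fin k → Bool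

NonEmpty : ∀ {k} → Selection k → Set
NonEmpty s = ∃ λ i → s i ≡ true

sumSel : ∀ {k} → (Fin k → ℕ) → Selection k → ℕ
sumSel {zero}  f s = 0
sumSel {suc k} f s with s zero
... | true  = f zero + sumSel (λ i → f (suc i)) (λ i → s (suc i))
... | false = sumSel (λ i → f (suc i)) (λ i → s (suc i))

HasZeroSum : ∀ {n k} → Multiset n k → Set
HasZeroSum {n} A = ∃ λ s → NonEmpty s
  × (n ∣ sumSel (λ i → toℕ (proj₁ (A i))) s)
  × (n ∣ sumSel (λ i → toℕ (proj₂ (A i))) s)

ZeroSumFree : ∀ {n k} → Multiset n k → Set
ZeroSumFree A = ¬ HasZeroSum A

mult : ∀ {n k} → Multiset n k → Zn² n → ℕ
mult {n} {zero}  A x = 0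
mult {n} {suc k} A x with ≡-dec _≟ᶠ_ _≟ᶠ_ (A zero) x
... | yes _ = suc (mult (λ i → A (suc i)) x)
... | no  _ = mult (λ i → A (suc i)) x

PropertyB : ℕ → Set
PropertyB n = (A : Multiset n (2 * n ∸ 2)) → ZeroSumFree A → ∃ λ x → n ∸ 2 ≤ mult A x

{-# OPTIONS --safe #-}
-- Adding −σ(A) to a zero-sum free A of length 2n − 2 gives a minimal zero-sum sequence U
-- of length 2n − 1. In the group algebra of (ℤ/p)² over ℤ/p a product of 2p − 1 factors
-- 1 − X^g vanishes, so expanding products over parts of U yields symmetric multilinear
-- forms with prescribed values on the elements of U: distinct elements are linearly
-- independent, and with θ_g = (1 − X^g)/(1 + X^g), which satisfies the addition law of
-- tanh, the forms of degree 4 and 2 on u, u, v, w, z force all but one of the values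
-- onto an affine line missing 0. Counting along that line gives an element of multiplicity
-- p − 1; three distinct values are treated by comparing sums of squares. Modulo 8 and 9
-- the linear form restricts the classes modulo 2 and 3 enough for an exhaustive search in
-- coordinates given by the two most frequent independent classes. Modulo 10 subsequences
-- with even sum are handled in the group algebra of (ℤ/5)²: a parity class with two
-- distinct values lies on an affine line modulo 5, which leaves a small search.

module Submission where

open import Defs
open import Data.Product using (_×_; _,_; proj₁; proj₂; ∃; ∃₂)
open import Data.Sum using (_⊎_; inj₁; inj₂; [_,_]′)
open import Data.Empty using (⊥; ⊥-elim)
open import Relation.Binary.PropositionalEquality using (_≡_; _≢_; refl; sym; trans; cong; cong₂; subst)
open import Relation.Nullary using (¬_; yes; no; Dec)
import Data.Nat.Properties as ℕₚ
import Data.Integer.Properties as ℤₚ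
open import Data.Nat.Primality using (Prime)
open import Data.Integer.Tactic.RingSolver using (solve-∀)
import Data.Nat.Divisibility as ℕ∣
open import Data.List.Membership.Propositional using (_∈_)

-- A minimal zero-sum sequence is convenient because only its empty and its full subsequence
-- contribute to the identity coefficient of a product of factors 1 ± X^g over it: the coefficient
-- is 1 plus a sign. With minus signs throughout, this yields only pairwise independence. More comes
-- from varying the signs: `θ g` is the quotient of the factor with minus by the factor with plus,
-- so a single weight serves all sign patterns on five terms. Taking out five terms leaves 2p - 6
-- factors, an even number, and makes degree five negligible; hence artanh matters only up to its
-- cubic term, and quadratic values involve quartic ones. The values of the forms on the basis u, v
-- are auxiliary unknowns, removed by explicit elimination certificates. Characteristic 2 and 3 lack
-- ½ or ⅓, so for 8 and 9 only linear forms are used; but there every residue is 0, 1 or -1, so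
-- distinct occurring classes are already independent. For 10 no local group algebra of the whole
-- group is at hand; blocks with even sum reduce the question to (ℤ/5)².

-- The group algebra of (ℤ/q)² over ℤ/p as a ring of commuting translation operators

module TranslationRing where

 open import Level using (0ℓ)
 open import Algebra using (CommutativeRing)
 open import Data.Nat as ℕ using (ℕ; zero)
 open import Data.Integer using (ℤ; +_; _+_; _*_; -_; _-_; 0ℤ; 1ℤ)
 open import Data.List using (List; []; _∷_; _++_; map)

 -- Integers modulo m

 infix 4 _≈[_]_
 -- The quotient is kept as data, so that each rule for congruences is one ring identity.
 record _≈[_]_ (a : ℤ) (m : ℕ) (b : ℤ) : Set where
  constructor mod-by
  field
   quotient : ℤ
   equality : a ≡ b + quotient * + m

 ≈-reflexive : ∀ {m a b} → a ≡ b → a ≈[ m ] b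
 ≈-reflexive {m} {a} refl = mod-by 0ℤ (lem a (+ m))
  where
  lem : ∀ a m → a ≡ a + 0ℤ * m
  lem = solve-∀

 ≈-refl : ∀ {m a} → a ≈[ m ] a
 ≈-refl = ≈-reflexive refl

 ≈-sym : ∀ {m a b} → a ≈[ m ] b → b ≈[ m ] a
 ≈-sym {m} {_} {b} (mod-by k refl) = mod-by (- k) (lem b k (+ m))
  where
  lem : ∀ b k m → b ≡ b + k * m + - k * m
  lem = solve-∀

 ≈-trans : ∀ {m a b c} → a ≈[ m ] b → b ≈[ m ] c → a ≈[ m ] c
 ≈-trans {m} {_} {_} {c} (mod-by k refl) (mod-by l refl) = mod-by (l + k) (lem c k l (+ m))
  where
  lem : ∀ c k l m → c + l * m + k * m ≡ c + (l + k) * m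
  lem = solve-∀

 +-cong-≈ : ∀ {m a b c d} → a ≈[ m ] b → c ≈[ m ] d → a + c ≈[ m ] b + d
 +-cong-≈ {m} {_} {b} {_} {d} (mod-by k refl) (mod-by l refl) = mod-by (k + l) (lem b d k l (+ m))
  where
  lem : ∀ b d k l m → b + k * m + (d + l * m) ≡ b + d + (k + l) * m
  lem = solve-∀

 *-cong-≈ : ∀ {m a b c d} → a ≈[ m ] b → c ≈[ m ] d → a * c ≈[ m ] b * d
 *-cong-≈ {m} {_} {b} {_} {d} (mod-by k refl) (mod-by l refl) =
  mod-by (b * l + k * d + k * l * + m) (lem b d k l (+ m))
  where
  lem : ∀ b d k l m → (b + k * m) * (d + l * m) ≡ b * d + (b * l + k * d + k * l * m) * m
  lem = solve-∀

 *-congˡ-≈ : ∀ {m} c {a b} → a ≈[ m ] b → c * a ≈[ m ] c * b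
 *-congˡ-≈ c = *-cong-≈ (≈-refl {a = c})

 neg-cong-≈ : ∀ {m a b} → a ≈[ m ] b → - a ≈[ m ] - b
 neg-cong-≈ {m} {_} {b} (mod-by k refl) = mod-by (- k) (lem b k (+ m))
  where
  lem : ∀ b k m → - (b + k * m) ≡ - b + - k * m
  lem = solve-∀

 m≈0 : ∀ m → + m ≈[ m ] 0ℤ
 m≈0 m = mod-by 1ℤ (lem (+ m))
  where
  lem : ∀ m → m ≡ 0ℤ + 1ℤ * m
  lem = solve-∀

 -- The lattice ℤ²

 G : Set
 G = ℤ × ℤ

 infixl 6 _⊕_
 _⊕_ : G → G → G
 (a , b) ⊕ (c , d) = a + c , b + d

 infixl 7 _·_
 _·_ : ℤ → G → G
 k · (a , b) = k * a , k * b

 𝟎 : G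
 𝟎 = 0ℤ , 0ℤ

 ⊕-assoc : ∀ g h k → (g ⊕ h) ⊕ k ≡ g ⊕ (h ⊕ k)
 ⊕-assoc (a , b) (c , d) (e , f) = cong₂ _,_ (ℤₚ.+-assoc a c e) (ℤₚ.+-assoc b d f)

 ⊕-comm : ∀ g h → g ⊕ h ≡ h ⊕ g
 ⊕-comm (a , b) (c , d) = cong₂ _,_ (ℤₚ.+-comm a c) (ℤₚ.+-comm b d)

 ⊕-identityʳ : ∀ g → g ⊕ 𝟎 ≡ g
 ⊕-identityʳ (a , b) = cong₂ _,_ (ℤₚ.+-identityʳ a) (ℤₚ.+-identityʳ b)

 ⊕-identityˡ : ∀ g → 𝟎 ⊕ g ≡ g
 ⊕-identityˡ g = trans (⊕-comm 𝟎 g) (⊕-identityʳ g)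

 ⊕-swapʳ : ∀ g h k → (g ⊕ h) ⊕ k ≡ (g ⊕ k) ⊕ h
 ⊕-swapʳ g h k = trans (⊕-assoc g h k) (trans (cong (g ⊕_) (⊕-comm h k)) (sym (⊕-assoc g k h)))

 -- Formal sums of translations, acting on functions on ℤ²

 Op : Set
 Op = List (ℤ × G)

 act : Op → (G → ℤ) → G → ℤ
 act []            f h = 0ℤ
 act ((c , g) ∷ a) f h = c * f (h ⊕ g) + act a f h

 scale : ℤ → G → Op → Op
 scale c g = map (λ x → c * proj₁ x , g ⊕ proj₂ x)

 _⊛_ : Op → Op → Op
 []            ⊛ b = []
 ((c , g) ∷ a) ⊛ b = scale c g b ++ (a ⊛ b)

 negate : Op → Op
 negate = map (λ x → - proj₁ x , proj₂ x)

 act-++ : ∀ a b f h → act (a ++ b) f h ≡ act a f h + act b f h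
 act-++ []            b f h = sym (ℤₚ.+-identityˡ _)
 act-++ ((c , g) ∷ a) b f h =
  trans (cong (λ z → c * f (h ⊕ g) + z) (act-++ a b f h)) (sym (ℤₚ.+-assoc (c * f (h ⊕ g)) (act a f h) (act b f h)))

 act-scale : ∀ c g b f h → act (scale c g b) f h ≡ c * act b f (h ⊕ g)
 act-scale c g []            f h = sym (ℤₚ.*-zeroʳ c)
 act-scale c g ((d , k) ∷ b) f h = trans
  (cong₂ (λ x y → c * d * f x + y) (sym (⊕-assoc h g k)) (act-scale c g b f h))
  (lem c d (f (h ⊕ g ⊕ k)) (act b f (h ⊕ g)))
  where
  lem : ∀ c d x y → c * d * x + c * y ≡ c * (d * x + y)
  lem = solve-∀

 act-⊛ : ∀ a b f h → act (a ⊛ b) f h ≡ act a (act b f) h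
 act-⊛ []            b f h = refl
 act-⊛ ((c , g) ∷ a) b f h = trans (act-++ (scale c g b) (a ⊛ b) f h)
  (cong₂ _+_ (act-scale c g b f h) (act-⊛ a b f h))

 act-negate : ∀ a f h → act (negate a) f h ≡ - act a f h
 act-negate []            f h = refl
 act-negate ((c , g) ∷ a) f h = trans (cong (λ z → - c * f (h ⊕ g) + z) (act-negate a f h)) (lem c (f (h ⊕ g)) (act a f h))
  where
  lem : ∀ c x y → - c * x + - y ≡ - (c * x + y)
  lem = solve-∀

 act-zero : ∀ a h → act a (λ _ → 0ℤ) h ≡ 0ℤ
 act-zero []            h = refl
 act-zero ((c , g) ∷ a) h = trans (cong₂ _+_ (ℤₚ.*-zeroʳ c) (act-zero a h)) refl

 act-linear : ∀ a c g f f′ h → act a (λ k → c * f (k ⊕ g) + f′ k) h ≡ c * act a f (h ⊕ g) + act a f′ h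
 act-linear []            c g f f′ h = sym (trans (ℤₚ.+-identityʳ (c * 0ℤ)) (ℤₚ.*-zeroʳ c))
 act-linear ((d , k) ∷ a) c g f f′ h = trans
  (cong₂ (λ x y → d * (c * f x + f′ (h ⊕ k)) + y) (⊕-swapʳ h k g) (act-linear a c g f f′ h))
  (lem c d (f (h ⊕ g ⊕ k)) (f′ (h ⊕ k)) (act a f (h ⊕ g)) (act a f′ h))
  where
  lem : ∀ c d x y z w → d * (c * x + y) + (c * z + w) ≡ c * (d * x + z) + (d * y + w)
  lem = solve-∀

 act-comm : ∀ a b f h → act a (act b f) h ≡ act b (act a f) h
 act-comm []            b f h = sym (act-zero b h)
 act-comm ((c , g) ∷ a) b f h = trans
  (cong (λ z → c * act b f (h ⊕ g) + z) (act-comm a b f h))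
  (sym (act-linear b c g f (act a f) h))

 act-cong-≈ : ∀ {m} a {f f′} → (∀ h → f h ≈[ m ] f′ h) → ∀ h → act a f h ≈[ m ] act a f′ h
 act-cong-≈ []            e h = ≈-refl
 act-cong-≈ ((c , g) ∷ a) e h = +-cong-≈ (*-congˡ-≈ c (e (h ⊕ g))) (act-cong-≈ a e h)

 -- Functions with period lattice qℤ², with values modulo p; translations act on
 -- them as the group algebra of (ℤ/q)² over ℤ/p.

 module Translations (p q : ℕ) where

  Periodic : (G → ℤ) → Set
  Periodic f = ∀ h g → f (h ⊕ + q · g) ≈[ p ] f h

  infix 4 _≋_
  -- Testing on periodic functions takes the place of a quotient of formal sums: it reduces
  -- coefficients modulo p and makes translations by qℤ² trivial.
  record _≋_ (a b : Op) : Set where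
   constructor ≋-by
   field at : ∀ f → Periodic f → ∀ h → act a f h ≈[ p ] act b f h

  open _≋_ public

  act-periodic : ∀ a f → Periodic f → Periodic (act a f)
  act-periodic []            f per h g = ≈-refl
  act-periodic ((c , k) ∷ a) f per h g = +-cong-≈
   (*-congˡ-≈ c (≈-trans (≈-reflexive (cong f (⊕-swapʳ h (+ q · g) k))) (per (h ⊕ k) g)))
   (act-periodic a f per h g)

  private
   by-≡ : ∀ {a b} → (∀ f h → act a f h ≡ act b f h) → a ≋ b
   by-≡ e = ≋-by λ f _ h → ≈-reflexive (e f h)

  -- Products act by composition (`act-⊛`), so the ring laws are those of commuting operators; that
  -- products respect `_≋_` uses that operators preserve periodicity.
  ring : CommutativeRing 0ℓ 0ℓ
  ring = record
   { Carrier = Op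
   ; _≈_ = _≋_
   ; _+_ = _++_
   ; _*_ = _⊛_
   ; -_ = negate
   ; 0# = []
   ; 1# = (1ℤ , 𝟎) ∷ []
   ; isCommutativeRing = record
    { isRing = record
     { +-isAbelianGroup = record
      { isGroup = record
       { isMonoid = record
        { isSemigroup = record
         { isMagma = record
          { isEquivalence = record
           { refl = ≋-by λ _ _ _ → ≈-refl
           ; sym = λ e → ≋-by λ f per h → ≈-sym (at e f per h)
           ; trans = λ e e′ → ≋-by λ f per h → ≈-trans (at e f per h) (at e′ f per h)
           }
          ; ∙-cong = λ {a} {b} {c} {d} e e′ → ≋-by λ f per h →
             ≈-trans (≈-reflexive (act-++ a c f h))
              (≈-trans (+-cong-≈ (at e f per h) (at e′ f per h)) (≈-reflexive (sym (act-++ b d f h))))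
          }
         ; assoc = λ a b c → by-≡ λ f h →
           trans (act-++ (a ++ b) c f h) (trans (cong (_+ act c f h) (act-++ a b f h))
             (trans (ℤₚ.+-assoc (act a f h) (act b f h) (act c f h))
              (sym (trans (act-++ a (b ++ c) f h) (cong (λ z → act a f h + z) (act-++ b c f h))))))
         }
        ; identity = (λ a → by-≡ λ f h → refl)
               , (λ a → by-≡ λ f h → trans (act-++ a [] f h) (ℤₚ.+-identityʳ _))
        }
       ; inverse = (λ a → by-≡ λ f h → trans (act-++ (negate a) a f h)
                (trans (cong (_+ act a f h) (act-negate a f h)) (ℤₚ.+-inverseˡ (act a f h))))
             , (λ a → by-≡ λ f h → trans (act-++ a (negate a) f h)
                (trans (cong (λ z → act a f h + z) (act-negate a f h)) (ℤₚ.+-inverseʳ (act a f h))))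
       ; ⁻¹-cong = λ {a} {b} e → ≋-by λ f per h → ≈-trans (≈-reflexive (act-negate a f h))
         (≈-trans (neg-cong-≈ (at e f per h)) (≈-reflexive (sym (act-negate b f h))))
       }
      ; comm = λ a b → by-≡ λ f h → trans (act-++ a b f h)
        (trans (ℤₚ.+-comm (act a f h) (act b f h)) (sym (act-++ b a f h)))
      }
     ; *-cong = λ {a} {b} {c} {d} e e′ → ≋-by λ f per h →
       ≈-trans (≈-reflexive (act-⊛ a c f h))
        (≈-trans (at e (act c f) (act-periodic c f per) h)
         (≈-trans (act-cong-≈ b (at e′ f per) h) (≈-reflexive (sym (act-⊛ b d f h)))))
     ; *-assoc = λ a b c → by-≡ λ f h →
       trans (act-⊛ (a ⊛ b) c f h) (trans (act-⊛ a b (act c f) h)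
        (sym (trans (act-⊛ a (b ⊛ c) f h) (act-ext a (act-⊛ b c f) h))))
     ; *-identity = (λ a → by-≡ λ f h → trans (act-⊛ ((1ℤ , 𝟎) ∷ []) a f h) (unit a f h))
            , (λ a → by-≡ λ f h → trans (act-⊛ a ((1ℤ , 𝟎) ∷ []) f h)
                (trans (act-comm a ((1ℤ , 𝟎) ∷ []) f h) (unit a f h)))
     ; distrib = (λ a b c → by-≡ λ f h → trans (act-⊛ a (b ++ c) f h)
             (trans (act-comm a (b ++ c) f h) (trans (act-++ b c (act a f) h)
              (trans (cong₂ _+_ (act-comm b a f h) (act-comm c a f h))
                (sym (trans (act-++ (a ⊛ b) (a ⊛ c) f h) (cong₂ _+_ (act-⊛ a b f h) (act-⊛ a c f h))))))))
          , (λ a b c → by-≡ λ f h → trans (act-⊛ (b ++ c) a f h)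
             (trans (act-++ b c (act a f) h)
              (sym (trans (act-++ (b ⊛ a) (c ⊛ a) f h) (cong₂ _+_ (act-⊛ b a f h) (act-⊛ c a f h))))))
     }
    ; *-comm = λ a b → by-≡ λ f h → trans (act-⊛ a b f h) (trans (act-comm a b f h) (sym (act-⊛ b a f h)))
    }
   }
   where
   act-ext : ∀ a {f f′} → (∀ h → f h ≡ f′ h) → ∀ h → act a f h ≡ act a f′ h
   act-ext []            e h = refl
   act-ext ((c , g) ∷ a) e h = cong₂ (λ x y → c * x + y) (e (h ⊕ g)) (act-ext a e h)

   unit : ∀ a f h → 1ℤ * act a f (h ⊕ 𝟎) + 0ℤ ≡ act a f h
   unit a f h = trans (ℤₚ.+-identityʳ _) (trans (ℤₚ.*-identityˡ _) (cong (act a f) (⊕-identityʳ h)))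

  X : G → Op
  X g = (1ℤ , g) ∷ []

  X-⊕ : ∀ g h → X (g ⊕ h) ≋ X g ⊛ X h
  X-⊕ g h = ≋-by λ f _ k → ≈-reflexive (lem (f (k ⊕ (g ⊕ h))))
   where
   lem : ∀ x → 1ℤ * x + 0ℤ ≡ 1ℤ * 1ℤ * x + 0ℤ
   lem = solve-∀

  X-𝟎 : X 𝟎 ≋ (1ℤ , 𝟎) ∷ []
  X-𝟎 = ≋-by λ _ _ _ → ≈-refl

  X-period : ∀ g → X (+ q · g) ≋ (1ℤ , 𝟎) ∷ []
  X-period g = ≋-by λ f per k → +-cong-≈ (*-congˡ-≈ 1ℤ
   (≈-trans (per k g) (≈-reflexive (cong f (sym (⊕-identityʳ k)))))) (≈-refl {a = 0ℤ})

-- Additivity of p-th powers in characteristic p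

module FrobeniusMap where

 open TranslationRing
 open import Level using (0ℓ)
 open import Algebra using (CommutativeRing)
 open import Data.Nat as ℕ using (ℕ; zero; suc; _∸_; _!; s≤s; z≤n)
 open import Data.Nat.Combinatorics using (_C_; k![n∸k]!∣n!; nCk≡n!/k![n-k]!; nCn≡1)
 open import Data.Nat.Divisibility as ℕ∣ using (divides)
 open import Data.Nat.DivMod using (m/n*n≡m)
 open import Data.Nat.Primality using (Prime; euclidsLemma; prime⇒nonTrivial; prime⇒nonZero)
 open import Data.Fin as Fin using (Fin; toℕ)
 open import Data.Fin.Properties using (toℕ<n; toℕ-inject₁; toℕ-fromℕ)
 import Data.Vec.Functional as Vector
 import Relation.Binary.Reasoning.Setoid as SetoidReasoning

 prime∤! : ∀ {p} → Prime p → ∀ n → p ℕ∣.∣ n ! → p ℕ.≤ n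
 prime∤! {p} pp zero    d = ⊥-elim (ℕₚ.<⇒≱ (ℕ.nonTrivial⇒n>1 p) (ℕ∣.∣⇒≤ d))
  where instance _ = prime⇒nonTrivial pp
 prime∤! {p} pp (suc n) d with euclidsLemma (suc n) (n !) pp d
 ... | inj₁ e = ℕ∣.∣⇒≤ e
 ... | inj₂ e = ℕₚ.m≤n⇒m≤1+n (prime∤! pp n e)

 -- The prime divides p! = C(p,k) · k! · (p - k)!, but neither factorial, both arguments being
 -- smaller than p.
 prime∣C : ∀ {p} → Prime p → ∀ k → 0 ℕ.< k → k ℕ.< p → p ℕ∣.∣ (p C k)
 prime∣C {p} pp k 0<k k<p
  with euclidsLemma (p C k) (k ! ℕ.* (p ∸ k) !) pp (subst (p ℕ∣.∣_) fact p∣p!)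
  where
  instance _ = ℕₚ.m*n≢0 (k !) ((p ∸ k) !) {{ℕₚ._!≢0 k}} {{ℕₚ._!≢0 (p ∸ k)}}
  fact : p ! ≡ (p C k) ℕ.* (k ! ℕ.* (p ∸ k) !)
  fact = sym (trans (cong (ℕ._* (k ! ℕ.* (p ∸ k) !)) (nCk≡n!/k![n-k]! (ℕₚ.<⇒≤ k<p)))
         (m/n*n≡m (k![n∸k]!∣n! (ℕₚ.<⇒≤ k<p))))
  n∣n! : ∀ n → 0 ℕ.< n → n ℕ∣.∣ n !
  n∣n! (suc n) _ = ℕ∣.m∣m*n (n !)
  p∣p! : p ℕ∣.∣ p !
  p∣p! = n∣n! p (ℕₚ.<-trans 0<k k<p)
 ... | inj₁ d = d
 ... | inj₂ d with euclidsLemma (k !) ((p ∸ k) !) pp d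
 ...   | inj₁ e = ⊥-elim (ℕₚ.<⇒≱ k<p (prime∤! pp k e))
 ...   | inj₂ e = ⊥-elim (ℕₚ.<⇒≱ (ℕₚ.∸-monoʳ-< 0<k (ℕₚ.<⇒≤ k<p)) (prime∤! pp (p ∸ k) e))

 module Frobenius {p : ℕ} (pp : Prime p) (R : CommutativeRing 0ℓ 0ℓ) where
  open CommutativeRing R renaming (refl to ≈refl; sym to ≈sym; trans to ≈trans; zero to *-zero)
  open import Algebra.Properties.Semiring.Mult semiring using (×-congˡ; ×-assocˡ) renaming (_×_ to _×′_)
  open import Algebra.Properties.Semiring.Exp semiring using (_^_; ^-assocʳ; ^-congˡ; ^-congʳ)
  open import Algebra.Properties.CommutativeSemiring.Binomial commutativeSemiring using (theorem; binomialTerm)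
  open import Algebra.Properties.Semiring.Sum semiring using (sum; sum-cong-≋; sum-replicate-zero; sum-init-last)

  module _ (char : ∀ a → p ×′ a ≈ 0#) where

   private
    multiple : ∀ n a → p ℕ∣.∣ n → n ×′ a ≈ 0#
    multiple n a (divides k eq) = ≈trans (×-congˡ (trans eq (ℕₚ.*-comm k p)))
     (≈trans (≈sym (×-assocˡ a p k)) (char (k ×′ a)))

    two-terms : ∀ n (t : Vector.Vector Carrier (suc (suc n))) →
        (∀ i → t (Fin.suc (Fin.inject₁ i)) ≈ 0#) →
        sum t ≈ t Fin.zero + t (Fin.fromℕ (suc n))
    two-terms n t mid = +-congˡ (≈trans (sum-init-last (λ i → t (Fin.suc i)))
     (≈trans (+-congʳ (≈trans (sum-cong-≋ mid) (sum-replicate-zero n))) (+-identityˡ _)))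

    go : ∀ n → suc (suc n) ≡ p → ∀ x y → (x + y) ^ p ≈ x ^ p + y ^ p
    go n refl x y = begin
     (x + y) ^ p                                          ≈⟨ theorem p x y ⟩
     sum (binomialTerm x y p)                             ≈⟨ two-terms (suc n) (binomialTerm x y p) mid ⟩
     binomialTerm x y p Fin.zero + binomialTerm x y p (Fin.fromℕ p)
      ≈⟨ +-cong first last ⟩
     y ^ p + x ^ p                                        ≈⟨ +-comm _ _ ⟩
     x ^ p + y ^ p                                        ∎
     where
     open SetoidReasoning setoid
     mid : ∀ i → binomialTerm x y p (Fin.suc (Fin.inject₁ i)) ≈ 0#
     mid i = multiple _ _ (prime∣C pp (suc (toℕ (Fin.inject₁ i))) (s≤s z≤n)
      (s≤s (subst (ℕ._< suc n) (sym (toℕ-inject₁ i)) (toℕ<n i))))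
     first : binomialTerm x y p Fin.zero ≈ y ^ p
     first = ≈trans (+-identityʳ _) (*-identityˡ _)
     last : binomialTerm x y p (Fin.fromℕ p) ≈ x ^ p
     last = ≈trans (×-congˡ (trans (cong (p C_) (toℕ-fromℕ p)) (nCn≡1 p)))
      (≈trans (+-identityʳ _) (≈trans (*-cong (^-congʳ x (toℕ-fromℕ p))
       (^-congʳ y (trans (cong (p ∸_) (toℕ-fromℕ p)) (ℕₚ.n∸n≡0 p)))) (*-identityʳ _)))

   frobenius : ∀ x y → (x + y) ^ p ≈ x ^ p + y ^ p
   frobenius = lift p refl
    where
    -- A separate variable for p can be matched as n + 2, the form in which the binomial sum shows
    -- its first and last term.
    lift : ∀ n → n ≡ p → ∀ x y → (x + y) ^ p ≈ x ^ p + y ^ p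
    lift zero refl = ⊥-elim (ℕ.≢-nonZero⁻¹ p {{prime⇒nonZero pp}} refl)
    lift (suc zero) refl = ⊥-elim (ℕ.nonTrivial⇒≢1 {{prime⇒nonTrivial pp}} refl)
    lift (suc (suc n)) e = go n e

   frobenius-iterate : ∀ k x y → (x + y) ^ (p ℕ.^ k) ≈ x ^ (p ℕ.^ k) + y ^ (p ℕ.^ k)
   frobenius-iterate zero    x y = ≈trans (*-identityʳ _) (+-cong (≈sym (*-identityʳ _)) (≈sym (*-identityʳ _)))
   frobenius-iterate (suc k) x y = begin
    (x + y) ^ (p ℕ.* p ℕ.^ k)                       ≈⟨ ^-assocʳ (x + y) p _ ⟨
    ((x + y) ^ p) ^ (p ℕ.^ k)                       ≈⟨ ^-congˡ (p ℕ.^ k) (frobenius x y) ⟩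
    (x ^ p + y ^ p) ^ (p ℕ.^ k)                     ≈⟨ frobenius-iterate k (x ^ p) (y ^ p) ⟩
    (x ^ p) ^ (p ℕ.^ k) + (y ^ p) ^ (p ℕ.^ k)       ≈⟨ +-cong (^-assocʳ x p _) (^-assocʳ y p _) ⟩
    x ^ (p ℕ.* p ℕ.^ k) + y ^ (p ℕ.* p ℕ.^ k)       ∎
    where open SetoidReasoning setoid

-- Group algebras, powers of the augmentation ideal, and counting zero-sums by identity coefficients

module GroupAlgebras where

 open TranslationRing
 open FrobeniusMap
 open import Level using (0ℓ)
 open import Algebra using (CommutativeRing)
 import Algebra.Solver.Ring as RingSolver
 import Algebra.Solver.Ring.AlmostCommutativeRing as ACR
 open import Data.Nat as ℕ using (ℕ; zero; suc; _∸_; s≤s)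
 open import Data.Nat.Divisibility as ℕ∣ using (divides)
 open import Data.Integer using (ℤ; +_; -[1+_]; _+_; _*_; -_; _-_; 0ℤ; 1ℤ; ∣_∣)
 import Data.Integer.Divisibility.Signed as ℤ∣
 open import Data.Maybe using (Maybe; just; nothing)
 open import Data.List using (List; []; _∷_; _++_; map; length; foldr)
 open import Data.List.Relation.Binary.Sublist.Propositional using (_⊆_; []; _∷_; _∷ʳ_)
 open import Data.List.Relation.Binary.Sublist.Propositional.Properties using (length-mono-≤)
 open import Data.List.Properties using (length-map)
 import Relation.Nullary.Decidable as Dec
 open import Relation.Nullary.Decidable using (_×-dec_)
 import Relation.Binary.Reasoning.Setoid as SetoidReasoning

 ≈0? : ∀ m a → Dec (a ≈[ m ] 0ℤ)
 ≈0? m a = Dec.map′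
  (λ { (ℤ∣.divides k e) → mod-by k (trans e (sym (ℤₚ.+-identityˡ _))) })
  (λ { (mod-by k e) → ℤ∣.divides k (trans e (ℤₚ.+-identityˡ _)) })
  (+ m ℤ∣.∣? a)

 Vanishes : ℕ → G → Set
 Vanishes m (a , b) = (a ≈[ m ] 0ℤ) × (b ≈[ m ] 0ℤ)

 vanishes? : ∀ m g → Dec (Vanishes m g)
 vanishes? m (a , b) = ≈0? m a ×-dec ≈0? m b

 +-vanishes-≈ : ∀ {m a b} → b ≈[ m ] 0ℤ → a + b ≈[ m ] a
 +-vanishes-≈ {a = a} e = ≈-trans (+-cong-≈ (≈-refl {a = a}) e) (≈-reflexive (ℤₚ.+-identityʳ a))

 multiple≈0 : ∀ m k → + m * k ≈[ m ] 0ℤ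
 multiple≈0 m k = mod-by k (lem (+ m) k)
  where
  lem : ∀ m k → m * k ≡ 0ℤ + k * m
  lem = solve-∀

 indicator : ℕ → G → ℤ
 indicator m g with vanishes? m g
 ... | yes _ = 1ℤ
 ... | no  _ = 0ℤ

 indicator-yes : ∀ m g → Vanishes m g → indicator m g ≡ 1ℤ
 indicator-yes m g z with vanishes? m g
 ... | yes _  = refl
 ... | no ¬z = ⊥-elim (¬z z)

 indicator-no : ∀ m g → ¬ Vanishes m g → indicator m g ≡ 0ℤ
 indicator-no m g ¬z with vanishes? m g
 ... | yes z = ⊥-elim (¬z z)
 ... | no _  = refl

 vanishes-shift : ∀ m h g → Vanishes m h → Vanishes m (h ⊕ + m · g)
 vanishes-shift m (a , b) (c , d) (x , y) =
  ≈-trans (+-vanishes-≈ (multiple≈0 m c)) x , ≈-trans (+-vanishes-≈ (multiple≈0 m d)) y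

 vanishes-unshift : ∀ m h g → Vanishes m (h ⊕ + m · g) → Vanishes m h
 vanishes-unshift m (a , b) (c , d) (x , y) =
  ≈-trans (≈-sym (+-vanishes-≈ (multiple≈0 m c))) x , ≈-trans (≈-sym (+-vanishes-≈ (multiple≈0 m d))) y

 indicator-shift : ∀ m h g → indicator m (h ⊕ + m · g) ≡ indicator m h
 indicator-shift m h g = go (vanishes? m h)
  where
  go : Dec (Vanishes m h) → indicator m (h ⊕ + m · g) ≡ indicator m h
  go (yes z) = trans (indicator-yes m _ (vanishes-shift m h g z)) (sym (indicator-yes m h z))
  go (no ¬z) = trans (indicator-no m _ λ z → ¬z (vanishes-unshift m h g z)) (sym (indicator-no m h ¬z))

 Σ⊕ : List G → G
 Σ⊕ = foldr _⊕_ 𝟎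

 -- What is used of the group algebra of (ℤ/q)² over ℤ/p: its universal character X and
 -- the coefficient φ of the identity.

 record GroupAlgebra (p q : ℕ) : Set₁ where
  field
   ring : CommutativeRing 0ℓ 0ℓ
  open CommutativeRing ring public
   using (Carrier; 0#; 1#; +-cong; +-congˡ; +-congʳ; *-cong; *-congˡ; *-congʳ; -‿cong; setoid;
       +-identityˡ; +-identityʳ; *-identityˡ; *-identityʳ; *-assoc; *-comm; zeroˡ; zeroʳ; distribʳ; distribˡ;
       -‿inverseʳ; semiring)
   renaming (_≈_ to _≋_; _+_ to _+′_; _*_ to _*′_; -_ to -′_; refl to ≋-refl; sym to ≋-sym; trans to ≋-trans; reflexive to ≋-reflexive)
  field
   constant   : ℤ → Carrier
   constant-+ : ∀ a b → constant (a + b) ≋ constant a +′ constant b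
   constant-* : ∀ a b → constant (a * b) ≋ constant a *′ constant b
   constant-- : ∀ a → constant (- a) ≋ -′ constant a
   constant-0 : constant 0ℤ ≋ 0#
   constant-1 : constant 1ℤ ≋ 1#
   constant-p : constant (+ p) ≋ 0#
   X          : G → Carrier
   X-⊕        : ∀ g h → X (g ⊕ h) ≋ X g *′ X h
   X-𝟎        : X 𝟎 ≋ 1#
   X-period   : ∀ g → X (+ q · g) ≋ 1#
   φ          : Carrier → ℤ
   φ-cong     : ∀ {a b} → a ≋ b → φ a ≈[ p ] φ b
   φ-+        : ∀ a b → φ (a +′ b) ≈[ p ] φ a + φ b
   φ-constant : ∀ c a → φ (constant c *′ a) ≈[ p ] c * φ a
   φ-X        : ∀ g → φ (X g) ≈[ p ] indicator q g

 -- The identity coefficient is obtained by applying an operator to the indicator of the lattice qℤ²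
 -- and evaluating at 0.
 groupAlgebra : ∀ p q → GroupAlgebra p q
 groupAlgebra p q = record
  { ring = T.ring
  ; constant = λ c → (c , 𝟎) ∷ []
  ; constant-+ = λ a b → by-≡ λ f h → +h a b (f (h ⊕ 𝟎))
  ; constant-* = λ a b → by-≡ λ f h → refl
  ; constant-- = λ a → by-≡ λ f h → refl
  ; constant-0 = by-≡ λ f h → refl
  ; constant-1 = by-≡ λ f h → refl
  ; constant-p = T.≋-by λ f _ h → ≈-trans (+-vanishes-≈ {a = + p * f (h ⊕ 𝟎)} ≈-refl) (multiple≈0 p _)
  ; X = T.X
  ; X-⊕ = T.X-⊕
  ; X-𝟎 = T.X-𝟎
  ; X-period = T.X-period
  ; φ = λ a → act a (indicator q) 𝟎
  ; φ-cong = λ e → T.at e (indicator q) (λ h g → ≈-reflexive (indicator-shift q h g)) 𝟎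
  ; φ-+ = λ a b → ≈-reflexive (act-++ a b (indicator q) 𝟎)
  ; φ-constant = λ c a → ≈-reflexive (trans (act-⊛ ((c , 𝟎) ∷ []) a (indicator q) 𝟎) (ℤₚ.+-identityʳ _))
  ; φ-X = λ g → ≈-reflexive (trans (ℤₚ.+-identityʳ _) (trans (ℤₚ.*-identityˡ _) (cong (indicator q) (⊕-identityˡ g))))
  }
  where
  module T = Translations p q
  by-≡ : ∀ {a b} → (∀ f h → act a f h ≡ act b f h) → a T.≋ b
  by-≡ e = T.≋-by λ f _ h → ≈-reflexive (e f h)
  +h : ∀ x y z → (x + y) * z + 0ℤ ≡ x * z + (y * z + 0ℤ)
  +h = solve-∀

 -- The group algebra of (ℤ/pᵏ)² over ℤ/p is local with nilpotent augmentation ideal.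

 module LocalAlgebra {p : ℕ} (pp : Prime p) (k : ℕ) (A : GroupAlgebra p (p ℕ.^ k)) where

  open GroupAlgebra A public
  open import Algebra.Properties.Semiring.Mult semiring using (×-congˡ) renaming (_×_ to _×′_)
  open import Algebra.Properties.Semiring.Exp semiring using (_^_; ^-homo-*; ^-congˡ)

  q : ℕ
  q = p ℕ.^ k

  private
   constant-homo : CommutativeRing.rawRing ℤₚ.+-*-commutativeRing ACR.-Raw-AlmostCommutative⟶ ACR.fromCommutativeRing ring
   constant-homo = record
    { ⟦_⟧ = constant
    ; +-homo = constant-+
    ; *-homo = constant-*
    ; -‿homo = constant--
    ; 0-homo = constant-0
    ; 1-homo = constant-1
    }

   weak : ∀ x y → Maybe (constant x ≋ constant y)
   weak x y with x ℤₚ.≟ y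
   ... | yes refl = just ≋-refl
   ... | no _     = nothing

  module Solver = RingSolver (CommutativeRing.rawRing ℤₚ.+-*-commutativeRing) (ACR.fromCommutativeRing ring) constant-homo
   weak

  open Solver using (solve; _:=_; _:+_; _:*_; _:-_; :-_; con)

  infixl 6 _−_
  _−_ : Carrier → Carrier → Carrier
  a − b = a +′ -′ b

  𝟙 : Carrier
  𝟙 = constant 1ℤ

  v : G → Carrier
  v g = 𝟙 − X g

  v-⊕ : ∀ g h → v (g ⊕ h) ≋ v g +′ X g *′ v h
  v-⊕ g h = ≋-trans (+-congˡ (-‿cong (X-⊕ g h)))
   (solve 2 (λ x y → con 1ℤ :- x :* y := (con 1ℤ :- x) :+ x :* (con 1ℤ :- y)) ≋-refl (X g) (X h))

  v-𝟎 : v 𝟎 ≋ 0#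
  v-𝟎 = ≋-trans (+-congˡ (-‿cong (≋-trans X-𝟎 (≋-sym constant-1)))) (-‿inverseʳ 𝟙)

  v-multiple⁺ : ∀ e n → ∃ λ c → v (+ n · e) ≋ c *′ v e
  v-multiple⁺ (a , b) zero = 0# , ≋-trans v-𝟎 (≋-sym (zeroˡ _))
  v-multiple⁺ e@(a , b) (suc n) with v-multiple⁺ e n
  ... | c , eq = 𝟙 +′ X e *′ c , ≋-trans (≋-reflexive (cong v (cong₂ _,_ (lem a (+ n)) (lem b (+ n)))))
   (≋-trans (v-⊕ e (+ n · e)) (≋-trans (+-congˡ (*-congˡ eq))
    (solve 3 (λ v x c → v :+ x :* (c :* v) := (con 1ℤ :+ x :* c) :* v) ≋-refl (v e) (X e) c)))
   where
   lem : ∀ a n → (1ℤ + n) * a ≡ a + n * a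
   lem = solve-∀
  v-multiple : ∀ e n → ∃ λ c → v (n · e) ≋ c *′ v e
  v-multiple e (+ n) = v-multiple⁺ e n
  v-multiple e@(a , b) -[1+ n ] with v-multiple⁺ e (suc n)
  ... | c , eq = -′ X (-[1+ n ] · e) *′ c , ≋-trans
   (solve 3 (λ m x u → m := (m :+ x :* u) :- x :* u) ≋-refl (v (-[1+ n ] · e)) (X (-[1+ n ] · e)) (v (+ suc n · e)))
   (≋-trans (+-congʳ (≋-trans (≋-sym (v-⊕ (-[1+ n ] · e) (+ suc n · e)))
     (≋-trans (≋-reflexive (cong v (cong₂ _,_ (lem a (+ suc n)) (lem b (+ suc n))))) v-𝟎)))
   (≋-trans (+-congˡ (-‿cong (*-congˡ eq)))
    (≋-trans (+-identityˡ _) (solve 3 (λ x c v → :- (x :* (c :* v)) := (:- x) :* c :* v) ≋-refl (X (-[1+ n ] · e)) c (v e)))))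
   where
   lem : ∀ a n → - n * a + n * a ≡ 0ℤ
   lem = solve-∀

  e₁ e₂ : G
  e₁ = 1ℤ , 0ℤ
  e₂ = 0ℤ , 1ℤ

  -- By v(g + h) = v g + X^g · v h the differences of the two basis vectors generate the
  -- augmentation ideal.
  v-generated : ∀ g → ∃₂ λ α β → v g ≋ α *′ v e₁ +′ β *′ v e₂
  v-generated (a , b) with v-multiple e₁ a | v-multiple e₂ b
  ... | c , eq | d , eq′ = c , X (a · e₁) *′ d ,
   ≋-trans (≋-reflexive (cong v (cong₂ _,_ (lem a b) (lem′ a b)))) (≋-trans (v-⊕ (a · e₁) (b · e₂))
    (+-cong eq (≋-trans (*-congˡ eq′) (≋-sym (*-assoc _ _ _)))))
   where
   lem : ∀ a b → a ≡ a * 1ℤ + b * 0ℤ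
   lem = solve-∀
   lem′ : ∀ a b → b ≡ a * 0ℤ + b * 1ℤ
   lem′ = solve-∀

  ×-constant : ∀ n a → n ×′ a ≋ constant (+ n) *′ a
  ×-constant zero    a = ≋-sym (≋-trans (*-congʳ constant-0) (zeroˡ a))
  ×-constant (suc n) a = ≋-trans (+-congˡ (×-constant n a))
   (≋-trans (solve 2 (λ a c → a :+ c :* a := (con 1ℤ :+ c) :* a) ≋-refl a (constant (+ n)))
    (*-congʳ (≋-sym (constant-+ 1ℤ (+ n)))))

  char-p : ∀ a → p ×′ a ≋ 0#
  char-p a = ≋-trans (×-constant p a) (≋-trans (*-congʳ constant-p) (zeroˡ a))

  X-power : ∀ n g → X g ^ n ≋ X (+ n · g)
  X-power zero    (a , b) = ≋-sym X-𝟎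
  X-power (suc n) g@(a , b) = ≋-trans (*-congˡ (X-power n g)) (≋-trans (≋-sym (X-⊕ g (+ n · g)))
   (≋-reflexive (cong X (cong₂ _,_ (lem a (+ n)) (lem b (+ n))))))
   where
   lem : ∀ a n → a + n * a ≡ (1ℤ + n) * a
   lem = solve-∀

  -- Frobenius gives (v g)^q + X^(qg) = (v g + X^g)^q = 1, and X^(qg) = 1.
  v-nilpotent : ∀ g → v g ^ q ≋ 0#
  v-nilpotent g = begin
   v g ^ q                      ≈⟨ solve 2 (λ a b → a := (a :+ b) :- b) ≋-refl (v g ^ q) (X g ^ q) ⟩
   (v g ^ q +′ X g ^ q) − X g ^ q ≈⟨ +-congʳ (frobenius-iterate char-p k (v g) (X g)) ⟨
   (v g +′ X g) ^ q − X g ^ q  ≈⟨ +-congʳ (^-congˡ q (solve 1 (λ x → (con 1ℤ :- x) :+ x := con 1ℤ) ≋-refl (X g))) ⟩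
   𝟙 ^ q − X g ^ q           ≈⟨ +-cong (one q) (-‿cong (≋-trans (X-power q g) (X-period g))) ⟩
   1# − 1#                  ≈⟨ -‿inverseʳ 1# ⟩
   0#                         ∎
   where
   open SetoidReasoning setoid
   open Frobenius pp ring
   one : ∀ n → 𝟙 ^ n ≋ 1#
   one zero = ≋-refl
   one (suc n) = ≋-trans (*-cong constant-1 (one n)) (*-identityˡ _)

  vs : List G → Carrier
  vs []       = 𝟙
  vs (g ∷ gs) = v g *′ vs gs

  -- A monomial of degree 2q - 1 in `v e₁` and `v e₂` contains a q-th power of one of them.
  top : ℕ
  top = q ℕ.+ q ∸ 1

  private
   power-zero : ∀ g n → q ℕ.≤ n → v g ^ n ≋ 0#
   power-zero g n q≤n = ≋-trans (≋-reflexive (cong (v g ^_) (sym (ℕₚ.m+[n∸m]≡n q≤n))))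
    (≋-trans (^-homo-* (v g) q (n ∸ q)) (≋-trans (*-congʳ (v-nilpotent g)) (zeroˡ _)))

   -- Writing a factor through the two generators moves one degree from the list into the exponents.
   -- The total degree is preserved, so when the list is used up one exponent has reached q.
   monomial-zero : ∀ gs i j → top ℕ.≤ i ℕ.+ j ℕ.+ length gs → v e₁ ^ i *′ v e₂ ^ j *′ vs gs ≋ 0#
   monomial-zero [] i j le with q ℕₚ.≤? i | q ℕₚ.≤? j
   ... | yes q≤i | _ = ≋-trans (*-congʳ (≋-trans (*-congʳ (power-zero e₁ i q≤i)) (zeroˡ _))) (zeroˡ _)
   ... | no _ | yes q≤j = ≋-trans (*-congʳ (≋-trans (*-congˡ (power-zero e₂ j q≤j)) (zeroʳ _))) (zeroˡ _)
   ... | no q≰i | no q≰j = ⊥-elim (ℕₚ.<⇒≱ (bound q i j (ℕₚ.≰⇒> q≰i) (ℕₚ.≰⇒> q≰j))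
    (subst (top ℕ.≤_) (ℕₚ.+-identityʳ (i ℕ.+ j)) le))
    where
    bound : ∀ q i j → i ℕ.< q → j ℕ.< q → i ℕ.+ j ℕ.< q ℕ.+ q ∸ 1
    bound (suc q) i j (s≤s i≤q) j<q = ℕₚ.+-mono-≤-< i≤q j<q
   monomial-zero (g ∷ gs) i j le with v-generated g
   ... | α , β , eq = begin
    M *′ (v g *′ vs gs)                              ≈⟨ *-congˡ (*-congʳ eq) ⟩
    M *′ ((α *′ v e₁ +′ β *′ v e₂) *′ vs gs)
      ≈⟨ solve 7 (λ a b α β x y w → a :* b :* ((α :* x :+ β :* y) :* w) := α :* (x :* a :* b :* w) :+ β :* (a :* (y :* b) :* w))
        ≋-refl (v e₁ ^ i) (v e₂ ^ j) α β (v e₁) (v e₂) (vs gs) ⟩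
    α *′ (v e₁ ^ suc i *′ v e₂ ^ j *′ vs gs) +′ β *′ (v e₁ ^ i *′ v e₂ ^ suc j *′ vs gs)
      ≈⟨ +-cong (*-congˡ (monomial-zero gs (suc i) j (subst (top ℕ.≤_) (ℕₚ.+-suc (i ℕ.+ j) (length gs)) le)))
            (*-congˡ (monomial-zero gs i (suc j) (subst (top ℕ.≤_) (shift i j (length gs)) le))) ⟩
    α *′ 0# +′ β *′ 0#                          ≈⟨ ≋-trans (+-cong (zeroʳ α) (zeroʳ β)) (+-identityˡ 0#) ⟩
    0#                                               ∎
    where
    open SetoidReasoning setoid
    M = v e₁ ^ i *′ v e₂ ^ j
    shift : ∀ i j n → i ℕ.+ j ℕ.+ suc n ≡ i ℕ.+ suc j ℕ.+ n
    shift i j n = trans (ℕₚ.+-suc (i ℕ.+ j) n) (cong (ℕ._+ n) (sym (ℕₚ.+-suc i j)))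

  -- Membership in the k-th power of the augmentation ideal, up to the annihilator of
  -- the complementary power.

  J : ℕ → Carrier → Set
  J k a = ∀ gs → top ℕ.≤ k ℕ.+ length gs → a *′ vs gs ≋ 0#

  J-zero : ∀ a → J 0 a
  J-zero a gs le = ≋-trans (*-congˡ (≋-trans (≋-sym (≋-trans (*-congʳ (*-identityˡ 1#)) (*-identityˡ (vs gs))))
   (monomial-zero gs 0 0 le))) (zeroʳ a)

  J-cong : ∀ {k a b} → a ≋ b → J k a → J k b
  J-cong e j gs le = ≋-trans (*-congʳ (≋-sym e)) (j gs le)

  J-+ : ∀ {k a b} → J k a → J k b → J k (a +′ b)
  J-+ {a = a} {b} j j′ gs le = ≋-trans (distribʳ (vs gs) a b) (≋-trans (+-cong (j gs le) (j′ gs le)) (+-identityˡ _))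

  J-neg : ∀ {k a} → J k a → J k (-′ a)
  J-neg {a = a} j gs le = ≋-trans (solve 2 (λ a w → (:- a) :* w := :- (a :* w)) ≋-refl a (vs gs))
   (≋-trans (-‿cong (j gs le)) (≋-trans (≋-sym (+-identityˡ _)) (-‿inverseʳ 0#)))

  J-* : ∀ {k a} b → J k a → J k (b *′ a)
  J-* {a = a} b j gs le = ≋-trans (*-assoc b a _) (≋-trans (*-congˡ (j gs le)) (zeroʳ b))

  J-weaken : ∀ {k a} → J (suc k) a → J k a
  J-weaken j gs le = j gs (ℕₚ.m≤n⇒m≤1+n le)

  -- Multiplication by an element of the augmentation ideal

  Raises : Carrier → Set
  Raises y = ∀ {k x} → J k x → J (suc k) (y *′ x)

  raises-v : ∀ g → Raises (v g)
  raises-v g {k} {x} j gs le = ≋-trans (solve 3 (λ x u w → u :* x :* w := x :* (u :* w)) ≋-refl x (v g) (vs gs))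
   (j (g ∷ gs) (subst (top ℕ.≤_) (sym (ℕₚ.+-suc k (length gs))) le))

  raises-cong : ∀ {a b} → a ≋ b → Raises a → Raises b
  raises-cong e r j = J-cong (*-congʳ e) (r j)

  raises-+ : ∀ {a b} → Raises a → Raises b → Raises (a +′ b)
  raises-+ {a} {b} r r′ {x = x} j = J-cong (≋-sym (distribʳ x a b)) (J-+ (r j) (r′ j))

  raises-* : ∀ {a} b → Raises a → Raises (b *′ a)
  raises-* {a} b r {x = x} j = J-cong (≋-sym (*-assoc b a x)) (J-* b (r j))

  φ-neg : ∀ a → φ (-′ a) ≈[ p ] - φ a
  φ-neg a = ≈-trans (φ-cong (solve 1 (λ a → :- a := con (- 1ℤ) :* a) ≋-refl a))
   (≈-trans (φ-constant (- 1ℤ) a) (≈-reflexive (ℤₚ.-1*i≡-i (φ a))))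

  φ-zero : ∀ {a} → a ≋ 0# → φ a ≈[ p ] 0ℤ
  φ-zero {a} e = ≈-trans (φ-cong (≋-trans e (≋-sym (≋-trans (*-congʳ constant-0) (zeroˡ a))))) (φ-constant 0ℤ a)

  -- ∏ (1 + ε X^g) over the pairs (ε , g) of a list

  binomials : List (ℤ × G) → Carrier
  binomials []            = 𝟙
  binomials ((ε , g) ∷ l) = (𝟙 +′ constant ε *′ X g) *′ binomials l

  signs : List (ℤ × G) → ℤ
  signs []            = 1ℤ
  signs ((ε , g) ∷ l) = ε * signs l

  elements : List (ℤ × G) → List G
  elements = map proj₂

  private
   count : List (ℤ × G) → G → ℤ
   count l h = φ (binomials l *′ X h)

   count-[] : ∀ h → count [] h ≈[ p ] indicator q h
   count-[] h = ≈-trans (φ-cong (≋-trans (*-congʳ constant-1) (*-identityˡ (X h)))) (φ-X h)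

   -- The first factor either omits `g` or selects it with weight `ε`, which shifts the target by
   -- `g`; iterated, the coefficient is a signed count of subsequences with prescribed sum.
   count-∷ : ∀ ε g l h → count ((ε , g) ∷ l) h ≈[ p ] count l h + ε * count l (h ⊕ g)
   count-∷ ε g l h = ≈-trans
    (φ-cong (≋-trans
      (solve 4 (λ e x w y → (con 1ℤ :+ e :* x) :* w :* y := w :* y :+ e :* (w :* (y :* x))) ≋-refl (constant ε) (X g) (binomials l) (X h))
      (+-congˡ (*-congˡ (*-congˡ (≋-sym (X-⊕ h g)))))))
    (≈-trans (φ-+ (binomials l *′ X h) (constant ε *′ (binomials l *′ X (h ⊕ g)))) (+-cong-≈ (≈-refl {a = count l h}) (φ-constant ε _)))

   shifted : ∀ h g s → Vanishes q (h ⊕ g ⊕ s) → Vanishes q (h ⊕ (g ⊕ s))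
   shifted h g s = subst (Vanishes q) (⊕-assoc h g s)

   combine : ∀ {x y a b} c → x ≈[ p ] a → y ≈[ p ] b → x + c * y ≈[ p ] a + c * b
   combine c e e′ = +-cong-≈ e (*-congˡ-≈ c e′)

   short : ∀ l {S} → S ⊆ elements l → length S ≡ suc (length l) → ⊥
   short l {S} s e = ℕₚ.1+n≰n (subst (ℕ._≤ length l) e (subst (length S ℕ.≤_) (length-map proj₂ l) (length-mono-≤ s)))

  expand-none : ∀ l h → (∀ {S} → S ⊆ elements l → ¬ Vanishes q (h ⊕ Σ⊕ S)) → φ (binomials l *′ X h) ≈[ p ] 0ℤ
  expand-none [] h none = ≈-trans (count-[] h) (≈-reflexive (indicator-no q h (subst (λ x → ¬ Vanishes q x) (⊕-identityʳ h) (none []))))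
  expand-none ((ε , g) ∷ l) h none = ≈-trans (count-∷ ε g l h)
   (≈-trans (combine ε (expand-none l h λ s → none (g ∷ʳ s))
    (expand-none l (h ⊕ g) λ {S} s z → none (refl ∷ s) (shifted h g (Σ⊕ S) z)))
    (≈-reflexive (trans (ℤₚ.+-identityˡ _) (ℤₚ.*-zeroʳ ε))))

  expand-empty : ∀ l h → Vanishes q h → (∀ {S} → S ⊆ elements l → Vanishes q (h ⊕ Σ⊕ S) → S ≡ []) →
          φ (binomials l *′ X h) ≈[ p ] 1ℤ
  expand-empty [] h z only = ≈-trans (count-[] h) (≈-reflexive (indicator-yes q h z))
  expand-empty ((ε , g) ∷ l) h z only = ≈-trans (count-∷ ε g l h)
   (≈-trans (combine ε (expand-empty l h z λ s → only (g ∷ʳ s))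
    (expand-none l (h ⊕ g) λ {S} s z′ → nonempty (only (refl ∷ s) (shifted h g (Σ⊕ S) z′))))
    (≈-reflexive (cong (λ z → 1ℤ + z) (ℤₚ.*-zeroʳ ε))))
   where
   nonempty : ∀ {S} → g ∷ S ≡ [] → ⊥
   nonempty ()

  expand-full : ∀ l h → Vanishes q (h ⊕ Σ⊕ (elements l)) →
         (∀ {S} → S ⊆ elements l → Vanishes q (h ⊕ Σ⊕ S) → length S ≡ length l) →
         φ (binomials l *′ X h) ≈[ p ] signs l
  expand-full [] h z only = ≈-trans (count-[] h) (≈-reflexive (indicator-yes q h (subst (Vanishes q) (⊕-identityʳ h) z)))
  expand-full ((ε , g) ∷ l) h z only = ≈-trans (count-∷ ε g l h)
   (≈-trans (combine ε
    (expand-none l h λ s z′ → short l s (only (g ∷ʳ s) z′))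
    (expand-full l (h ⊕ g) (subst (Vanishes q) (sym (⊕-assoc h g _)) z)
      λ {S} s z′ → ℕₚ.suc-injective (only (refl ∷ s) (shifted h g (Σ⊕ S) z′))))
    (≈-reflexive (ℤₚ.+-identityˡ _)))

  -- In a minimal zero-sum sequence only ∅ and the whole sequence contribute.
  expand-minimal : ∀ l → 0 ℕ.< length l → Vanishes q (Σ⊕ (elements l)) →
           (∀ {S} → S ⊆ elements l → Vanishes q (Σ⊕ S) → S ≡ [] ⊎ length S ≡ length l) →
           φ (binomials l) ≈[ p ] 1ℤ + signs l
  expand-minimal ((ε , g) ∷ l) _ z only = ≈-trans
   (φ-cong (≋-sym (≋-trans (*-congˡ X-𝟎) (*-identityʳ _))))
   (≈-trans (count-∷ ε g l 𝟎)
    (combine ε (expand-empty l 𝟎 (≈-refl , ≈-refl) empty)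
      (expand-full l (𝟎 ⊕ g) (subst (Vanishes q) (cong (_⊕ Σ⊕ (elements l)) (sym (⊕-identityˡ g))) z) full)))
   where
   empty : ∀ {S} → S ⊆ elements l → Vanishes q (𝟎 ⊕ Σ⊕ S) → S ≡ []
   empty {S} s z′ with only (g ∷ʳ s) (subst (Vanishes q) (⊕-identityˡ (Σ⊕ S)) z′)
   ... | inj₁ e = e
   ... | inj₂ e = ⊥-elim (short l s e)
   full : ∀ {S} → S ⊆ elements l → Vanishes q (𝟎 ⊕ g ⊕ Σ⊕ S) → length S ≡ length l
   full {S} s z′ with only (refl ∷ s) (subst (λ y → Vanishes q (y ⊕ Σ⊕ S)) (⊕-identityˡ g) z′)
   ... | inj₂ e = ℕₚ.suc-injective e

  minus : List G → List (ℤ × G)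
  minus = map (- 1ℤ ,_)

  binomials-minus : ∀ gs → binomials (minus gs) ≋ vs gs
  binomials-minus []       = ≋-refl
  binomials-minus (g ∷ gs) = *-cong
   (≋-trans (+-congˡ (*-congʳ (constant-- 1ℤ))) (solve 1 (λ x → con 1ℤ :+ (:- con 1ℤ) :* x := con 1ℤ :- x) ≋-refl (X g)))
   (binomials-minus gs)

  elements-minus : ∀ gs → elements (minus gs) ≡ gs
  elements-minus []       = refl
  elements-minus (g ∷ gs) = cong (g ∷_) (elements-minus gs)

-- Elements of (ℤ/n)² as integer vectors

module ResidueVectors where

 open TranslationRing
 open import Data.Nat as ℕ using (ℕ)
 open import Data.Integer using (+_; _+_; -_; _-_)
 open import Data.Fin as Fin using (toℕ)
 open import Data.Fin.Properties using () renaming (_≟_ to _≟ᶠ_)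
 open import Data.Product.Properties using (≡-dec)
 import Relation.Nullary.Decidable as Dec

 ⟪_⟫ : ∀ {n} → Zn² n → G
 ⟪ x , y ⟫ = + toℕ x , + toℕ y

 _≟²_ : ∀ {n} (x y : Zn² n) → Dec (x ≡ y)
 _≟²_ = ≡-dec _≟ᶠ_ _≟ᶠ_

-- The search algorithm on tables of subsequence sums

module SearchProcedure where

 open import Data.Bool using (Bool; true; false; _∧_; _∨_; if_then_else_; T)
 open import Data.Nat as ℕ using (ℕ; zero; suc; _∸_; _<ᵇ_; _≤ᵇ_)
 open import Data.Integer using (ℤ; +_; _+_; -_)
 open import Data.List using (List; []; _∷_; _++_; length; replicate; take; drop)
 open import Data.List.Relation.Unary.All as All using ([]; _∷_)
 open import Data.List.Relation.Binary.Sublist.Propositional using ([]; _∷_)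

 -- Exhaustive search for zero-sum free sequences in (ℤ/N)²

 -- Entry (i , j) records that (i , j) is known to be a sum over a subsequence of the part chosen so far.
 Table : Set
 Table = List (List Bool)

 -- A candidate is given by its negative and the maximal number of its copies.
 record Candidate : Set where
  constructor candidate
  field
   -x -y limit : ℕ
 open Candidate

 at : ∀ {A : Set} → A → List A → ℕ → A
 at d []      _       = d
 at d (x ∷ l) zero    = x
 at d (x ∷ l) (suc i) = at d l i

 entry : Table → ℕ → ℕ → Bool
 entry t i j = at false (at [] t i) j

 rotate : ∀ {A : Set} → ℕ → List A → List A
 rotate n l = drop n l ++ take n l

 or : List Bool → List Bool → List Bool
 or (a ∷ r) (b ∷ s) = (a ∨ b) ∷ or r s
 or _       _       = []

 or-rotated : ℕ → Table → Table → Table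
 or-rotated n (r ∷ t) (s ∷ t′) = or r (rotate n s) ∷ or-rotated n t t′
 or-rotated n _       _        = []

 -- Rotating the table by the negative of an element translates the set of recorded sums by that
 -- element; this, and the test `blocked`, is why candidates carry negatives.
 add : Candidate → Table → Table
 add c t = or-rotated (-y c) t (rotate (-x c) t)

 blocked : Table → Candidate → Bool
 blocked t c = entry t (-x c) (-y c)

 available : Table → List Candidate → List Candidate
 available t []       = []
 available t (c ∷ cs) = if blocked t c then available t cs else c ∷ available t cs

 capacity : List Candidate → ℕ
 capacity []       = 0
 capacity (c ∷ cs) = limit c ℕ.+ capacity cs

 -- The result true means that no sequence of the required length exists; running out of
 -- fuel gives false.
 mutual
  impossible : ℕ → Table → List Candidate → ℕ → Bool
  impossible (suc fuel) t cs (suc n) = impossible-from fuel t (available t cs) (capacity (available t cs)) (suc n)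
  impossible _          _ _  _       = false

  -- The argument `total` carries the capacity of the candidate list along; a branch is cut when it
  -- falls below the number of elements still required.
  impossible-from : ℕ → Table → List Candidate → ℕ → ℕ → Bool
  impossible-from zero       t cs       total n = false
  impossible-from (suc fuel) t []       total n = true
  impossible-from (suc fuel) t (c ∷ cs) total n =
   if total <ᵇ n then true else (impossible-with fuel t c cs (limit c) n ∧ impossible-from fuel t cs (total ∸ limit c) n)

  -- Here at least one further copy of the candidate is to be taken. Hence having no copies left, or
  -- no places left, counts as impossible.
  impossible-with : ℕ → Table → Candidate → List Candidate → ℕ → ℕ → Bool
  impossible-with zero       t c cs k       n       = false
  impossible-with (suc fuel) t c cs zero    n       = true
  impossible-with (suc fuel) t c cs (suc k) zero    = true
  impossible-with (suc fuel) t c cs (suc k) (suc n) =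
   if blocked t c then true else impossible-next fuel (add c t) c cs k n

  impossible-next : ℕ → Table → Candidate → List Candidate → ℕ → ℕ → Bool
  impossible-next fuel t c cs k n = impossible fuel t cs n ∧ impossible-with fuel t c cs k n

 cells : ℕ → ℕ → ℕ → List Bool
 cells m zero    j = []
 cells m (suc n) j = (j ≤ᵇ m) ∷ cells m n (suc j)

 rows : List Bool → ℕ → ℕ → ℕ → Table
 rows r m zero    i = []
 rows r m (suc n) i = (if i ≤ᵇ m then r else replicate (length r) false) ∷ rows r m n (suc i)

 -- the sums over subsequences of m₁ copies of (1 , 0) and m₂ copies of (0 , 1)
 initial : ℕ → ℕ → ℕ → Table
 initial N m₁ m₂ = rows (cells m₂ N 0) m₁ N 0

-- The finite verifications for the moduli 8 and 9

module SearchResults where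

 open TranslationRing
 open GroupAlgebras
 open ResidueVectors
 open SearchProcedure
 open import Data.Bool using (Bool; true; false; _∧_; if_then_else_; T)
 open import Data.Nat as ℕ using (ℕ; zero; suc; _∸_; NonZero; _≡ᵇ_)
 open import Data.Nat.DivMod using (_%_)
 open import Data.Integer using (ℤ; +_; _+_; -_; _-_; 0ℤ; 1ℤ)
 open import Data.Fin as Fin using (Fin; toℕ)
 open import Data.List using (List; []; _∷_; map; reverse; allFin; cartesianProduct; filter)
 open import Data.List.Relation.Unary.All as All using (All; []; _∷_; all?)
 open import Data.List.Relation.Unary.Any as Any using (here)
 open import Data.List.Relation.Binary.Sublist.Propositional using ([]; _∷_)
 open import Relation.Nullary.Decidable.Core using (T?)
 open import Relation.Nullary.Decidable using (_×-dec_; ¬?; isYes)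

 below : ℕ → (ℕ → Bool) → Bool
 below zero    f = true
 below (suc n) f = f n ∧ below n f

 module Candidates (N p : ℕ) .{{_ : NonZero N}} .{{_ : NonZero p}} where

  -- A vector whose second coordinate is nonzero modulo p lies outside the class of (1 , 0), where
  -- (0 , 1) is most frequent; any other vector is bounded by the overall maximum only.
  limit-of : ℕ → ℕ → Zn² N → ℕ
  limit-of m₁ m₂ (x , y) = if (toℕ y % p) ≡ᵇ 0 then m₁ else m₂

  candidate-of : ℕ → ℕ → Zn² N → Candidate
  candidate-of m₁ m₂ g = candidate ((N ∸ toℕ (proj₁ g)) % N) ((N ∸ toℕ (proj₂ g)) % N) (limit-of m₁ m₂ g)

  points : (Zn² N → Bool) → List (Zn² N)
  points ok = filter (λ g → T? (ok g)) (cartesianProduct (reverse (allFin N)) (reverse (allFin N)))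

  verified : ℕ → ℕ → (Zn² N → Bool) → ℕ → ℕ → Bool
  verified fuel n ok m₁ m₂ = impossible fuel (initial N m₁ m₂) (map (candidate-of m₁ m₂) (points ok)) (n ∸ (m₁ ℕ.+ m₂))

  module Admissible (e₁ e₂ : Zn² N) where

   Allowed : List G → Zn² N → Set
   Allowed ws g = All (λ w → ¬ Vanishes p (⟪ g ⟫ ⊕ w)) ws × g ≢ e₁ × g ≢ e₂

   allowed? : ∀ ws g → Dec (Allowed ws g)
   allowed? ws g = all? (λ w → ¬? (vanishes? p (⟪ g ⟫ ⊕ w))) ws ×-dec ¬? (g ≟² e₁) ×-dec ¬? (g ≟² e₂)

   -- The multiplicities run over 1 ≤ m₂ ≤ m₁ ≤ N - 3, each shifted by one because both are
   -- positive.
   all-verified : ℕ → List G → Bool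
   all-verified fuel ws = below (N ∸ 3) (λ a → below (suc a) (λ b → verified fuel (N ℕ.+ N ∸ 2) (λ g → isYes (allowed? ws g)) (suc a) (suc b)))

 -- the classes (1 , 1) and (2 , 2) modulo 3 exclude each other, and so do (1 , 2) and (2 , 1)
 excluded : Bool → Bool → List G
 excluded b b′ = 𝟎 ∷ (1ℤ , 0ℤ) ∷ (0ℤ , 1ℤ) ∷ diagonal b ∷ antidiagonal b′ ∷ []
  where
  diagonal antidiagonal : Bool → G
  diagonal true  = 1ℤ , 1ℤ
  diagonal false = + 2 , + 2
  antidiagonal true  = 1ℤ , + 2
  antidiagonal false = + 2 , 1ℤ

 -- Settled by evaluation. The fuel 1000 only bounds the depth of the recursion: too small a value
 -- would produce `false`. Modulo 2 the zero class is the only forbidden one.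
 check-8 : Candidates.Admissible.all-verified 8 2 (Fin.suc Fin.zero , Fin.zero) (Fin.zero , Fin.suc Fin.zero) 1000 (𝟎 ∷ []) ≡ true
 check-8 = refl

 check-9 : ∀ b b′ → Candidates.Admissible.all-verified 9 3 (Fin.suc Fin.zero , Fin.zero) (Fin.zero , Fin.suc Fin.zero) 1000 (excluded b b′) ≡ true
 check-9 true  true  = refl
 check-9 true  false = refl
 check-9 false true  = refl
 check-9 false false = refl

-- Additive forms from the group algebra, and the hyperbolic tangent

module MultilinearForms where

 open TranslationRing
 open FrobeniusMap
 open GroupAlgebras
 open import Data.Nat as ℕ using (ℕ; zero; suc; _∸_)
 open import Data.Nat.Primality using (Prime; prime⇒nonZero)
 open import Data.Integer using (ℤ; +_; -[1+_]; _+_; _*_; -_; _-_; 0ℤ; 1ℤ)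
 open import Data.List using (List; map; length)
 import Relation.Binary.Reasoning.Setoid as SetoidReasoning

 infix 4 _≈²[_]_
 _≈²[_]_ : G → ℕ → G → Set
 (a , b) ≈²[ m ] (c , d) = (a ≈[ m ] c) × (b ≈[ m ] d)

 -- Additive maps ℤ² → ℤ/m

 Additive : ℕ → (G → ℤ) → Set
 Additive m f = ∀ g h → f (g ⊕ h) ≈[ m ] f g + f h

 module _ {m : ℕ} {f : G → ℤ} (additive : Additive m f) where

  additive-𝟎 : f 𝟎 ≈[ m ] 0ℤ
  additive-𝟎 = ≈-trans (≈-reflexive (lem (f 𝟎))) (≈-trans (+-cong-≈ (≈-sym (additive 𝟎 𝟎)) (≈-refl {a = - f 𝟎})) (≈-reflexive (lem′ (f 𝟎))))
   where
   lem : ∀ x → x ≡ (x + x) + - x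
   lem = solve-∀
   lem′ : ∀ x → x + - x ≡ 0ℤ
   lem′ = solve-∀

  additive-multiple⁺ : ∀ n g → f (+ n · g) ≈[ m ] + n * f g
  additive-multiple⁺ zero    (a , b) = additive-𝟎
  additive-multiple⁺ (suc n) g@(a , b) = ≈-trans (≈-reflexive (cong f (cong₂ _,_ (lem a (+ n)) (lem b (+ n)))))
   (≈-trans (additive g (+ n · g)) (≈-trans (+-cong-≈ (≈-refl {a = f g}) (additive-multiple⁺ n g)) (≈-reflexive (sym (lem (f g) (+ n))))))
   where
   lem : ∀ a n → (1ℤ + n) * a ≡ a + n * a
   lem = solve-∀

  additive-multiple : ∀ n g → f (n · g) ≈[ m ] n * f g
  additive-multiple (+ n) g = additive-multiple⁺ n g
  additive-multiple -[1+ n ] g@(a , b) = ≈-trans (≈-reflexive (lem (f (-[1+ n ] · g)) (+ suc n * f g)))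
   (≈-trans (+-cong-≈ (≈-trans (+-cong-≈ (≈-refl {a = f (-[1+ n ] · g)}) (≈-sym (additive-multiple⁺ (suc n) g)))
    (≈-trans (≈-sym (additive (-[1+ n ] · g) (+ suc n · g)))
      (≈-trans (≈-reflexive (cong f (cong₂ _,_ (cancel a (+ suc n)) (cancel b (+ suc n))))) additive-𝟎)))
      (≈-refl {a = - (+ suc n * f g)}))
    (≈-reflexive (lem′ (f g) (+ suc n))))
   where
   lem : ∀ x y → x ≡ (x + y) + - y
   lem = solve-∀
   cancel : ∀ a n → - n * a + n * a ≡ 0ℤ
   cancel = solve-∀
   lem′ : ∀ x n → 0ℤ + - (n * x) ≡ - n * x
   lem′ = solve-∀

  additive-combination : ∀ α β u v → f (α · u ⊕ β · v) ≈[ m ] α * f u + β * f v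
  additive-combination α β u v = ≈-trans (additive (α · u) (β · v)) (+-cong-≈ (additive-multiple α u) (additive-multiple β v))

 module Functionals {p : ℕ} (pp : Prime p) (k : ℕ) (A : GroupAlgebra p (p ℕ.^ k)) where

  open LocalAlgebra pp k A public
  open Solver using (solve; _:=_; _:+_; _:*_; _:-_; :-_; con)

  X-cong : ∀ {g h} → g ≈²[ q ] h → X g ≋ X h
  X-cong {a , b} {c , d} (mod-by s refl , mod-by t refl) = ≋-trans
   (≋-reflexive (cong X (cong₂ _,_ (lem c s (+ q)) (lem d t (+ q)))))
   (≋-trans (X-⊕ (c , d) (+ q · (s , t))) (≋-trans (*-congˡ (X-period (s , t))) (*-identityʳ _)))
   where
   lem : ∀ c s q → c + s * q ≡ c + q * s
   lem = solve-∀

  v-cong : ∀ {g h} → g ≈²[ q ] h → v g ≋ v h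
  v-cong e = +-congˡ (-‿cong (X-cong e))

  φ-J : ∀ {t a} rest b → J t a → top ℕ.≤ t ℕ.+ length rest → φ (a *′ (b *′ vs rest)) ≈[ p ] 0ℤ
  φ-J {a = a} rest b j le = φ-zero (≋-trans (solve 3 (λ a b w → a :* (b :* w) := b :* (a :* w)) ≋-refl a b (vs rest))
   (≋-trans (*-congˡ (j rest le)) (zeroʳ b)))

  -- φ(− · w) depends only on the class modulo a power of the augmentation ideal
  φ-mod-J : ∀ {t a b} rest c → J t (a − b) → top ℕ.≤ t ℕ.+ length rest →
         φ (a *′ (c *′ vs rest)) ≈[ p ] φ (b *′ (c *′ vs rest))
  φ-mod-J {a = a} {b} rest c j le = ≈-trans
   (φ-cong (solve 3 (λ a b w → a :* w := b :* w :+ (a :- b) :* w) ≋-refl a b (c *′ vs rest)))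
   (≈-trans (φ-+ (b *′ (c *′ vs rest)) ((a − b) *′ (c *′ vs rest))) (+-vanishes-≈ (φ-J rest c j le)))

  J-raised : ∀ {a} → Raises a → J 1 a
  J-raised {a} r = J-cong (≋-trans (*-congˡ constant-1) (*-identityʳ a)) (r (J-zero 𝟙))

  -- The bilinear part: v (g ⊕ h) ≡ v g + v h modulo the square

  v-additive : ∀ g h → J 2 (v (g ⊕ h) − (v g +′ v h))
  v-additive g h = J-cong (≋-trans (solve 2 (λ x y → :- ((con 1ℤ :- x) :* (con 1ℤ :- y)) := (con 1ℤ :- x :* y) :- ((con 1ℤ :- x) :+ (con 1ℤ :- y))) ≋-refl (X g) (X h))
    (+-congʳ (+-congˡ (-‿cong (≋-sym (X-⊕ g h))))))
   (J-neg (raises-v g (J-raised (raises-v h))))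

  linearForm : List G → G → ℤ
  linearForm rest g = φ (v g *′ (𝟙 *′ vs rest))

  -- The defect of additivity lies in the square of the augmentation ideal, and `rest` supplies the
  -- other factors that annihilate it.
  linearForm-additive : ∀ rest → top ℕ.≤ 2 ℕ.+ length rest → Additive p (linearForm rest)
  linearForm-additive rest le g h = ≈-trans (φ-mod-J rest 𝟙 (v-additive g h) le)
   (≈-trans (φ-cong (distribʳ _ (v g) (v h))) (φ-+ _ _))

  bilinearForm : List G → G → G → ℤ
  bilinearForm rest h g = φ ((v h *′ v g) *′ (𝟙 *′ vs rest))

  bilinearForm-additive : ∀ rest → top ℕ.≤ 3 ℕ.+ length rest → ∀ h → Additive p (bilinearForm rest h)
  bilinearForm-additive rest le h g g′ = ≈-trans
   (φ-mod-J {b = v h *′ v g +′ v h *′ v g′} rest 𝟙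
    (J-cong (solve 4 (λ h a b c → h :* (c :- (a :+ b)) := h :* c :- (h :* a :+ h :* b)) ≋-refl (v h) (v g) (v g′) (v (g ⊕ g′)))
      (raises-v h (v-additive g g′))) le)
   (≈-trans (φ-cong (distribʳ _ (v h *′ v g) (v h *′ v g′))) (φ-+ _ _))

  bilinearForm-comm : ∀ rest h g → bilinearForm rest h g ≈[ p ] bilinearForm rest g h
  bilinearForm-comm rest h g = φ-cong (*-congʳ (*-comm (v h) (v g)))

 -- p odd and different from 3: θ g = (1 − X g)/(1 + X g) satisfies the addition law of
 -- the hyperbolic tangent, and θ + θ³/3 is additive modulo fifth powers.

 module Tangent {p : ℕ} (pp : Prime p) (k : ℕ) (A : GroupAlgebra p (p ℕ.^ k))
            (½ ⅓ : ℤ) (2½ : + 2 * ½ ≈[ p ] 1ℤ) (3⅓ : + 3 * ⅓ ≈[ p ] 1ℤ) where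

  open Functionals pp k A public
  open Solver using (solve; _:=_; _:+_; _:*_; _:-_; :-_; con)
  open import Algebra.Properties.Semiring.Exp semiring using (_^_; ^-congˡ)

  constant-cong : ∀ {a b} → a ≈[ p ] b → constant a ≋ constant b
  constant-cong {_} {b} (mod-by c refl) = ≋-trans (constant-+ b (c * + p))
   (≋-trans (+-congˡ (≋-trans (constant-* c (+ p)) (≋-trans (*-congˡ constant-p) (zeroʳ _)))) (+-identityʳ _))

  plus : G → Carrier
  plus g = 𝟙 +′ X g

  private
   power-pred : ∀ x n → 0 ℕ.< n → x ^ n ≋ x *′ x ^ (n ∸ 1)
   power-pred x (suc n) _ = ≋-refl

   0<q : 0 ℕ.< q
   0<q = ℕₚ.m^n>0 p {{prime⇒nonZero pp}} k

  -- From (1 + X^g)^q = 1 + X^(qg) = 2 the inverse of 1 + X^g is half of its power with exponent q -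
  -- 1.
  inverse : G → Carrier
  inverse g = constant ½ *′ plus g ^ (q ∸ 1)

  plus-inverse : ∀ g → plus g *′ inverse g ≋ 𝟙
  plus-inverse g = begin
   plus g *′ (constant ½ *′ plus g ^ (q ∸ 1))  ≈⟨ solve 3 (λ a c b → a :* (c :* b) := c :* (a :* b)) ≋-refl (plus g) (constant ½) (plus g ^ (q ∸ 1)) ⟩
   constant ½ *′ (plus g *′ plus g ^ (q ∸ 1))  ≈⟨ *-congˡ (power-pred (plus g) q 0<q) ⟨
   constant ½ *′ plus g ^ q                    ≈⟨ *-congˡ (frobenius-iterate char-p k 𝟙 (X g)) ⟩
   constant ½ *′ (𝟙 ^ q +′ X g ^ q)            ≈⟨ *-congˡ (+-cong (one q) (≋-trans (X-power q g) (≋-trans (X-period g) (≋-sym constant-1)))) ⟩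
   constant ½ *′ (𝟙 +′ 𝟙)                      ≈⟨ *-congˡ (constant-+ 1ℤ 1ℤ) ⟨
   constant ½ *′ constant (+ 2)                ≈⟨ constant-* ½ (+ 2) ⟨
   constant (½ * + 2)                          ≈⟨ constant-cong (≈-trans (≈-reflexive (ℤₚ.*-comm ½ (+ 2))) 2½) ⟩
   𝟙                                           ∎
   where
   open SetoidReasoning setoid
   open Frobenius pp ring
   one : ∀ n → 𝟙 ^ n ≋ 𝟙
   one zero = ≋-sym constant-1
   one (suc n) = ≋-trans (*-congˡ (one n)) (≋-trans (*-congˡ constant-1) (*-identityʳ _))

  θ : G → Carrier
  θ g = inverse g *′ v g

  plus-θ : ∀ g → plus g *′ θ g ≋ v g
  plus-θ g = ≋-trans (≋-sym (*-assoc _ _ _)) (≋-trans (*-congʳ (plus-inverse g)) (≋-trans (*-congʳ constant-1) (*-identityˡ _)))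

  raises-θ : ∀ g → Raises (θ g)
  raises-θ g = raises-* (inverse g) (raises-v g)

  θ-cong : ∀ {g h} → g ≈²[ q ] h → θ g ≋ θ h
  θ-cong e = *-cong (*-congˡ (^-congˡ (q ∸ 1) (+-congˡ (X-cong e)))) (v-cong e)

  -- After multiplication by the unit (1 + X^g)(1 + X^h) the law is polynomial and follows from (1 +
  -- x)(1 + y) + (1 - x)(1 - y) = 2(1 + xy).
  θ-⊕ : ∀ g h → θ (g ⊕ h) ≋ (θ g +′ θ h) − θ g *′ θ h *′ θ (g ⊕ h)
  θ-⊕ g h = begin
   t  ≈⟨ cancel ⟩
   i *′ (P *′ t)
     ≈⟨ *-congˡ (begin
       P *′ t
        ≈⟨ solve 5 (λ x y a b t → (x :* y) :* t := ((x :* y) :* t :+ (x :* a) :* (y :* b) :* t) :- (x :* a) :* (y :* b) :* t)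
             ≋-refl (plus g) (plus h) a b t ⟩
       (P *′ t +′ (plus g *′ a) *′ (plus h *′ b) *′ t) − (plus g *′ a) *′ (plus h *′ b) *′ t
        ≈⟨ +-congʳ (begin
          P *′ t +′ (plus g *′ a) *′ (plus h *′ b) *′ t  ≈⟨ +-congˡ (*-congʳ (*-cong (plus-θ g) (plus-θ h))) ⟩
          P *′ t +′ v g *′ v h *′ t
            ≈⟨ solve 3 (λ x y t → (con 1ℤ :+ x) :* (con 1ℤ :+ y) :* t :+ (con 1ℤ :- x) :* (con 1ℤ :- y) :* t := (con 1ℤ :+ con 1ℤ) :* ((con 1ℤ :+ x :* y) :* t)) ≋-refl (X g) (X h) t ⟩
          (𝟙 +′ 𝟙) *′ ((𝟙 +′ X g *′ X h) *′ t)          ≈⟨ *-congˡ (*-congʳ (+-congˡ (≋-sym (X-⊕ g h)))) ⟩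
          (𝟙 +′ 𝟙) *′ (plus (g ⊕ h) *′ t)               ≈⟨ *-congˡ (plus-θ (g ⊕ h)) ⟩
          (𝟙 +′ 𝟙) *′ v (g ⊕ h)                         ≈⟨ *-congˡ (+-congˡ (-‿cong (X-⊕ g h))) ⟩
          (𝟙 +′ 𝟙) *′ (𝟙 − X g *′ X h)
            ≈⟨ solve 2 (λ x y → (con 1ℤ :+ con 1ℤ) :* (con 1ℤ :- x :* y) := (con 1ℤ :+ y) :* (con 1ℤ :- x) :+ (con 1ℤ :+ x) :* (con 1ℤ :- y)) ≋-refl (X g) (X h) ⟩
          plus h *′ v g +′ plus g *′ v h                 ≈⟨ +-cong (*-congˡ (≋-sym (plus-θ g))) (*-congˡ (≋-sym (plus-θ h))) ⟩
          plus h *′ (plus g *′ a) +′ plus g *′ (plus h *′ b) ∎) ⟩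
       (plus h *′ (plus g *′ a) +′ plus g *′ (plus h *′ b)) − (plus g *′ a) *′ (plus h *′ b) *′ t
        ≈⟨ solve 5 (λ x y a b t → (y :* (x :* a) :+ x :* (y :* b)) :- (x :* a) :* (y :* b) :* t := (x :* y) :* ((a :+ b) :- a :* b :* t))
             ≋-refl (plus g) (plus h) a b t ⟩
       P *′ ((a +′ b) − a *′ b *′ t) ∎) ⟩
   i *′ (P *′ ((a +′ b) − a *′ b *′ t))  ≈⟨ cancel ⟨
   (a +′ b) − a *′ b *′ t ∎
   where
   open SetoidReasoning setoid
   a = θ g
   b = θ h
   t = θ (g ⊕ h)
   P = plus g *′ plus h
   i = inverse g *′ inverse h
   cancel : ∀ {x} → x ≋ i *′ (P *′ x)
   cancel {x} = ≋-sym (≋-trans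
    (solve 5 (λ i j x y z → (i :* j) :* ((x :* y) :* z) := (x :* i) :* ((y :* j) :* z)) ≋-refl (inverse g) (inverse h) (plus g) (plus h) x)
    (≋-trans (*-cong (≋-trans (plus-inverse g) constant-1) (≋-trans (*-congʳ (≋-trans (plus-inverse h) constant-1)) (*-identityˡ x))) (*-identityˡ x)))

  -- The series of artanh cut off after its cubic term.
  L : G → Carrier
  L g = θ g +′ constant ⅓ *′ (θ g *′ (θ g *′ θ g))

  θ-additive : ∀ g h → J 3 (θ (g ⊕ h) − (θ g +′ θ h))
  θ-additive g h = J-cong
   (≋-trans (solve 3 (λ a b t → :- (a :* (b :* t)) := ((a :+ b) :- a :* b :* t) :- (a :+ b)) ≋-refl (θ g) (θ h) (θ (g ⊕ h)))
    (+-congʳ (≋-sym (θ-⊕ g h))))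
   (J-neg (raises-θ g (raises-θ h (J-raised (raises-θ (g ⊕ h))))))

  -- Using the addition law twice replaces t by s - ab(s - abt), where s = a + b. The cubic defect
  -- ab·s then has coefficient 3·⅓ - 1 = 0, and every other term contains at least five factors `θ`.
  L-additive : ∀ g h → J 5 (L (g ⊕ h) − (L g +′ L h))
  L-additive g h = J-cong (≋-sym error) (J-+ r₁ (J-neg (J-* (constant ⅓) (J-+ (J-+ (J-* (constant (+ 3)) r₂) (J-neg (J-* (constant (+ 3)) r₃))) r₄))))
   where
   a = θ g
   b = θ h
   t = θ (g ⊕ h)
   s = a +′ b
   c = constant ⅓
   ra = raises-θ g
   rb = raises-θ h
   rt = raises-θ (g ⊕ h)
   rs : Raises s
   rs = raises-+ ra rb
   r₁ : J 5 (a *′ (a *′ (b *′ (b *′ t))))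
   r₁ = ra (ra (rb (rb (J-raised rt))))
   r₂ : J 5 (s *′ (s *′ (a *′ (b *′ t))))
   r₂ = rs (rs (ra (rb (J-raised rt))))
   r₃ : J 5 (t *′ (s *′ (a *′ (a *′ (b *′ (b *′ t))))))
   r₃ = J-weaken (J-weaken (rt (rs (ra (ra (rb (rb (J-raised rt))))))))
   r₄ : J 5 (t *′ (t *′ (a *′ (b *′ (a *′ (b *′ (a *′ (b *′ t))))))))
   r₄ = J-weaken (J-weaken (J-weaken (J-weaken (rt (rt (ra (rb (ra (rb (ra (rb (J-raised rt))))))))))))
   open SetoidReasoning setoid
   error : L (g ⊕ h) − (L g +′ L h) ≋
         a *′ (a *′ (b *′ (b *′ t))) +′ (-′ (c *′ ((constant (+ 3) *′ (s *′ (s *′ (a *′ (b *′ t)))) +′ (-′ (constant (+ 3) *′ (t *′ (s *′ (a *′ (a *′ (b *′ (b *′ t)))))))))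
           +′ t *′ (t *′ (a *′ (b *′ (a *′ (b *′ (a *′ (b *′ t))))))))))
   error = begin
    (t +′ c *′ (t *′ (t *′ t))) − (L g +′ L h)
      ≈⟨ +-congʳ (+-cong twice (*-congˡ (*-cong (θ-⊕ g h) (*-cong (θ-⊕ g h) (θ-⊕ g h))))) ⟩
    ((s − a *′ b *′ (s − a *′ b *′ t)) +′ c *′ (r *′ (r *′ r))) − (L g +′ L h)
      ≈⟨ solve 4 (λ a b t c → ((let s = a :+ b ; r = s :- a :* b :* t in
          ((s :- a :* b :* (s :- a :* b :* t)) :+ c :* (r :* (r :* r))) :- ((a :+ c :* (a :* (a :* a))) :+ (b :+ c :* (b :* (b :* b)))))
          := let s = a :+ b in
            (con (+ 3) :* c :- con 1ℤ) :* (a :* b :* s) :+ (a :* (a :* (b :* (b :* t))) :+ (:- (c :* ((con (+ 3) :* (s :* (s :* (a :* (b :* t)))) :+ (:- (con (+ 3) :* (t :* (s :* (a :* (a :* (b :* (b :* t)))))))))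
              :+ t :* (t :* (a :* (b :* (a :* (b :* (a :* (b :* t))))))))))))
          ) ≋-refl a b t c ⟩
    (constant (+ 3) *′ c − 𝟙) *′ (a *′ b *′ s) +′ _
      ≈⟨ +-congʳ (≋-trans (*-congʳ (≋-trans (+-congʳ (≋-trans (≋-sym (constant-* (+ 3) ⅓)) (constant-cong 3⅓))) (-‿inverseʳ 𝟙))) (zeroˡ _)) ⟩
    0# +′ _ ≈⟨ +-identityˡ _ ⟩
    _ ∎
    where
    r = s − a *′ b *′ t
    twice : t ≋ s − a *′ b *′ (s − a *′ b *′ t)
    twice = ≋-trans (θ-⊕ g h) (+-congˡ (-‿cong (*-congˡ (θ-⊕ g h))))

-- Quartic and quadratic forms of a minimal zero-sum sequence

module QuarticForm where

 open TranslationRing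
 open FrobeniusMap
 open GroupAlgebras
 open MultilinearForms
 open import Data.Nat as ℕ using (ℕ; zero; suc; s≤s; z≤n)
 open import Data.Bool using (Bool; true; false)
 open import Data.Integer using (ℤ; +_; _+_; _*_; -_; _-_; 1ℤ)
 open import Data.List using (List; []; _∷_; _++_; map; length)
 open import Data.List.Properties using (length-map)
 open import Data.List.Relation.Binary.Sublist.Propositional using (_⊆_; []; _∷_)

 record MinimalZeroSum (m : ℕ) (l : List G) : Set where
  field
   zero-sum : Vanishes m (Σ⊕ l)
   minimal  : ∀ {S} → S ⊆ l → Vanishes m (Σ⊕ S) → S ≡ [] ⊎ length S ≡ length l

 -- The symmetric quartic and quadratic forms attached to a minimal zero-sum sequence
 -- containing u, u, v, w, z.
 record Quartic (p : ℕ) (u v w z : G) : Set where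
  field
   D          : G → G → G → G → ℤ
   D-additive : ∀ b c d → Additive p (λ a → D a b c d)
   D-cong     : ∀ {a a′} b c d → a ≈²[ p ] a′ → D a b c d ≈[ p ] D a′ b c d
   D-swap₁    : ∀ a b c d → D a b c d ≈[ p ] D b a c d
   D-swap₂    : ∀ a b c d → D a b c d ≈[ p ] D a c b d
   D-swap₃    : ∀ a b c d → D a b c d ≈[ p ] D a b d c
   Q          : G → G → ℤ
   Q-additive : ∀ b → Additive p (λ a → Q a b)
   Q-cong     : ∀ {a a′} b → a ≈²[ p ] a′ → Q a b ≈[ p ] Q a′ b
   Q-swap     : ∀ a b → Q a b ≈[ p ] Q b a
   D-uuvw     : D u u v w ≈[ p ] 1ℤ
   D-uuvz     : D u u v z ≈[ p ] 1ℤ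
   D-uuwz     : D u u w z ≈[ p ] 1ℤ
   D-uvwz     : D u v w z ≈[ p ] 1ℤ
   Q-uu       : Q u u ≈[ p ] + 3 + (D u u u u + D u u u u)
   Q-uv       : Q u v ≈[ p ] + 3 + (D u u u v + D u v v v)
   Q-uw       : Q u w ≈[ p ] + 3 + (D u u u w + D u w w w)
   Q-uz       : Q u z ≈[ p ] + 3 + (D u u u z + D u z z z)
   Q-vw       : Q v w ≈[ p ] + 3 + (D v v v w + D v w w w)
   Q-vz       : Q v z ≈[ p ] + 3 + (D v v v z + D v z z z)
   Q-wz       : Q w z ≈[ p ] + 3 + (D w w w z + D w z z z)

 module Forms {p : ℕ} (pp : Prime p) (k : ℕ) (A : GroupAlgebra p (p ℕ.^ k))
          (½ ⅓ : ℤ) (2½ : + 2 * ½ ≈[ p ] 1ℤ) (3⅓ : + 3 * ⅓ ≈[ p ] 1ℤ) where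

  open Tangent pp k A ½ ⅓ 2½ 3⅓ public
  open Solver using (solve; _:=_; _:+_; _:*_; _:-_; :-_; con)

  θs : List (Bool × G) → Carrier
  θs []              = 𝟙
  θs ((true  , g) ∷ l) = θ g *′ θs l
  θs ((false , g) ∷ l) = θs l

  pluses : List G → Carrier
  pluses []      = 𝟙
  pluses (g ∷ l) = plus g *′ pluses l

  signed : Bool × G → ℤ × G
  signed (true  , g) = - 1ℤ , g
  signed (false , g) = 1ℤ , g

  -- Each `θ g` replaces the factor 1 + X^g of the weight by 1 - X^g.
  θs-pluses : ∀ l w → θs l *′ (pluses (map proj₂ l) *′ w) ≋ binomials (map signed l) *′ w
  θs-pluses [] w = ≋-trans (*-congˡ (≋-trans (*-congʳ constant-1) (*-identityˡ w))) ≋-refl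
  θs-pluses ((true , g) ∷ l) w = ≋-trans
   (solve 5 (λ t m s n w → (t :* m) :* ((s :* n) :* w) := (s :* t) :* (m :* (n :* w))) ≋-refl (θ g) (θs l) (plus g) (pluses (map proj₂ l)) w)
   (≋-trans (*-cong (≋-trans (plus-θ g) (≋-sym (≋-trans (+-congˡ (*-congʳ (constant-- 1ℤ)))
    (solve 1 (λ x → con 1ℤ :+ (:- con 1ℤ) :* x := con 1ℤ :- x) ≋-refl (X g))))) (θs-pluses l w)) (≋-sym (*-assoc _ _ w)))
  θs-pluses ((false , g) ∷ l) w = ≋-trans
   (solve 4 (λ m s n w → m :* ((s :* n) :* w) := s :* (m :* (n :* w))) ≋-refl (θs l) (plus g) (pluses (map proj₂ l)) w)
   (≋-trans (*-cong (solve 1 (λ x → con 1ℤ :+ x := con 1ℤ :+ con 1ℤ :* x) ≋-refl (X g)) (θs-pluses l w)) (≋-sym (*-assoc _ _ w)))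

  binomials-++ : ∀ l l′ → binomials (l ++ l′) ≋ binomials l *′ binomials l′
  binomials-++ [] l′ = ≋-sym (≋-trans (*-congʳ constant-1) (*-identityˡ _))
  binomials-++ ((ε , g) ∷ l) l′ = ≋-trans (*-congˡ (binomials-++ l l′)) (≋-sym (*-assoc _ _ _))

  signs-++ : ∀ l l′ → signs (l ++ l′) ≡ signs l * signs l′
  signs-++ [] l′ = sym (ℤₚ.*-identityˡ (signs l′))
  signs-++ ((ε , g) ∷ l) l′ = trans (cong (λ z → ε * z) (signs-++ l l′)) (sym (ℤₚ.*-assoc ε (signs l) (signs l′)))

  signs-minus : ∀ gs n → length gs ≡ n ℕ.+ n → signs (minus gs) ≡ 1ℤ
  signs-minus [] n e = refl
  signs-minus (g ∷ []) (suc n) e with trans (ℕₚ.suc-injective e) (ℕₚ.+-suc n n)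
  ... | ()
  signs-minus (g ∷ h ∷ gs) (suc n) e = trans (lem (signs (minus gs)))
   (signs-minus gs n (ℕₚ.suc-injective (trans (ℕₚ.suc-injective e) (ℕₚ.+-suc n n))))
   where
   lem : ∀ x → - 1ℤ * (- 1ℤ * x) ≡ x
   lem = solve-∀

  elements-signed : ∀ l rest → elements (map signed l ++ minus rest) ≡ map proj₂ l ++ rest
  elements-signed [] rest = elements-minus rest
  elements-signed ((true , g) ∷ l) rest = cong (g ∷_) (elements-signed l rest)
  elements-signed ((false , g) ∷ l) rest = cong (g ∷_) (elements-signed l rest)

  -- Minimality leaves 1 plus the sign of the full sequence, to which `rest` contributes +1 because
  -- its length is even.
  θs-value : ∀ x l rest n → length rest ≡ n ℕ.+ n → MinimalZeroSum q (map proj₂ (x ∷ l) ++ rest) →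
          φ (θs (x ∷ l) *′ (pluses (map proj₂ (x ∷ l)) *′ vs rest)) ≈[ p ] 1ℤ + signs (map signed (x ∷ l))
  θs-value x l rest n even min = ≈-trans
   (φ-cong (≋-trans (θs-pluses l′ (vs rest)) (≋-trans (*-congˡ (≋-sym (binomials-minus rest))) (≋-sym (binomials-++ (map signed l′) (minus rest))))))
   (≈-trans (expand-minimal all (s≤s z≤n) (subst (λ y → Vanishes q (Σ⊕ y)) (sym els) zero-sum)
     λ {S} s z → subst (λ n → S ≡ [] ⊎ length S ≡ n) len (minimal (subst (S ⊆_) els s) z))
    (≈-reflexive (cong (λ z → 1ℤ + z) (trans (signs-++ (map signed l′) (minus rest))
      (trans (cong (λ z → signs (map signed l′) * z) (signs-minus rest n even)) (ℤₚ.*-identityʳ (signs (map signed l′))))))))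
   where
   open MinimalZeroSum min
   l′ = x ∷ l
   all = map signed l′ ++ minus rest
   els = elements-signed l′ rest
   len : length (map proj₂ l′ ++ rest) ≡ length all
   len = trans (cong length (sym els)) (length-map proj₂ all)

  module _ (u v w z : G) (rest : List G) (n : ℕ) (even : length rest ≡ n ℕ.+ n)
        (long : top ℕ.≤ 5 ℕ.+ length rest) (min : MinimalZeroSum q (u ∷ u ∷ v ∷ w ∷ z ∷ rest)) where

   private
    T = u ∷ u ∷ v ∷ w ∷ z ∷ []
    W = pluses T *′ vs rest

    -- An even number of minus signs gives the coefficient 2, which ½ normalises to 1.
    ½φ : Carrier → ℤ
    ½φ a = ½ * φ (a *′ W)

    ½φ-cong : ∀ {a b} → a ≋ b → ½φ a ≈[ p ] ½φ b
    ½φ-cong e = *-congˡ-≈ ½ (φ-cong (*-congʳ e))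

    ½φ-+ : ∀ a b → ½φ (a +′ b) ≈[ p ] ½φ a + ½φ b
    ½φ-+ a b = ≈-trans (*-congˡ-≈ ½ (≈-trans (φ-cong (distribʳ W a b)) (φ-+ _ _))) (≈-reflexive (ℤₚ.*-distribˡ-+ ½ (φ (a *′ W)) (φ (b *′ W))))

    ½φ-const : ∀ c a → ½φ (constant c *′ a) ≈[ p ] c * ½φ a
    ½φ-const c a = ≈-trans (*-congˡ-≈ ½ (≈-trans (φ-cong (*-assoc (constant c) a W)) (φ-constant c _))) (≈-reflexive (lem ½ c (φ (a *′ W))))
      where
      lem : ∀ h c x → h * (c * x) ≡ c * (h * x)
      lem = solve-∀

    ½φ-J : ∀ {a b} → J 5 (a − b) → ½φ a ≈[ p ] ½φ b
    ½φ-J j = *-congˡ-≈ ½ (φ-mod-J rest (pluses T) j long)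

    additive-from : ∀ {f : G → Carrier} y → (∀ g h → J 5 (y *′ (f (g ⊕ h) − (f g +′ f h)))) → Additive p (λ g → ½φ (f g *′ y))
    additive-from {f} y j g h = ≈-trans
      (½φ-J {b = f g *′ y +′ f h *′ y}
       (J-cong (solve 4 (λ a b c y → y :* (c :- (a :+ b)) := c :* y :- (a :* y :+ b :* y)) ≋-refl (f g) (f h) (f (g ⊕ h)) y) (j g h)))
      (½φ-+ _ _)

    D : G → G → G → G → ℤ
    D a b c d = ½φ (θ a *′ (θ b *′ (θ c *′ θ d)))

    value : ∀ {x l} → map proj₂ (x ∷ l) ≡ T → signs (map signed (x ∷ l)) ≡ 1ℤ → ∀ {a} → a ≋ θs (x ∷ l) → ½φ a ≈[ p ] 1ℤ
    value {x} {l} eq sg e = ≈-trans (*-congˡ-≈ ½ (≈-trans (φ-cong (*-cong e (*-congʳ (≋-reflexive (cong pluses (sym eq))))))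
      (θs-value x l rest n even (subst (λ y → MinimalZeroSum q (y ++ rest)) (sym eq) min))))
      (≈-trans (≈-reflexive (trans (cong (λ s → ½ * (1ℤ + s)) sg) (ℤₚ.*-comm ½ (+ 2)))) 2½)

    four : ∀ {a b c d} → a *′ (b *′ (c *′ d)) ≋ a *′ (b *′ (c *′ (d *′ 𝟙)))
    four {a} {b} {c} {d} = solve 4 (λ a b c d → a :* (b :* (c :* d)) := a :* (b :* (c :* (d :* con 1ℤ)))) ≋-refl a b c d

    two : ∀ {a b} → a *′ b ≋ a *′ (b *′ 𝟙)
    two {a} {b} = solve 2 (λ a b → a :* b := a :* (b :* con 1ℤ)) ≋-refl a b

    -- Since `θ` is additive only up to degree three, a form of degree two has to be built from `L`;
    -- the factor 3 clears the denominator.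
    Q : G → G → ℤ
    Q a b = + 3 * ½φ (L a *′ L b)

    -- The product of the two truncations has terms of degree 2, 4 and 6. The first has value 1, the
    -- second consists of values of `D`, and degree six is annihilated by `rest`.
    Q-value : ∀ a b → ½φ (θ a *′ θ b) ≈[ p ] 1ℤ → Q a b ≈[ p ] + 3 + (D a a a b + D a b b b)
    Q-value a b e = ≈-trans (*-congˡ-≈ (+ 3) (≈-trans
      (½φ-J {b = θ a *′ θ b +′ constant ⅓ *′ (θ a *′ (θ a *′ (θ a *′ θ b)) +′ θ a *′ (θ b *′ (θ b *′ θ b)))}
       (J-cong (solve 3 (λ a b c → c :* c :* (a :* (a :* (a :* (b :* (b :* b))))) :=
           (a :+ c :* (a :* (a :* a))) :* (b :+ c :* (b :* (b :* b))) :- (a :* b :+ c :* (a :* (a :* (a :* b)) :+ a :* (b :* (b :* b)))))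
           ≋-refl (θ a) (θ b) (constant ⅓))
         (J-weaken (J-* _ (raises-θ a (raises-θ a (raises-θ a (raises-θ b (raises-θ b (J-raised (raises-θ b)))))))))))
      (≈-trans (½φ-+ _ _) (+-cong-≈ e (≈-trans (½φ-const ⅓ _) (*-congˡ-≈ ⅓ (½φ-+ _ _)))))))
      (≈-trans (≈-reflexive (lem ⅓ (D a a a b + D a b b b))) (≈-trans (+-cong-≈ (≈-refl {a = + 3})
       (*-cong-≈ 3⅓ (≈-refl {a = D a a a b + D a b b b}))) (≈-reflexive (cong (λ z → + 3 + z) (ℤₚ.*-identityˡ (D a a a b + D a b b b))))))
      where
      lem : ∀ t x → + 3 * (1ℤ + t * x) ≡ + 3 + + 3 * t * x
      lem = solve-∀

    t = true
    f = false

   quarticForms : p ≡ q → Quartic p u v w z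
   quarticForms p≡q = record
    { D = D
    ; D-additive = λ b c d → additive-from (θ b *′ (θ c *′ θ d)) λ g h → J-weaken
       (J-cong (solve 4 (λ b c d x → b :* (c :* (d :* x)) := (b :* (c :* d)) :* x) ≋-refl (θ b) (θ c) (θ d) _)
         (raises-θ b (raises-θ c (raises-θ d (θ-additive g h)))))
    ; D-cong = λ b c d e → ½φ-cong (*-congʳ (θ-cong (subst (λ m → _ ≈²[ m ] _) p≡q e)))
    ; D-swap₁ = λ a b c d → ½φ-cong (solve 3 (λ a b x → a :* (b :* x) := b :* (a :* x)) ≋-refl (θ a) (θ b) (θ c *′ θ d))
    ; D-swap₂ = λ a b c d → ½φ-cong (solve 4 (λ a b c d → a :* (b :* (c :* d)) := a :* (c :* (b :* d))) ≋-refl (θ a) (θ b) (θ c) (θ d))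
    ; D-swap₃ = λ a b c d → ½φ-cong (solve 4 (λ a b c d → a :* (b :* (c :* d)) := a :* (b :* (d :* c))) ≋-refl (θ a) (θ b) (θ c) (θ d))
    ; Q = Q
    ; Q-additive = λ b g h → ≈-trans (*-congˡ-≈ (+ 3) (additive-from (L b) (λ g h → J-* (L b) (L-additive g h)) g h)) (≈-reflexive (ℤₚ.*-distribˡ-+ (+ 3) (½φ (L g *′ L b)) (½φ (L h *′ L b))))
    ; Q-cong = λ b e → *-congˡ-≈ (+ 3) (½φ-cong (*-congʳ (L-cong (subst (λ m → _ ≈²[ m ] _) p≡q e))))
    ; Q-swap = λ a b → *-congˡ-≈ (+ 3) (½φ-cong (*-comm (L a) (L b)))
    ; D-uuvw = value {x = t , u} {l = (t , u) ∷ (t , v) ∷ (t , w) ∷ (f , z) ∷ []} refl refl four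
    ; D-uuvz = value {x = t , u} {l = (t , u) ∷ (t , v) ∷ (f , w) ∷ (t , z) ∷ []} refl refl four
    ; D-uuwz = value {x = t , u} {l = (t , u) ∷ (f , v) ∷ (t , w) ∷ (t , z) ∷ []} refl refl four
    ; D-uvwz = value {x = t , u} {l = (f , u) ∷ (t , v) ∷ (t , w) ∷ (t , z) ∷ []} refl refl four
    ; Q-uu = Q-value u u (value {x = t , u} {l = (t , u) ∷ (f , v) ∷ (f , w) ∷ (f , z) ∷ []} refl refl two)
    ; Q-uv = Q-value u v (value {x = t , u} {l = (f , u) ∷ (t , v) ∷ (f , w) ∷ (f , z) ∷ []} refl refl two)
    ; Q-uw = Q-value u w (value {x = t , u} {l = (f , u) ∷ (f , v) ∷ (t , w) ∷ (f , z) ∷ []} refl refl two)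
    ; Q-uz = Q-value u z (value {x = t , u} {l = (f , u) ∷ (f , v) ∷ (f , w) ∷ (t , z) ∷ []} refl refl two)
    ; Q-vw = Q-value v w (value {x = f , u} {l = (f , u) ∷ (t , v) ∷ (t , w) ∷ (f , z) ∷ []} refl refl two)
    ; Q-vz = Q-value v z (value {x = f , u} {l = (f , u) ∷ (t , v) ∷ (f , w) ∷ (t , z) ∷ []} refl refl two)
    ; Q-wz = Q-value w z (value {x = f , u} {l = (f , u) ∷ (f , v) ∷ (t , w) ∷ (t , z) ∷ []} refl refl two)
    }
    where
    L-cong : ∀ {g h} → g ≈²[ q ] h → L g ≋ L h
    L-cong e = +-cong (θ-cong e) (*-congˡ (*-cong (θ-cong e) (*-cong (θ-cong e) (θ-cong e))))

-- A reflective normaliser for certificates of polynomial consequences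

module PolynomialIdentities where

 open TranslationRing
 open import Data.Nat as ℕ using (ℕ; zero; suc)
 open import Data.Bool using (Bool; true; false; if_then_else_)
 open import Data.Integer using (ℤ; +_; -[1+_]; _+_; _*_; -_; _-_; 0ℤ; 1ℤ; _^_)
 open import Data.List using (List; []; _∷_)
 open import Data.List.Relation.Unary.All using (All; []; _∷_)

 -- Integer polynomials, normalised to sorted lists of monomials

 infixl 6 _:+_ _:-_
 infixl 7 _:*_
 infix  8 :-_
 data Expr : Set where
  var  : ℕ → Expr
  con  : ℤ → Expr
  _:+_ : Expr → Expr → Expr
  _:*_ : Expr → Expr → Expr
  :-_  : Expr → Expr

 _:-_ : Expr → Expr → Expr
 a :- b = a :+ :- b

 # : ℕ → Expr
 # n = con (+ n)

 Env : Set
 Env = ℕ → ℤ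

 -- Opaque copies of the operations keep the type checker from unfolding integer arithmetic.
 infixl 6 _⊞_
 infixl 7 _⊠_
 infix  8 ⊟_
 abstract
  _⊞_ _⊠_ : ℤ → ℤ → ℤ
  _⊞_ = _+_
  _⊠_ = _*_
  ⊟_ : ℤ → ℤ
  ⊟_ = -_
  ⊞-def : ∀ a b → a ⊞ b ≡ a + b
  ⊞-def a b = refl
  ⊠-def : ∀ a b → a ⊠ b ≡ a * b
  ⊠-def a b = refl
  ⊟-def : ∀ a → ⊟ a ≡ - a
  ⊟-def a = refl
  ⊞-comm : ∀ a b → a ⊞ b ≡ b ⊞ a
  ⊞-comm = ℤₚ.+-comm
  ⊞-cong : ∀ {m a b c d} → a ≈[ m ] b → c ≈[ m ] d → a ⊞ c ≈[ m ] b ⊞ d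
  ⊞-cong = +-cong-≈
  ⊠-cong : ∀ {m a b c d} → a ≈[ m ] b → c ≈[ m ] d → a ⊠ c ≈[ m ] b ⊠ d
  ⊠-cong = *-cong-≈
  ⊟-cong : ∀ {m a b} → a ≈[ m ] b → ⊟ a ≈[ m ] ⊟ b
  ⊟-cong = neg-cong-≈

 ⟦_⟧ : Expr → Env → ℤ
 ⟦ var i ⟧  ρ = ρ i
 ⟦ con c ⟧  ρ = c
 ⟦ a :+ b ⟧ ρ = ⟦ a ⟧ ρ ⊞ ⟦ b ⟧ ρ
 ⟦ a :* b ⟧ ρ = ⟦ a ⟧ ρ ⊠ ⟦ b ⟧ ρ
 ⟦ :- a ⟧   ρ = ⊟ ⟦ a ⟧ ρ

 ⟦⟧-cong : ∀ {m ρ ρ′} e → (∀ i → ρ i ≈[ m ] ρ′ i) → ⟦ e ⟧ ρ ≈[ m ] ⟦ e ⟧ ρ′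
 ⟦⟧-cong (var i)  h = h i
 ⟦⟧-cong (con c)  h = ≈-refl
 ⟦⟧-cong (a :+ b) h = ⊞-cong (⟦⟧-cong a h) (⟦⟧-cong b h)
 ⟦⟧-cong (a :* b) h = ⊠-cong (⟦⟧-cong a h) (⟦⟧-cong b h)
 ⟦⟧-cong (:- a)   h = ⊟-cong (⟦⟧-cong a h)

 Mono : Set
 Mono = List ℕ

 Poly : Set
 Poly = List (ℤ × Mono)

 data Comparison : Set where
  less equal greater : Comparison

 compareℕ : ℕ → ℕ → Comparison
 compareℕ m n = if m ℕ.≡ᵇ n then equal else if m ℕ.<ᵇ n then less else greater

 compareM : Mono → Mono → Comparison
 compareM []      []      = equal
 compareM []      (_ ∷ _) = less
 compareM (_ ∷ _) []      = greater
 compareM (m ∷ ms) (n ∷ ns) with compareℕ m n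
 ... | equal = compareM ms ns
 ... | c     = c

 addM : Mono → Mono → Mono
 addM []       ns       = ns
 addM ms       []       = ms
 addM (m ∷ ms) (n ∷ ns) = m ℕ.+ n ∷ addM ms ns

 select : Comparison → Poly → Poly → Poly → Poly
 select less    P Q R = P
 select equal   P Q R = Q
 select greater P Q R = R

 cons : ℤ → Mono → Poly → Poly
 cons (+ zero) m P = P
 cons c        m P = (c , m) ∷ P

 addP : Poly → Poly → Poly
 addP []            Q             = Q
 addP (x ∷ P)       []            = x ∷ P
 addP (x ∷ P)       (y ∷ Q)       = select (compareM (proj₂ x) (proj₂ y))
  (x ∷ addP P (y ∷ Q)) (cons (proj₁ x + proj₁ y) (proj₂ x) (addP P Q)) (y ∷ addP (x ∷ P) Q)

 scaleP : ℤ → Mono → Poly → Poly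
 scaleP c m []            = []
 scaleP c m ((d , n) ∷ P) = cons (c * d) (addM m n) (scaleP c m P)

 mulP : Poly → Poly → Poly
 mulP []            Q = []
 mulP ((c , m) ∷ P) Q = addP (scaleP c m Q) (mulP P Q)

 unitM : ℕ → Mono
 unitM zero    = 1 ∷ []
 unitM (suc i) = 0 ∷ unitM i

 norm : Expr → Poly
 norm (var i)  = (1ℤ , unitM i) ∷ []
 norm (con c)  = cons c [] []
 norm (a :+ b) = addP (norm a) (norm b)
 norm (a :* b) = mulP (norm a) (norm b)
 norm (:- a)   = scaleP (- 1ℤ) [] (norm a)

 evalM : Mono → Env → ℤ
 evalM []       ρ = 1ℤ
 evalM (m ∷ ms) ρ = ρ 0 ^ m * evalM ms (λ i → ρ (suc i))

 evalP : Poly → Env → ℤ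
 evalP []            ρ = 0ℤ
 evalP ((c , m) ∷ P) ρ = c * evalM m ρ + evalP P ρ

 compareℕ-equal : ∀ m n → compareℕ m n ≡ equal → m ≡ n
 compareℕ-equal m n e with m ℕ.≡ᵇ n in eq
 ... | true = ℕₚ.≡ᵇ⇒≡ m n (subst Data.Bool.T (sym eq) _)
 ... | false with m ℕ.<ᵇ n
 compareℕ-equal m n () | false | true
 compareℕ-equal m n () | false | false

 compareM-equal : ∀ m n → compareM m n ≡ equal → m ≡ n
 compareM-equal []       []       e = refl
 compareM-equal (m ∷ ms) (n ∷ ns) e with compareℕ m n in eq
 ... | equal = cong₂ _∷_ (compareℕ-equal m n eq) (compareM-equal ms ns e)

 addM-sound : ∀ m n ρ → evalM (addM m n) ρ ≡ evalM m ρ * evalM n ρ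
 addM-sound []       ns       ρ = sym (ℤₚ.*-identityˡ (evalM ns ρ))
 addM-sound (m ∷ ms) []       ρ = sym (ℤₚ.*-identityʳ (evalM (m ∷ ms) ρ))
 addM-sound (m ∷ ms) (n ∷ ns) ρ = trans
  (cong₂ _*_ (ℤₚ.^-distribˡ-+-* (ρ 0) m n) (addM-sound ms ns (λ i → ρ (suc i))))
  (lem (ρ 0 ^ m) (ρ 0 ^ n) _ _)
  where
  lem : ∀ a b c d → a * b * (c * d) ≡ a * c * (b * d)
  lem = solve-∀

 cons-sound : ∀ c m P ρ → evalP (cons c m P) ρ ≡ c * evalM m ρ + evalP P ρ
 cons-sound (+ zero)   m P ρ = sym (ℤₚ.+-identityˡ _)
 cons-sound (+ suc _)  m P ρ = refl
 cons-sound (-[1+ _ ]) m P ρ = refl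

 select-sound : ∀ k {P Q R ρ x} → evalP P ρ ≡ x → (k ≡ equal → evalP Q ρ ≡ x) → evalP R ρ ≡ x → evalP (select k P Q R) ρ ≡ x
 select-sound less    p q r = p
 select-sound equal   p q r = q refl
 select-sound greater p q r = r

 addP-sound : ∀ P Q ρ → evalP (addP P Q) ρ ≡ evalP P ρ + evalP Q ρ
 addP-sound []      Q       ρ = sym (ℤₚ.+-identityˡ _)
 addP-sound (x ∷ P) []      ρ = sym (ℤₚ.+-identityʳ _)
 addP-sound ((c , m) ∷ P) ((d , n) ∷ Q) ρ = select-sound (compareM m n)
  (trans (cong (λ z → c * evalM m ρ + z) (addP-sound P ((d , n) ∷ Q) ρ)) (sym (ℤₚ.+-assoc (c * evalM m ρ) (evalP P ρ) _)))
  (λ eq → trans (cons-sound (c + d) m (addP P Q) ρ) (trans (cong (λ z → (c + d) * evalM m ρ + z) (addP-sound P Q ρ))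
   (trans (gather c d (evalM m ρ) (evalP P ρ) (evalP Q ρ)) (cong (λ k → c * evalM m ρ + evalP P ρ + (d * evalM k ρ + evalP Q ρ)) (compareM-equal m n eq)))))
  (trans (cong (λ z → d * evalM n ρ + z) (addP-sound ((c , m) ∷ P) Q ρ)) (exchange (d * evalM n ρ) (c * evalM m ρ + evalP P ρ) (evalP Q ρ)))
  where
  exchange : ∀ a b c → a + (b + c) ≡ b + (a + c)
  exchange = solve-∀
  gather : ∀ c d x p q → (c + d) * x + (p + q) ≡ c * x + p + (d * x + q)
  gather = solve-∀

 scaleP-sound : ∀ c m P ρ → evalP (scaleP c m P) ρ ≡ c * evalM m ρ * evalP P ρ
 scaleP-sound c m []            ρ = sym (ℤₚ.*-zeroʳ (c * evalM m ρ))
 scaleP-sound c m ((d , n) ∷ P) ρ = trans (cons-sound (c * d) (addM m n) (scaleP c m P) ρ)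
  (trans (cong₂ (λ x y → c * d * x + y) (addM-sound m n ρ) (scaleP-sound c m P ρ)) (lem c d (evalM m ρ) (evalM n ρ) (evalP P ρ)))
  where
  lem : ∀ c d x y z → c * d * (x * y) + c * x * z ≡ c * x * (d * y + z)
  lem = solve-∀

 mulP-sound : ∀ P Q ρ → evalP (mulP P Q) ρ ≡ evalP P ρ * evalP Q ρ
 mulP-sound []            Q ρ = refl
 mulP-sound ((c , m) ∷ P) Q ρ = trans (addP-sound (scaleP c m Q) (mulP P Q) ρ)
  (trans (cong₂ _+_ (scaleP-sound c m Q ρ) (mulP-sound P Q ρ)) (sym (ℤₚ.*-distribʳ-+ (evalP Q ρ) (c * evalM m ρ) (evalP P ρ))))

 unitM-sound : ∀ i ρ → evalM (unitM i) ρ ≡ ρ i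
 unitM-sound zero    ρ = trans (ℤₚ.*-identityʳ _) (ℤₚ.*-identityʳ (ρ 0))
 unitM-sound (suc i) ρ = trans (ℤₚ.*-identityˡ _) (unitM-sound i (λ i → ρ (suc i)))

 norm-sound : ∀ e ρ → evalP (norm e) ρ ≡ ⟦ e ⟧ ρ
 norm-sound (var i)  ρ = trans (ℤₚ.+-identityʳ _) (trans (ℤₚ.*-identityˡ _) (unitM-sound i ρ))
 norm-sound (con c)  ρ = trans (cons-sound c [] [] ρ) (trans (ℤₚ.+-identityʳ _) (ℤₚ.*-identityʳ c))
 norm-sound (a :+ b) ρ = trans (addP-sound (norm a) (norm b) ρ) (trans (cong₂ _+_ (norm-sound a ρ) (norm-sound b ρ)) (sym (⊞-def (⟦ a ⟧ ρ) (⟦ b ⟧ ρ))))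
 norm-sound (a :* b) ρ = trans (mulP-sound (norm a) (norm b) ρ) (trans (cong₂ _*_ (norm-sound a ρ) (norm-sound b ρ)) (sym (⊠-def (⟦ a ⟧ ρ) (⟦ b ⟧ ρ))))
 norm-sound (:- a)   ρ = trans (scaleP-sound (- 1ℤ) [] (norm a) ρ) (trans (cong (λ z → - 1ℤ * 1ℤ * z) (norm-sound a ρ)) (trans (ℤₚ.-1*i≡-i (⟦ a ⟧ ρ)) (sym (⊟-def (⟦ a ⟧ ρ)))))

 -- Soundness of `norm` suffices: that the difference normalises to the empty list is found by
 -- evaluation.
 identity : ∀ e e′ → norm (e :- e′) ≡ [] → ∀ ρ → ⟦ e ⟧ ρ ≡ ⟦ e′ ⟧ ρ
 identity e e′ eq ρ = ℤₚ.i-j≡0⇒i≡j (⟦ e ⟧ ρ) (⟦ e′ ⟧ ρ) (trans (sym (trans (⊞-def _ _) (cong (λ y → ⟦ e ⟧ ρ + y) (⊟-def (⟦ e′ ⟧ ρ)))))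
  (trans (sym (norm-sound (e :- e′) ρ)) (cong (λ P → evalP P ρ) eq)))

 -- Consequences of polynomial congruences, certified by a linear combination

 combination : List (Expr × Expr) → Expr
 combination []             = # 0
 combination ((c , h) ∷ hs) = c :* h :+ combination hs

 combination-vanishes : ∀ {m ρ} hs → All (λ h → ⟦ proj₂ h ⟧ ρ ≈[ m ] 0ℤ) hs → ⟦ combination hs ⟧ ρ ≈[ m ] 0ℤ
 combination-vanishes []             []       = ≈-refl
 combination-vanishes {ρ = ρ} ((c , h) ∷ hs) (z ∷ zs) = ≈-trans (⊞-cong
  (≈-trans (≈-reflexive (⊠-def (⟦ c ⟧ ρ) (⟦ h ⟧ ρ))) (≈-trans (*-congˡ-≈ (⟦ c ⟧ ρ) z) (≈-reflexive (ℤₚ.*-zeroʳ (⟦ c ⟧ ρ)))))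
  (combination-vanishes hs zs)) (≈-reflexive (⊞-def 0ℤ 0ℤ))

 certified : ∀ {m ρ} e hs → norm (e :- combination hs) ≡ [] → All (λ h → ⟦ proj₂ h ⟧ ρ ≈[ m ] 0ℤ) hs → ⟦ e ⟧ ρ ≈[ m ] 0ℤ
 certified {ρ = ρ} e hs eq zs = ≈-trans (≈-reflexive (identity e (combination hs) eq ρ)) (combination-vanishes hs zs)

-- Elimination theory of the relations between coordinates and form values

module QuarticClassification where

 open TranslationRing
 open PolynomialIdentities
 open import Data.Nat as ℕ using (ℕ; zero; suc)
 open import Data.Nat.Primality using (Prime; euclidsLemma)
 open import Data.Integer using (ℤ; +_; _+_; _*_; -_; _-_; 0ℤ; 1ℤ; ∣_∣)
 import Data.Integer.Divisibility.Signed as ℤ∣ₛ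
 open import Data.List using (List; []; _∷_)
 open import Data.List.Relation.Unary.All as All using (All; []; _∷_)
 open GroupAlgebras using (≈0?)

 ≈0⇒∣ : ∀ {m a} → a ≈[ m ] 0ℤ → m ℕ∣.∣ ∣ a ∣
 ≈0⇒∣ {m} (mod-by k eq) = ℤ∣ₛ.∣⇒∣ᵤ (ℤ∣ₛ.divides k (trans eq (ℤₚ.+-identityˡ (k * + m))))

 ∣⇒≈0 : ∀ {m a} → m ℕ∣.∣ ∣ a ∣ → a ≈[ m ] 0ℤ
 ∣⇒≈0 {m} {a} d with ℤ∣ₛ.∣ᵤ⇒∣ {+ m} {a} d
 ... | ℤ∣ₛ.divides k eq = mod-by k (trans eq (sym (ℤₚ.+-identityˡ (k * + m))))

 prime-product : ∀ {p} → Prime p → ∀ a b → a * b ≈[ p ] 0ℤ → (a ≈[ p ] 0ℤ) ⊎ (b ≈[ p ] 0ℤ)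
 prime-product {p} pp a b z with euclidsLemma ∣ a ∣ ∣ b ∣ pp (subst (p ℕ∣.∣_) (ℤₚ.abs-* a b) (≈0⇒∣ z))
 ... | inj₁ d = inj₁ (∣⇒≈0 d)
 ... | inj₂ d = inj₂ (∣⇒≈0 d)

 env : List ℤ → Env
 env []       i       = 0ℤ
 env (x ∷ xs) zero    = x
 env (x ∷ xs) (suc i) = env xs i

 data Congruent (m : ℕ) : List ℤ → List ℤ → Set where
  []  : Congruent m [] []
  _∷_ : ∀ {x y xs ys} → x ≈[ m ] y → Congruent m xs ys → Congruent m (x ∷ xs) (y ∷ ys)

 env-cong : ∀ {m xs ys} → Congruent m xs ys → ∀ i → env xs i ≈[ m ] env ys i
 env-cong []       i       = ≈-refl
 env-cong (e ∷ es) zero    = e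
 env-cong (e ∷ es) (suc i) = env-cong es i

 infix 4 _⊢_≈0[_]
 -- A record keeps the context and the expression recoverable by unification; they could not be read
 -- back from the evaluated integer.
 record _⊢_≈0[_] (xs : List ℤ) (e : Expr) (p : ℕ) : Set where
  constructor holds
  field proof : ⟦ e ⟧ (env xs) ≈[ p ] 0ℤ

 open _⊢_≈0[_] public

 by : ∀ {p xs e} hs → norm (e :- combination hs) ≡ [] → All (λ h → xs ⊢ proj₂ h ≈0[ p ]) hs → xs ⊢ e ≈0[ p ]
 by {e = e} hs eq zs = holds (certified e hs eq (All.map proof zs))

 along : ∀ {p xs ys} e → Congruent p xs ys → xs ⊢ e ≈0[ p ] → ys ⊢ e ≈0[ p ]
 along e c (holds z) = holds (≈-trans (≈-sym (⟦⟧-cong e (env-cong c))) z)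

 difference⇒≈ : ∀ {p xs} a b → xs ⊢ a :- b ≈0[ p ] → ⟦ a ⟧ (env xs) ≈[ p ] ⟦ b ⟧ (env xs)
 difference⇒≈ {p} {xs} a b (holds z) = ≈-trans (≈-reflexive (isolate A B)) (≈-trans
  (+-cong-≈ (≈-refl {a = B}) (≈-trans (≈-reflexive (sym (trans (⊞-def A (⊟ B)) (cong (λ y → A + y) (⊟-def B))))) z))
  (≈-reflexive (ℤₚ.+-identityʳ B)))
  where
  A = ⟦ a ⟧ (env xs)
  B = ⟦ b ⟧ (env xs)
  isolate : ∀ a b → a ≡ b + (a + - b)
  isolate = solve-∀

 module _ {p : ℕ} (pp : Prime p) where

  split : ∀ {xs a b} → xs ⊢ a :* b ≈0[ p ] → (xs ⊢ a ≈0[ p ]) ⊎ (xs ⊢ b ≈0[ p ])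
  split {xs} {a} {b} (holds z) with prime-product pp (⟦ a ⟧ (env xs)) (⟦ b ⟧ (env xs)) (≈-trans (≈-reflexive (sym (⊠-def _ _))) z)
  ... | inj₁ y = inj₁ (holds y)
  ... | inj₂ y = inj₂ (holds y)

  cancel : ∀ {xs a b} → ¬ (xs ⊢ a ≈0[ p ]) → xs ⊢ a :* b ≈0[ p ] → xs ⊢ b ≈0[ p ]
  cancel ¬a z with split z
  ... | inj₁ y = ⊥-elim (¬a y)
  ... | inj₂ y = y

 -- The coordinates (α , β), (γ , δ) of w, z with respect to u, v when all but one of
 -- u, v, w, z lie on a line λ = 1 and the remaining one, if off the line, has λ = 0.
 data Standard (p : ℕ) (α β γ δ : ℤ) : Set where
  u-off  : β ≈[ p ] 1ℤ → δ ≈[ p ] 1ℤ → Standard p α β γ δ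
  v-off  : α ≈[ p ] 1ℤ → γ ≈[ p ] 1ℤ → Standard p α β γ δ
  all-on : α + β ≈[ p ] 1ℤ → γ + δ ≈[ p ] 1ℤ → Standard p α β γ δ
  w-off  : α + β ≈[ p ] 0ℤ → γ + δ ≈[ p ] 1ℤ → Standard p α β γ δ
  z-off  : α + β ≈[ p ] 1ℤ → γ + δ ≈[ p ] 0ℤ → Standard p α β γ δ

 module QuarticEquations where

  -- The relations between the values of the forms, as polynomials in the coordinates
  -- and in e = D(uuuu), a = D(uuuv), b = D(uuvv), f = D(uvvv), h = D(vvvv), q = Q(vv).

  one-w : (α β a b : Expr) → Expr
  one-w α β a b = α :* a :+ β :* b :- # 1

  -- This is D(u,u,w,z) = 1; with a, b, f in place of e, a, b it is D(u,v,w,z) = 1. In the same way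
  -- `one-w` is D(u,u,v,w) = 1.
  one-wz : (α β γ δ e a b : Expr) → Expr
  one-wz α β γ δ e a b = α :* γ :* e :+ (α :* δ :+ β :* γ) :* a :+ β :* δ :* b :- # 1

  -- The value D(x,w,w,w) for w = αu + βv, where cᵢ is the value of D at x, at 3 - i copies of u and
  -- at i copies of v.
  cubic : (α β c₀ c₁ c₂ c₃ : Expr) → Expr
  cubic α β c₀ c₁ c₂ c₃ = α :* α :* α :* c₀ :+ # 3 :* α :* α :* β :* c₁ :+ # 3 :* α :* β :* β :* c₂ :+ β :* β :* β :* c₃

  -- The equation Q(u,w) = 3 + D(u,u,u,w) + D(u,w,w,w), with Q(u,u) and Q(u,v) replaced by their
  -- values; `pair-vw` and `pair-wz` are its analogues.
  pair-uw : (α β e a b f : Expr) → Expr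
  pair-uw α β e a b f = α :* (# 3 :+ # 2 :* e) :+ β :* (# 3 :+ a :+ f) :- # 3 :- (α :* e :+ β :* a) :- cubic α β e a b f

  pair-vw : (α β a b f h q : Expr) → Expr
  pair-vw α β a b f h q = α :* (# 3 :+ a :+ f) :+ β :* q :- # 3 :- (α :* f :+ β :* h) :- cubic α β a b f h

  pair-wz : (α β γ δ e a b f h q : Expr) → Expr
  pair-wz α β γ δ e a b f h q = α :* γ :* (# 3 :+ # 2 :* e) :+ (α :* δ :+ β :* γ) :* (# 3 :+ a :+ f) :+ β :* δ :* q :- # 3
   :- (γ :* cubic α β e a b f :+ δ :* cubic α β a b f h) :- (α :* cubic γ δ e a b f :+ β :* cubic γ δ a b f h)

 module QuarticAlgebra {p : ℕ} (pp : Prime p) (2≉0 : ¬ (+ 2 ≈[ p ] 0ℤ)) (3≉0 : ¬ (+ 3 ≈[ p ] 0ℤ)) where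

  open QuarticEquations

  private
   _⊩_ : List ℤ → Expr → Set
   xs ⊩ e = xs ⊢ e ≈0[ p ]
   infix 4 _⊩_

  -- T₁, T₂ and III in terms of r = x + y − 1, s = a − 1, t = b − 1, π = x y

  K NL T₁ T₂ : (r s t π : Expr) → Expr
  K r s t π = r :* (t :- s) :- # 3 :* s :* t
  NL r s t π = r :* (t :- s) :- s :* t :+ # 1
  T₁ r s t π = t :* (r :- s) :* (r :+ s :+ # 2) :- π :* (# 2 :* t :+ s :* s :+ K r s t π)
  T₂ r s t π = s :* (r :+ t) :* (# 2 :- r :+ t) :+ (π :- r) :* (# 2 :* s :+ t :* t :+ K r s t π)

  q₂ q₁ q₀ : (r s t : Expr) → Expr
  q₂ r s t = r :* s :* s :+ # 3 :* r :* t :+ t :* t :+ # 5 :* s :- r :* t :* t :- # 3 :* r :* s :- # 3 :* s :* s :- # 3 :* t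
  q₁ r s t = r :* s :* t :* t :+ r :* r :* t :* t :+ r :* r :* r :* s :+ # 3 :* r :* s :* s :+ s :* t :* t :+ # 5 :* r :* t :+ # 4 :* s :* t
   :- r :* s :* s :* t :- r :* r :* s :* s :- r :* r :* r :* t :- # 2 :* s :* s :* t :* t :- r :* r :* s :- # 4 :* r :* r :* t
   :- # 3 :* s :* s :* t :- t :* t :- # 2 :* s
  q₀ r s t = # 2 :* r :* s :* s :* t :* t :+ r :* r :* s :* s :* t :+ r :* r :* r :* r :* t :+ r :* s :* t :* t :+ # 3 :* r :* s :* s :* t
   :+ r :* r :* r :* t :+ r :* t :* t :- # 2 :* r :* r :* s :* t :* t :- # 2 :* r :* r :* s :* t :- r :* r :* t :* t
   :- # 2 :* r :* r :* t :- s :* t :* t :- # 2 :* s :* t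

  III : (r s t π : Expr) → Expr
  III r s t π = q₂ r s t :* π :* π :+ q₁ r s t :* π :+ q₀ r s t

  -- Modulo `NL` this is, up to sign, the product of the conditions `on-one` and `on-zero` at a root
  -- x; it vanishes when one of w, z leaves the line.
  bracketed : (s t π : Expr) → Expr
  bracketed s t π = π :* (t :- s) :* (t :- s) :+ t :* (s :+ # 1) :* (s :+ # 1)

  private
   r = var 0
   s = var 1
   t = var 2
   π = var 3
   bracket = bracketed s t π

  module Classification (r₀ s₀ t₀ π₀ : ℤ)
   (t₁ : (r₀ ∷ s₀ ∷ t₀ ∷ π₀ ∷ []) ⊩ T₁ r s t π) (t₂ : (r₀ ∷ s₀ ∷ t₀ ∷ π₀ ∷ []) ⊩ T₂ r s t π)
   (π≉0 : ¬ ((r₀ ∷ s₀ ∷ t₀ ∷ π₀ ∷ []) ⊩ π)) (π′≉0 : ¬ ((r₀ ∷ s₀ ∷ t₀ ∷ π₀ ∷ []) ⊩ π :- r)) where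

   private
    xs : List ℤ
    xs = r₀ ∷ s₀ ∷ t₀ ∷ π₀ ∷ []

   private
    numeral-2 : ¬ (xs ⊩ # 2)
    numeral-2 (holds z) = 2≉0 z
    numeral-3 : ¬ (xs ⊩ # 3)
    numeral-3 (holds z) = 3≉0 z

   -- At s = t = 1 the relations T₁, T₂ read (r − 1)(r + 3) = 0 and (r + 1)(3 − r) = 0.
   not-one : xs ⊩ s :- # 1 → xs ⊩ t :- # 1 → ⊥
   not-one s₁ t₁′ = numeral-3 (by ((:- # 1 , (r :- # 1) :* (r :+ # 3)) ∷ (r :+ # 2 , r) ∷ []) refl (x ∷
     cancel pp numeral-2 (cancel pp numeral-2 (by ((# 1 , (r :- # 1) :* (r :+ # 3)) ∷ (# 1 , (r :+ # 1) :* (# 3 :- r)) ∷ []) refl (x ∷ y ∷ []))) ∷ []))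
    where
    x : xs ⊩ (r :- # 1) :* (r :+ # 3)
    x = by ((# 1 , T₁ r s t π)
     ∷ (:- (π :* r :+ # 3 :* π :* t :- π :* s :- s :* t :- π :- # 3 :* t) , s :- # 1)
     ∷ (:- (r :* r :+ π :+ # 2 :* r :- π :* r :- # 3) , t :- # 1) ∷ []) refl (t₁ ∷ s₁ ∷ t₁′ ∷ [])
    y : xs ⊩ (r :+ # 1) :* (# 3 :- r)
    y = by ((# 1 , T₂ r s t π)
     ∷ (:- (# 3 :* r :* t :+ t :* t :+ # 2 :* π :+ # 2 :* t :- π :* r :- # 3 :* π :* t) , s :- # 1)
     ∷ (:- (π :* r :+ π :* t :+ # 2 :* r :+ t :+ # 3 :- r :* t :- r :* r :- # 2 :* π) , t :- # 1) ∷ []) refl (t₂ ∷ s₁ ∷ t₁′ ∷ [])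

   -- Modulo `NL`, the square (t - s)² times `T₁` or `T₂` is, up to sign, `bracket` times a
   -- cofactor. Both cofactors vanish only at s = t = 1, which `not-one` excludes.
   off-line : xs ⊩ NL r s t π → xs ⊩ bracket
   off-line nl = decide (split pp x) (split pp y)
    where
    square = (t :- s) :* (t :- s)
    x : xs ⊩ ((# 1 :- s) :* (# 2 :* t :- # 1 :- s)) :* bracket
    x = by ((:- square , T₁ r s t π) ∷ (# 2 :* t :* (s :+ # 1) :* (t :- # 1) :- π :* square :+ t :* NL r s t π , NL r s t π) ∷ []) refl (t₁ ∷ nl ∷ [])
    y : xs ⊩ ((# 1 :- t) :* (# 2 :* s :- # 1 :- t)) :* bracket
    y = by ((square , T₂ r s t π)
     ∷ (:- (π :* square :+ t :* (# 2 :* s :* t :- # 3 :* s :* s :- t :* t :+ # 2) :- t :* NL r s t π) , NL r s t π) ∷ []) refl (t₂ ∷ nl ∷ [])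
    decide : (xs ⊩ (# 1 :- s) :* (# 2 :* t :- # 1 :- s)) ⊎ (xs ⊩ bracket) →
         (xs ⊩ (# 1 :- t) :* (# 2 :* s :- # 1 :- t)) ⊎ (xs ⊩ bracket) → xs ⊩ bracket
    decide (inj₂ z) _ = z
    decide _ (inj₂ z) = z
    decide (inj₁ f) (inj₁ g) with split pp f | split pp g
    ... | inj₁ s₁ | inj₁ t₁′ = ⊥-elim (not-one (by ((:- # 1 , _) ∷ []) refl (s₁ ∷ [])) (by ((:- # 1 , _) ∷ []) refl (t₁′ ∷ [])))
    ... | inj₁ s₁ | inj₂ g′ = ⊥-elim (not-one (by ((:- # 1 , _) ∷ []) refl (s₁ ∷ []))
        (by ((:- # 1 , # 2 :* s :- # 1 :- t) ∷ (:- # 2 , # 1 :- s) ∷ []) refl (g′ ∷ s₁ ∷ [])))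
    ... | inj₂ f′ | inj₁ t₁′ = ⊥-elim (not-one (by ((:- # 1 , # 2 :* t :- # 1 :- s) ∷ (:- # 2 , # 1 :- t) ∷ []) refl (f′ ∷ t₁′ ∷ []))
        (by ((:- # 1 , _) ∷ []) refl (t₁′ ∷ [])))
    ... | inj₂ f′ | inj₂ g′ = ⊥-elim (not-one
        (cancel pp numeral-3 (by ((# 2 , # 2 :* s :- # 1 :- t) ∷ (# 1 , # 2 :* t :- # 1 :- s) ∷ []) refl (g′ ∷ f′ ∷ [])))
        (cancel pp numeral-3 (by ((# 1 , # 2 :* s :- # 1 :- t) ∷ (# 2 , # 2 :* t :- # 1 :- s) ∷ []) refl (g′ ∷ f′ ∷ []))))

   private
    M D : Expr
    M = π :* (# 2 :- s :- t) :+ t :* (# 2 :+ # 2 :* s :- t)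
    D = # 2 :- s :- t

   -- Both `T₁` and `T₂` are linear in π; eliminating π gives 4·s·t·NL·(r + t - s) = 0. Each factor
   -- is examined in turn, and `III` removes the spurious solutions.
   classify : xs ⊩ III r s t π → ¬ (xs ⊩ (# 1 :+ r) :* (# 1 :+ r) :- # 4 :* π) →
         ((xs ⊩ s) × (xs ⊩ t)) ⊎ ((xs ⊩ NL r s t π) × (xs ⊩ bracket))
   classify iii distinct = go (split pp (cancel pp numeral-2 (cancel pp numeral-2 product)))
    where
    Conclusion = ((xs ⊩ s) × (xs ⊩ t)) ⊎ ((xs ⊩ NL r s t π) × (xs ⊩ bracket))

    product : xs ⊩ # 2 :* (# 2 :* (s :* (t :* (NL r s t π :* (r :+ t :- s)))))
    product = by ((# 2 :* s :+ t :* t :+ K r s t π , T₁ r s t π) ∷ (# 2 :* t :+ s :* s :+ K r s t π , T₂ r s t π) ∷ []) refl (t₁ ∷ t₂ ∷ [])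

    -- Every branch that appeals to `III` has r = s - t; substituting this first keeps the
    -- certificates small.
    specialised : xs ⊩ r :+ t :- s → xs ⊩ III (s :- t) s t π
    specialised e = holds (proof (along {xs = xs} {ys = s₀ ⊞ ⊟ t₀ ∷ s₀ ∷ t₀ ∷ π₀ ∷ []} (III r s t π) (difference⇒≈ r (s :- t) (by ((# 1 , r :+ t :- s) ∷ []) refl (e ∷ [])) ∷ ≈-refl ∷ ≈-refl ∷ ≈-refl ∷ []) iii))

    case-s : xs ⊩ s → Conclusion
    case-s sz = [ (λ tz → inj₁ (sz , tz)) , with-r ]′ (split pp (cancel pp π′≉0 (by {e = (π :- r) :* (t :* (t :+ r))}
      ((# 1 , T₂ r s t π) ∷ (:- (# 3 :* r :* t :+ t :* t :+ # 2 :* π :+ # 2 :* t :- π :* r :- # 3 :* π :* t) , s) ∷ []) refl (t₂ ∷ sz ∷ []))))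
     where
     with-r : xs ⊩ t :+ r → Conclusion
     with-r t+r = [ (λ tz → inj₁ (sz , tz)) , (λ f → ⊥-elim ([ two , none ]′ (split pp f))) ]′ (split pp (by {e = t :* ((# 2 :- t) :* (t :+ π))}
       ((:- # 1 , T₁ r s t π) ∷ (π :* r :+ # 3 :* π :* t :- π :* s :- s :* t :- # 2 :* t , s)
        ∷ (r :* t :+ # 2 :* t :- π :* t :- t :* t , t :+ r) ∷ []) refl (t₁ ∷ sz ∷ t+r ∷ [])))
      where
      none : xs ⊩ t :+ π → ⊥
      none t+π = π′≉0 (by ((# 1 , t :+ π) ∷ (:- # 1 , t :+ r) ∷ []) refl (t+π ∷ t+r ∷ []))
      two : xs ⊩ # 2 :- t → ⊥
      two 2-t = π′≉0 (by ((# 1 , π :+ # 2) ∷ (:- # 1 , t :+ r) ∷ (:- # 1 , # 2 :- t) ∷ []) refl (π+2 ∷ t+r ∷ 2-t ∷ []))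
       where
       -- At s = 0, t = 2, r = -2 the relation `III` reads -6(π + 2)² = 0, so π = r, against `π′≉0`.
       square : xs ⊩ (π :+ # 2) :* (π :+ # 2)
       square = cancel pp numeral-3 (cancel pp numeral-2 (by ((:- # 1 , III (s :- t) s t π)
        ∷ (# 6 :* π :* s :* t :* t :+ π :* π :* s :* s :+ # 9 :* s :* t :* t :* t :+ # 2 :* s :* s :* s :* t :+ # 2 :* π :* s :* s :+ # 8 :* π :* t :* t :+ # 6 :* π :* π :* t :+ # 2 :* s :* s :* t :+ # 2 :* t :* t :* t :+ # 9 :* π :* t :+ # 5 :* π :* π :+ # 4 :* t :* t :- # 3 :* π :* s :* s :* t :- # 7 :* π :* t :* t :* t :- π :* π :* s :* t :- π :* π :* t :* t :- # 6 :* s :* s :* t :* t :- # 6 :* t :* t :* t :* t :- # 8 :* π :* s :* t :- # 6 :* π :* π :* s :- # 2 :* s :* t :* t :- # 2 :* s :* t :- # 2 :* π :- # 2 :* t , s)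
        ∷ (:- (# 2 :* π :* t :* t :* t :+ π :* π :* t :* t :+ t :* t :* t :* t :- # 6 :* π :* t :- # 3 :* π :* π :- # 3 :* t :* t :- # 12 :* π :- # 6 :* t :- # 12) , # 2 :- t) ∷ [])
        refl (specialised (by ((# 1 , t :+ r) ∷ (:- # 1 , s) ∷ []) refl (t+r ∷ sz ∷ [])) ∷ sz ∷ 2-t ∷ [])))
       π+2 : xs ⊩ π :+ # 2
       π+2 = [ (λ z → z) , (λ z → z) ]′ (split pp square)

    -- The mirror image of `case-s` under the exchange of u and v, which sends r, s, t, π to -r, t,
    -- s, π - r.
    case-t : xs ⊩ t → Conclusion
    case-t tz = [ (λ sz → inj₁ (sz , tz)) , with-r ]′ (split pp (cancel pp π≉0 (by {e = π :* (s :* (r :- s))}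
      ((# 1 , T₁ r s t π) ∷ (:- (# 3 :* π :* s :+ r :* r :+ # 2 :* r :- π :* r :- s :* s :- # 2 :* π :- # 2 :* s) , t) ∷ []) refl (t₁ ∷ tz ∷ []))))
     where
     with-r : xs ⊩ r :- s → Conclusion
     with-r r-s = [ (λ sz → inj₁ (sz , tz)) , (λ f → ⊥-elim (two (cancel pp π≉0 f))) ]′ (split pp (by {e = s :* (π :* (# 2 :- r))}
       ((# 1 , T₂ r s t π) ∷ (:- (π :* r :+ π :* t :+ # 3 :* r :* s :+ s :* t :+ # 2 :* s :- # 3 :* π :* s :- r :* t :- r :* r) , t) ∷ []) refl (t₂ ∷ tz ∷ [])))
      where
      two : xs ⊩ # 2 :- r → ⊥
      two 2-r = π′≉0 (by ((# 1 , π :- # 2) ∷ (# 1 , # 2 :- r) ∷ []) refl (π-2 ∷ 2-r ∷ []))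
       where
       π-2 : xs ⊩ π :- # 2
       π-2 = cancel pp π≉0 (cancel pp numeral-3 (cancel pp numeral-2 (by ((:- # 1 , III (s :- t) s t π)
        ∷ (# 6 :* π :* s :* s :* t :+ # 2 :* π :* t :* t :* t :+ π :* π :* t :* t :+ # 9 :* s :* s :* t :* t :+ # 2 :* s :* s :* s :* s :+ t :* t :* t :* t :+ # 8 :* π :* s :* t :+ # 6 :* π :* π :* s :+ # 2 :* s :* t :* t :+ # 2 :* s :* s :* s :+ # 9 :* π :* s :+ # 4 :* s :* t :- # 7 :* π :* s :* t :* t :- # 3 :* π :* s :* s :* s :- π :* π :* s :* t :- π :* π :* s :* s :- # 6 :* s :* t :* t :* t :- # 6 :* s :* s :* s :* t :- # 8 :* π :* s :* s :- # 4 :* π :* t :* t :- # 2 :* π :* π :* t :- # 2 :* s :* s :* t :- # 2 :* t :* t :* t :- # 6 :* π :* t :- # 3 :* π :* π :- # 2 :* s :* s :- # 3 :* t :* t :- # 2 :* s , t)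
        ∷ (:- (π :* π :* s :* s :+ # 2 :* π :* s :* s :+ # 4 :* π :* s :+ # 6 :* π :- # 4 :* π :* π :* s :- # 3 :* π :* π) , (# 2 :- r) :+ (r :- s)) ∷ [])
        refl (specialised (by ((# 1 , r :- s) ∷ (# 1 , t) ∷ []) refl (r-s ∷ tz ∷ [])) ∷ tz
          ∷ by ((# 1 , # 2 :- r) ∷ (# 1 , r :- s) ∷ []) refl (2-r ∷ r-s ∷ []) ∷ []))))

    case-r : xs ⊩ r :+ t :- s → Conclusion
    case-r e = [ case-t , with-m ]′ (split pp (by {e = t :* M} ((:- # 1 , T₁ r s t π)
      ∷ (π :* s :+ r :* t :+ s :* t :+ # 2 :* t :- π :* t :- t :* t , r :+ t :- s) ∷ []) refl (t₁ ∷ e ∷ [])))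
     where
     with-m : xs ⊩ M → Conclusion
     with-m m = [ case-t , (λ f₁ → [ case-s , (λ f₂ → [ case-s , (λ f₃ → [ (λ g → ⊥-elim (equal-roots g)) ,
       (λ f₄ → [ tangent , (λ g → inj₂ (nl g , off-line (nl g))) ]′ (split pp f₄)) ]′ (split pp f₃)) ]′ (split pp f₂)) ]′ (split pp f₁)) ]′
       (split pp (cancel pp numeral-2 factors))
      where
      -- Solving the linear relation `M` for π and inserting the result into D² · `III` gives a
      -- resultant that factors. Its last factor is -`NL` at r = s - t.
      factors : xs ⊩ # 2 :* (t :* (s :* (s :* ((s :+ t :+ # 1) :* ((# 2 :+ # 2 :* t :- s) :* (s :* s :- s :* t :+ t :* t :- # 1))))))
      factors = by ((:- D :* D , III (s :- t) s t π)
       ∷ (q₂ (s :- t) s t :* (D :* π :- t :* (# 2 :+ # 2 :* s :- t)) :+ q₁ (s :- t) s t :* D , M) ∷ []) refl (specialised e ∷ m ∷ [])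
      equal-roots : xs ⊩ s :+ t :+ # 1 → ⊥
      equal-roots g = distinct (cancel pp numeral-3 (by ((:- # 4 , M)
       ∷ (# 3 :* r :+ # 3 :* s :+ # 6 :- # 3 :* t , r :+ t :- s)
       ∷ (# 3 :* s :+ # 3 :- # 4 :* π :- t , s :+ t :+ # 1) ∷ []) refl (m ∷ e ∷ g ∷ [])))
      nl : xs ⊩ s :* s :- s :* t :+ t :* t :- # 1 → xs ⊩ NL r s t π
      nl g = by ((t :- s , r :+ t :- s) ∷ (:- # 1 , s :* s :- s :* t :+ t :* t :- # 1) ∷ []) refl (e ∷ g ∷ [])
      tangent : xs ⊩ # 2 :+ # 2 :* t :- s → Conclusion
      tangent g = [ case-t , (λ z → ⊥-elim (π′≉0 (cancel pp numeral-3 z))) ]′ (split pp (by {e = t :* (# 3 :* (π :- r))} ((:- # 1 , M)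
       ∷ (:- (# 3 :* t) , r :+ t :- s)
       ∷ (:- (:- (π :+ t)) , # 2 :+ # 2 :* t :- s) ∷ []) refl (m ∷ e ∷ g ∷ [])))

    go : (xs ⊩ s) ⊎ (xs ⊩ t :* (NL r s t π :* (r :+ t :- s))) → Conclusion
    go = [ case-s , (λ f → [ case-t , (λ g → [ (λ nl → inj₂ (nl , off-line nl)) , case-r ]′ (split pp g)) ]′ (split pp f)) ]′

-- From the relations to the five standard positions

module StandardCoordinates where

 open TranslationRing
 open GroupAlgebras
 open PolynomialIdentities
 open QuarticClassification
 open import Data.Nat as ℕ using (ℕ; zero)
 open import Data.Integer using (ℤ; +_; _+_; _*_; -_; _-_; 0ℤ; 1ℤ)
 open import Data.List using (List; []; _∷_)
 open import Data.List.Relation.Unary.All as All using ([]; _∷_)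

 module StandardPosition {p : ℕ} (pp : Prime p) (2≉0 : ¬ (+ 2 ≈[ p ] 0ℤ)) (3≉0 : ¬ (+ 3 ≈[ p ] 0ℤ)) where

  open QuarticEquations
  open QuarticAlgebra pp 2≉0 3≉0

  infix 4 _⊩_
  _⊩_ : List ℤ → Expr → Set
  xs ⊩ e = xs ⊢ e ≈0[ p ]

  private
   α = var 0
   β = var 1
   γ = var 2
   δ = var 3
   a = var 4
   b = var 5
   e = var 6
   f = var 7

  -- The cubic relations, which only involve one copy of u.
  record Cubic (xs : List ℤ) : Set where
   field
    α≉0 : ¬ (xs ⊩ α)
    β≉0 : ¬ (xs ⊩ β)
    γ≉0 : ¬ (xs ⊩ γ)
    δ≉0 : ¬ (xs ⊩ δ)
    Δ≉0 : ¬ (xs ⊩ α :* δ :- β :* γ)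
    w₁  : xs ⊩ one-w α β a b
    z₁  : xs ⊩ one-w γ δ a b
    wze : xs ⊩ one-wz α β γ δ e a b
    wzf : xs ⊩ one-wz α β γ δ a b f
    uw  : xs ⊩ pair-uw α β e a b f
    uz  : xs ⊩ pair-uw γ δ e a b f

  -- What is left of `pair-uw` once `one-w` has removed a and b.
  polar : (α β e f : Expr) → Expr
  polar α β e f = e :* (α :* α :* α :- α) :+ f :* (β :* β :* β :- β) :+ # 3 :* (α :- # 1) :* (β :- # 1)

  module FromCubic {xs : List ℤ} (c : Cubic xs) where
   open Cubic c

   numeral-2 : ¬ (xs ⊩ # 2)
   numeral-2 (holds z) = 2≉0 z

   wPolar : xs ⊩ polar α β e f
   wPolar = by ((:- # 1 , pair-uw α β e a b f) ∷ (:- # 3 :* α :* β , one-w α β a b) ∷ []) refl (uw ∷ w₁ ∷ [])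

   zPolar : xs ⊩ polar γ δ e f
   zPolar = by ((:- # 1 , pair-uw γ δ e a b f) ∷ (:- # 3 :* γ :* δ , one-w γ δ a b) ∷ []) refl (uz ∷ z₁ ∷ [])

   -- The relation for D(u,u,w,z) with β and δ eliminated through `one-w` for w and z, and the
   -- relation for D(u,v,w,z) with α and γ eliminated.
   A₁ A₂ : Expr
   A₁ = α :* γ :* (e :* b :- a :* a) :- (b :- # 1)
   A₂ = β :* δ :* (f :* a :- b :* b) :- (a :- # 1)

   a₁ : xs ⊩ A₁
   a₁ = by ((b , one-wz α β γ δ e a b) ∷ (:- (γ :* a :+ δ :* b) , one-w α β a b) ∷ (:- # 1 , one-w γ δ a b) ∷ []) refl (wze ∷ w₁ ∷ z₁ ∷ [])

   a₂ : xs ⊩ A₂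
   a₂ = by ((a , one-wz α β γ δ a b f) ∷ (:- (γ :* a :+ δ :* b) , one-w α β a b) ∷ (:- # 1 , one-w γ δ a b) ∷ []) refl (wzf ∷ w₁ ∷ z₁ ∷ [])

   -- If a = 0 then β = δ = 1/b, and (α − γ)² = 1 unless b = 1.
   a-vanishes : xs ⊩ a → (xs ⊩ β :- # 1) × (xs ⊩ δ :- # 1) ⊎ (xs ⊩ α :+ β :- # 1) × (xs ⊩ γ :+ δ) ⊎ (xs ⊩ α :+ β) × (xs ⊩ γ :+ δ :- # 1)
   a-vanishes az = [ on-line , off ]′ (split pp difference)
    where
    b≉0 : ¬ (xs ⊩ b)
    b≉0 bz = 1≉0 (by ((α , a) ∷ (β , b) ∷ (:- # 1 , one-w α β a b) ∷ []) refl (az ∷ bz ∷ w₁ ∷ []))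
     where
     1≉0 : ¬ (xs ⊩ # 1)
     1≉0 (holds z) = 2≉0 (+-cong-≈ z z)
    β-δ : xs ⊩ β :- δ
    β-δ = cancel pp b≉0 (by ((# 1 , one-w α β a b) ∷ (:- # 1 , one-w γ δ a b) ∷ (γ :- α , a) ∷ []) refl (w₁ ∷ z₁ ∷ az ∷ []))
    E F : Expr
    E = α :* γ :* e :- (# 1 :- β)
    F = β :* β :* f :- (# 1 :- α :- γ)
    Ez : xs ⊩ E
    Ez = by ((# 1 , one-wz α β γ δ e a b) ∷ (:- (α :* δ :+ β :* γ) , a) ∷ (:- β , one-w γ δ a b) ∷ (β :* γ , a) ∷ []) refl (wze ∷ az ∷ z₁ ∷ az ∷ [])
    Fz : xs ⊩ F
    Fz = by ((# 1 , one-wz α β γ δ a b f) ∷ (:- α , one-w γ δ a b) ∷ (:- γ , one-w α β a b) ∷ (α :* γ , a) ∷ (β :* f , β :- δ) ∷ []) refl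
     (wzf ∷ z₁ ∷ w₁ ∷ az ∷ β-δ ∷ [])
    wReduced zReduced : Expr
    wReduced = :- (α :* α :- # 1) :* β :+ (# 1 :- α :- γ) :* γ :* (β :+ # 1) :+ # 3 :* γ :* β :* (α :- # 1)
    zReduced = :- (γ :* γ :- # 1) :* β :+ (# 1 :- α :- γ) :* α :* (β :+ # 1) :+ # 3 :* α :* β :* (γ :- # 1)
    wz : xs ⊩ (β :- # 1) :* wReduced
    wz = by ((γ :* β , polar α β e f) ∷ (:- (α :* α :- # 1) :* β , E) ∷ (:- γ :* (β :* β :- # 1) , F) ∷ []) refl (wPolar ∷ Ez ∷ Fz ∷ [])
    zz : xs ⊩ (β :- # 1) :* zReduced
    zz = by ((α :* β , polar γ δ e f) ∷ (:- (γ :* γ :- # 1) :* β , E) ∷ (:- α :* (β :* β :- # 1) , F)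
     ∷ (α :* β :* (f :* (β :* β :+ β :* δ :+ δ :* δ :- # 1) :+ # 3 :* (γ :- # 1)) , β :- δ) ∷ []) refl (zPolar ∷ Ez ∷ Fz ∷ β-δ ∷ [])
    difference : xs ⊩ (β :- # 1) :* ((α :- γ) :* ((α :- γ :- # 1) :* (α :- γ :+ # 1)))
    difference = by ((:- (α :* γ) , polar α β e f) ∷ (α :* γ , polar γ δ e f) ∷ ((α :- γ) :* (α :* α :+ α :* γ :+ γ :* γ :- # 1) , E)
     ∷ (α :* γ :* (f :* (β :* β :+ β :* δ :+ δ :* δ :- # 1) :+ # 3 :* (γ :- # 1)) , β :- δ) ∷ []) refl (wPolar ∷ zPolar ∷ Ez ∷ β-δ ∷ [])
    Conclusion = (xs ⊩ β :- # 1) × (xs ⊩ δ :- # 1) ⊎ (xs ⊩ α :+ β :- # 1) × (xs ⊩ γ :+ δ) ⊎ (xs ⊩ α :+ β) × (xs ⊩ γ :+ δ :- # 1)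
    on-line : xs ⊩ β :- # 1 → Conclusion
    on-line β₁ = inj₁ (β₁ , by ((# 1 , β :- # 1) ∷ (:- # 1 , β :- δ) ∷ []) refl (β₁ ∷ β-δ ∷ []))
    minus : xs ⊩ α :- γ :- # 1 → xs ⊩ wReduced → Conclusion
    minus d w₀ = inj₂ (inj₁ (α+β , by ((# 1 , α :+ β :- # 1) ∷ (:- # 1 , α :- γ :- # 1) ∷ (:- # 1 , β :- δ) ∷ []) refl (α+β ∷ d ∷ β-δ ∷ [])))
     where
     α+β : xs ⊩ α :+ β :- # 1
     α+β = cancel pp γ≉0 (cancel pp numeral-2 (by ((:- # 1 , wReduced) ∷ (β :* γ :+ γ :- α :* β :- β , α :- γ :- # 1) ∷ []) refl (w₀ ∷ d ∷ [])))
    plus : xs ⊩ α :- γ :+ # 1 → xs ⊩ zReduced → Conclusion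
    plus d z₀ = inj₂ (inj₂ (by ((# 1 , γ :+ β :- # 1) ∷ (# 1 , α :- γ :+ # 1) ∷ []) refl (γ+β ∷ d ∷ [])
         , by ((# 1 , γ :+ β :- # 1) ∷ (:- # 1 , β :- δ) ∷ []) refl (γ+β ∷ β-δ ∷ [])))
     where
     γ+β : xs ⊩ γ :+ β :- # 1
     γ+β = cancel pp α≉0 (cancel pp numeral-2 (by ((:- # 1 , zReduced) ∷ (β :* γ :+ β :- α :* β :- α , α :- γ :+ # 1) ∷ []) refl (z₀ ∷ d ∷ [])))
    off : xs ⊩ (α :- γ) :* ((α :- γ :- # 1) :* (α :- γ :+ # 1)) → Conclusion
    off g = [ (λ d → [ on-line , minus d ]′ (split pp wz)) , (λ d → [ on-line , plus d ]′ (split pp zz)) ]′ (split pp (cancel pp α≉γ g))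
     where
     α≉γ : ¬ (xs ⊩ α :- γ)
     α≉γ α-γ = Δ≉0 (by ((δ , α :- γ) ∷ (:- γ , β :- δ) ∷ []) refl (α-γ ∷ β-δ ∷ []))

  -- The relations in terms of X = aα, Y = bβ, X′ = aγ, Y′ = bδ, where X + Y = X′ + Y′ = 1.

  W₁ : (X Y X′ Y′ a b : Expr) → Expr
  W₁ X Y X′ Y′ a b = (a :- # 1) :* X′ :* ((Y :* Y :- b :* b) :- X :* Y′ :* (# 1 :+ a :- # 3 :* b))
   :+ (b :- # 1) :* Y′ :* ((X :* X :- a :* a) :- X′ :* Y :* (# 1 :+ b :- # 3 :* a))

  module Wz (X Y X′ Y′ a b : Expr) where
   C F C₃ W₃ : Expr
   C₁ : Expr → Expr → Expr
   C₁ X Y = a :* X :* (# 3 :+ a) :- # 3 :* a :* a :- X :* X :* X :- # 3 :* X :* X :* Y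
   C₃ = # 3 :* b :* X :* X′ :+ a :* (X :* Y′ :+ Y :* X′) :* (# 3 :+ a) :- # 3 :* a :* a :* b
    :- (X :* X :* X :* Y′ :+ # 3 :* X :* X :* Y :* X′ :+ X′ :* X′ :* X′ :* Y :+ # 3 :* X′ :* X′ :* Y′ :* X)
    :- (# 3 :* X :* X :* Y :* Y′ :+ # 3 :* X :* Y :* Y :* X′ :+ # 3 :* X′ :* X′ :* Y′ :* Y :+ # 3 :* X′ :* Y′ :* Y′ :* X)
   C = Y′ :* (b :* b :- Y :* Y) :* C₁ X Y :- Y :* (b :* b :- Y′ :* Y′) :* C₁ X′ Y′ :+ (Y :* Y :- Y′ :* Y′) :* C₃
   F = :- # 3 :* X :* Y :* Y :* Y′ :* (b :* b :- Y :* Y) :+ # 3 :* X′ :* Y′ :* Y′ :* Y :* (b :* b :- Y′ :* Y′)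
    :+ (Y :* Y :- Y′ :* Y′) :* ((X :* Y′ :+ Y :* X′) :* b :* b
     :- (# 3 :* X :* Y :* Y :* Y′ :+ Y :* Y :* Y :* X′ :+ # 3 :* X′ :* Y′ :* Y′ :* Y :+ Y′ :* Y′ :* Y′ :* X))
   W₃ = Y :* Y′ :* (Y :* Y :- Y′ :* Y′) :* X :* X′ :* (# 2 :* a :* a :- X :* X :- X′ :* X′) :* (X :* X′ :+ b :- # 1)
    :+ X :* X′ :* F :* (Y :* Y′ :+ a :- # 1) :+ X :* X′ :* Y :* Y′ :* C

  module Generic (α₀ β₀ γ₀ δ₀ a₀ b₀ e₀ f₀ h₀ q₀ : ℤ)
   (c : Cubic (α₀ ∷ β₀ ∷ γ₀ ∷ δ₀ ∷ a₀ ∷ b₀ ∷ e₀ ∷ f₀ ∷ h₀ ∷ q₀ ∷ []))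
   (a≉0 : ¬ ((α₀ ∷ β₀ ∷ γ₀ ∷ δ₀ ∷ a₀ ∷ b₀ ∷ e₀ ∷ f₀ ∷ h₀ ∷ q₀ ∷ []) ⊩ a))
   (b≉0 : ¬ ((α₀ ∷ β₀ ∷ γ₀ ∷ δ₀ ∷ a₀ ∷ b₀ ∷ e₀ ∷ f₀ ∷ h₀ ∷ q₀ ∷ []) ⊩ b))
   (vw : (α₀ ∷ β₀ ∷ γ₀ ∷ δ₀ ∷ a₀ ∷ b₀ ∷ e₀ ∷ f₀ ∷ h₀ ∷ q₀ ∷ []) ⊩ pair-vw α β a b f (var 8) (var 9))
   (vz : (α₀ ∷ β₀ ∷ γ₀ ∷ δ₀ ∷ a₀ ∷ b₀ ∷ e₀ ∷ f₀ ∷ h₀ ∷ q₀ ∷ []) ⊩ pair-vw γ δ a b f (var 8) (var 9))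
   (wz : (α₀ ∷ β₀ ∷ γ₀ ∷ δ₀ ∷ a₀ ∷ b₀ ∷ e₀ ∷ f₀ ∷ h₀ ∷ q₀ ∷ []) ⊩ pair-wz α β γ δ e a b f (var 8) (var 9)) where

   private
    h = var 8
    q = var 9
    xs ys : List ℤ
    xs = α₀ ∷ β₀ ∷ γ₀ ∷ δ₀ ∷ a₀ ∷ b₀ ∷ e₀ ∷ f₀ ∷ h₀ ∷ q₀ ∷ []
    x₀ = a₀ ⊠ α₀
    y₀ = a₀ ⊠ γ₀
    ys = x₀ ∷ y₀ ∷ a₀ ∷ b₀ ∷ []
    x = var 0
    y = var 1
    a′ = var 2
    b′ = var 3

   open Cubic c
   open FromCubic c

   sum-one : ∀ i j → xs ⊩ i :+ j :- # 1 → ⟦ i ⟧ (env xs) + ⟦ j ⟧ (env xs) ≈[ p ] 1ℤ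
   sum-one i j z = ≈-trans (≈-reflexive (sym (⊞-def _ _))) (difference⇒≈ (i :+ j) (# 1) z)

   sum-zero : ∀ i j → xs ⊩ i :+ j → ⟦ i ⟧ (env xs) + ⟦ j ⟧ (env xs) ≈[ p ] 0ℤ
   sum-zero i j (holds z) = ≈-trans (≈-reflexive (sym (⊞-def _ _))) z

   private
    W₂ : (α β γ δ : Expr) → Expr
    W₂ α β γ δ = (α :* γ :* a :* a :+ b :- # 1) :* δ :* a :* (α :* α :- # 1) :+ (β :* δ :* b :* b :+ a :- # 1) :* γ :* b :* (β :* β :- # 1)
     :+ # 3 :* γ :* δ :* a :* b :* (α :- # 1) :* (β :- # 1)

    w₂ : xs ⊩ W₂ α β γ δ
    w₂ = cancel pp α≉0 (cancel pp β≉0 (by ((α :* γ :* b :* β :* δ :* a , polar α β e f) ∷ (:- β :* δ :* a :* (α :* α :* α :- α) , A₁)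
     ∷ (:- α :* γ :* b :* (β :* β :* β :- β) , A₂) ∷ []) refl (wPolar ∷ a₁ ∷ a₂ ∷ [])))

    z₂ : xs ⊩ W₂ γ δ α β
    z₂ = cancel pp γ≉0 (cancel pp δ≉0 (by ((α :* γ :* b :* β :* δ :* a , polar γ δ e f) ∷ (:- β :* δ :* a :* (γ :* γ :* γ :- γ) , A₁)
     ∷ (:- α :* γ :* b :* (δ :* δ :* δ :- δ) , A₂) ∷ []) refl (zPolar ∷ a₁ ∷ a₂ ∷ [])))

    multiplier : (X Y : Expr) → Expr
    multiplier X Y = X :* X :- X :* Y :+ Y :* Y :+ X :+ Y :- # 3 :* a :* b

    w₁′ : xs ⊩ W₁ (a :* α) (b :* β) (a :* γ) (b :* δ) a b
    w₁′ = by ((a :* b , W₂ α β γ δ) ∷ (:- (a :* γ) :* (b :* δ) :* multiplier (a :* α) (b :* β) , one-w α β a b) ∷ []) refl (w₂ ∷ w₁ ∷ [])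

    z₁′ : xs ⊩ W₁ (a :* γ) (b :* δ) (a :* α) (b :* β) a b
    z₁′ = by ((a :* b , W₂ γ δ α β) ∷ (:- (a :* α) :* (b :* β) :* multiplier (a :* γ) (b :* δ) , one-w γ δ a b) ∷ []) refl (z₂ ∷ z₁ ∷ [])

    substituted : Congruent p (a₀ ⊠ α₀ ∷ b₀ ⊠ β₀ ∷ a₀ ⊠ γ₀ ∷ b₀ ⊠ δ₀ ∷ a₀ ∷ b₀ ∷ []) (x₀ ∷ 1ℤ ⊞ ⊟ x₀ ∷ y₀ ∷ 1ℤ ⊞ ⊟ y₀ ∷ a₀ ∷ b₀ ∷ [])
    substituted = ≈-refl ∷ difference⇒≈ {xs = xs} (b :* β) (# 1 :- a :* α) (by ((# 1 , one-w α β a b) ∷ []) refl (w₁ ∷ []))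
     ∷ ≈-refl ∷ difference⇒≈ {xs = xs} (b :* δ) (# 1 :- a :* γ) (by ((# 1 , one-w γ δ a b) ∷ []) refl (z₁ ∷ [])) ∷ ≈-refl ∷ ≈-refl ∷ []

    w : ys ⊩ W₁ x (# 1 :- x) y (# 1 :- y) a′ b′
    w = holds (proof (along (W₁ (var 0) (var 1) (var 2) (var 3) (var 4) (var 5)) substituted (holds (proof w₁′))))

    z : ys ⊩ W₁ y (# 1 :- y) x (# 1 :- x) a′ b′
    z = holds (proof (along (W₁ (var 2) (var 3) (var 0) (var 1) (var 4) (var 5)) substituted (holds (proof z₁′))))

    x≉y : ¬ (ys ⊩ x :- y)
    x≉y (holds eq) = Δ≉0 (by ((δ , α :- γ) ∷ (:- γ , β :- δ) ∷ []) refl (α-γ ∷ β-δ ∷ []))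
     where
     difference : xs ⊩ a :* α :- a :* γ
     difference = holds eq
     α-γ : xs ⊩ α :- γ
     α-γ = cancel pp a≉0 (by ((# 1 , a :* α :- a :* γ) ∷ []) refl (difference ∷ []))
     β-δ : xs ⊩ β :- δ
     β-δ = cancel pp b≉0 (by ((# 1 , one-w α β a b) ∷ (:- # 1 , one-w γ δ a b) ∷ (:- # 1 , a :* α :- a :* γ) ∷ []) refl (w₁ ∷ z₁ ∷ difference ∷ []))

    r = x :+ y :- # 1
    s = a′ :- # 1
    t = b′ :- # 1
    π = x :* y

    -- The combination x·W₁(x,y) - y·W₁(y,x) is antisymmetric, and `T₁` is its quotient by x - y.
    -- The multipliers 1 - x and 1 - y give `T₂` in the same way.
    t₁ : ys ⊩ T₁ r s t π
    t₁ = cancel pp x≉y (by ((x , W₁ x (# 1 :- x) y (# 1 :- y) a′ b′) ∷ (:- y , W₁ y (# 1 :- y) x (# 1 :- x) a′ b′) ∷ []) refl (w ∷ z ∷ []))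

    t₂ : ys ⊩ T₂ r s t π
    t₂ = cancel pp x≉y (by ((# 1 :- x , W₁ x (# 1 :- x) y (# 1 :- y) a′ b′) ∷ (:- (# 1 :- y) , W₁ y (# 1 :- y) x (# 1 :- x) a′ b′) ∷ []) refl (w ∷ z ∷ []))

    -- The multipliers are chosen so that the coefficients of q and of h cancel simultaneously.
    eliminated : Expr
    eliminated = δ :* (# 1 :- β :* β) :* pair-vw α β a b f h q :- β :* (# 1 :- δ :* δ) :* pair-vw γ δ a b f h q
     :+ (β :* β :- δ :* δ) :* pair-wz α β γ δ e a b f h q

    -- The coefficients of e and f in `eliminated`, which tell by what multiples `A₁` and `A₂` have
    -- to be subtracted.
    e-part f-part : Expr
    e-part = (β :* β :- δ :* δ) :* α :* γ :* (# 2 :- α :* α :- γ :* γ)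
    f-part = :- # 3 :* α :* β :* β :* δ :* (# 1 :- β :* β) :+ # 3 :* γ :* δ :* δ :* β :* (# 1 :- δ :* δ)
     :+ (β :* β :- δ :* δ) :* ((α :* δ :+ β :* γ) :- (# 3 :* α :* β :* β :* δ :+ β :* β :* β :* γ :+ # 3 :* γ :* δ :* δ :* β :+ δ :* δ :* δ :* α))

    wz₃ : xs ⊩ Wz.W₃ (a :* α) (b :* β) (a :* γ) (b :* δ) a b
    wz₃ = by ((a³b⁴ :* (α :* γ :* b :* β :* δ :* a) , eliminated) ∷ (:- a³b⁴ :* (β :* δ :* a :* e-part) , A₁) ∷ (:- a³b⁴ :* (α :* γ :* b :* f-part) , A₂) ∷ [])
     refl (by ((δ :* (# 1 :- β :* β) , pair-vw α β a b f h q) ∷ (:- β :* (# 1 :- δ :* δ) , pair-vw γ δ a b f h q)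
      ∷ (β :* β :- δ :* δ , pair-wz α β γ δ e a b f h q) ∷ []) refl (vw ∷ vz ∷ wz ∷ []) ∷ a₁ ∷ a₂ ∷ [])
     where
     a³b⁴ = a :* a :* a :* b :* b :* b :* b

    x≉0 : ¬ (ys ⊩ x)
    x≉0 (holds eq) = α≉0 (cancel pp a≉0 (holds eq))

    y≉0 : ¬ (ys ⊩ y)
    y≉0 (holds eq) = γ≉0 (cancel pp a≉0 (holds eq))

    x≉1 : ¬ (ys ⊩ # 1 :- x)
    x≉1 (holds eq) = β≉0 (cancel pp b≉0 (by ((# 1 , one-w α β a b) ∷ (# 1 , # 1 :- a :* α) ∷ []) refl (w₁ ∷ holds eq ∷ [])))

    y≉1 : ¬ (ys ⊩ # 1 :- y)
    y≉1 (holds eq) = δ≉0 (cancel pp b≉0 (by ((# 1 , one-w γ δ a b) ∷ (# 1 , # 1 :- a :* γ) ∷ []) refl (z₁ ∷ holds eq ∷ [])))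

    iii : ys ⊩ III r s t π
    iii = cancel pp x≉y (cancel pp x≉0 (cancel pp y≉0 (by ((# 1 , Wz.W₃ x (# 1 :- x) y (# 1 :- y) a′ b′) ∷ []) refl
     (holds (proof (along (Wz.W₃ (var 0) (var 1) (var 2) (var 3) (var 4) (var 5)) substituted (holds (proof wz₃)))) ∷ []))))

    π≉0 : ¬ (ys ⊩ π)
    π≉0 πz = y≉0 (cancel pp x≉0 πz)

    π′≉0 : ¬ (ys ⊩ π :- r)
    π′≉0 πz = y≉1 (cancel pp x≉1 (by ((# 1 , π :- r) ∷ []) refl (πz ∷ [])))

    distinct : ¬ (ys ⊩ (# 1 :+ r) :* (# 1 :+ r) :- # 4 :* π)
    distinct πz = x≉y (cancel pp x≉y (by ((# 1 , (# 1 :+ r) :* (# 1 :+ r) :- # 4 :* π) ∷ []) refl (πz ∷ [])))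

    relations : ((ys ⊩ s) × (ys ⊩ t)) ⊎ ((ys ⊩ NL r s t π) × (ys ⊩ bracketed s t π))
    relations = [ (λ { (holds sz , holds tz) → inj₁ (holds sz , holds tz) }) , (λ { (holds nl , holds br) → inj₂ (holds nl , holds br) }) ]′
     (Classification.classify (x₀ ⊞ y₀ ⊞ ⊟ 1ℤ) (a₀ ⊞ ⊟ 1ℤ) (b₀ ⊞ ⊟ 1ℤ) (x₀ ⊠ y₀)
      (holds (proof t₁)) (holds (proof t₂)) (λ { (holds πz) → π≉0 (holds πz) }) (λ { (holds πz) → π′≉0 (holds πz) })
      (holds (proof iii)) (λ { (holds πz) → distinct (holds πz) }))

    d = b′ :- a′

    -- These are ab(α + β - 1) and ab(α + β) in terms of x = aα and bβ = 1 - x. The relation `NL` is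
    -- `on-one` at one root plus `on-zero` at the other.
    on-one on-zero : Expr → Expr
    on-one x = x :* d :- a′ :* t
    on-zero x = x :* d :+ a′

   generic : Standard p α₀ β₀ γ₀ δ₀
   generic = [ on , (λ { (nl , br) → off nl br }) ]′ relations
    where
    on : (ys ⊩ s) × (ys ⊩ t) → Standard p α₀ β₀ γ₀ δ₀
    on (holds sz , holds tz) = all-on
     (sum-one α β (by ((# 1 , one-w α β a b) ∷ (:- α , a :- # 1) ∷ (:- β , b :- # 1) ∷ []) refl (w₁ ∷ holds sz ∷ holds tz ∷ [])))
     (sum-one γ δ (by ((# 1 , one-w γ δ a b) ∷ (:- γ , a :- # 1) ∷ (:- δ , b :- # 1) ∷ []) refl (z₁ ∷ holds sz ∷ holds tz ∷ [])))

    module _ (nl : ys ⊩ NL r s t π) (br : ys ⊩ bracketed s t π) where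

     root : ys ⊩ on-one x :* on-zero x
     root = by ((d :* x , NL r s t π) ∷ (:- # 1 , bracketed s t π) ∷ []) refl (nl ∷ br ∷ [])

     partner-one : ys ⊩ on-one x → ys ⊩ on-zero y
     partner-one z = by ((# 1 , NL r s t π) ∷ (:- # 1 , on-one x) ∷ []) refl (nl ∷ z ∷ [])

     partner-zero : ys ⊩ on-zero x → ys ⊩ on-one y
     partner-zero z = by ((# 1 , NL r s t π) ∷ (:- # 1 , on-zero x) ∷ []) refl (nl ∷ z ∷ [])

     off : Standard p α₀ β₀ γ₀ δ₀
     off = [ (λ z → z-off (w-one z) (z-zero (partner-one z))) , (λ z → w-off (w-zero z) (z-one (partner-zero z))) ]′ (split pp root)
      where
      w-one : ys ⊩ on-one x → α₀ + β₀ ≈[ p ] 1ℤ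
      w-one (holds z) = sum-one α β (cancel pp a≉0 (cancel pp b≉0 (by ((# 1 , a :* α :* (b :- a) :- a :* (b :- # 1)) ∷ (a , one-w α β a b) ∷ []) refl
       (holds z ∷ w₁ ∷ []))))
      z-one : ys ⊩ on-one y → γ₀ + δ₀ ≈[ p ] 1ℤ
      z-one (holds z) = sum-one γ δ (cancel pp a≉0 (cancel pp b≉0 (by ((# 1 , a :* γ :* (b :- a) :- a :* (b :- # 1)) ∷ (a , one-w γ δ a b) ∷ []) refl
       (holds z ∷ z₁ ∷ []))))
      w-zero : ys ⊩ on-zero x → α₀ + β₀ ≈[ p ] 0ℤ
      w-zero (holds z) = sum-zero α β (cancel pp a≉0 (cancel pp b≉0 (by ((# 1 , a :* α :* (b :- a) :+ a) ∷ (a , one-w α β a b) ∷ []) refl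
       (holds z ∷ w₁ ∷ []))))
      z-zero : ys ⊩ on-zero y → γ₀ + δ₀ ≈[ p ] 0ℤ
      z-zero (holds z) = sum-zero γ δ (cancel pp a≉0 (cancel pp b≉0 (by ((# 1 , a :* γ :* (b :- a) :+ a) ∷ (a , one-w γ δ a b) ∷ []) refl
       (holds z ∷ z₁ ∷ []))))

  module _ {α₀ β₀ γ₀ δ₀ a₀ b₀ e₀ f₀ h₀ q₀ : ℤ} where

   private
    xs xs′ : List ℤ
    xs  = α₀ ∷ β₀ ∷ γ₀ ∷ δ₀ ∷ a₀ ∷ b₀ ∷ e₀ ∷ f₀ ∷ h₀ ∷ q₀ ∷ []
    xs′ = β₀ ∷ α₀ ∷ δ₀ ∷ γ₀ ∷ b₀ ∷ a₀ ∷ f₀ ∷ e₀ ∷ []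

    -- All relations of `Cubic` concern the cubic form D(u,·,·,·), and as a system they are
    -- symmetric in u and v: the values at u, w, z and at v, w, z trade places.
    mirror : Cubic xs → Cubic xs′
    mirror c = record
     { α≉0 = λ { (holds z) → β≉0 (holds z) }
     ; β≉0 = λ { (holds z) → α≉0 (holds z) }
     ; γ≉0 = λ { (holds z) → δ≉0 (holds z) }
     ; δ≉0 = λ { (holds z) → γ≉0 (holds z) }
     ; Δ≉0 = λ { (holds z) → Δ≉0 (by ((:- # 1 , β :* γ :- α :* δ) ∷ []) refl (holds z ∷ [])) }
     ; w₁ = holds (proof {xs} {one-w β α b a} (by ((# 1 , one-w α β a b) ∷ []) refl (w₁ ∷ [])))
     ; z₁ = holds (proof {xs} {one-w δ γ b a} (by ((# 1 , one-w γ δ a b) ∷ []) refl (z₁ ∷ [])))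
     ; wze = holds (proof {xs} {one-wz β α δ γ f b a} (by ((# 1 , one-wz α β γ δ a b f) ∷ []) refl (wzf ∷ [])))
     ; wzf = holds (proof {xs} {one-wz β α δ γ b a e} (by ((# 1 , one-wz α β γ δ e a b) ∷ []) refl (wze ∷ [])))
     ; uw = holds (proof {xs} {pair-uw β α f b a e} (by ((# 1 , pair-uw α β e a b f) ∷ []) refl (uw ∷ [])))
     ; uz = holds (proof {xs} {pair-uw δ γ f b a e} (by ((# 1 , pair-uw γ δ e a b f) ∷ []) refl (uz ∷ [])))
     }
     where open Cubic c

    one : ∀ i → xs ⊩ i :- # 1 → ⟦ i ⟧ (env xs) ≈[ p ] 1ℤ
    one i = difference⇒≈ i (# 1)

    one+ : ∀ i j → xs ⊩ i :+ j :- # 1 → ⟦ i ⟧ (env xs) + ⟦ j ⟧ (env xs) ≈[ p ] 1ℤ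
    one+ i j z = ≈-trans (≈-reflexive (sym (⊞-def _ _))) (difference⇒≈ (i :+ j) (# 1) z)

    zero+ : ∀ i j → xs ⊩ i :+ j → ⟦ i ⟧ (env xs) + ⟦ j ⟧ (env xs) ≈[ p ] 0ℤ
    zero+ i j (holds z) = ≈-trans (≈-reflexive (sym (⊞-def _ _))) z

   -- The generic argument divides by a and by b. The case a = 0 is solved from the cubic relations
   -- alone, and b = 0 is its mirror image.
   standard : Cubic xs → xs ⊩ pair-vw α β a b f (var 8) (var 9) → xs ⊩ pair-vw γ δ a b f (var 8) (var 9) →
        xs ⊩ pair-wz α β γ δ e a b f (var 8) (var 9) → Standard p α₀ β₀ γ₀ δ₀
   standard c vw vz wz = decide (≈0? p a₀) (≈0? p b₀)
    where
    decide : Dec (a₀ ≈[ p ] 0ℤ) → Dec (b₀ ≈[ p ] 0ℤ) → Standard p α₀ β₀ γ₀ δ₀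
    decide (yes az) _ = [ (λ { (z , z′) → u-off (one β z) (one δ z′) }) ,
     [ (λ { (z , z′) → z-off (one+ α β z) (zero+ γ δ z′) }) , (λ { (z , z′) → w-off (zero+ α β z) (one+ γ δ z′) }) ]′ ]′
     (FromCubic.a-vanishes c (holds az))
    decide (no _) (yes bz) = [ (λ { (holds z , holds z′) → v-off (one α (holds z)) (one γ (holds z′)) }) ,
     [ (λ { (holds z , holds z′) → z-off (one+ α β (swap₁ (holds z))) (zero+ γ δ (swap₀ (holds z′))) }) ,
      (λ { (holds z , holds z′) → w-off (zero+ α β (swap₀ (holds z))) (one+ γ δ (swap₁ (holds z′))) }) ]′ ]′
     (FromCubic.a-vanishes (mirror c) (holds bz))
     where
     swap₁ : ∀ {i j} → xs ⊩ var j :+ var i :- # 1 → xs ⊩ var i :+ var j :- # 1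
     swap₁ (holds z) = holds (≈-trans (≈-reflexive (cong (_⊞ ⊟ 1ℤ) (⊞-comm _ _))) z)
     swap₀ : ∀ {i j} → xs ⊩ var j :+ var i → xs ⊩ var i :+ var j
     swap₀ (holds z) = holds (≈-trans (≈-reflexive (⊞-comm _ _)) z)
    decide (no a≉0) (no b≉0) = Generic.generic α₀ β₀ γ₀ δ₀ a₀ b₀ e₀ f₀ h₀ q₀ c (λ { (holds z) → a≉0 z }) (λ { (holds z) → b≉0 z }) vw vz wz

-- Expanding the forms in the basis u, v

module QuarticToStandard where

 open TranslationRing
 open GroupAlgebras
 open MultilinearForms
 open QuarticForm
 open PolynomialIdentities
 open QuarticClassification
 open StandardCoordinates
 open import Data.Bool using (Bool; true; false)
 open import Data.Nat as ℕ using (ℕ; suc)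
 open import Data.Integer using (ℤ; +_; _+_; _*_; -_; _-_; 0ℤ; 1ℤ)
 open import Data.List using (List; []; _∷_)
 open import Data.List.Relation.Unary.All as All using ([]; _∷_)

 module _ {p : ℕ} (pp : Prime p) (2≉0 : ¬ (+ 2 ≈[ p ] 0ℤ)) (3≉0 : ¬ (+ 3 ≈[ p ] 0ℤ))
      {u v w z : G} (forms : Quartic p u v w z) {α₀ β₀ γ₀ δ₀ : ℤ}
      (w-coordinates : w ≈²[ p ] α₀ · u ⊕ β₀ · v) (z-coordinates : z ≈²[ p ] γ₀ · u ⊕ δ₀ · v)
      (α≉0 : ¬ (α₀ ≈[ p ] 0ℤ)) (β≉0 : ¬ (β₀ ≈[ p ] 0ℤ)) (γ≉0 : ¬ (γ₀ ≈[ p ] 0ℤ)) (δ≉0 : ¬ (δ₀ ≈[ p ] 0ℤ))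
      (Δ≉0 : ¬ (α₀ * δ₀ - β₀ * γ₀ ≈[ p ] 0ℤ)) where

  open Quartic forms
  open QuarticEquations
  open StandardPosition pp 2≉0 3≉0

  private
   xs : List ℤ
   xs = α₀ ∷ β₀ ∷ γ₀ ∷ δ₀ ∷ D u u u v ∷ D u u v v ∷ D u u u u ∷ D u v v v ∷ D v v v v ∷ Q v v ∷ []

   ρ : Env
   ρ = env xs

   α = var 0
   β = var 1
   γ = var 2
   δ = var 3
   a = var 4
   b = var 5
   e = var 6
   f = var 7
   h = var 8
   q = var 9

   Coordinates : Set
   Coordinates = Expr × Expr

   IsPoint : G → Coordinates → Set
   IsPoint g (x , y) = g ≈²[ p ] ⟦ x ⟧ ρ · u ⊕ ⟦ y ⟧ ρ · v

   cu cv cw cz : Coordinates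
   cu = # 1 , # 0
   cv = # 0 , # 1
   cw = α , β
   cz = γ , δ

   u-point : IsPoint u cu
   u-point = ≈-reflexive (lem (proj₁ u) (proj₁ v)) , ≈-reflexive (lem (proj₂ u) (proj₂ v))
    where
    lem : ∀ x y → x ≡ 1ℤ * x + 0ℤ * y
    lem = solve-∀

   v-point : IsPoint v cv
   v-point = ≈-reflexive (lem (proj₁ u) (proj₁ v)) , ≈-reflexive (lem (proj₂ u) (proj₂ v))
    where
    lem : ∀ x y → y ≡ 0ℤ * x + 1ℤ * y
    lem = solve-∀

   lin : Coordinates → Expr → Expr → Expr
   lin (x , y) A B = x :* A :+ y :* B

   HasValue : ℤ → Expr → Set
   HasValue n E = n ≈[ p ] ⟦ E ⟧ ρ

   linear : ∀ {F : G → ℤ} → Additive p F → (∀ {a a′} → a ≈²[ p ] a′ → F a ≈[ p ] F a′) →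
         ∀ {g} c → IsPoint g c → ∀ {A B} → HasValue (F u) A → HasValue (F v) B → HasValue (F g) (lin c A B)
   linear additive respects (x , y) point {A′} {B′} A B = ≈-trans (respects point) (≈-trans (additive-combination additive (⟦ x ⟧ ρ) (⟦ y ⟧ ρ) u v)
    (≈-trans (≈-reflexive (sym (trans (⊞-def _ _) (cong₂ _+_ (⊠-def _ _) (⊠-def _ _)))))
     (⊞-cong (⊠-cong (≈-refl {a = ⟦ x ⟧ ρ}) A) (⊠-cong (≈-refl {a = ⟦ y ⟧ ρ}) B))))

   -- By symmetry the value of `D` at a word in u and v depends only on the number of copies of v;
   -- that number is the index.
   E : ℕ → Expr
   E 0 = e
   E 1 = a
   E 2 = b
   E 3 = f
   E _ = h

   side : Bool → G
   side false = u
   side true  = v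

   weight : Bool → ℕ
   weight false = 0
   weight true  = 1

   basis : ∀ i j k l → HasValue (D (side i) (side j) (side k) (side l)) (E (weight i ℕ.+ weight j ℕ.+ weight k ℕ.+ weight l))
   basis false false false false = ≈-refl
   basis false false false true  = ≈-refl
   basis false false true  false = D-swap₃ u u v u
   basis false false true  true  = ≈-refl
   basis false true  false false = ≈-trans (D-swap₂ u v u u) (D-swap₃ u u v u)
   basis false true  false true  = D-swap₂ u v u v
   basis false true  true  false = ≈-trans (D-swap₃ u v v u) (D-swap₂ u v u v)
   basis false true  true  true  = ≈-refl
   basis true  false false false = ≈-trans (D-swap₁ v u u u) (≈-trans (D-swap₂ u v u u) (D-swap₃ u u v u))
   basis true  false false true  = ≈-trans (D-swap₁ v u u v) (D-swap₂ u v u v)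
   basis true  false true  false = ≈-trans (D-swap₁ v u v u) (≈-trans (D-swap₃ u v v u) (D-swap₂ u v u v))
   basis true  false true  true  = D-swap₁ v u v v
   basis true  true  false false = ≈-trans (D-swap₂ v v u u) (≈-trans (D-swap₁ v u v u) (≈-trans (D-swap₃ u v v u) (D-swap₂ u v u v)))
   basis true  true  false true  = ≈-trans (D-swap₂ v v u v) (D-swap₁ v u v v)
   basis true  true  true  false = ≈-trans (D-swap₃ v v v u) (≈-trans (D-swap₂ v v u v) (D-swap₁ v u v v))
   basis true  true  true  true  = ≈-refl

   D₂ : ∀ a c d → Additive p (λ b → D a b c d)
   D₂ a c d g h = ≈-trans (D-swap₁ a _ c d) (≈-trans (D-additive a c d g h) (+-cong-≈ (D-swap₁ g a c d) (D-swap₁ h a c d)))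

   D₂-cong : ∀ a c d {b b′} → b ≈²[ p ] b′ → D a b c d ≈[ p ] D a b′ c d
   D₂-cong a c d r = ≈-trans (D-swap₁ a _ c d) (≈-trans (D-cong a c d r) (D-swap₁ _ a c d))

   D₃ : ∀ a b d → Additive p (λ c → D a b c d)
   D₃ a b d g h = ≈-trans (D-swap₂ a b _ d) (≈-trans (D₂ a b d g h) (+-cong-≈ (D-swap₂ a g b d) (D-swap₂ a h b d)))

   D₃-cong : ∀ a b d {c c′} → c ≈²[ p ] c′ → D a b c d ≈[ p ] D a b c′ d
   D₃-cong a b d r = ≈-trans (D-swap₂ a b _ d) (≈-trans (D₂-cong a b d r) (D-swap₂ a _ b d))

   D₄ : ∀ a b c → Additive p (λ d → D a b c d)
   D₄ a b c g h = ≈-trans (D-swap₃ a b c _) (≈-trans (D₃ a b c g h) (+-cong-≈ (D-swap₃ a b g c) (D-swap₃ a b h c)))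

   D₄-cong : ∀ a b c {d d′} → d ≈²[ p ] d′ → D a b c d ≈[ p ] D a b c d′
   D₄-cong a b c r = ≈-trans (D-swap₃ a b c _) (≈-trans (D₃-cong a b c r) (D-swap₃ a b _ c))

   linear₁ : Coordinates → (ℕ → Expr) → ℕ → Expr
   linear₁ c F n = lin c (F n) (F (suc n))

   quartic : (c₁ c₂ c₃ c₄ : Coordinates) → Expr
   quartic c₁ c₂ c₃ c₄ = linear₁ c₁ (linear₁ c₂ (linear₁ c₃ (linear₁ c₄ E))) 0

   -- weights add up from the left, so that the weight of v in one slot raises the index by one
   quartic-value : ∀ {g₁ g₂ g₃ g₄} c₁ c₂ c₃ c₄ → IsPoint g₁ c₁ → IsPoint g₂ c₂ → IsPoint g₃ c₃ → IsPoint g₄ c₄ →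
          HasValue (D g₁ g₂ g₃ g₄) (quartic c₁ c₂ c₃ c₄)
   quartic-value {g₁} {g₂} {g₃} {g₄} c₁ c₂ c₃ c₄ p₁ p₂ p₃ p₄ = linear (D-additive g₂ g₃ g₄) (D-cong g₂ g₃ g₄) c₁ p₁ {A = linear₁ c₂ (linear₁ c₃ (linear₁ c₄ E)) 0} {B = linear₁ c₂ (linear₁ c₃ (linear₁ c₄ E)) 1} (two false) (two true)
    where
    four : ∀ i j k → HasValue (D (side i) (side j) (side k) g₄) (linear₁ c₄ E (weight i ℕ.+ weight j ℕ.+ weight k))
    four i j k = linear (D₄ (side i) (side j) (side k)) (D₄-cong (side i) (side j) (side k)) c₄ p₄ {A = E (weight i ℕ.+ weight j ℕ.+ weight k)} {B = E (suc (weight i ℕ.+ weight j ℕ.+ weight k))} (last false) (last true)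
     where
     n = weight i ℕ.+ weight j ℕ.+ weight k
     last : ∀ l → HasValue (D (side i) (side j) (side k) (side l)) (E (weight l ℕ.+ n))
     last l = subst (λ m → HasValue (D (side i) (side j) (side k) (side l)) (E m)) (ℕₚ.+-comm n (weight l)) (basis i j k l)
    three : ∀ i j → HasValue (D (side i) (side j) g₃ g₄) (linear₁ c₃ (linear₁ c₄ E) (weight i ℕ.+ weight j))
    three i j = linear (D₃ (side i) (side j) g₄) (D₃-cong (side i) (side j) g₄) c₃ p₃ {A = linear₁ c₄ E (weight i ℕ.+ weight j)} {B = linear₁ c₄ E (suc (weight i ℕ.+ weight j))} (last false) (last true)
     where
     n = weight i ℕ.+ weight j
     last : ∀ l → HasValue (D (side i) (side j) (side l) g₄) (linear₁ c₄ E (weight l ℕ.+ n))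
     last l = subst (λ m → HasValue (D (side i) (side j) (side l) g₄) (linear₁ c₄ E m)) (ℕₚ.+-comm n (weight l)) (four i j l)
    two : ∀ i → HasValue (D (side i) g₂ g₃ g₄) (linear₁ c₂ (linear₁ c₃ (linear₁ c₄ E)) (weight i))
    two i = linear (D₂ (side i) g₃ g₄) (D₂-cong (side i) g₃ g₄) c₂ p₂ {A = linear₁ c₃ (linear₁ c₄ E) (weight i)} {B = linear₁ c₃ (linear₁ c₄ E) (suc (weight i))} (last false) (last true)
     where
     n = weight i
     last : ∀ l → HasValue (D (side i) (side l) g₃ g₄) (linear₁ c₃ (linear₁ c₄ E) (weight l ℕ.+ n))
     last l = subst (λ m → HasValue (D (side i) (side l) g₃ g₄) (linear₁ c₃ (linear₁ c₄ E) m)) (ℕₚ.+-comm n (weight l)) (three i l)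

   quu quv : Expr
   quu = # 3 :+ (e :+ e)
   quv = # 3 :+ (a :+ f)

   quadratic : (c₁ c₂ : Coordinates) → Expr
   quadratic c₁ c₂ = lin c₁ (lin c₂ quu quv) (lin c₂ quv q)

   sum : ∀ {m n A B} → HasValue m A → HasValue n B → HasValue (m + n) (A :+ B)
   sum x y = ≈-trans (≈-reflexive (sym (⊞-def _ _))) (⊞-cong x y)

   Q₂ : ∀ a → Additive p (λ b → Q a b)
   Q₂ a g h = ≈-trans (Q-swap a _) (≈-trans (Q-additive a g h) (+-cong-≈ (Q-swap g a) (Q-swap h a)))

   Q₂-cong : ∀ a {b b′} → b ≈²[ p ] b′ → Q a b ≈[ p ] Q a b′
   Q₂-cong a r = ≈-trans (Q-swap a _) (≈-trans (Q-cong a r) (Q-swap _ a))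

   quadratic-value : ∀ {g₁ g₂} c₁ c₂ → IsPoint g₁ c₁ → IsPoint g₂ c₂ → HasValue (Q g₁ g₂) (quadratic c₁ c₂)
   quadratic-value {g₁} {g₂} c₁ c₂ p₁ p₂ = linear (Q-additive g₂) (Q-cong g₂) c₁ p₁ {A = lin c₂ quu quv} {B = lin c₂ quv q}
    (linear (Q₂ u) (Q₂-cong u) c₂ p₂ {A = quu} {B = quv} uu uv)
    (linear (Q₂ v) (Q₂-cong v) c₂ p₂ {A = quv} {B = q} (≈-trans (Q-swap v u) uv) ≈-refl)
    where
    uu : HasValue (Q u u) quu
    uu = ≈-trans Q-uu (sum {A = # 3} {B = e :+ e} ≈-refl (sum {A = e} {B = e} ≈-refl ≈-refl))
    uv : HasValue (Q u v) quv
    uv = ≈-trans Q-uv (sum {A = # 3} {B = a :+ f} ≈-refl (sum {A = a} {B = f} ≈-refl ≈-refl))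

   equation : ∀ {m A B} → HasValue m A → HasValue m B → xs ⊩ A :- B
   equation {m} {A} {B} x y = holds (≈-trans (⊞-cong (≈-trans (≈-sym x) y) (≈-refl {a = ⊟ ⟦ B ⟧ ρ}))
    (≈-reflexive (trans (⊞-def _ _) (trans (cong (λ n → ⟦ B ⟧ ρ + n) (⊟-def _)) (ℤₚ.+-inverseʳ (⟦ B ⟧ ρ))))))

   one : ∀ {g₁ g₂ g₃ g₄} c₁ c₂ c₃ c₄ → IsPoint g₁ c₁ → IsPoint g₂ c₂ → IsPoint g₃ c₃ → IsPoint g₄ c₄ →
       D g₁ g₂ g₃ g₄ ≈[ p ] 1ℤ → xs ⊩ quartic c₁ c₂ c₃ c₄ :- # 1
   one c₁ c₂ c₃ c₄ p₁ p₂ p₃ p₄ value = equation {A = quartic c₁ c₂ c₃ c₄} {B = # 1} (quartic-value c₁ c₂ c₃ c₄ p₁ p₂ p₃ p₄) value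

   pair : ∀ {g₁ g₂} c₁ c₂ → IsPoint g₁ c₁ → IsPoint g₂ c₂ → Q g₁ g₂ ≈[ p ] + 3 + (D g₁ g₁ g₁ g₂ + D g₁ g₂ g₂ g₂) →
        xs ⊩ quadratic c₁ c₂ :- (# 3 :+ (quartic c₁ c₁ c₁ c₂ :+ quartic c₁ c₂ c₂ c₂))
   pair c₁ c₂ p₁ p₂ value = equation {A = quadratic c₁ c₂} {B = # 3 :+ (quartic c₁ c₁ c₁ c₂ :+ quartic c₁ c₂ c₂ c₂)} (quadratic-value c₁ c₂ p₁ p₂)
    (≈-trans value (sum {A = # 3} {B = quartic c₁ c₁ c₁ c₂ :+ quartic c₁ c₂ c₂ c₂} ≈-refl
     (sum {A = quartic c₁ c₁ c₁ c₂} {B = quartic c₁ c₂ c₂ c₂} (quartic-value c₁ c₁ c₁ c₂ p₁ p₁ p₁ p₂) (quartic-value c₁ c₂ c₂ c₂ p₁ p₂ p₂ p₂))))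

   from : ∀ {A B} → norm (A :- combination ((# 1 , B) ∷ [])) ≡ [] → xs ⊩ B → xs ⊩ A
   from {A} {B} eq z = by ((# 1 , B) ∷ []) eq (z ∷ [])

   P-w : IsPoint w cw
   P-w = w-coordinates
   P-z : IsPoint z cz
   P-z = z-coordinates

   cubic-equations : Cubic xs
   cubic-equations = record
    { α≉0 = λ { (holds n) → α≉0 n }
    ; β≉0 = λ { (holds n) → β≉0 n }
    ; γ≉0 = λ { (holds n) → γ≉0 n }
    ; δ≉0 = λ { (holds n) → δ≉0 n }
    ; Δ≉0 = λ { (holds n) → Δ≉0 (≈-trans (≈-reflexive (sym (trans (⊞-def _ _) (cong₂ _+_ (⊠-def _ _) (trans (⊟-def _) (cong -_ (⊠-def _ _))))))) n) }
    ; w₁ = from refl (one cu cu cv cw u-point u-point v-point P-w D-uuvw)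
    ; z₁ = from refl (one cu cu cv cz u-point u-point v-point P-z D-uuvz)
    ; wze = from refl (one cu cu cw cz u-point u-point P-w P-z D-uuwz)
    ; wzf = from refl (one cu cv cw cz u-point v-point P-w P-z D-uvwz)
    ; uw = from refl (pair cu cw u-point P-w Q-uw)
    ; uz = from refl (pair cu cz u-point P-z Q-uz)
    }

  quartic⇒standard : Standard p α₀ β₀ γ₀ δ₀
  quartic⇒standard = standard cubic-equations (from refl (pair cv cw v-point P-w Q-vw)) (from refl (pair cv cz v-point P-z Q-vz))
   (from refl (pair cw cz P-w P-z Q-wz))

-- Lists as multisets, minimal zero-sum sequences, and the translation from indexed families

module ZeroSumSequences where

 open TranslationRing
 open GroupAlgebras
 open MultilinearForms
 open QuarticForm
 open ResidueVectors
 open QuarticClassification using (∣⇒≈0; ≈0⇒∣)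
 open import Data.Bool using (Bool; true; false) renaming (_≟_ to _≟ᵇ_)
 open import Data.Nat as ℕ using (ℕ; zero; suc; _∸_; NonZero)
 open import Data.Nat.DivMod using (_%_; _/_; m%n<n; m≡m%n+[m/n]*n)
 open import Data.Integer using (ℤ; +_; _+_; _*_; -_; _-_; 0ℤ; ∣_∣)
 open import Data.Fin as Fin using (Fin; toℕ; fromℕ<)
 open import Data.Fin.Properties using (toℕ-fromℕ<; toℕ-injective; toℕ<n; any?) renaming (_≟_ to _≟ᶠ_)
 open import Data.Product.Properties using (≡-dec)
 open import Data.List using (List; []; _∷_; _++_; map; length; replicate; tabulate)
 open import Data.List.Relation.Unary.All as All using (All; []; _∷_)
 open import Data.List.Relation.Unary.Any using (here)
 open import Data.List.Membership.Propositional.Properties using (∈-∃++)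
 open import Data.List.Relation.Binary.Sublist.Propositional using (_⊆_; []; _∷_; _∷ʳ_; ⊆-refl)
 open import Data.List.Relation.Binary.Permutation.Propositional using (_↭_; prep; swap; ↭-sym; ↭-trans; ↭-refl)
 import Data.List.Relation.Binary.Permutation.Propositional as Perm
 open import Data.List.Relation.Binary.Permutation.Propositional.Properties using (shift; ↭-length)
 open import Data.Fin.Subset.Properties using (anySubset?)
 import Data.Vec as Vec
 import Data.Vec.Properties as Vecₚ
 import Relation.Nullary.Decidable as Dec
 open import Relation.Nullary.Decidable using (_×-dec_)

 -- Sub-multisets and permutations

 ⊆-through-↭ : ∀ {A : Set} {l l′ S : List A} → l ↭ l′ → S ⊆ l′ → ∃ λ S′ → S′ ⊆ l × S′ ↭ S
 ⊆-through-↭ Perm.refl s = _ , s , ↭-refl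
 ⊆-through-↭ (prep x π) (.x ∷ʳ s) with ⊆-through-↭ π s
 ... | S′ , s′ , σ = S′ , x ∷ʳ s′ , σ
 ⊆-through-↭ (prep x π) (refl ∷ s) with ⊆-through-↭ π s
 ... | S′ , s′ , σ = x ∷ S′ , refl ∷ s′ , prep x σ
 ⊆-through-↭ (swap x y π) (.y ∷ʳ .x ∷ʳ s) with ⊆-through-↭ π s
 ... | S′ , s′ , σ = S′ , x ∷ʳ y ∷ʳ s′ , σ
 ⊆-through-↭ (swap x y π) (.y ∷ʳ refl ∷ s) with ⊆-through-↭ π s
 ... | S′ , s′ , σ = x ∷ S′ , refl ∷ y ∷ʳ s′ , prep x σ
 ⊆-through-↭ (swap x y π) (refl ∷ .x ∷ʳ s) with ⊆-through-↭ π s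
 ... | S′ , s′ , σ = y ∷ S′ , x ∷ʳ refl ∷ s′ , prep y σ
 ⊆-through-↭ (swap x y π) (refl ∷ refl ∷ s) with ⊆-through-↭ π s
 ... | S′ , s′ , σ = x ∷ y ∷ S′ , refl ∷ refl ∷ s′ , swap x y σ
 ⊆-through-↭ (Perm.trans π π′) s with ⊆-through-↭ π′ s
 ... | S₁ , s₁ , σ₁ with ⊆-through-↭ π s₁
 ...   | S₂ , s₂ , σ₂ = S₂ , s₂ , ↭-trans σ₂ σ₁

 Σ⊕-↭ : ∀ {l l′} → l ↭ l′ → Σ⊕ l ≡ Σ⊕ l′
 Σ⊕-↭ Perm.refl = refl
 Σ⊕-↭ (prep x π) = cong (x ⊕_) (Σ⊕-↭ π)
 Σ⊕-↭ (swap {xs = xs} {ys = ys} x y π) = trans (sym (⊕-assoc x y (Σ⊕ xs))) (trans (cong₂ _⊕_ (⊕-comm x y) (Σ⊕-↭ π)) (⊕-assoc y x (Σ⊕ ys)))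
 Σ⊕-↭ (Perm.trans π π′) = trans (Σ⊕-↭ π) (Σ⊕-↭ π′)

 Σ⊕-++ : ∀ l l′ → Σ⊕ (l ++ l′) ≡ Σ⊕ l ⊕ Σ⊕ l′
 Σ⊕-++ []      l′ = sym (⊕-identityˡ _)
 Σ⊕-++ (g ∷ l) l′ = trans (cong (g ⊕_) (Σ⊕-++ l l′)) (sym (⊕-assoc g (Σ⊕ l) (Σ⊕ l′)))

 complement : ∀ {S l} → S ⊆ l → ∃ λ C → C ⊆ l × (Σ⊕ S ⊕ Σ⊕ C ≡ Σ⊕ l) × (length S ℕ.+ length C ≡ length l)
 complement [] = [] , [] , refl , refl
 complement {S} (g ∷ʳ s) with complement s
 ... | C , c , e , n = g ∷ C , refl ∷ c , trans (trans (sym (⊕-assoc (Σ⊕ S) g (Σ⊕ C))) (trans (cong (_⊕ Σ⊕ C) (⊕-comm (Σ⊕ S) g)) (⊕-assoc g (Σ⊕ S) (Σ⊕ C)))) (cong (g ⊕_) e)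
       , trans (ℕₚ.+-suc (length S) (length C)) (cong suc n)
 complement {g ∷ S} (refl ∷ s) with complement s
 ... | C , c , e , n = C , g ∷ʳ c , trans (⊕-assoc g (Σ⊕ S) (Σ⊕ C)) (cong (g ⊕_) e) , cong suc n

 ZeroFree : ℕ → List G → Set
 ZeroFree m l = ∀ {S} → S ⊆ l → Vanishes m (Σ⊕ S) → S ≡ []

 length-zero : ∀ {A : Set} {l : List A} → length l ≡ 0 → l ≡ []
 length-zero {l = []} _ = refl

 minimal-↭ : ∀ {m l l′} → l ↭ l′ → MinimalZeroSum m l → MinimalZeroSum m l′
 minimal-↭ {m} {l} {l′} π min = record
  { zero-sum = subst (Vanishes m) (Σ⊕-↭ π) zero-sum
  ; minimal = λ {S} s z → transport s z (⊆-through-↭ π s)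
  }
  where
  open MinimalZeroSum min
  transport : ∀ {S} → S ⊆ l′ → Vanishes m (Σ⊕ S) → (∃ λ S′ → S′ ⊆ l × S′ ↭ S) → S ≡ [] ⊎ length S ≡ length l′
  transport {S} s z (S′ , s′ , σ) with minimal s′ (subst (Vanishes m) (sym (Σ⊕-↭ σ)) z)
  ... | inj₁ refl = inj₁ (length-zero (sym (↭-length σ)))
  ... | inj₂ e = inj₂ (trans (sym (↭-length σ)) (trans e (↭-length π)))

 vanishes-⊕ : ∀ {m g h} → Vanishes m g → Vanishes m h → Vanishes m (g ⊕ h)
 vanishes-⊕ (a , b) (c , d) = +-cong-≈ a c , +-cong-≈ b d

 vanishes-cancelˡ : ∀ {m} g h → Vanishes m g → Vanishes m (g ⊕ h) → Vanishes m h
 vanishes-cancelˡ (a , b) (c , d) (x , y) (x′ , y′) = cancel x x′ , cancel y y′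
  where
  cancel : ∀ {m a c} → a ≈[ m ] 0ℤ → a + c ≈[ m ] 0ℤ → c ≈[ m ] 0ℤ
  cancel {m} {a} {c} z z′ = ≈-trans (≈-sym (≈-trans (+-cong-≈ z (≈-refl {a = c})) (≈-reflexive (ℤₚ.+-identityˡ c)))) z′

 -- A zero-sum subsequence through `g` has its complement inside `l`; the complement is a zero-sum
 -- too, hence empty.
 completed-minimal : ∀ {m g l} → ZeroFree m l → Vanishes m (g ⊕ Σ⊕ l) → MinimalZeroSum m (g ∷ l)
 completed-minimal {m} {g} {l} free z = record { zero-sum = z ; minimal = cases }
  where
  cases : ∀ {S} → S ⊆ g ∷ l → Vanishes m (Σ⊕ S) → S ≡ [] ⊎ length S ≡ suc (length l)
  cases (_ ∷ʳ s) zS = inj₁ (free s zS)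
  cases {_ ∷ S} (refl ∷ s) zS with complement s
  ... | C , c , e , n = inj₂ (cong suc (trans (sym (ℕₚ.+-identityʳ _)) (trans (cong (length S ℕ.+_) (sym (cong length C≡[]))) n)))
   where
   C≡[] : C ≡ []
   C≡[] = free c (vanishes-cancelˡ (g ⊕ Σ⊕ S) (Σ⊕ C) zS (subst (Vanishes m) (trans (cong (g ⊕_) (sym e)) (sym (⊕-assoc g (Σ⊕ S) (Σ⊕ C)))) z))

 -- Elements of (ℤ/n)² as vectors of ℤ²

 residue : ∀ n .{{_ : NonZero n}} (a : ℕ) → ∃ λ (r : Fin n) → + toℕ r + + a ≈[ n ] 0ℤ
 residue n a = fromℕ< (m%n<n b n) , ∣⇒≈0 (subst (n ℕ∣.∣_) (cong (ℕ._+ a) (sym (toℕ-fromℕ< (m%n<n b n)))) d)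
  where
  b = n ∸ a % n
  d : n ℕ∣.∣ b % n ℕ.+ a
  d = ℕ∣.∣m+n∣m⇒∣n {m = b / n ℕ.* n} (subst (n ℕ∣.∣_) eq (ℕ∣.∣m∣n⇒∣m+n (ℕ∣.∣-refl {n}) (ℕ∣.n∣m*n (a / n)))) (ℕ∣.n∣m*n (b / n))
   where
   eq : n ℕ.+ a / n ℕ.* n ≡ b / n ℕ.* n ℕ.+ (b % n ℕ.+ a)
   eq = trans (cong (ℕ._+ a / n ℕ.* n) (sym (ℕₚ.m∸n+n≡m (ℕₚ.<⇒≤ (m%n<n a n)))))
    (trans (ℕₚ.+-assoc b (a % n) (a / n ℕ.* n)) (trans (cong (b ℕ.+_) (sym (m≡m%n+[m/n]*n a n)))
     (trans (cong (ℕ._+ a) (trans (m≡m%n+[m/n]*n b n) (ℕₚ.+-comm (b % n) (b / n ℕ.* n)))) (ℕₚ.+-assoc (b / n ℕ.* n) (b % n) a))))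

 residue-vector : ∀ n .{{_ : NonZero n}} (g : ℕ × ℕ) → ∃ λ (x : Zn² n) → Vanishes n (⟪ x ⟫ ⊕ (+ proj₁ g , + proj₂ g))
 residue-vector n (a , b) with residue n a | residue n b
 ... | r , z | s , z′ = (r , s) , z , z′

 residue-≤ : ∀ {n a b} → a ℕ.≤ b → b ℕ.< n → + b ≈[ n ] + a → b ≡ a
 residue-≤ {n} {a} {b} a≤b b<n e with b ∸ a in eq
 ... | zero = ℕₚ.≤-antisym (ℕₚ.m∸n≡0⇒m≤n eq) a≤b
 ... | suc k = ⊥-elim (ℕₚ.<⇒≱ (ℕₚ.≤-<-trans (ℕₚ.m∸n≤m b a) b<n) (subst (n ℕ.≤_) (sym eq) (ℕ∣.∣⇒≤ (≈0⇒∣ z))))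
  where
  z : + suc k ≈[ n ] 0ℤ
  z = ≈-trans (≈-reflexive (trans (cong +_ (sym eq)) (trans (sym (ℤₚ.⊖-≥ a≤b)) (sym (ℤₚ.m-n≡m⊖n b a)))))
   (≈-trans (+-cong-≈ e (≈-refl {a = - (+ a)})) (≈-reflexive (ℤₚ.+-inverseʳ (+ a))))

 residue-unique : ∀ {n a b} → a ℕ.< n → b ℕ.< n → + a ≈[ n ] + b → a ≡ b
 residue-unique {n} {a} {b} a<n b<n e with ℕₚ.≤-total a b
 ... | inj₁ a≤b = sym (residue-≤ a≤b b<n (≈-sym e))
 ... | inj₂ b≤a = residue-≤ b≤a a<n e

 ⟪⟫-injective : ∀ {n} {x y : Zn² n} → ⟪ x ⟫ ≈²[ n ] ⟪ y ⟫ → x ≡ y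
 ⟪⟫-injective {x = a , b} {c , d} (e , e′) = cong₂ _,_
  (toℕ-injective (residue-unique (toℕ<n a) (toℕ<n c) e)) (toℕ-injective (residue-unique (toℕ<n b) (toℕ<n d) e′))

 -- Multiplicities

 increment : ∀ {A : Set} → Dec A → ℕ → ℕ
 increment (yes _) n = suc n
 increment (no _)  n = n

 count : ∀ {n} → Zn² n → List (Zn² n) → ℕ
 count x []      = 0
 count x (y ∷ l) = increment (y ≟² x) (count x l)

 mult≡count : ∀ {n k} (A : Multiset n k) x → mult A x ≡ count x (tabulate A)
 mult≡count {k = zero}  A x = refl
 mult≡count {k = suc k} A x with ≡-dec _≟ᶠ_ _≟ᶠ_ (A Fin.zero) x
 ... | yes _ = cong suc (mult≡count (λ i → A (Fin.suc i)) x)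
 ... | no  _ = mult≡count (λ i → A (Fin.suc i)) x

 gather : ∀ {n} (x : Zn² n) l → ∃ λ r → l ↭ replicate (count x l) x ++ r × All (_≢ x) r
 gather x [] = [] , ↭-refl , []
 gather x (y ∷ l) with y ≟² x | gather x l
 ... | yes refl | r , π , ne = r , prep x π , ne
 ... | no y≢x | r , π , ne = y ∷ r , ↭-trans (prep y π) (↭-sym (shift y (replicate (count x l) x) r)) , y≢x ∷ ne

 to-front : ∀ {A : Set} {x : A} {l} → x ∈ l → ∃ λ r → l ↭ x ∷ r
 to-front {x = x} x∈l with ∈-∃++ x∈l
 ... | ys , zs , refl = ys ++ zs , shift x ys zs

 -- The translation between the indexed families of the statement and lists

 extend : ∀ {k} → Bool → Selection k → Selection (suc k)
 extend b s Fin.zero    = b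
 extend b s (Fin.suc i) = s i

 selected : ∀ {n k} (A : Multiset n k) {S} → S ⊆ map ⟪_⟫ (tabulate A) →
      ∃ λ s → (Σ⊕ S ≡ (+ sumSel (λ i → toℕ (proj₁ (A i))) s , + sumSel (λ i → toℕ (proj₂ (A i))) s)) × (S ≡ [] ⊎ NonEmpty s)
 selected {k = zero}  A [] = (λ ()) , refl , inj₁ refl
 selected {k = suc k} A (_ ∷ʳ t) with selected (λ i → A (Fin.suc i)) t
 ... | s , e , d = extend false s , e , nonempty d
  where
  nonempty : ∀ {S} → S ≡ [] ⊎ NonEmpty s → S ≡ [] ⊎ NonEmpty (extend false s)
  nonempty (inj₁ z) = inj₁ z
  nonempty (inj₂ (i , z)) = inj₂ (Fin.suc i , z)
 selected {k = suc k} A (refl ∷ t) with selected (λ i → A (Fin.suc i)) t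
 ... | s , e , d = extend true s , cong (⟪ A Fin.zero ⟫ ⊕_) e , inj₂ (Fin.zero , refl)

 zeroFree : ∀ {n k} (A : Multiset n k) → ZeroSumFree A → ZeroFree n (map ⟪_⟫ (tabulate A))
 zeroFree A free s z with selected A s
 ... | t , e , inj₁ empty = empty
 ... | t , e , inj₂ ne = ⊥-elim (free (t , ne , ≈0⇒∣ (proj₁ z′) , ≈0⇒∣ (proj₂ z′)))
  where z′ = subst (Vanishes _) e z

 record Completion (n k : ℕ) (A : Multiset n k) : Set where
  field
   extra : Zn² n
   minimal : MinimalZeroSum n (map ⟪_⟫ (extra ∷ tabulate A))

 completion : ∀ {n k} .{{_ : NonZero n}} (A : Multiset n k) → ZeroSumFree A → Completion n k A
 completion {n} A free with selected A ⊆-refl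
 ... | t , e , _ with residue-vector n (sumSel (λ i → toℕ (proj₁ (A i))) t , sumSel (λ i → toℕ (proj₂ (A i))) t)
 ...   | x , z = record { extra = x ; minimal = completed-minimal (zeroFree A free) (subst (λ g → Vanishes n (⟪ x ⟫ ⊕ g)) (sym e) z) }

 sumSel-cong : ∀ {k} (f : Fin k → ℕ) {s s′ : Selection k} → (∀ i → s i ≡ s′ i) → sumSel f s ≡ sumSel f s′
 sumSel-cong {zero}  f e = refl
 sumSel-cong {suc k} f {s} {s′} e with s Fin.zero | s′ Fin.zero | e Fin.zero
 ... | true  | .true  | refl = cong (f Fin.zero ℕ.+_) (sumSel-cong (λ i → f (Fin.suc i)) (λ i → e (Fin.suc i)))
 ... | false | .false | refl = sumSel-cong (λ i → f (Fin.suc i)) (λ i → e (Fin.suc i))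

 -- The argument refutes zero-sum freeness; since selections are finitely many Boolean vectors, an
 -- actual zero-sum can be extracted.
 hasZeroSum? : ∀ {n k} (A : Multiset n k) → Dec (HasZeroSum A)
 hasZeroSum? {n} {k} A = Dec.map′ to from (anySubset? test)
  where
  f g : Fin k → ℕ
  f i = toℕ (proj₁ (A i))
  g i = toℕ (proj₂ (A i))
  Good : Selection k → Set
  Good s = NonEmpty s × (n ℕ∣.∣ sumSel f s) × (n ℕ∣.∣ sumSel g s)
  test : ∀ v → Dec (Good (Vec.lookup v))
  test v = any? (λ i → Vec.lookup v i ≟ᵇ true) ×-dec (n ℕ∣.∣? sumSel f (Vec.lookup v)) ×-dec (n ℕ∣.∣? sumSel g (Vec.lookup v))
  to : ∃ (λ v → Good (Vec.lookup v)) → HasZeroSum A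
  to (v , good) = Vec.lookup v , good
  from : HasZeroSum A → ∃ (λ v → Good (Vec.lookup v))
  from (s , (i , e) , d , d′) = Vec.tabulate s , (i , trans (same i) e) ,
   subst (n ℕ∣.∣_) (sumSel-cong f (λ i → sym (same i))) d , subst (n ℕ∣.∣_) (sumSel-cong g (λ i → sym (same i))) d′
   where
   same : ∀ i → Vec.lookup (Vec.tabulate s) i ≡ s i
   same i = Vecₚ.lookup∘tabulate s i

-- Linear algebra over ℤ/p, pigeonhole, and counting along a line

module PrimeFields where

 open TranslationRing
 open FrobeniusMap
 open GroupAlgebras
 open MultilinearForms
 open QuarticForm
 open QuarticClassification
 open QuarticToStandard
 open ZeroSumSequences
 open ResidueVectors
 open import Data.Nat as ℕ using (ℕ; zero; suc; _∸_; s≤s; z≤n; NonZero)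
 import Data.Nat.GCD as GCD
 open import Data.Nat.Coprimality using (Coprime; coprime-Bézout)
 open import Data.Nat.Primality using (Prime; prime⇒nonTrivial; prime⇒irreducible)
 open import Data.Integer using (ℤ; +_; -[1+_]; _+_; _*_; -_; _-_; 0ℤ; 1ℤ; ∣_∣)
 open import Data.Fin as Fin using (Fin; toℕ)
 open import Data.Fin.Properties using (pigeonhole)
 open import Data.List using (List; []; _∷_; _++_; map; length; lookup)
 open import Data.List.Relation.Unary.All as All using ([]; _∷_)
 open import Data.List.Relation.Unary.Any as Any using (here; there)
 open import Data.List.Relation.Binary.Sublist.Propositional using ([]; _∷_)
 open import Data.List.Relation.Binary.Permutation.Propositional using (_↭_; prep; swap; ↭-trans; ↭-refl)
 import Data.List.Relation.Binary.Permutation.Propositional as Perm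
 open import Data.List.Relation.Binary.Permutation.Propositional.Properties using (∈-resp-↭)
 import Relation.Nullary.Decidable as Dec

 reduce : ∀ n .{{_ : NonZero n}} a → ∃ λ (r : Fin n) → + toℕ r ≈[ n ] a
 -- `residue` returns the class of the negative; applied to m(n - 1), which is congruent to -m, it
 -- returns the class of m.
 reduce n (+ m) with residue n (m ℕ.* (n ∸ 1))
 ... | r , z = r , ≈-trans (≈-reflexive (lem (+ toℕ r) (+ (m ℕ.* (n ∸ 1))))) (≈-trans (+-cong-≈ z (≈-refl {a = - (+ (m ℕ.* (n ∸ 1)))}))
   (mod-by (- (+ m)) (trans (cong (λ z → 0ℤ + - z) (trans (ℤₚ.pos-* m (n ∸ 1)) (cong (λ z → + m * z) (pred n (ℕₚ.n≢0⇒n>0 (ℕ.≢-nonZero⁻¹ n)))))) (lem′ (+ m) (+ n)))))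
  where
  pred : ∀ m → 0 ℕ.< m → + (m ∸ 1) ≡ + m - 1ℤ
  pred (suc m) _ = refl
  lem : ∀ r b → r ≡ r + b + - b
  lem = solve-∀
  lem′ : ∀ m n → 0ℤ + - (m * (n + - 1ℤ)) ≡ m + - m * n
  lem′ = solve-∀
 reduce n -[1+ m ] with residue n (suc m)
 ... | r , z = r , ≈-trans (≈-reflexive (lem (+ toℕ r) (+ suc m))) (≈-trans (+-cong-≈ z (≈-refl {a = - (+ suc m)})) (≈-reflexive (ℤₚ.+-identityˡ _)))
  where
  lem : ∀ r b → r ≡ r + b + - b
  lem = solve-∀

 ≈? : ∀ {m} a b → Dec (a ≈[ m ] b)
 ≈? {m} a b = Dec.map′ (λ z → ≈-trans (≈-reflexive (lem a b)) (+-vanishes-≈ z))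
  (λ e → ≈-trans (+-cong-≈ e (≈-refl {a = - b})) (≈-reflexive (ℤₚ.+-inverseʳ b))) (≈0? m (a + - b))
  where
  lem : ∀ a b → a ≡ b + (a + - b)
  lem = solve-∀

 det : G → G → ℤ
 det (a , b) (c , d) = a * d - b * c

 -- Coordinates with respect to vectors u, v with invertible determinant, by Cramer's rule
 module Coordinates {m : ℕ} {u v : G} (i : ℤ) (di : det u v * i ≈[ m ] 1ℤ) where

  α β : G → ℤ
  α g = det g v * i
  β g = det u g * i

  α-additive : Additive m α
  α-additive (a , b) (c , d) = ≈-reflexive (lem a b c d (proj₁ v) (proj₂ v) i)
   where
   lem : ∀ a b c d x y i → ((a + c) * y + - ((b + d) * x)) * i ≡ (a * y + - (b * x)) * i + (c * y + - (d * x)) * i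
   lem = solve-∀

  β-additive : Additive m β
  β-additive (a , b) (c , d) = ≈-reflexive (lem a b c d (proj₁ u) (proj₂ u) i)
   where
   lem : ∀ a b c d x y i → (x * (b + d) + - (y * (a + c))) * i ≡ (x * b + - (y * a)) * i + (x * d + - (y * c)) * i
   lem = solve-∀

  α-cong : ∀ {g h} → g ≈²[ m ] h → α g ≈[ m ] α h
  α-cong (e , e′) = *-cong-≈ (+-cong-≈ (*-cong-≈ e ≈-refl) (neg-cong-≈ (*-cong-≈ e′ ≈-refl))) (≈-refl {a = i})

  β-cong : ∀ {g h} → g ≈²[ m ] h → β g ≈[ m ] β h
  β-cong (e , e′) = *-cong-≈ (+-cong-≈ (*-congˡ-≈ (proj₁ u) e′) (neg-cong-≈ (*-congˡ-≈ (proj₂ u) e))) (≈-refl {a = i})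

  unit : ∀ a → det u v * i * a ≈[ m ] a
  unit a = ≈-trans (*-cong-≈ (di) (≈-refl {a = a})) (≈-reflexive (ℤₚ.*-identityˡ a))

  cramer : ∀ g → g ≈²[ m ] α g · u ⊕ β g · v
  cramer (a , b) = ≈-trans (≈-sym (unit a)) (≈-reflexive (lem₁ a b (proj₁ u) (proj₂ u) (proj₁ v) (proj₂ v) i))
        , ≈-trans (≈-sym (unit b)) (≈-reflexive (lem₂ a b (proj₁ u) (proj₂ u) (proj₁ v) (proj₂ v) i))
   where
   lem₁ : ∀ a b s t x y i → (s * y + - (t * x)) * i * a ≡ (a * y + - (b * x)) * i * s + (s * b + - (t * a)) * i * x
   lem₁ = solve-∀
   lem₂ : ∀ a b s t x y i → (s * y + - (t * x)) * i * b ≡ (a * y + - (b * x)) * i * t + (s * b + - (t * a)) * i * y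
   lem₂ = solve-∀

  αu : α u ≈[ m ] 1ℤ
  αu = di

  βv : β v ≈[ m ] 1ℤ
  βv = di

  det-self : ∀ g → det g g * i ≈[ m ] 0ℤ
  det-self (a , b) = ≈-reflexive (lem a b i)
   where
   lem : ∀ a b i → (a * b + - (b * a)) * i ≡ 0ℤ
   lem = solve-∀

  αv : α v ≈[ m ] 0ℤ
  αv = det-self v

  βu : β u ≈[ m ] 0ℤ
  βu = det-self u

  vanishing : ∀ g → α g ≈[ m ] 0ℤ → β g ≈[ m ] 0ℤ → Vanishes m g
  vanishing g a b = ≈-trans (proj₁ (cramer g)) (null (proj₁ u) (proj₁ v)) , ≈-trans (proj₂ (cramer g)) (null (proj₂ u) (proj₂ v))
   where
   null : ∀ x y → α g * x + β g * y ≈[ m ] 0ℤ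
   null x y = +-cong-≈ (*-cong-≈ a (≈-refl {a = x})) (*-cong-≈ b (≈-refl {a = y}))

 -- The field ℤ/p

 module PrimeField {p : ℕ} (pp : Prime p) where

  1≉0 : ¬ (1ℤ ≈[ p ] 0ℤ)
  1≉0 z = ℕ.nonTrivial⇒≢1 {{prime⇒nonTrivial pp}} (ℕ∣.∣1⇒≡1 (≈0⇒∣ z))

  private
   coprime : ∀ n → ¬ (p ℕ∣.∣ n) → Coprime n p
   coprime n p∤n (d∣n , d∣p) with prime⇒irreducible pp d∣p
   ... | inj₁ d≡1 = d≡1
   ... | inj₂ refl = ⊥-elim (p∤n d∣n)

   inverse⁺ : ∀ n → ¬ (p ℕ∣.∣ n) → ∃ λ b → + n * b ≈[ p ] 1ℤ
   inverse⁺ n p∤n with coprime-Bézout (coprime n p∤n)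
   ... | GCD.Bézout.Identity.+- x y eq = + x , mod-by (+ y) (trans (sym (ℤₚ.pos-* n x))
    (trans (cong +_ (trans (ℕₚ.*-comm n x) (sym eq))) (trans (ℤₚ.pos-+ 1 (y ℕ.* p)) (cong (λ z → 1ℤ + z) (ℤₚ.pos-* y p)))))
   ... | GCD.Bézout.Identity.-+ x y eq = - (+ x) , mod-by (- (+ y)) (trans (lem (+ n) (+ x))
    (trans (cong (λ z → 1ℤ + - z) (trans (cong (λ z → 1ℤ + z) (sym (ℤₚ.pos-* x n))) (trans (sym (ℤₚ.pos-+ 1 (x ℕ.* n))) (trans (cong +_ eq) (ℤₚ.pos-* y p)))))
     (lem′ (+ y) (+ p))))
    where
    lem : ∀ n x → n * - x ≡ 1ℤ + - (1ℤ + x * n)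
    lem = solve-∀
    lem′ : ∀ y p → 1ℤ + - (y * p) ≡ 1ℤ + - y * p
    lem′ = solve-∀

  inverse : ∀ a → ¬ (a ≈[ p ] 0ℤ) → ∃ λ b → a * b ≈[ p ] 1ℤ
  inverse (+ n) a≉0 = inverse⁺ n (λ d → a≉0 (∣⇒≈0 d))
  inverse (-[1+ n ]) a≉0 with inverse⁺ (suc n) (λ d → a≉0 (∣⇒≈0 d))
  ... | b , e = - b , ≈-trans (≈-reflexive (lem (+ suc n) b)) e
   where
   lem : ∀ n b → - n * - b ≡ n * b
   lem = solve-∀

  cancel-≈ : ∀ a {b c} → ¬ (a ≈[ p ] 0ℤ) → a * b ≈[ p ] a * c → b ≈[ p ] c
  cancel-≈ a {b} {c} a≉0 e with inverse a a≉0
  ... | i , ai = ≈-trans (≈-sym (recover b)) (≈-trans (*-congˡ-≈ i e) (recover c))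
   where
   lem : ∀ i a b → i * (a * b) ≡ a * i * b
   lem = solve-∀
   recover : ∀ b → i * (a * b) ≈[ p ] b
   recover b = ≈-trans (≈-reflexive (lem i a b)) (≈-trans (*-cong-≈ ai (≈-refl {a = b})) (≈-reflexive (ℤₚ.*-identityˡ b)))

  dependent : ∀ x y → ¬ Vanishes p x → det x y ≈[ p ] 0ℤ → ∃ λ β → y ≈²[ p ] β · x
  dependent (a , b) (c , d) x≉0 z with ≈0? p a
  ... | no a≉0 with inverse a a≉0
  ...   | i , ai = i * c , ≈-sym (≈-trans (≈-reflexive (lem i c a)) (unit c))
        , ≈-trans (≈-sym (unit d)) (≈-trans (≈-reflexive (lem₂ a i d b c)) (+-vanishes-≈ (≈-trans (*-congˡ-≈ i z) (≈-reflexive (ℤₚ.*-zeroʳ i)))))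
   where
   unit : ∀ x → a * i * x ≈[ p ] x
   unit x = ≈-trans (*-cong-≈ ai (≈-refl {a = x})) (≈-reflexive (ℤₚ.*-identityˡ x))
   lem : ∀ i c a → i * c * a ≡ a * i * c
   lem = solve-∀
   lem₂ : ∀ a i d b c → a * i * d ≡ i * c * b + i * (a * d + - (b * c))
   lem₂ = solve-∀
  dependent (a , b) (c , d) x≉0 z | yes a≈0 with inverse b (λ b≈0 → x≉0 (a≈0 , b≈0))
  ...   | i , bi = i * d , ≈-trans (≈-sym (unit c)) (≈-trans (≈-reflexive (lem₂ a i d b c)) (+-vanishes-≈ (≈-trans (*-congˡ-≈ (- i) z) (≈-reflexive (ℤₚ.*-zeroʳ (- i))))))
        , ≈-sym (≈-trans (≈-reflexive (lem i d b)) (unit d))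
   where
   unit : ∀ x → b * i * x ≈[ p ] x
   unit x = ≈-trans (*-cong-≈ bi (≈-refl {a = x})) (≈-reflexive (ℤₚ.*-identityˡ x))
   lem : ∀ i d b → i * d * b ≡ b * i * d
   lem = solve-∀
   lem₂ : ∀ a i d b c → b * i * c ≡ i * d * a + - i * (a * d + - (b * c))
   lem₂ = solve-∀

 -- Counting in lists

 count-++ : ∀ {n} (x : Zn² n) l l′ → count x (l ++ l′) ≡ count x l ℕ.+ count x l′
 count-++ x []      l′ = refl
 count-++ x (y ∷ l) l′ = trans (cong (increment (y ≟² x)) (count-++ x l l′)) (distribute (y ≟² x))
  where
  distribute : ∀ {A : Set} (d : Dec A) {m n} → increment d (m ℕ.+ n) ≡ increment d m ℕ.+ n
  distribute (yes _) = refl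
  distribute (no _)  = refl

 count-↭ : ∀ {n} (x : Zn² n) {l l′} → l ↭ l′ → count x l ≡ count x l′
 count-↭ x Perm.refl = refl
 count-↭ x (prep y π) = cong (increment (y ≟² x)) (count-↭ x π)
 count-↭ x (swap y z π) = trans (exchange (y ≟² x) (z ≟² x)) (cong (λ n → increment (z ≟² x) (increment (y ≟² x) n)) (count-↭ x π))
  where
  exchange : ∀ {A B : Set} (d : Dec A) (d′ : Dec B) {n} → increment d (increment d′ n) ≡ increment d′ (increment d n)
  exchange (yes _) (yes _) = refl
  exchange (yes _) (no _)  = refl
  exchange (no _)  (yes _) = refl
  exchange (no _)  (no _)  = refl
 count-↭ x (Perm.trans π π′) = trans (count-↭ x π) (count-↭ x π′)

 count-self : ∀ {n} (x : Zn² n) l → count x (x ∷ l) ≡ suc (count x l)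
 count-self x l with x ≟² x
 ... | yes _ = refl
 ... | no ne = ⊥-elim (ne refl)

 two-positions : ∀ {A : Set} (l : List A) (i j : Fin (length l)) → i Fin.< j → ∃ λ r → l ↭ lookup l i ∷ lookup l j ∷ r
 two-positions (x ∷ l) Fin.zero (Fin.suc j) _ = _ , prep x (proj₂ (to-front (lookup-∈ l j)))
  where
  lookup-∈ : ∀ {A : Set} (l : List A) i → lookup l i ∈ l
  lookup-∈ (x ∷ l) Fin.zero = here refl
  lookup-∈ (x ∷ l) (Fin.suc i) = there (lookup-∈ l i)
 two-positions (x ∷ l) (Fin.suc i) (Fin.suc j) (s≤s i<j) with two-positions l i j i<j
 ... | r , π = x ∷ r , ↭-trans (prep x π) (↭-trans (swap x _ ↭-refl) (prep _ (swap x _ ↭-refl)))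

 repeated-value : ∀ {A : Set} {n} (f : A → Fin n) l → n ℕ.< length l → ∃₂ λ x y → ∃ λ r → (l ↭ x ∷ y ∷ r) × f x ≡ f y
 repeated-value f l n<l with pigeonhole n<l (λ i → f (lookup l i))
 ... | i , j , i<j , e with two-positions l i j i<j
 ...   | r , π = lookup l i , lookup l j , r , π , e

 front-pair : ∀ {A : Set} {x y : A} {l} → x ∈ l → y ∈ l → x ≢ y → ∃ λ r → l ↭ x ∷ y ∷ r
 front-pair x∈l y∈l x≢y with to-front x∈l
 ... | r , π with ∈-resp-↭ π y∈l
 ...   | here y≡x = ⊥-elim (x≢y (sym y≡x))
 ...   | there y∈r with to-front y∈r
 ...     | r′ , π′ = r′ , ↭-trans π (prep _ π′)

 -- If all elements of the sequence outside a single value lie on the line λ = 1, and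
 -- λ = 0 at that value, then its multiplicity is congruent to −1.

 module LineCount {p : ℕ} (5≤p : 5 ℕ.≤ p) (U : List (Zn² p)) (size : length U ≡ p ℕ.+ p ∸ 1)
   (total : Vanishes p (Σ⊕ (map ⟪_⟫ U))) (few : ∀ x → count x U ℕ.+ 2 ℕ.≤ p)
   {λ′ : G → ℤ} (additive : Additive p λ′) (respects : ∀ {g h} → g ≈²[ p ] h → λ′ g ≈[ p ] λ′ h) where

  abstract
   good? : ∀ (y : Zn² p) → Dec (λ′ ⟪ y ⟫ ≈[ p ] 1ℤ)
   good? y = ≈? (λ′ ⟪ y ⟫) 1ℤ

  module _ (on-or-zero : ∀ {y} → y ∈ U → ¬ (λ′ ⟪ y ⟫ ≈[ p ] 1ℤ) → λ′ ⟪ y ⟫ ≈[ p ] 0ℤ)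
      (unique : ∀ {y z} → y ∈ U → z ∈ U → ¬ (λ′ ⟪ y ⟫ ≈[ p ] 1ℤ) → ¬ (λ′ ⟪ z ⟫ ≈[ p ] 1ℤ) → y ≡ z) where

   private
    increment′ : ∀ {A : Set} → Dec A → ℕ → ℕ
    increment′ (yes _) n = n
    increment′ (no _)  n = suc n

    goods bads : List (Zn² p) → ℕ
    goods [] = 0
    goods (y ∷ l) = increment (good? y) (goods l)
    bads [] = 0
    bads (y ∷ l) = increment′ (good? y) (bads l)

    partition : ∀ l → goods l ℕ.+ bads l ≡ length l
    partition [] = refl
    partition (y ∷ l) = trans (step (good? y)) (cong suc (partition l))
     where
     step : ∀ {A : Set} (d : Dec A) {m n} → increment d m ℕ.+ increment′ d n ≡ suc (m ℕ.+ n)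
     step (yes _) = refl
     step (no _) {m} {n} = ℕₚ.+-suc m n

    λ-sum : ∀ l → (∀ {y} → y ∈ l → y ∈ U) → λ′ (Σ⊕ (map ⟪_⟫ l)) ≈[ p ] + goods l
    λ-sum [] _ = additive-𝟎 {f = λ′} additive
    λ-sum (y ∷ l) sub = ≈-trans (additive ⟪ y ⟫ (Σ⊕ (map ⟪_⟫ l))) (step (good? y))
     where
     rest = λ-sum l (λ z → sub (there z))
     step : (d : Dec (λ′ ⟪ y ⟫ ≈[ p ] 1ℤ)) → λ′ ⟪ y ⟫ + λ′ (Σ⊕ (map ⟪_⟫ l)) ≈[ p ] + increment d (goods l)
     step (yes e) = +-cong-≈ e rest
     step (no ne) = ≈-trans (+-cong-≈ (on-or-zero (sub (here refl)) ne) rest) (≈-reflexive (ℤₚ.+-identityˡ (+ goods l)))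

    bads-equal : ∀ e l → (∀ {y} → y ∈ l → y ∈ U) → e ∈ U → ¬ (λ′ ⟪ e ⟫ ≈[ p ] 1ℤ) → bads l ℕ.≤ count e l
    bads-equal e [] sub e∈U ne = z≤n
    bads-equal e (y ∷ l) sub e∈U ne = step (good? y) (y ≟² e)
     where
     rest = bads-equal e l (λ z → sub (there z)) e∈U ne
     step : (d : Dec (λ′ ⟪ y ⟫ ≈[ p ] 1ℤ)) (d′ : Dec (y ≡ e)) → increment′ d (bads l) ℕ.≤ increment d′ (count e l)
     step (yes _)  (yes _) = ℕₚ.m≤n⇒m≤1+n rest
     step (yes _)  (no _)  = rest
     step (no _)   (yes _) = s≤s rest
     step (no ny)  (no y≢e) = ⊥-elim (y≢e (unique (sub (here refl)) e∈U ny ne))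

    bads-few : ∀ l → (∀ {y} → y ∈ l → y ∈ U) → bads l ≡ 0 ⊎ (∃ λ e → e ∈ U × ¬ (λ′ ⟪ e ⟫ ≈[ p ] 1ℤ))
    bads-few [] sub = inj₁ refl
    bads-few (y ∷ l) sub = step (good? y) (bads-few l (λ z → sub (there z)))
     where
     step : (d : Dec (λ′ ⟪ y ⟫ ≈[ p ] 1ℤ)) → bads l ≡ 0 ⊎ (∃ λ e → e ∈ U × ¬ (λ′ ⟪ e ⟫ ≈[ p ] 1ℤ)) →
       increment′ d (bads l) ≡ 0 ⊎ (∃ λ e → e ∈ U × ¬ (λ′ ⟪ e ⟫ ≈[ p ] 1ℤ))
     step (yes _) rest = rest
     step (no ny) _ = inj₂ (y , sub (here refl) , ny)

    few-bads : bads U ℕ.+ 2 ℕ.≤ p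
    few-bads = [ (λ e → subst (λ n → n ℕ.+ 2 ℕ.≤ p) (sym e) (ℕₚ.≤-trans (s≤s (s≤s z≤n)) 5≤p))
     , (λ { (e , e∈U , ne) → ℕₚ.≤-trans (ℕₚ.+-monoˡ-≤ 2 (bads-equal e U (λ z → z) e∈U ne)) (few e) }) ]′ (bads-few U (λ z → z))

    p∣goods : p ℕ∣.∣ goods U
    p∣goods = ≈0⇒∣ (≈-trans (≈-sym (λ-sum U (λ z → z))) (≈-trans (respects {h = 𝟎} total) (additive-𝟎 {f = λ′} additive)))

    too-many : p ℕ.< goods U
    too-many = ℕₚ.+-cancelʳ-≤ (bads U) (suc p) (goods U) (subst (suc p ℕ.+ bads U ℕ.≤_) (sym (trans (partition U) size))
     (ℕₚ.≤-trans (ℕₚ.≤-reflexive eq) (ℕₚ.∸-monoˡ-≤ 1 (ℕₚ.+-monoʳ-≤ p few-bads))))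
     where
     eq : suc p ℕ.+ bads U ≡ p ℕ.+ (bads U ℕ.+ 2) ∸ 1
     eq = cong (_∸ 1) (trans (cong suc (sym (ℕₚ.+-suc p (bads U)))) (trans (sym (ℕₚ.+-suc p (suc (bads U)))) (cong (p ℕ.+_) (ℕₚ.+-comm 2 (bads U)))))

    too-few : goods U ℕ.< p ℕ.+ p
    too-few = ℕₚ.≤-trans (s≤s (subst (goods U ℕ.≤_) (trans (partition U) size) (ℕₚ.m≤m+n (goods U) (bads U))))
     (ℕₚ.≤-reflexive (ℕₚ.m+[n∸m]≡n (ℕₚ.≤-trans (s≤s z≤n) (ℕₚ.≤-trans 5≤p (ℕₚ.m≤m+n p p)))))

   -- The number of terms on the line is a multiple of p, being the value of the form at the
   -- vanishing total. At most p - 2 of the 2p - 1 terms lie off the line, so this number is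
   -- strictly between p and 2p.
   line-contradiction : ⊥
   line-contradiction = impossible p∣goods
    where
    impossible : p ℕ∣.∣ goods U → ⊥
    impossible (ℕ∣.divides zero e) = ℕₚ.<⇒≱ too-many (subst (ℕ._≤ p) (sym e) z≤n)
    impossible (ℕ∣.divides (suc zero) e) = ℕₚ.<⇒≱ too-many (ℕₚ.≤-reflexive (trans e (ℕₚ.+-identityʳ p)))
    impossible (ℕ∣.divides (suc (suc k)) e) = ℕₚ.<⇒≱ too-few (subst (p ℕ.+ p ℕ.≤_) (sym e) (ℕₚ.+-monoʳ-≤ p (ℕₚ.m≤m+n p (k ℕ.* p))))

-- Sequences with three distinct values, by sums of squares

module ThreeDistinctValues where

 open TranslationRing
 open GroupAlgebras
 open MultilinearForms
 open QuarticClassification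
 open ZeroSumSequences
 open ResidueVectors
 open PrimeFields
 open import Data.Nat as ℕ using (ℕ; zero; suc; _∸_; s≤s; NonZero)
 open import Data.Nat.Primality using (Prime; prime⇒nonZero)
 open import Data.Integer using (ℤ; +_; _+_; _*_; -_; _-_; 0ℤ; 1ℤ)
 open import Data.Fin as Fin using (Fin; toℕ)
 open import Data.Fin.Properties using (toℕ<n)
 open import Data.List using (List; []; _∷_; _++_; map; length; applyUpTo)
 open import Data.List.Properties using (length-map; length-++; length-applyUpTo)
 open import Data.List.Relation.Unary.All as All using (All; []; _∷_)
 open import Data.List.Relation.Unary.AllPairs as AllPairs using (AllPairs; []; _∷_)
 open import Data.List.Relation.Unary.Any as Any using (here; there)
 open import Data.List.Membership.Propositional.Properties using (∈-++⁺ʳ; ∈-++⁺ˡ; ∈-map⁺; ∈-applyUpTo⁺)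
 open import Data.List.Relation.Binary.Permutation.Propositional using (_↭_; prep; ↭-sym; ↭-trans; ↭-refl)
 open import Data.List.Relation.Binary.Permutation.Propositional.Properties using (map⁺; ↭-length; ∈-resp-↭)

 distinct⇒↭ : ∀ {A : Set} (xs ys : List A) → AllPairs _≢_ xs → All (_∈ ys) xs → length xs ≡ length ys → xs ↭ ys
 distinct⇒↭ [] [] _ _ _ = ↭-refl
 distinct⇒↭ (x ∷ xs) ys (ne ∷ d) (x∈ys ∷ sub) len with to-front x∈ys
 ... | r , π = ↭-trans (prep x (distinct⇒↭ xs r d (remaining ne sub) (ℕₚ.suc-injective (trans len (↭-length π))))) (↭-sym π)
  where
  outside : ∀ {y} → x ≢ y → y ∈ x ∷ r → y ∈ r
  outside x≢y (here y≡x) = ⊥-elim (x≢y (sym y≡x))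
  outside x≢y (there y∈r) = y∈r
  remaining : ∀ {xs} → All (x ≢_) xs → All (_∈ ys) xs → All (_∈ r) xs
  remaining [] [] = []
  remaining (ne ∷ nes) (y∈ys ∷ sub) = outside ne (∈-resp-↭ π y∈ys) ∷ remaining nes sub

 small≉0 : ∀ {p} n → suc n ℕ.< p → ¬ (+ suc n ≈[ p ] 0ℤ)
 small≉0 n n<p z = ℕₚ.<⇒≱ n<p (ℕ∣.∣⇒≤ (≈0⇒∣ z))

 nonzero-* : ∀ {p} → Prime p → ∀ {a b} → ¬ (a ≈[ p ] 0ℤ) → ¬ (b ≈[ p ] 0ℤ) → ¬ (a * b ≈[ p ] 0ℤ)
 nonzero-* pp {a} {b} a≉0 b≉0 z = [ a≉0 , b≉0 ]′ (prime-product pp a b z)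

 +≈0⇒≈- : ∀ {m a b} → a + b ≈[ m ] 0ℤ → a ≈[ m ] - b
 +≈0⇒≈- {m} {a} {b} z = ≈-trans (≈-reflexive (lem a b)) (≈-trans (+-cong-≈ z (≈-refl {a = - b})) (≈-reflexive (ℤₚ.+-identityˡ (- b))))
  where
  lem : ∀ a b → a ≡ a + b + - b
  lem = solve-∀

 Σsquares : ℕ → ℤ
 Σsquares zero = 0ℤ
 Σsquares (suc n) = + suc n * + suc n + Σsquares n

 6Σsquares : ∀ n → + 6 * Σsquares n ≡ + n * (1ℤ + + n) * (1ℤ + + 2 * + n)
 6Σsquares zero = refl
 6Σsquares (suc n) = trans (lem₁ (+ n) (Σsquares n)) (trans (cong (λ z → + 6 * ((1ℤ + + n) * (1ℤ + + n)) + z) (6Σsquares n)) (lem₂ (+ n)))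
  where
  lem₁ : ∀ n s → + 6 * ((1ℤ + n) * (1ℤ + n) + s) ≡ + 6 * ((1ℤ + n) * (1ℤ + n)) + + 6 * s
  lem₁ = solve-∀
  lem₂ : ∀ n → + 6 * ((1ℤ + n) * (1ℤ + n)) + n * (1ℤ + n) * (1ℤ + + 2 * n) ≡ (1ℤ + n) * (1ℤ + (1ℤ + n)) * (1ℤ + + 2 * (1ℤ + n))
  lem₂ = solve-∀

 -- A minimal zero-sum sequence u^a v^b w^c of length 2p − 1 with w = α u + β v: minimality
 -- says that for 0 < k < c one of the residues kα, kβ lies in [1, p − a), [1, p − b)
 -- respectively. By counting, these residues exhaust both intervals, and comparing sums of
 -- squares shows that one of a, b, c is −1 modulo p.

 module ThreeValues {p : ℕ} (pp : Prime p) {α β : ℤ} {a b : ℕ} (A B : ℕ)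
   (a+A : a ℕ.+ suc A ≡ p) (b+B : b ℕ.+ suc B ≡ p) (A>0 : 0 ℕ.< A) (B>0 : 0 ℕ.< B) (c<p : suc (suc (A ℕ.+ B)) ℕ.< p)
   (total₁ : + a + + suc (A ℕ.+ B) * α ≈[ p ] 0ℤ) (total₂ : + b + + suc (A ℕ.+ B) * β ≈[ p ] 0ℤ)
   (minimal : ∀ i j k → i ℕ.≤ a → j ℕ.≤ b → k ℕ.≤ suc (A ℕ.+ B) →
         + i + + k * α ≈[ p ] 0ℤ → + j + + k * β ≈[ p ] 0ℤ → k ≡ 0 ⊎ k ≡ suc (A ℕ.+ B)) where

  open PrimeField pp

  private
   c = suc (A ℕ.+ B)

   instance
    p≢0 : NonZero p
    p≢0 = prime⇒nonZero pp

   full : ∀ {a A α} → a ℕ.+ suc A ≡ p → + a + + c * α ≈[ p ] 0ℤ → + c * α ≈[ p ] + suc A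
   full {a} {A} {α} eq z = ≈-trans (≈-reflexive (lem (+ a) (+ c * α) (+ suc A)))
    (≈-trans (+-cong-≈ (+-cong-≈ z (neg-cong-≈ (≈-trans (≈-reflexive (trans (sym (ℤₚ.pos-+ a (suc A))) (cong +_ eq))) (m≈0 p)))) (≈-refl {a = + suc A}))
     (≈-reflexive (ℤₚ.+-identityˡ (+ suc A))))
    where
    lem : ∀ a x y → x ≡ a + x + - (a + y) + y
    lem = solve-∀

   cα≈ : + c * α ≈[ p ] + suc A
   cα≈ = full {α = α} a+A total₁
   cβ≈ : + c * β ≈[ p ] + suc B
   cβ≈ = full {α = β} b+B total₂

   A<p : suc A ℕ.< p
   A<p = ℕₚ.≤-<-trans (s≤s (ℕₚ.≤-trans (ℕₚ.m≤m+n A B) (ℕₚ.n≤1+n _))) c<p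
   B<p : suc B ℕ.< p
   B<p = ℕₚ.≤-<-trans (s≤s (ℕₚ.≤-trans (ℕₚ.m≤n+m B A) (ℕₚ.n≤1+n _))) c<p

   scaled≉0 : ∀ {α A} → + c * α ≈[ p ] + suc A → suc A ℕ.< p → ¬ (α ≈[ p ] 0ℤ)
   scaled≉0 {α} {A} e A<p z = small≉0 A A<p (≈-trans (≈-sym e) (≈-trans (*-congˡ-≈ (+ c) z) (≈-reflexive (ℤₚ.*-zeroʳ (+ c)))))

   α≉0 : ¬ (α ≈[ p ] 0ℤ)
   α≉0 = scaled≉0 {α} cα≈ A<p
   β≉0 : ¬ (β ≈[ p ] 0ℤ)
   β≉0 = scaled≉0 {β} cβ≈ B<p

   Image : ℕ → ℕ ⊎ ℕ → Set
   Image k (inj₁ i) = i ℕ.< A × (+ suc i ≈[ p ] + k * α)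
   Image k (inj₂ i) = i ℕ.< B × (+ suc i ≈[ p ] + k * β)

   -- If the least residue r of -kα exceeds a, then kα is congruent to p - r, which lies in [1, A].
   beyond : ∀ {a A α} k → a ℕ.+ suc A ≡ p → (r : Fin p) → + toℕ r ≈[ p ] - (+ k * α) → a ℕ.< toℕ r →
        ∃ λ i → i ℕ.< A × (+ suc i ≈[ p ] + k * α)
   beyond {a} {A} {α} k eq r e a<r with p ∸ toℕ r in eq′
   ... | zero = ⊥-elim (ℕₚ.<⇒≱ (toℕ<n r) (ℕₚ.m∸n≡0⇒m≤n eq′))
   ... | suc i = i , ℕₚ.+-cancelˡ-< a i A (ℕₚ.≤-pred (ℕₚ.≤-trans below (ℕₚ.≤-reflexive (trans (sym eq) (ℕₚ.+-suc a A)))))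
     , ≈-trans (+≈0⇒≈- {a = + suc i} {b = + toℕ r} (≈-trans (≈-reflexive (cong +_ whole)) (m≈0 p))) (≈-trans (neg-cong-≈ e) (≈-reflexive (ℤₚ.neg-involutive (+ k * α))))
    where
    whole : suc i ℕ.+ toℕ r ≡ p
    whole = trans (cong (ℕ._+ toℕ r) (sym eq′)) (ℕₚ.m∸n+n≡m (ℕₚ.<⇒≤ (toℕ<n r)))
    below : suc (suc (a ℕ.+ i)) ℕ.≤ p
    below = subst (suc (suc (a ℕ.+ i)) ℕ.≤_) whole (ℕₚ.≤-trans (ℕₚ.≤-reflexive (cong suc (ℕₚ.+-comm (suc a) i))) (ℕₚ.+-monoʳ-≤ (suc i) a<r))

   -- If neither residue were too large, the corresponding copies of u and v together with k + 1
   -- copies of w would form a proper zero-sum.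
   image : ∀ k → k ℕ.< A ℕ.+ B → ∃ (Image (suc k))
   image k k<c with reduce p (- (+ suc k * α)) | reduce p (- (+ suc k * β))
   ... | r , e | s , e′ with toℕ r ℕ.≤? a | toℕ s ℕ.≤? b
   ...   | no r≰a | _ with beyond {α = α} (suc k) a+A r e (ℕₚ.≰⇒> r≰a)
   ...     | i , im = inj₁ i , im
   image k k<c | r , e | s , e′ | yes _ | no s≰b with beyond {α = β} (suc k) b+B s e′ (ℕₚ.≰⇒> s≰b)
   ...     | i , im = inj₂ i , im
   image k k<c | r , e | s , e′ | yes r≤a | yes s≤b with minimal (toℕ r) (toℕ s) (suc k) r≤a s≤b (s≤s (ℕₚ.<⇒≤ k<c)) (vanish e) (vanish e′)
    where
    vanish : ∀ {x y} → x ≈[ p ] - y → x + y ≈[ p ] 0ℤ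
    vanish {x} {y} e = ≈-trans (+-cong-≈ e (≈-refl {a = y})) (≈-reflexive (ℤₚ.+-inverseˡ y))
   ...     | inj₂ refl = ⊥-elim (ℕₚ.<-irrefl refl k<c)

   image-injective : ∀ {k k′ t} → k ℕ.< p → k′ ℕ.< p → Image k t → Image k′ t → k ≡ k′
   image-injective {k} {k′} {inj₁ i} k<p k′<p (_ , e) (_ , e′) = residue-unique k<p k′<p
    (cancel-≈ α α≉0 (≈-trans (≈-reflexive (ℤₚ.*-comm α (+ k))) (≈-trans (≈-sym e) (≈-trans e′ (≈-reflexive (ℤₚ.*-comm (+ k′) α))))))
   image-injective {k} {k′} {inj₂ i} k<p k′<p (_ , e) (_ , e′) = residue-unique k<p k′<p
    (cancel-≈ β β≉0 (≈-trans (≈-reflexive (ℤₚ.*-comm β (+ k))) (≈-trans (≈-sym e) (≈-trans e′ (≈-reflexive (ℤₚ.*-comm (+ k′) β))))))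

   -- Chosen so that the image of k weighs α²β²k², whichever of the two intervals it falls into.
   weight : ℕ ⊎ ℕ → ℤ
   weight (inj₁ i) = β * β * (+ suc i * + suc i)
   weight (inj₂ i) = α * α * (+ suc i * + suc i)

   image-weight : ∀ {k} t → Image k t → weight t ≈[ p ] α * α * (β * β) * (+ k * + k)
   image-weight {k} (inj₁ i) (_ , e) = ≈-trans (*-congˡ-≈ (β * β) (*-cong-≈ e e)) (≈-reflexive (lem α β (+ k)))
    where
    lem : ∀ α β k → β * β * (k * α * (k * α)) ≡ α * α * (β * β) * (k * k)
    lem = solve-∀
   image-weight {k} (inj₂ i) (_ , e) = ≈-trans (*-congˡ-≈ (α * α) (*-cong-≈ e e)) (≈-reflexive (lem α β (+ k)))
    where
    lem : ∀ α β k → α * α * (k * β * (k * β)) ≡ α * α * (β * β) * (k * k)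
    lem = solve-∀

   total : List (ℕ ⊎ ℕ) → ℤ
   total [] = 0ℤ
   total (t ∷ ts) = weight t + total ts

   total-Σ⊕ : ∀ ts → Σ⊕ (map (λ t → weight t , 0ℤ) ts) ≡ (total ts , 0ℤ)
   total-Σ⊕ [] = refl
   total-Σ⊕ (t ∷ ts) = cong ((weight t , 0ℤ) ⊕_) (total-Σ⊕ ts)

   total-↭ : ∀ {ts ts′} → ts ↭ ts′ → total ts ≡ total ts′
   total-↭ {ts} {ts′} π = cong proj₁ (trans (sym (total-Σ⊕ ts)) (trans (Σ⊕-↭ (map⁺ (λ t → weight t , 0ℤ) π)) (total-Σ⊕ ts′)))

   record Images (n : ℕ) : Set where
    field
     list     : List (ℕ ⊎ ℕ)
     size     : length list ≡ n
     distinct : AllPairs _≢_ list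
     all      : All (λ t → ∃ λ k → k ℕ.< n × Image (suc k) t) list
     sum      : total list ≈[ p ] α * α * (β * β) * Σsquares n

   images : ∀ n → n ℕ.≤ A ℕ.+ B → Images n
   images zero _ = record { list = [] ; size = refl ; distinct = [] ; all = [] ; sum = ≈-reflexive (sym (ℤₚ.*-zeroʳ (α * α * (β * β)))) }
   images (suc n) n<c with image n n<c | images n (ℕₚ.<⇒≤ n<c)
   ... | t , im | is = record
    { list = t ∷ list
    ; size = cong suc size
    ; distinct = All.map new all ∷ distinct
    ; all = (n , ℕₚ.n<1+n n , im) ∷ All.map (λ { (k , k<n , i) → k , ℕₚ.m≤n⇒m≤1+n k<n , i }) all
    ; sum = ≈-trans (+-cong-≈ (image-weight t im) sum) (≈-reflexive (sym (ℤₚ.*-distribˡ-+ (α * α * (β * β)) (+ suc n * + suc n) (Σsquares n))))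
    }
    where
    open Images is
    n<p : suc n ℕ.< p
    n<p = ℕₚ.≤-<-trans (ℕₚ.≤-trans n<c (ℕₚ.≤-trans (ℕₚ.n≤1+n _) (ℕₚ.n≤1+n _))) c<p
    new : ∀ {t′} → (∃ λ k → k ℕ.< n × Image (suc k) t′) → t ≢ t′
    new (k , k<n , i) refl = ℕₚ.<⇒≢ k<n (ℕₚ.suc-injective (image-injective (ℕₚ.<-trans (s≤s k<n) n<p) n<p i im))

   targets : List (ℕ ⊎ ℕ)
   targets = map inj₁ (applyUpTo (λ i → i) A) ++ map inj₂ (applyUpTo (λ i → i) B)

   squares-below : ∀ (f : ℕ → ℕ ⊎ ℕ) γ → (∀ i → weight (f i) ≡ γ * (+ suc i * + suc i)) → ∀ n → total (map f (applyUpTo (λ i → i) n)) ≡ γ * Σsquares n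
   squares-below f γ eq n = trans (general (λ i → i) 0 (λ i → refl) n) (cong (λ z → γ * z) (from-0 n))
    where
    from : ℕ → ℕ → ℤ
    from zero    m = 0ℤ
    from (suc n) m = + suc m * + suc m + from n (suc m)
    last : ∀ n m → from (suc n) m ≡ from n m + + suc (m ℕ.+ n) * + suc (m ℕ.+ n)
    last zero m = trans (ℤₚ.+-comm (+ suc m * + suc m) 0ℤ) (cong (λ k → 0ℤ + + suc k * + suc k) (sym (ℕₚ.+-identityʳ m)))
    last (suc n) m = trans (cong (λ z → + suc m * + suc m + z) (trans (last n (suc m)) (cong (λ k → from n (suc m) + + suc k * + suc k) (sym (ℕₚ.+-suc m n)))))
     (sym (ℤₚ.+-assoc (+ suc m * + suc m) (from n (suc m)) _))
    from-0 : ∀ n → from n 0 ≡ Σsquares n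
    from-0 zero = refl
    from-0 (suc n) = trans (last n 0) (trans (cong (_+ + suc n * + suc n) (from-0 n)) (ℤₚ.+-comm (Σsquares n) (+ suc n * + suc n)))
    general : ∀ (g : ℕ → ℕ) m → (∀ i → g i ≡ m ℕ.+ i) → ∀ n → total (map f (applyUpTo g n)) ≡ γ * from n m
    general g m e zero = sym (ℤₚ.*-zeroʳ γ)
    general g m e (suc n) = trans (cong₂ _+_ (trans (cong (λ k → weight (f k)) (trans (e 0) (ℕₚ.+-identityʳ m))) (eq m))
     (general (λ i → g (suc i)) (suc m) (λ i → trans (e (suc i)) (ℕₚ.+-suc m i)) n)) (sym (ℤₚ.*-distribˡ-+ γ (+ suc m * + suc m) (from n (suc m))))

   total-++ : ∀ ts ts′ → total (ts ++ ts′) ≡ total ts + total ts′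
   total-++ [] ts′ = sym (ℤₚ.+-identityˡ _)
   total-++ (t ∷ ts) ts′ = trans (cong (λ z → weight t + z) (total-++ ts ts′)) (sym (ℤₚ.+-assoc (weight t) (total ts) (total ts′)))

   targets-total : total targets ≡ β * β * Σsquares A + α * α * Σsquares B
   targets-total = trans (total-++ (map inj₁ (applyUpTo (λ i → i) A)) _)
    (cong₂ _+_ (squares-below inj₁ (β * β) (λ _ → refl) A) (squares-below inj₂ (α * α) (λ _ → refl) B))

   targets-size : length targets ≡ A ℕ.+ B
   targets-size = trans (length-++ (map inj₁ (applyUpTo (λ i → i) A)))
    (cong₂ ℕ._+_ (trans (length-map inj₁ (applyUpTo (λ i → i) A)) (length-applyUpTo (λ i → i) A)) (trans (length-map inj₂ (applyUpTo (λ i → i) B)) (length-applyUpTo (λ i → i) B)))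

   in-targets : ∀ {k} t → Image k t → t ∈ targets
   in-targets (inj₁ i) (i<A , _) = ∈-++⁺ˡ (∈-map⁺ inj₁ (∈-applyUpTo⁺ (λ i → i) i<A))
   in-targets (inj₂ i) (i<B , _) = ∈-++⁺ʳ (map inj₁ (applyUpTo (λ i → i) A)) (∈-map⁺ inj₂ (∈-applyUpTo⁺ (λ i → i) i<B))

   -- The images of 1, ..., A + B are distinct and the two intervals together have A + B points, so
   -- the images rearrange them; both sides are the total weight.
   squares : α * α * (β * β) * Σsquares (A ℕ.+ B) ≈[ p ] β * β * Σsquares A + α * α * Σsquares B
   squares = ≈-trans (≈-sym sum) (≈-reflexive (trans
    (total-↭ (distinct⇒↭ list targets distinct (All.map (λ { {t} (_ , _ , im) → in-targets t im }) all) (trans size (sym targets-size)))) targets-total))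
    where open Images (images (A ℕ.+ B) ℕₚ.≤-refl)

   -- Multiply `squares` by 6c⁴, replace cα and cβ by A + 1 and B + 1, and insert the closed formula
   -- for sums of squares; the resulting polynomial factors.
   product : + suc A * (+ suc B * (+ c * (+ suc c * (+ A * + B)))) ≈[ p ] 0ℤ
   product = ≈-trans (≈-reflexive (trans (identity (+ A) (+ B)) (cong₃ (sym (6Σsquares (A ℕ.+ B))) (sym (6Σsquares A)) (sym (6Σsquares B)))))
    (≈-trans (+-cong-≈ (*-cong-≈ (*-cong-≈ (*-cong-≈ sα sα) (*-cong-≈ sβ sβ)) ≈-refl)
      (neg-cong-≈ (*-congˡ-≈ (+ c * + c) (+-cong-≈ (*-cong-≈ (*-cong-≈ sβ sβ) ≈-refl) (*-cong-≈ (*-cong-≈ sα sα) ≈-refl)))))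
     (≈-trans (≈-reflexive (factor (+ c) α β (Σsquares (A ℕ.+ B)) (Σsquares A) (Σsquares B)))
      (≈-trans (*-congˡ-≈ (+ 6 * (+ c * + c * (+ c * + c))) (≈-trans (+-cong-≈ squares (≈-refl {a = - (β * β * Σsquares A + α * α * Σsquares B)}))
       (≈-reflexive (ℤₚ.+-inverseʳ (β * β * Σsquares A + α * α * Σsquares B))))) (≈-reflexive (ℤₚ.*-zeroʳ (+ 6 * (+ c * + c * (+ c * + c))))))))
    where
    sα = ≈-sym cα≈
    sβ = ≈-sym cβ≈
    cong₃ : ∀ {x x′ y y′ z z′} → x ≡ x′ → y ≡ y′ → z ≡ z′ →
     (+ suc A * + suc A) * (+ suc B * + suc B) * x + - ((+ c * + c) * ((+ suc B * + suc B) * y + (+ suc A * + suc A) * z)) ≡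
     (+ suc A * + suc A) * (+ suc B * + suc B) * x′ + - ((+ c * + c) * ((+ suc B * + suc B) * y′ + (+ suc A * + suc A) * z′))
    cong₃ refl refl refl = refl
    factor : ∀ c α β s t r → (c * α * (c * α)) * (c * β * (c * β)) * (+ 6 * s) + - ((c * c) * ((c * β * (c * β)) * (+ 6 * t) + (c * α * (c * α)) * (+ 6 * r))) ≡
         + 6 * (c * c * (c * c)) * (α * α * (β * β) * s + - (β * β * t + α * α * r))
    factor = solve-∀
    identity : ∀ A B → (1ℤ + A) * ((1ℤ + B) * ((1ℤ + (A + B)) * ((1ℤ + (1ℤ + (A + B))) * (A * B)))) ≡
     ((1ℤ + A) * (1ℤ + A)) * ((1ℤ + B) * (1ℤ + B)) * ((A + B) * (1ℤ + (A + B)) * (1ℤ + + 2 * (A + B)))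
     + - (((1ℤ + (A + B)) * (1ℤ + (A + B))) * (((1ℤ + B) * (1ℤ + B)) * (A * (1ℤ + A) * (1ℤ + + 2 * A)) + ((1ℤ + A) * (1ℤ + A)) * (B * (1ℤ + B) * (1ℤ + + 2 * B))))
    identity = solve-∀

   positive≉0 : ∀ n → 0 ℕ.< n → n ℕ.< p → ¬ (+ n ≈[ p ] 0ℤ)
   positive≉0 (suc n) _ n<p = small≉0 n n<p

  three-values-contradiction : ⊥
  three-values-contradiction = nonzero-* pp (small≉0 A A<p) (nonzero-* pp (small≉0 B B<p)
   (nonzero-* pp (small≉0 (A ℕ.+ B) (ℕₚ.≤-<-trans (ℕₚ.n≤1+n _) c<p)) (nonzero-* pp (small≉0 c c<p)
    (nonzero-* pp (positive≉0 A A>0 (ℕₚ.<-trans (ℕₚ.n<1+n A) A<p)) (positive≉0 B B>0 (ℕₚ.<-trans (ℕₚ.n<1+n B) B<p)))))) product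

-- The contradiction for primes p ≥ 5

module PrimeModulus where

 open TranslationRing
 open FrobeniusMap
 open GroupAlgebras
 open MultilinearForms
 open QuarticForm
 open QuarticClassification
 open QuarticToStandard
 open ZeroSumSequences
 open ResidueVectors
 open PrimeFields
 open ThreeDistinctValues
 open import Data.Nat as ℕ using (ℕ; zero; suc; _∸_; s≤s; z≤n; NonZero)
 open import Data.Nat.Primality using (Prime; prime⇒nonZero)
 open import Data.Integer using (ℤ; +_; _+_; _*_; -_; _-_; 0ℤ; 1ℤ)
 open import Data.Nat.Tactic.RingSolver using () renaming (solve-∀ to ℕ-solve-∀)
 open import Data.Fin as Fin using (Fin)
 open import Data.List using (List; []; _∷_; _++_; map; length; replicate; lookup)
 open import Data.List.Properties using (length-map; length-++; length-replicate; map-++; ++-assoc)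
 open import Data.List.Relation.Unary.All as All using (All; []; _∷_)
 open import Data.List.Relation.Unary.Any as Any using (here; there)
 open import Data.List.Membership.Propositional using (_∈_; find; lose)
 open import Data.List.Membership.Propositional.Properties using (∈-++⁺ʳ)
 open import Data.List.Relation.Binary.Sublist.Propositional using (_⊆_; []; _∷_; _∷ʳ_)
 open import Data.List.Relation.Binary.Sublist.Propositional.Properties using (length-mono-≤) renaming (map⁺ to ⊆-map; ++⁺ to ⊆-++)
 open import Data.List.Relation.Binary.Permutation.Propositional using (_↭_; prep; swap; ↭-sym; ↭-trans; ↭-refl; ↭-reflexive)
 open import Data.List.Relation.Binary.Permutation.Propositional.Properties using (shift; shifts; map⁺; ↭-length; ++⁺ˡ; ∈-resp-↭; All-resp-↭)
 open import Relation.Nullary.Decidable using (_×-dec_; ¬?)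

 minimal⇒free : ∀ {m g l} → MinimalZeroSum m (g ∷ l) → ZeroFree m l
 minimal⇒free {g = g} {l} min {S} s z = [ (λ e → e) , (λ e → ⊥-elim (ℕₚ.<⇒≱ (ℕₚ.≤-reflexive (sym e)) (length-mono-≤ s))) ]′
  (MinimalZeroSum.minimal min (g ∷ʳ s) z)

 module _ {p : ℕ} (pp : Prime p) (k : ℕ) (A : GroupAlgebra p (p ℕ.^ k)) where
  open Functionals pp k A

  free-value : ∀ l → ZeroFree q l → φ (vs l) ≈[ p ] 1ℤ
  free-value l free = ≈-trans (φ-cong (≋-trans (≋-sym (binomials-minus l)) (≋-sym (≋-trans (*-congˡ X-𝟎) (*-identityʳ (binomials (minus l)))))))
   (expand-empty (minus l) 𝟎 (≈-refl , ≈-refl) λ {S} s z → free (subst (S ⊆_) (elements-minus l) s) (subst (Vanishes q) (⊕-identityˡ (Σ⊕ S)) z))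

  bilinearForm-value : ∀ rest h g → ZeroFree q (h ∷ g ∷ rest) → bilinearForm rest h g ≈[ p ] 1ℤ
  bilinearForm-value rest h g free = ≈-trans (φ-cong (≋-trans (*-congˡ (≋-trans (*-congʳ constant-1) (*-identityˡ (vs rest)))) (*-assoc (v h) (v g) (vs rest)))) (free-value (h ∷ g ∷ rest) free)

  bilinearForm-cong : ∀ rest h {g g′} → g ≈²[ q ] g′ → bilinearForm rest h g ≈[ p ] bilinearForm rest h g′
  bilinearForm-cong rest h e = φ-cong (*-congʳ (*-congˡ (v-cong e)))

  linearForm-value : ∀ rest g → ZeroFree q (g ∷ rest) → linearForm rest g ≈[ p ] 1ℤ
  linearForm-value rest g free = ≈-trans (φ-cong (*-congˡ (≋-trans (*-congʳ constant-1) (*-identityˡ (vs rest))))) (free-value (g ∷ rest) free)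

 count-replicate : ∀ {n} (x : Zn² n) m → count x (replicate m x) ≡ m
 count-replicate x zero = refl
 count-replicate x (suc m) = trans (count-self x (replicate m x)) (cong suc (count-replicate x m))

 replicate-⊆ : ∀ {A : Set} (x : A) {m n} → m ℕ.≤ n → replicate m x ⊆ replicate n x
 replicate-⊆ x {n = zero} z≤n = []
 replicate-⊆ x {n = suc n} z≤n = x ∷ʳ replicate-⊆ x {n = n} z≤n
 replicate-⊆ x (s≤s le) = refl ∷ replicate-⊆ x le

 constant-list : ∀ {A : Set} (x : A) l → All (_≡ x) l → l ≡ replicate (length l) x
 constant-list x [] [] = refl
 constant-list x (y ∷ l) (refl ∷ es) = cong (x ∷_) (constant-list x l es)

 additive-replicate : ∀ {m n} {f : G → ℤ} → Additive m f → ∀ k (x : Zn² n) → f (Σ⊕ (map ⟪_⟫ (replicate k x))) ≈[ m ] + k * f ⟪ x ⟫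
 additive-replicate {f = f} additive zero x = additive-𝟎 {f = f} additive
 additive-replicate {f = f} additive (suc k) x = ≈-trans (additive ⟪ x ⟫ _) (≈-trans (+-cong-≈ (≈-refl {a = f ⟪ x ⟫}) (additive-replicate {f = f} additive k x)) (≈-reflexive (lem (f ⟪ x ⟫) (+ k))))
  where
  lem : ∀ a n → a + n * a ≡ (1ℤ + n) * a
  lem = solve-∀

 remaining : ∀ {A : Set} {x y : A} {l r} → l ↭ x ∷ r → y ∈ l → y ≢ x → y ∈ r
 remaining π y∈l y≢x with ∈-resp-↭ π y∈l
 ... | here y≡x = ⊥-elim (y≢x y≡x)
 ... | there y∈r = y∈r

 search : ∀ {A : Set} {P : A → Set} → (∀ x → Dec (P x)) → ∀ l → (∃ λ x → x ∈ l × P x) ⊎ (∀ {x} → x ∈ l → ¬ P x)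
 search P? l with Any.any? P? l
 ... | yes any = inj₁ (find any)
 ... | no none = inj₂ λ x∈l px → none (lose x∈l px)

 -- All elements but copies of one value lie on a line λ = 1: λ = α + β, λ = β or λ = α,
 -- depending on which alternatives of Standard occur.

 module StandardPairs {p : ℕ} (pp : Prime p) (5≤p : 5 ℕ.≤ p) (U : List (Zn² p)) (size : length U ≡ p ℕ.+ p ∸ 1)
   (zero-sum : Vanishes p (Σ⊕ (map ⟪_⟫ U))) (few : ∀ x → count x U ℕ.+ 2 ℕ.≤ p)
   (u v : Zn² p) (α β : G → ℤ) (α-additive : Additive p α) (β-additive : Additive p β)
   (α-cong : ∀ {g h} → g ≈²[ p ] h → α g ≈[ p ] α h) (β-cong : ∀ {g h} → g ≈²[ p ] h → β g ≈[ p ] β h)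
   (αu : α ⟪ u ⟫ ≈[ p ] 1ℤ) (βv : β ⟪ v ⟫ ≈[ p ] 1ℤ) (αv : α ⟪ v ⟫ ≈[ p ] 0ℤ) (βu : β ⟪ u ⟫ ≈[ p ] 0ℤ)
   (α≉0 : ∀ {w} → w ∈ U × w ≢ u × w ≢ v → ¬ (α ⟪ w ⟫ ≈[ p ] 0ℤ)) (β≉0 : ∀ {w} → w ∈ U × w ≢ u × w ≢ v → ¬ (β ⟪ w ⟫ ≈[ p ] 0ℤ))
   (Δ≉0 : ∀ {w z} → w ∈ U × w ≢ u × w ≢ v → z ∈ U × z ≢ u × z ≢ v → w ≢ z → ¬ (α ⟪ w ⟫ * β ⟪ z ⟫ - β ⟪ w ⟫ * α ⟪ z ⟫ ≈[ p ] 0ℤ))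
   (pair : ∀ {w z} → w ∈ U × w ≢ u × w ≢ v → z ∈ U × z ≢ u × z ≢ v → w ≢ z → Standard p (α ⟪ w ⟫) (β ⟪ w ⟫) (α ⟪ z ⟫) (β ⟪ z ⟫)) where

  open PrimeField pp

  private
   Other : Zn² p → Set
   Other w = w ∈ U × w ≢ u × w ≢ v

   other? : ∀ w → Dec (w ≢ u × w ≢ v)
   other? w = ¬? (w ≟² u) ×-dec ¬? (w ≟² v)

   clash : ∀ {a b c} → a ≈[ p ] b → a ≈[ p ] c → c ≈[ p ] b
   clash e e′ = ≈-trans (≈-sym e′) e

   vanishing-left : ∀ {a b c} → a + b ≈[ p ] c → b ≈[ p ] c → a ≈[ p ] 0ℤ
   vanishing-left {a} {b} {c} e e′ = ≈-trans (≈-reflexive (lem a b)) (≈-trans (+-cong-≈ e (neg-cong-≈ e′)) (≈-reflexive (ℤₚ.+-inverseʳ c)))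
    where
    lem : ∀ a b → a ≡ a + b + - b
    lem = solve-∀

   vanishing-right : ∀ {a b c} → a + b ≈[ p ] c → a ≈[ p ] c → b ≈[ p ] 0ℤ
   vanishing-right {a} {b} e = vanishing-left (≈-trans (≈-reflexive (ℤₚ.+-comm b a)) e)

   proportional : ∀ {a b c d s} → a + b ≈[ p ] 0ℤ → c + d ≈[ p ] 0ℤ → s ≡ a * d - b * c → s ≈[ p ] 0ℤ
   proportional {a} {b} {c} {d} e e′ refl = ≈-trans (≈-reflexive (lem a b c d)) (≈-trans (+-cong-≈ (*-congˡ-≈ d e) (neg-cong-≈ (*-congˡ-≈ b e′)))
    (≈-reflexive (lem′ d b)))
    where
    lem : ∀ a b c d → a * d + - (b * c) ≡ d * (a + b) + - (b * (c + d))
    lem = solve-∀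
    lem′ : ∀ d b → d * 0ℤ + - (b * 0ℤ) ≡ 0ℤ
    lem′ = solve-∀

   classify : ∀ {y} → y ∈ U → (y ≡ u) ⊎ (y ≡ v) ⊎ Other y
   classify {y} y∈U with y ≟² u | y ≟² v
   ... | yes e | _ = inj₁ e
   ... | no _ | yes e = inj₂ (inj₁ e)
   ... | no y≢u | no y≢v = inj₂ (inj₂ (y∈U , y≢u , y≢v))

   0≉1 : ¬ (0ℤ ≈[ p ] 1ℤ)
   0≉1 e = 1≉0 (≈-sym e)

   module Line {w₀ z₀ : Zn² p} (ow : Other w₀) (oz : Other z₀) (w₀≢z₀ : w₀ ≢ z₀) where

    λ+ : G → ℤ
    λ+ g = α g + β g

    λ+-additive : Additive p λ+
    λ+-additive g h = ≈-trans (+-cong-≈ (α-additive g h) (β-additive g h)) (≈-reflexive (lem (α g) (α h) (β g) (β h)))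
     where
     lem : ∀ a b c d → a + b + (c + d) ≡ a + c + (b + d)
     lem = solve-∀

    λu : λ+ ⟪ u ⟫ ≈[ p ] 1ℤ
    λu = +-cong-≈ αu βu
    λv : λ+ ⟪ v ⟫ ≈[ p ] 1ℤ
    λv = +-cong-≈ αv βv

    -- With `w` on the line, the alternatives `u-off`, `v-off` and `w-off` for a pair (w, z) would
    -- give α(w) = 0, β(w) = 0 or 0 = 1. So z has λ = 1 or λ = 0, and two different values with λ =
    -- 0 would be parallel.
    on-line : ∀ {w} → Other w → λ+ ⟪ w ⟫ ≈[ p ] 1ℤ → ⊥
    on-line {w} ow λw = LineCount.line-contradiction 5≤p U size zero-sum few λ+-additive (λ e → +-cong-≈ (α-cong e) (β-cong e))
     on-or-zero unique
     where
     value : ∀ {z} → Other z → z ≢ w → (λ+ ⟪ z ⟫ ≈[ p ] 1ℤ) ⊎ (λ+ ⟪ z ⟫ ≈[ p ] 0ℤ)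
     value oz z≢w with pair ow oz (λ e → z≢w (sym e))
     ... | u-off e _ = ⊥-elim (α≉0 ow (vanishing-left λw e))
     ... | v-off e _ = ⊥-elim (β≉0 ow (vanishing-right λw e))
     ... | all-on _ e = inj₁ e
     ... | w-off e _ = ⊥-elim (0≉1 (clash λw e))
     ... | z-off _ e = inj₂ e
     off : ∀ {y} → y ∈ U → ¬ (λ+ ⟪ y ⟫ ≈[ p ] 1ℤ) → Other y × (λ+ ⟪ y ⟫ ≈[ p ] 0ℤ)
     off {y} y∈U ne with classify y∈U
     ... | inj₁ refl = ⊥-elim (ne λu)
     ... | inj₂ (inj₁ refl) = ⊥-elim (ne λv)
     ... | inj₂ (inj₂ oy) with y ≟² w
     ...   | yes refl = ⊥-elim (ne λw)
     ...   | no y≢w = oy , [ (λ e → ⊥-elim (ne e)) , (λ e → e) ]′ (value oy y≢w)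
     on-or-zero : ∀ {y} → y ∈ U → ¬ (λ+ ⟪ y ⟫ ≈[ p ] 1ℤ) → λ+ ⟪ y ⟫ ≈[ p ] 0ℤ
     on-or-zero y∈U ne = proj₂ (off y∈U ne)
     both : ∀ {y z} → Other y → Other z → λ+ ⟪ y ⟫ ≈[ p ] 0ℤ → λ+ ⟪ z ⟫ ≈[ p ] 0ℤ → y ≢ z → ⊥
     both {y} {z} oy oz e e′ y≢z = Δ≉0 oy oz y≢z (proportional {α ⟪ y ⟫} {β ⟪ y ⟫} {α ⟪ z ⟫} {β ⟪ z ⟫} e e′ refl)
     unique : ∀ {y z} → y ∈ U → z ∈ U → ¬ (λ+ ⟪ y ⟫ ≈[ p ] 1ℤ) → ¬ (λ+ ⟪ z ⟫ ≈[ p ] 1ℤ) → y ≡ z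
     unique {y} {z} y∈U z∈U ne ne′ with off y∈U ne | off z∈U ne′ | y ≟² z
     ... | _ | _ | yes e = e
     ... | oy , e | oz , e′ | no y≢z = ⊥-elim (both oy oz e e′ y≢z)

    module Off (off : ∀ {w} → Other w → ¬ (λ+ ⟪ w ⟫ ≈[ p ] 1ℤ)) where

     alternative : ∀ {w z} → Other w → Other z → w ≢ z →
          ((β ⟪ w ⟫ ≈[ p ] 1ℤ) × (β ⟪ z ⟫ ≈[ p ] 1ℤ)) ⊎ ((α ⟪ w ⟫ ≈[ p ] 1ℤ) × (α ⟪ z ⟫ ≈[ p ] 1ℤ))
     alternative ow oz w≢z with pair ow oz w≢z
     ... | u-off e e′ = inj₁ (e , e′)
     ... | v-off e e′ = inj₂ (e , e′)
     ... | all-on e _ = ⊥-elim (off ow e)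
     ... | w-off _ e = ⊥-elim (off oz e)
     ... | z-off e _ = ⊥-elim (off ow e)

     β-line : (∀ {w} → Other w → β ⟪ w ⟫ ≈[ p ] 1ℤ) → ⊥
     β-line on = LineCount.line-contradiction 5≤p U size zero-sum few β-additive β-cong
      (λ { y∈U ne → subst (λ y → β ⟪ y ⟫ ≈[ p ] 0ℤ) (sym (is-u y∈U ne)) βu }) (λ y∈U z∈U ne ne′ → trans (is-u y∈U ne) (sym (is-u z∈U ne′)))
      where
      is-u : ∀ {y} → y ∈ U → ¬ (β ⟪ y ⟫ ≈[ p ] 1ℤ) → y ≡ u
      is-u y∈U ne with classify y∈U
      ... | inj₁ e = e
      ... | inj₂ (inj₁ refl) = ⊥-elim (ne βv)
      ... | inj₂ (inj₂ oy) = ⊥-elim (ne (on oy))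

     α-line : (∀ {w} → Other w → α ⟪ w ⟫ ≈[ p ] 1ℤ) → ⊥
     α-line on = LineCount.line-contradiction 5≤p U size zero-sum few α-additive α-cong
      (λ { y∈U ne → subst (λ y → α ⟪ y ⟫ ≈[ p ] 0ℤ) (sym (is-v y∈U ne)) αv }) (λ y∈U z∈U ne ne′ → trans (is-v y∈U ne) (sym (is-v z∈U ne′)))
      where
      is-v : ∀ {y} → y ∈ U → ¬ (α ⟪ y ⟫ ≈[ p ] 1ℤ) → y ≡ v
      is-v y∈U ne with classify y∈U
      ... | inj₁ refl = ⊥-elim (ne αu)
      ... | inj₂ (inj₁ e) = e
      ... | inj₂ (inj₂ oy) = ⊥-elim (ne (on oy))

     -- A value with β ≠ 1 forces α = 1 on both members of every pair it belongs to; for the value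
     -- itself, `w₀` or `z₀` serves as partner.
     exceptional : ∀ {w} → Other w → ¬ (β ⟪ w ⟫ ≈[ p ] 1ℤ) → ∀ {z} → Other z → α ⟪ z ⟫ ≈[ p ] 1ℤ
     exceptional {w} ow′ ne {z} oz′ with z ≟² w
     ... | no z≢w = [ (λ e → ⊥-elim (ne (proj₁ e))) , proj₂ ]′ (alternative ow′ oz′ (λ e → z≢w (sym e)))
     ... | yes refl with z ≟² w₀
     ...   | no z≢w₀ = [ (λ e → ⊥-elim (ne (proj₁ e))) , proj₁ ]′ (alternative ow′ ow z≢w₀)
     ...   | yes refl = [ (λ e → ⊥-elim (ne (proj₁ e))) , proj₁ ]′ (alternative ow oz w₀≢z₀)

     conclusion : (∃ λ w → w ∈ U × ((w ≢ u × w ≢ v) × ¬ (β ⟪ w ⟫ ≈[ p ] 1ℤ))) ⊎ (∀ {w} → w ∈ U → ¬ ((w ≢ u × w ≢ v) × ¬ (β ⟪ w ⟫ ≈[ p ] 1ℤ))) → ⊥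
     conclusion (inj₁ (w , w∈U , nes , ne)) = α-line (exceptional (w∈U , nes) ne)
     conclusion (inj₂ none) = β-line (λ { {w} (w∈U , nes) → stable w (λ ne → none w∈U (nes , ne)) })
      where
      stable : ∀ w → ¬ ¬ (β ⟪ w ⟫ ≈[ p ] 1ℤ) → β ⟪ w ⟫ ≈[ p ] 1ℤ
      stable w nn with ≈? {p} (β ⟪ w ⟫) 1ℤ
      ... | yes e = e
      ... | no ne = ⊥-elim (nn ne)

    conclusion : (∃ λ w → w ∈ U × ((w ≢ u × w ≢ v) × (λ+ ⟪ w ⟫ ≈[ p ] 1ℤ))) ⊎ (∀ {w} → w ∈ U → ¬ ((w ≢ u × w ≢ v) × (λ+ ⟪ w ⟫ ≈[ p ] 1ℤ))) → ⊥
    conclusion (inj₁ (w , w∈U , nes , e)) = on-line (w∈U , nes) e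
    conclusion (inj₂ none) = Off.conclusion (λ { (w∈U , nes) e → none w∈U (nes , e) })
     (search (λ w → other? w ×-dec ¬? (≈? (β ⟪ w ⟫) 1ℤ)) U)

    contradiction : ⊥
    contradiction = conclusion (search (λ w → other? w ×-dec ≈? (λ+ ⟪ w ⟫) 1ℤ) U)

  standard-contradiction : ∀ {w z} → Other w → Other z → w ≢ z → ⊥
  standard-contradiction ow oz w≢z = Line.contradiction ow oz w≢z

 module PrimeCore {p : ℕ} (pp : Prime p) (algebra : GroupAlgebra p (p ℕ.^ 1)) (5≤p : 5 ℕ.≤ p) (U : List (Zn² p)) (size : length U ≡ p ℕ.+ p ∸ 1)
   (min : MinimalZeroSum p (map ⟪_⟫ U)) (few : ∀ x → count x U ℕ.+ 2 ℕ.≤ p) where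

  open PrimeField pp

  private
   instance
    p≢0 : NonZero p
    p≢0 = prime⇒nonZero pp

   q≡p : p ℕ.^ 1 ≡ p
   q≡p = ℕₚ.*-identityʳ p

   module F = Functionals pp 1 algebra

   minimal-front : ∀ {l} → U ↭ l → MinimalZeroSum (p ℕ.^ 1) (map ⟪_⟫ l)
   minimal-front {l} π = subst (λ m → MinimalZeroSum m (map ⟪_⟫ l)) (sym q≡p) (minimal-↭ (map⁺ ⟪_⟫ π) min)

   top≡ : F.top ≡ length U
   top≡ = trans (cong (λ m → m ℕ.+ m ∸ 1) q≡p) (sym size)

   long : ∀ t {T rest} → length T ≡ t → U ↭ T ++ rest → F.top ℕ.≤ t ℕ.+ length (map ⟪_⟫ rest)
   long t {T} {rest} refl π = ℕₚ.≤-reflexive (trans top≡ (trans (↭-length π) (trans (length-++ T) (cong (length T ℕ.+_) (sym (length-map ⟪_⟫ rest))))))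

   9≤U : 9 ℕ.≤ length U
   9≤U = subst (9 ℕ.≤_) (sym size) (ℕₚ.∸-monoˡ-≤ 1 (ℕₚ.+-mono-≤ 5≤p 5≤p))

   -- Removing y or x leaves a zero-sum free sequence, so the bilinear form with `t` takes the value
   -- 1 at x and at y alike; additivity then gives β = 1. The case β = 0 shows that 0 does not
   -- occur.
   multiple⇒equal : ∀ {x y t rest} → U ↭ x ∷ y ∷ t ∷ rest → ∀ β → ⟪ x ⟫ ≈²[ p ] β · ⟪ y ⟫ → x ≡ y
   multiple⇒equal {x} {y} {t} {rest} π β e = ⟪⟫-injective (≈-trans (proj₁ e) (unit (proj₁ ⟪ y ⟫)) , ≈-trans (proj₂ e) (unit (proj₂ ⟪ y ⟫)))
    where
    R = map ⟪_⟫ rest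
    value : ∀ {s h g} → U ↭ s ∷ h ∷ g ∷ rest → F.bilinearForm R ⟪ h ⟫ ⟪ g ⟫ ≈[ p ] 1ℤ
    value {s} {h} {g} π = bilinearForm-value pp 1 algebra R ⟪ h ⟫ ⟪ g ⟫ (minimal⇒free (minimal-front π))
    additive : Additive p (F.bilinearForm R ⟪ t ⟫)
    additive = F.bilinearForm-additive R (long 3 {x ∷ y ∷ t ∷ []} refl π) ⟪ t ⟫
    β≈1 : β ≈[ p ] 1ℤ
    β≈1 = ≈-sym (≈-trans (≈-sym (value {y} {t} {x} (↭-trans π (↭-trans (swap x y ↭-refl) (prep y (swap x t ↭-refl))))))
     (≈-trans (bilinearForm-cong pp 1 algebra R ⟪ t ⟫ (subst (λ m → ⟪ x ⟫ ≈²[ m ] β · ⟪ y ⟫) (sym q≡p) e))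
      (≈-trans (additive-multiple {f = F.bilinearForm R ⟪ t ⟫} additive β ⟪ y ⟫) (≈-trans (*-congˡ-≈ β (value {x} {t} {y} (↭-trans π (prep x (swap y t ↭-refl)))))
       (≈-reflexive (ℤₚ.*-identityʳ β))))))
    unit : ∀ a → β * a ≈[ p ] a
    unit a = ≈-trans (*-cong-≈ β≈1 (≈-refl {a = a})) (≈-reflexive (ℤₚ.*-identityˡ a))

   third : ∀ {x y : Zn² p} {r} → U ↭ x ∷ y ∷ r → ∃₂ λ t rest → r ≡ t ∷ rest
   third {r = []} π = ⊥-elim (ℕₚ.<⇒≱ (s≤s (s≤s (s≤s z≤n))) (subst (9 ℕ.≤_) (↭-length π) 9≤U))
   third {r = t ∷ rest} π = t , rest , refl

   nonzero : ∀ {x y} → x ∈ U → y ∈ U → x ≢ y → ¬ Vanishes p ⟪ x ⟫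
   nonzero x∈U y∈U x≢y z with front-pair x∈U y∈U x≢y
   ... | r , π with third π
   ...   | t , rest , refl = x≢y (multiple⇒equal π 0ℤ z)

   independent : ∀ {x y} → x ∈ U → y ∈ U → x ≢ y → ¬ (det ⟪ x ⟫ ⟪ y ⟫ ≈[ p ] 0ℤ)
   independent {x} {y} x∈U y∈U x≢y z with front-pair y∈U x∈U (λ e → x≢y (sym e)) | dependent ⟪ x ⟫ ⟪ y ⟫ (nonzero x∈U y∈U x≢y) z
   ... | r , π | β , e with third π
   ...   | t , rest , refl = x≢y (sym (multiple⇒equal π β e))

   -- The slope of y relative to x, measured with an auxiliary linear form s
   form : G → G → ℤ
   form (s , t) (a , b) = s * a + t * b

   slope-by : ∀ (s x y : G) → Dec (det x y ≈[ p ] 0ℤ) → Fin p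
   slope-by s x y (yes _) = proj₁ (reduce p 0ℤ)
   slope-by s x y (no d≉0) = proj₁ (reduce p (form s y * proj₁ (inverse (det x y) d≉0)))

   slope : ∀ (s x y : G) → Fin p
   slope s x y = slope-by s x y (≈0? p (det x y))

   -- Equal slopes annihilate the right-hand side of the Plücker relation s(x)·det(y,z) =
   -- s(y)·det(x,z) - s(z)·det(x,y).
   slope-equal : ∀ s x y z (d : Dec (det x y ≈[ p ] 0ℤ)) (d′ : Dec (det x z ≈[ p ] 0ℤ)) → ¬ (form s x ≈[ p ] 0ℤ) →
         ¬ (det x y ≈[ p ] 0ℤ) → ¬ (det x z ≈[ p ] 0ℤ) → slope-by s x y d ≡ slope-by s x z d′ → det y z ≈[ p ] 0ℤ
   slope-equal s x y z (yes d) d′ _ n _ _ = ⊥-elim (n d)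
   slope-equal s x y z (no _) (yes d′) _ _ n _ = ⊥-elim (n d′)
   slope-equal s x y z (no d) (no d′) e≉0 _ _ eq with inverse (det x y) d | inverse (det x z) d′
   ... | i , di | j , dj with reduce p (form s y * i) | reduce p (form s z * j)
   ...   | r , re | r′ , re′ with eq
   ...     | refl = [ (λ e → ⊥-elim (e≉0 e)) , (λ e → e) ]′ (prime-product pp (form s x) (det y z)
    (≈-trans (≈-reflexive (plücker s x y z)) (≈-trans (+-cong-≈ ez≈ (≈-refl {a = - (form s z * det x y)})) (≈-reflexive (ℤₚ.+-inverseʳ (form s z * det x y))))))
    where
    plücker : ∀ s x y z → form s x * det y z ≡ form s y * det x z + - (form s z * det x y)
    plücker (s , t) (a , b) (c , d) (e , f) = lem s t a b c d e f
     where
     lem : ∀ s t a b c d e f → (s * a + t * b) * (c * f + - (d * e)) ≡ (s * c + t * d) * (a * f + - (b * e)) + - ((s * e + t * f) * (a * d + - (b * c)))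
     lem = solve-∀
    swap₁ : ∀ y x d i → y * x * (d * i) ≡ y * i * (d * x)
    swap₁ = solve-∀
    swap₂ : ∀ z e d j → z * j * (d * e) ≡ z * d * (e * j)
    swap₂ = solve-∀
    ez≈ : form s y * det x z ≈[ p ] form s z * det x y
    ez≈ = ≈-trans (≈-sym (≈-trans (*-congˡ-≈ (form s y * det x z) di) (≈-reflexive (ℤₚ.*-identityʳ (form s y * det x z)))))
     (≈-trans (≈-reflexive (swap₁ (form s y) (det x z) (det x y) i)) (≈-trans (*-cong-≈ (≈-trans (≈-sym re) re′) (≈-refl {a = det x y * det x z}))
      (≈-trans (≈-reflexive (swap₂ (form s z) (det x z) (det x y) j)) (≈-trans (*-congˡ-≈ (form s z * det x y) dj) (≈-reflexive (ℤₚ.*-identityʳ (form s z * det x y)))))))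

   auxiliary : ∀ x → ¬ Vanishes p x → ∃ λ s → ¬ (form s x ≈[ p ] 0ℤ)
   auxiliary (a , b) ne with ≈0? p a
   ... | no a≉0 = (1ℤ , 0ℤ) , λ z → a≉0 (≈-trans (≈-reflexive (lem a b)) z)
    where
    lem : ∀ a b → a ≡ 1ℤ * a + 0ℤ * b
    lem = solve-∀
   ... | yes a≈0 = (0ℤ , 1ℤ) , λ z → ne (a≈0 , ≈-trans (≈-reflexive (lem a b)) z)
    where
    lem : ∀ a b → b ≡ 0ℤ * a + 1ℤ * b
    lem = solve-∀

   -- More than p elements differ from x, and distinct ones have distinct slopes.
   double : ∀ {x} → x ∈ U → ∃₂ λ v r → v ≢ x × U ↭ v ∷ v ∷ r
   double {x} x∈U = conclude (gather x U)
    where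
    conclude : (∃ λ r → U ↭ replicate (count x U) x ++ r × All (_≢ x) r) → ∃₂ λ v r → v ≢ x × U ↭ v ∷ v ∷ r
    conclude (r , π , ne) = finish (auxiliary ⟪ x ⟫ x≉0)
     where
     total : count x U ℕ.+ length r ≡ p ℕ.+ p ∸ 1
     total = trans (cong (ℕ._+ length r) (sym (length-replicate (count x U)))) (trans (sym (length-++ (replicate (count x U) x))) (trans (sym (↭-length π)) size))
     p<r : p ℕ.< length r
     p<r = ℕₚ.+-cancelˡ-≤ (count x U) (suc p) (length r) (subst (count x U ℕ.+ suc p ℕ.≤_) (sym total)
      (ℕₚ.≤-trans (ℕₚ.≤-reflexive (cong (_∸ 1) eq)) (ℕₚ.∸-monoˡ-≤ 1 (ℕₚ.+-monoʳ-≤ p (few x)))))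
      where
      eq : suc (count x U ℕ.+ suc p) ≡ p ℕ.+ (count x U ℕ.+ 2)
      eq = trans (cong suc (trans (ℕₚ.+-suc (count x U) p) (cong suc (ℕₚ.+-comm (count x U) p))))
       (trans (sym (trans (ℕₚ.+-suc p (suc (count x U))) (cong suc (ℕₚ.+-suc p (count x U))))) (cong (p ℕ.+_) (ℕₚ.+-comm 2 (count x U))))
     in-U : ∀ {y} → y ∈ r → y ∈ U
     in-U y∈r = ∈-resp-↭ (↭-sym π) (∈-++⁺ʳ (replicate (count x U) x) y∈r)
     ≢x : ∀ {y} → y ∈ r → y ≢ x
     ≢x = All.lookup ne
     x≉0 : ¬ Vanishes p ⟪ x ⟫
     x≉0 = witness r in-U ≢x (ℕₚ.≤-trans (s≤s z≤n) p<r)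
      where
      witness : ∀ l → (∀ {y} → y ∈ l → y ∈ U) → (∀ {y} → y ∈ l → y ≢ x) → 0 ℕ.< length l → ¬ Vanishes p ⟪ x ⟫
      witness (y ∷ l) sub nx _ = nonzero x∈U (sub (here refl)) (λ e → nx (here refl) (sym e))
     finish : (∃ λ s → ¬ (form s ⟪ x ⟫ ≈[ p ] 0ℤ)) → ∃₂ λ v r → v ≢ x × U ↭ v ∷ v ∷ r
     finish (s , s≉0) = last (repeated-value (λ y → slope s ⟪ x ⟫ ⟪ y ⟫) r p<r)
      where
      last : (∃₂ λ y z → ∃ λ r′ → (r ↭ y ∷ z ∷ r′) × slope s ⟪ x ⟫ ⟪ y ⟫ ≡ slope s ⟪ x ⟫ ⟪ z ⟫) → ∃₂ λ v r → v ≢ x × U ↭ v ∷ v ∷ r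
      last (y , z , r′ , π′ , eq) = y , replicate (count x U) x ++ r′ , ≢x y∈r , ↭-trans π (↭-trans (++⁺ˡ (replicate (count x U) x) π′)
       (subst (λ w → replicate (count x U) x ++ y ∷ w ∷ r′ ↭ y ∷ y ∷ replicate (count x U) x ++ r′) y≡z (shifts (replicate (count x U) x) (y ∷ y ∷ []))))
       where
       y∈r : y ∈ r
       y∈r = ∈-resp-↭ (↭-sym π′) (here refl)
       z∈r : z ∈ r
       z∈r = ∈-resp-↭ (↭-sym π′) (there (here refl))
       against : ∀ {w} → w ∈ r → ¬ (det ⟪ x ⟫ ⟪ w ⟫ ≈[ p ] 0ℤ)
       against w∈r = independent x∈U (in-U w∈r) (λ e → ≢x w∈r (sym e))
       parallel : det ⟪ y ⟫ ⟪ z ⟫ ≈[ p ] 0ℤ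
       parallel = slope-equal s ⟪ x ⟫ ⟪ y ⟫ ⟪ z ⟫ (≈0? p (det ⟪ x ⟫ ⟪ y ⟫)) (≈0? p (det ⟪ x ⟫ ⟪ z ⟫)) s≉0 (against y∈r) (against z∈r) eq
       y≡z : y ≡ z
       y≡z with y ≟² z
       ... | yes e = e
       ... | no y≢z = ⊥-elim (independent (in-U y∈r) (in-U z∈r) y≢z parallel)

   2≉0 : ¬ (+ 2 ≈[ p ] 0ℤ)
   2≉0 = small≉0 1 (ℕₚ.≤-trans (s≤s (s≤s (s≤s z≤n))) 5≤p)

   3≉0 : ¬ (+ 3 ≈[ p ] 0ℤ)
   3≉0 = small≉0 2 (ℕₚ.≤-trans (s≤s (s≤s (s≤s (s≤s z≤n)))) 5≤p)

  module WithBasis {u v : Zn² p} {r : List (Zn² p)} (v∈U : v ∈ U) (u≢v : u ≢ v) (π : U ↭ u ∷ u ∷ r) where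

   private
    u∈U : u ∈ U
    u∈U = ∈-resp-↭ (↭-sym π) (here refl)

    d : ℤ
    d = det ⟪ u ⟫ ⟪ v ⟫

    d⁻¹ : ∃ λ i → d * i ≈[ p ] 1ℤ
    d⁻¹ = inverse d (independent u∈U v∈U u≢v)

    i : ℤ
    i = proj₁ d⁻¹

    i≉0 : ¬ (i ≈[ p ] 0ℤ)
    i≉0 z = 1≉0 (≈-trans (≈-sym (proj₂ d⁻¹)) (≈-trans (*-congˡ-≈ d z) (≈-reflexive (ℤₚ.*-zeroʳ d))))

    open Coordinates {p} {⟪ u ⟫} {⟪ v ⟫} i (proj₂ d⁻¹)

    Other : Zn² p → Set
    Other w = w ∈ U × w ≢ u × w ≢ v

    α≉0 : ∀ {w} → Other w → ¬ (α ⟪ w ⟫ ≈[ p ] 0ℤ)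
    α≉0 (w∈U , _ , w≢v) = nonzero-* pp (independent w∈U v∈U w≢v) i≉0

    β≉0 : ∀ {w} → Other w → ¬ (β ⟪ w ⟫ ≈[ p ] 0ℤ)
    β≉0 (w∈U , w≢u , _) = nonzero-* pp (independent u∈U w∈U (λ e → w≢u (sym e))) i≉0

    Δ≉0 : ∀ {w z} → Other w → Other z → w ≢ z → ¬ (α ⟪ w ⟫ * β ⟪ z ⟫ - β ⟪ w ⟫ * α ⟪ z ⟫ ≈[ p ] 0ℤ)
    Δ≉0 {w} {z} (w∈U , _) (z∈U , _) w≢z zero-det = nonzero-* pp (nonzero-* pp i≉0 i≉0) (nonzero-* pp (independent u∈U v∈U u≢v) (independent w∈U z∈U w≢z))
     (≈-trans (≈-reflexive (lem (proj₁ ⟪ u ⟫) (proj₂ ⟪ u ⟫) (proj₁ ⟪ v ⟫) (proj₂ ⟪ v ⟫) (proj₁ ⟪ w ⟫) (proj₂ ⟪ w ⟫) (proj₁ ⟪ z ⟫) (proj₂ ⟪ z ⟫) i)) zero-det)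
     where
     lem : ∀ s t x y a b e f i → i * i * ((s * y + - (t * x)) * (a * f + - (b * e))) ≡
        (a * y + - (b * x)) * i * ((s * f + - (t * e)) * i) + - ((s * b + - (t * a)) * i * ((e * y + - (f * x)) * i))
     lem = solve-∀

    pair : ∀ {w z} → Other w → Other z → w ≢ z → Standard p (α ⟪ w ⟫) (β ⟪ w ⟫) (α ⟪ z ⟫) (β ⟪ z ⟫)
    pair {w} {z} ow oz w≢z = conclude (to-front v∈r)
     where
     v∈ur : v ∈ u ∷ r
     v∈ur = remaining π v∈U (λ e → u≢v (sym e))
     twice : ∀ {y} → y ∈ U → y ≢ u → y ∈ r
     twice y∈U y≢u = remaining ↭-refl (remaining π y∈U y≢u) y≢u
     v∈r = twice v∈U (λ e → u≢v (sym e))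
     w∈r = twice (proj₁ ow) (proj₁ (proj₂ ow))
     z∈r = twice (proj₁ oz) (proj₁ (proj₂ oz))
     conclude : (∃ λ r₁ → r ↭ v ∷ r₁) → Standard p (α ⟪ w ⟫) (β ⟪ w ⟫) (α ⟪ z ⟫) (β ⟪ z ⟫)
     conclude (r₁ , π₁) with front-pair (remaining π₁ w∈r (proj₂ (proj₂ ow))) (remaining π₁ z∈r (proj₂ (proj₂ oz))) w≢z
     ... | rest , π₂ = quartic⇒standard pp 2≉0 3≉0 forms (cramer ⟪ w ⟫) (cramer ⟪ z ⟫) (α≉0 ow) (β≉0 ow) (α≉0 oz) (β≉0 oz) (Δ≉0 ow oz w≢z)
      where
      whole : U ↭ u ∷ u ∷ v ∷ w ∷ z ∷ rest
      whole = ↭-trans π (prep u (prep u (↭-trans π₁ (prep v π₂))))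
      2⁻¹ = inverse (+ 2) 2≉0
      3⁻¹ = inverse (+ 3) 3≉0
      -- Of the 2p - 1 terms five are taken out; that 2(p - 3) is even makes the sign of the rest
      -- positive.
      even : length (map ⟪_⟫ rest) ≡ (p ∸ 3) ℕ.+ (p ∸ 3)
      even = trans (length-map ⟪_⟫ rest) (trans (cong (_∸ 5) (trans (sym (↭-length whole)) size)) (halves p 5≤p))
       where
       halves : ∀ p → 5 ℕ.≤ p → p ℕ.+ p ∸ 1 ∸ 5 ≡ (p ∸ 3) ℕ.+ (p ∸ 3)
       halves (suc (suc (suc (suc (suc n))))) _ = trans (cong (_∸ 1) (ℕₚ.+-suc n (4 ℕ.+ n))) (trans (ℕₚ.+-suc n (3 ℕ.+ n)) (cong suc (trans (ℕₚ.+-suc n (2 ℕ.+ n)) refl)))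
       halves (suc (suc (suc (suc zero)))) (s≤s (s≤s (s≤s (s≤s ()))))
       halves (suc (suc (suc zero))) (s≤s (s≤s (s≤s ())))
       halves (suc (suc zero)) (s≤s (s≤s ()))
       halves (suc zero) (s≤s ())
      forms : Quartic p ⟪ u ⟫ ⟪ v ⟫ ⟪ w ⟫ ⟪ z ⟫
      forms = Forms.quarticForms pp 1 algebra (proj₁ 2⁻¹) (proj₁ 3⁻¹) (proj₂ 2⁻¹) (proj₂ 3⁻¹) ⟪ u ⟫ ⟪ v ⟫ ⟪ w ⟫ ⟪ z ⟫ (map ⟪_⟫ rest) (p ∸ 3) even
       (long 5 {u ∷ u ∷ v ∷ w ∷ z ∷ []} refl whole) (minimal-front whole) (sym q≡p)

    contradiction-from : (∃ λ w → Other w) → (∀ {w} → Other w → (∀ {z} → Other z → z ≡ w) → ⊥) → ⊥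
    contradiction-from (w , ow) three = [ (λ { (z , z∈U , nes , z≢w) → StandardPairs.standard-contradiction pp 5≤p U size (MinimalZeroSum.zero-sum min) few u v α β
      α-additive β-additive α-cong β-cong αu βv αv βu α≉0 β≉0 Δ≉0 pair ow (z∈U , nes) (λ e → z≢w (sym e)) })
     , (λ none → three ow (λ { {z} (z∈U , nes) → equal z (λ z≢w → none z∈U (nes , z≢w)) })) ]′
     (search (λ z → (¬? (z ≟² u) ×-dec ¬? (z ≟² v)) ×-dec ¬? (z ≟² w)) U)
     where
     equal : ∀ z → ¬ (z ≢ w) → z ≡ w
     equal z nn with z ≟² w
     ... | yes e = e
     ... | no ne = ⊥-elim (nn ne)

    shape : ℕ → ℕ → ℕ → Zn² p → List (Zn² p)
    shape i j k w = replicate i u ++ replicate j v ++ replicate k w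

    shape-value : ∀ {f : G → ℤ} → Additive p f → ∀ i j k w → f (Σ⊕ (map ⟪_⟫ (shape i j k w))) ≈[ p ] + i * f ⟪ u ⟫ + (+ j * f ⟪ v ⟫ + + k * f ⟪ w ⟫)
    shape-value {f} additive i j k w = ≈-trans (part (replicate i u) (replicate j v ++ replicate k w))
     (+-cong-≈ (additive-replicate {f = f} additive i u) (≈-trans (part (replicate j v) (replicate k w))
      (+-cong-≈ (additive-replicate {f = f} additive j v) (additive-replicate {f = f} additive k w))))
     where
     part : ∀ l l′ → f (Σ⊕ (map ⟪_⟫ (l ++ l′))) ≈[ p ] f (Σ⊕ (map ⟪_⟫ l)) + f (Σ⊕ (map ⟪_⟫ l′))
     part l l′ = ≈-trans (≈-reflexive (cong f (trans (cong Σ⊕ (map-++ ⟪_⟫ l l′)) (Σ⊕-++ (map ⟪_⟫ l) (map ⟪_⟫ l′))))) (additive _ _)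

    shape-α : ∀ i j k w → α (Σ⊕ (map ⟪_⟫ (shape i j k w))) ≈[ p ] + i + + k * α ⟪ w ⟫
    shape-α i j k w = ≈-trans (shape-value {α} α-additive i j k w) (≈-trans (+-cong-≈ (*-congˡ-≈ (+ i) αu) (+-cong-≈ (*-congˡ-≈ (+ j) αv) (≈-refl {a = + k * α ⟪ w ⟫})))
     (≈-reflexive (lem (+ i) (+ j) (+ k * α ⟪ w ⟫))))
     where
     lem : ∀ i j x → i * 1ℤ + (j * 0ℤ + x) ≡ i + x
     lem = solve-∀

    shape-β : ∀ i j k w → β (Σ⊕ (map ⟪_⟫ (shape i j k w))) ≈[ p ] + j + + k * β ⟪ w ⟫
    shape-β i j k w = ≈-trans (shape-value {β} β-additive i j k w) (≈-trans (+-cong-≈ (*-congˡ-≈ (+ i) βu) (+-cong-≈ (*-congˡ-≈ (+ j) βv) (≈-refl {a = + k * β ⟪ w ⟫})))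
     (≈-reflexive (lem (+ i) (+ j) (+ k * β ⟪ w ⟫))))
     where
     lem : ∀ i j x → i * 0ℤ + (j * 1ℤ + x) ≡ j + x
     lem = solve-∀

    shape-length : ∀ i j k w → length (shape i j k w) ≡ i ℕ.+ (j ℕ.+ k)
    shape-length i j k w = trans (length-++ (replicate i u)) (cong₂ ℕ._+_ (length-replicate i)
     (trans (length-++ (replicate j v)) (cong₂ ℕ._+_ (length-replicate j) (length-replicate k))))

    -- With a + A + 1 = p = b + B + 1 the length 2p - 1 gives c = A + B + 1, the shape required by
    -- `ThreeValues`. That no multiplicity exceeds p - 2 makes A and B positive.
    three-values : ∀ {w} a b c → U ↭ shape a b c w → a ℕ.+ 2 ℕ.≤ p → b ℕ.+ 2 ℕ.≤ p → c ℕ.+ 2 ℕ.≤ p → ⊥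
    three-values {w} a b c σ la lb lc with ℕₚ.m≤n⇒∃[o]m+o≡n la | ℕₚ.m≤n⇒∃[o]m+o≡n lb
    ... | o , ea | o′ , eb = finish (suc o) (suc o′) (trans (sym (ℕₚ.+-assoc a 2 o)) ea) (trans (sym (ℕₚ.+-assoc b 2 o′)) eb) (s≤s z≤n) (s≤s z≤n)
     where
     finish : ∀ A B → a ℕ.+ suc A ≡ p → b ℕ.+ suc B ≡ p → 0 ℕ.< A → 0 ℕ.< B → ⊥
     finish A B ea eb A>0 B>0 = ThreeValues.three-values-contradiction pp {α ⟪ w ⟫} {β ⟪ w ⟫} {a} {b} A B ea eb A>0 B>0
       (subst (ℕ._≤ p) (trans (ℕₚ.+-comm c 2) (cong (2 ℕ.+_) c≡)) lc)
       (subst (λ c → + a + + c * α ⟪ w ⟫ ≈[ p ] 0ℤ) c≡ (≈-trans (≈-sym (shape-α a b c w)) (≈-trans (α-cong whole) (additive-𝟎 {f = α} α-additive))))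
       (subst (λ c → + b + + c * β ⟪ w ⟫ ≈[ p ] 0ℤ) c≡ (≈-trans (≈-sym (shape-β a b c w)) (≈-trans (β-cong whole) (additive-𝟎 {f = β} β-additive))))
       (subst (λ c → ∀ i j k → i ℕ.≤ a → j ℕ.≤ b → k ℕ.≤ c → + i + + k * α ⟪ w ⟫ ≈[ p ] 0ℤ → + j + + k * β ⟪ w ⟫ ≈[ p ] 0ℤ → k ≡ 0 ⊎ k ≡ c) c≡ minimal)
      where
      total : a ℕ.+ (b ℕ.+ c) ≡ p ℕ.+ p ∸ 1
      total = trans (sym (shape-length a b c w)) (trans (sym (↭-length σ)) size)
      c≡ : c ≡ suc (A ℕ.+ B)
      c≡ = ℕₚ.+-cancelˡ-≡ b _ _ (ℕₚ.+-cancelˡ-≡ a _ _ (trans total (trans (cong₂ (λ m n → m ℕ.+ n ∸ 1) (sym ea) (sym eb)) (cong (_∸ 1) (rearrange a A b B)))))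
       where
       rearrange : ∀ a A b B → a ℕ.+ suc A ℕ.+ (b ℕ.+ suc B) ≡ suc (a ℕ.+ (b ℕ.+ suc (A ℕ.+ B)))
       rearrange = ℕ-solve-∀
      min′ : MinimalZeroSum p (map ⟪_⟫ (shape a b c w))
      min′ = minimal-↭ (map⁺ ⟪_⟫ σ) min
      whole : Σ⊕ (map ⟪_⟫ (shape a b c w)) ≈²[ p ] 𝟎
      whole = MinimalZeroSum.zero-sum min′
      minimal : ∀ i j k → i ℕ.≤ a → j ℕ.≤ b → k ℕ.≤ c → + i + + k * α ⟪ w ⟫ ≈[ p ] 0ℤ → + j + + k * β ⟪ w ⟫ ≈[ p ] 0ℤ → k ≡ 0 ⊎ k ≡ c
      minimal i j k i≤a j≤b k≤c zα zβ = conclude (MinimalZeroSum.minimal min′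
        (⊆-map ⟪_⟫ (⊆-++ (replicate-⊆ u i≤a) (⊆-++ (replicate-⊆ v j≤b) (replicate-⊆ w k≤c))))
        (vanishing (Σ⊕ (map ⟪_⟫ (shape i j k w))) (≈-trans (shape-α i j k w) zα) (≈-trans (shape-β i j k w) zβ)))
       where
       len : length (map ⟪_⟫ (shape i j k w)) ≡ i ℕ.+ (j ℕ.+ k)
       len = trans (length-map ⟪_⟫ (shape i j k w)) (shape-length i j k w)
       conclude : map ⟪_⟫ (shape i j k w) ≡ [] ⊎ length (map ⟪_⟫ (shape i j k w)) ≡ length (map ⟪_⟫ (shape a b c w)) → k ≡ 0 ⊎ k ≡ c
       conclude (inj₁ e) = inj₁ (ℕₚ.m+n≡0⇒n≡0 j (ℕₚ.m+n≡0⇒n≡0 i (trans (sym len) (cong length e))))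
       conclude (inj₂ e) = inj₂ (ℕₚ.≤-antisym k≤c (ℕₚ.+-cancelˡ-≤ b c k (ℕₚ.+-cancelˡ-≤ a (b ℕ.+ c) (b ℕ.+ k) (ℕₚ.≤-trans
        (ℕₚ.≤-reflexive (trans (sym (trans (length-map ⟪_⟫ (shape a b c w)) (shape-length a b c w))) (trans (sym e) len)))
        (ℕₚ.+-mono-≤ i≤a (ℕₚ.+-monoˡ-≤ k j≤b))))))

    few-after : ∀ {l l′} → U ↭ l ++ l′ → ∀ x → count x l′ ℕ.+ 2 ℕ.≤ p
    few-after {l} {l′} σ x = ℕₚ.≤-trans (ℕₚ.+-monoˡ-≤ 2 (subst (count x l′ ℕ.≤_) (sym (trans (count-↭ x σ) (count-++ x l l′))) (ℕₚ.m≤n+m (count x l′) (count x l)))) (few x)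

    one-other-value : (O : List (Zn² p)) (b : ℕ) → U ↭ replicate (count u U) u ++ replicate b v ++ O → b ℕ.+ 2 ℕ.≤ p →
           All Other O → ∀ {w} → (∀ {z} → Other z → z ≡ w) → ⊥
    one-other-value O b σ lb others {w} only = three-values (count u U) b (length O) (subst (λ l → U ↭ replicate (count u U) u ++ replicate b v ++ l) O≡ σ) (few u) lb
      (subst (λ n → n ℕ.+ 2 ℕ.≤ p) (trans (cong (count w) O≡) (count-replicate w (length O)))
       (few-after {replicate (count u U) u ++ replicate b v} (↭-trans σ (↭-reflexive (sym (++-assoc (replicate (count u U) u) (replicate b v) O)))) w))
     where
     O≡ : O ≡ replicate (length O) w
     O≡ = constant-list w O (All.map only others)

   basis-contradiction : ⊥
   basis-contradiction with gather u U
   ... | r₁ , σ₁ , ne₁ with gather v r₁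
   ...   | O , σ₂ , ne₂ = contradiction-from (witness O others (ℕₚ.≤-trans (s≤s z≤n) 3≤O)) (λ _ → one-other-value O (count v r₁) σ (few-after {replicate (count u U) u} σ₁ v) others)
    where
    σ : U ↭ replicate (count u U) u ++ replicate (count v r₁) v ++ O
    σ = ↭-trans σ₁ (++⁺ˡ (replicate (count u U) u) σ₂)
    combine : ∀ {l} → (∀ {x} → x ∈ l → x ∈ U) → All (_≢ u) l → All (_≢ v) l → All Other l
    combine sub [] [] = []
    combine sub (a ∷ as) (b ∷ bs) = (sub (here refl) , a , b) ∷ combine (λ z → sub (there z)) as bs
    after : ∀ {A : Set} {P : A → Set} (l : List A) {l′} → All P (l ++ l′) → All P l′
    after [] all = all
    after (_ ∷ l) (_ ∷ all) = after l all
    others : All Other O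
    others = combine (λ x∈O → ∈-resp-↭ (↭-sym σ) (∈-++⁺ʳ (replicate (count u U) u) (∈-++⁺ʳ (replicate (count v r₁) v) x∈O))) (after (replicate (count v r₁) v) (All-resp-↭ σ₂ ne₁)) ne₂
    3≤O : 3 ℕ.≤ length O
    3≤O = room (count u U) (count v r₁) (length O) (few u) (few-after {replicate (count u U) u} σ₁ v)
     (trans (sym (trans (length-++ (replicate (count u U) u)) (cong₂ ℕ._+_ (length-replicate (count u U)) (trans (length-++ (replicate (count v r₁) v)) (cong (ℕ._+ length O) (length-replicate (count v r₁)))))))
      (trans (sym (↭-length σ)) size))
     where
     room : ∀ a b o → a ℕ.+ 2 ℕ.≤ p → b ℕ.+ 2 ℕ.≤ p → a ℕ.+ (b ℕ.+ o) ≡ p ℕ.+ p ∸ 1 → 3 ℕ.≤ o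
     room a b o la lb e = ℕₚ.+-cancelˡ-≤ b 3 o (ℕₚ.+-cancelˡ-≤ a (b ℕ.+ 3) (b ℕ.+ o) (ℕₚ.≤-trans (ℕₚ.≤-reflexive (cong (_∸ 1) (rearrange a b)))
      (ℕₚ.≤-trans (ℕₚ.∸-monoˡ-≤ 1 (ℕₚ.+-mono-≤ la lb)) (ℕₚ.≤-reflexive (sym e)))))
      where
      rearrange : ∀ a b → suc (a ℕ.+ (b ℕ.+ 3)) ≡ a ℕ.+ 2 ℕ.+ (b ℕ.+ 2)
      rearrange = ℕ-solve-∀
    witness : ∀ l → All Other l → 0 ℕ.< length l → ∃ Other
    witness (w ∷ l) (ow ∷ _) _ = w , ow

  prime-contradiction : ⊥
  prime-contradiction = start U refl
   where
   start : ∀ l → l ≡ U → ⊥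
   start [] refl = ℕₚ.<⇒≱ (s≤s z≤n) 9≤U
   start (v ∷ _) refl = finish (double (here refl))
    where
    finish : (∃₂ λ u r → u ≢ v × U ↭ u ∷ u ∷ r) → ⊥
    finish (u , r , u≢v , π) = WithBasis.basis-contradiction (here refl) u≢v π

-- Soundness of the exhaustive search

module SearchSoundness where

 open TranslationRing
 open GroupAlgebras
 open MultilinearForms
 open QuarticClassification
 open ZeroSumSequences
 open SearchProcedure
 open import Data.Bool using (Bool; true; false; _∧_; if_then_else_; T)
 open import Data.Nat as ℕ using (ℕ; zero; suc; _∸_; s≤s; z≤n; _<ᵇ_)
 open import Data.Integer using (ℤ; +_; _+_; _*_; -_; 0ℤ; 1ℤ)
 open import Data.Unit using (tt)
 open import Data.List using (List; []; _∷_; _++_; length; take; drop)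
 open import Data.List.Properties using (length-++; length-drop; take++drop≡id)
 open import Data.List.Relation.Unary.All as All using (All; []; _∷_)
 open import Data.List.Relation.Unary.All.Properties using () renaming (++⁺ to All-++; drop⁺ to All-drop; take⁺ to All-take)
 open import Data.List.Relation.Binary.Sublist.Propositional using (_⊆_; []; _∷_; _∷ʳ_; minimum)

 open Candidate

 at-++ : ∀ {A : Set} (d : A) xs ys i → (at d (xs ++ ys) i ≡ at d xs i) ⊎ (∃ λ k → i ≡ length xs ℕ.+ k × at d (xs ++ ys) i ≡ at d ys k)
 at-++ d []       ys i       = inj₂ (i , refl , refl)
 at-++ d (x ∷ xs) ys zero    = inj₁ refl
 at-++ d (x ∷ xs) ys (suc i) with at-++ d xs ys i
 ... | inj₁ e = inj₁ e
 ... | inj₂ (k , e , e′) = inj₂ (k , cong suc e , e′)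

 at-drop : ∀ {A : Set} (d : A) n l i → at d (drop n l) i ≡ at d l (n ℕ.+ i)
 at-drop d zero    l       i = refl
 at-drop d (suc n) []      i = refl
 at-drop d (suc n) (x ∷ l) i = at-drop d n l i

 at-take : ∀ {A : Set} (d : A) n l i → (at d (take n l) i ≡ d) ⊎ (at d (take n l) i ≡ at d l i)
 at-take d zero    l       i       = inj₁ refl
 at-take d (suc n) []      i       = inj₁ refl
 at-take d (suc n) (x ∷ l) zero    = inj₂ refl
 at-take d (suc n) (x ∷ l) (suc i) = at-take d n l i

 at-rotate : ∀ {A : Set} (d : A) n l i → n ℕ.≤ length l →
      (at d (rotate n l) i ≡ d) ⊎ (∃ λ k → at d (rotate n l) i ≡ at d l k × (+ k ≈[ length l ] + i + + n))
 at-rotate d n l i n≤l with at-++ d (drop n l) (take n l) i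
 ... | inj₁ e = inj₂ (n ℕ.+ i , trans e (at-drop d n l i) , ≈-reflexive (trans (ℤₚ.pos-+ n i) (ℤₚ.+-comm (+ n) (+ i))))
 ... | inj₂ (k , e , e′) with at-take d n l k
 ...   | inj₁ f = inj₁ (trans e′ f)
 ...   | inj₂ f = inj₂ (k , trans e′ f , ≈-sym (mod-by 1ℤ (trans (sym (ℤₚ.pos-+ i n)) (trans (cong +_ i+n) (trans (ℤₚ.pos-+ k (length l)) (cong (λ z → + k + z) (sym (ℤₚ.*-identityˡ (+ length l)))))))))
  where
  i+n : i ℕ.+ n ≡ k ℕ.+ length l
  i+n = trans (cong (ℕ._+ n) (trans e (ℕₚ.+-comm (length (drop n l)) k))) (trans (ℕₚ.+-assoc k (length (drop n l)) n)
   (cong (k ℕ.+_) (trans (cong (ℕ._+ n) (length-drop n l)) (ℕₚ.m∸n+n≡m n≤l))))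

 length-rotate : ∀ {A : Set} n (l : List A) → length (rotate n l) ≡ length l
 length-rotate n l = trans (length-++ (drop n l)) (trans (ℕₚ.+-comm (length (drop n l)) (length (take n l)))
  (trans (sym (length-++ (take n l))) (cong length (take++drop≡id n l))))

 length-or : ∀ r s → length r ≡ length s → length (or r s) ≡ length r
 length-or []      []      e = refl
 length-or (a ∷ r) (b ∷ s) e = cong suc (length-or r s (ℕₚ.suc-injective e))

 at-or : ∀ r s j → at false (or r s) j ≡ true → (at false r j ≡ true) ⊎ (at false s j ≡ true)
 at-or (true  ∷ r) (b ∷ s) zero    e = inj₁ refl
 at-or (false ∷ r) (b ∷ s) zero    e = inj₂ e
 at-or (a     ∷ r) (b ∷ s) (suc j) e = at-or r s j e

 entry-or-rotated : ∀ n t t′ i j → entry (or-rotated n t t′) i j ≡ true → (entry t i j ≡ true) ⊎ (at false (rotate n (at [] t′ i)) j ≡ true)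
 entry-or-rotated n (r ∷ t) (s ∷ t′) zero    j e = at-or r (rotate n s) j e
 entry-or-rotated n (r ∷ t) (s ∷ t′) (suc i) j e = entry-or-rotated n t t′ i j e

 module Search (N : ℕ) where

  Shaped : Table → Set
  Shaped t = length t ≡ N × All (λ r → length r ≡ N) t

  -- One direction is enough: a marked entry is an actual sum. A sum left unmarked would only weaken
  -- the pruning.
  Sound : Table → List G → Set
  Sound t L = ∀ i j → entry t i j ≡ true → ∃ λ S → S ⊆ L × (Σ⊕ S ≈²[ N ] (+ i , + j))

  record Matches (c : Candidate) (g : G) : Set where
   constructor matches
   field
    x-small : -x c ℕ.≤ N
    y-small : -y c ℕ.≤ N
    negated : Vanishes N (g ⊕ (+ -x c , + -y c))

  -- `L` is the part already entered into the table and `R` the part still to come.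
  Free : List G → List G → Set
  Free L R = ∀ {S T} → S ⊆ L → T ⊆ R → Vanishes N (Σ⊕ S ⊕ Σ⊕ T) → T ≡ []

  -- The remaining sequence cut into blocks of equal elements in the order of the candidates, the
  -- normal form that the search enumerates.
  data Fill : List Candidate → List G → Set where
   []    : Fill [] []
   block : ∀ {c cs B R} → All (Matches c) B → length B ℕ.≤ limit c → Fill cs R → Fill (c ∷ cs) (B ++ R)

  sum≈ : ∀ {a b c d} → a ≈[ N ] c → b + d ≈[ N ] 0ℤ → c ≡ d → a + (b + 0ℤ) ≈[ N ] 0ℤ
  sum≈ {a} {b} {c} e z refl = ≈-trans (+-cong-≈ e (≈-reflexive (ℤₚ.+-identityʳ b))) (≈-trans (≈-reflexive (ℤₚ.+-comm c b)) z)

  -- A blocked candidate has its negative among the sums over `L`, so adding it to those terms would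
  -- give a zero-sum.
  not-blocked : ∀ {t L c g R} → Sound t L → Free L (g ∷ R) → Matches c g → blocked t c ≡ true → ⊥
  not-blocked {t} {L} {c} {g} {R} sound free (matches _ _ (z , z′)) b with sound (-x c) (-y c) b
  ... | S , s , e , e′ with free {T = g ∷ []} s (refl ∷ minimum R) (sum≈ {b = proj₁ g} e z refl , sum≈ {b = proj₂ g} e′ z′ refl)
  ...   | ()

  move : ∀ {L g R} → Free L (g ∷ R) → Free (g ∷ L) R
  move {L} {g} {R} free (_ ∷ʳ s) t z = free s (g ∷ʳ t) z
  move {L} {g} {R} free {_ ∷ S} {T} (refl ∷ s) t z with free s (refl ∷ t) (subst (Vanishes N) (trans (cong (_⊕ Σ⊕ T) (⊕-comm g (Σ⊕ S))) (⊕-assoc (Σ⊕ S) g (Σ⊕ T))) z)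
  ... | ()

  shaped-or-rotated : ∀ n t t′ → length t ≡ length t′ → All (λ r → length r ≡ N) t → All (λ r → length r ≡ N) t′ →
       length (or-rotated n t t′) ≡ length t × All (λ r → length r ≡ N) (or-rotated n t t′)
  shaped-or-rotated n []      []       e [] [] = refl , []
  shaped-or-rotated n (r ∷ t) (s ∷ t′) e (a ∷ as) (b ∷ bs) with shaped-or-rotated n t t′ (ℕₚ.suc-injective e) as bs
  ... | e′ , all = cong suc e′ , trans (length-or r (rotate n s) (trans a (sym (trans (length-rotate n s) b)))) a ∷ all

  all-rotate : ∀ {P : List Bool → Set} n t → All P t → All P (rotate n t)
  all-rotate n t all = All-++ (All-drop n all) (All-take n all)

  add-shaped : ∀ c {t} → Shaped t → Shaped (add c t)
  add-shaped c {t} (e , all) with shaped-or-rotated (-y c) t (rotate (-x c) t) (sym (length-rotate (-x c) t)) all (all-rotate (-x c) t all)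
  ... | e′ , all′ = trans e′ e , all′

  shaped-row : ∀ (t : Table) i → All (λ r → length r ≡ N) t → (at [] t i ≡ []) ⊎ (length (at [] t i) ≡ N)
  shaped-row []      i       []        = inj₁ refl
  shaped-row (r ∷ t) zero    (e ∷ _)   = inj₂ e
  shaped-row (r ∷ t) (suc i) (_ ∷ all) = shaped-row t i all

  add-sound : ∀ {c g t L} → Shaped t → Matches c g → Sound t L → Sound (add c t) (g ∷ L)
  add-sound {c} {g} {t} {L} (len , all) (matches x≤ y≤ (z , z′)) sound i j e with entry-or-rotated (-y c) t (rotate (-x c) t) i j e
  ... | inj₁ old with sound i j old
  ...   | S , s , es = S , g ∷ʳ s , es
  add-sound {c} {g} {t} {L} (len , all) (matches x≤ y≤ (z , z′)) sound i j e | inj₂ new with at-rotate [] (-x c) t i (subst (-x c ℕ.≤_) (sym len) x≤)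
  ... | inj₁ empty = ⊥-elim (none (-y c) (subst (λ r → at false (rotate (-y c) r) j ≡ true) empty new))
   where
   none : ∀ n → at false (rotate {Bool} n []) j ≡ true → ⊥
   none zero ()
   none (suc n) ()
  ... | inj₂ (k , ek , k≈) = locate (shaped-row t k all)
   where
   new′ : at false (rotate (-y c) (at [] t k)) j ≡ true
   new′ = subst (λ r → at false (rotate (-y c) r) j ≡ true) ek new
   shift-back : ∀ {a b s m n} → s ≈[ N ] + m → + m ≈[ N ] + n + b → a + b ≈[ N ] 0ℤ → a + s ≈[ N ] + n
   shift-back {a} {b} {s} {m} {n} es em eb = ≈-trans (+-cong-≈ (≈-refl {a = a}) (≈-trans es em)) (≈-trans (≈-reflexive (lem a (+ n) b)) (+-vanishes-≈ eb))
    where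
    lem : ∀ a n b → a + (n + b) ≡ n + (a + b)
    lem = solve-∀
   locate : (at [] t k ≡ []) ⊎ (length (at [] t k) ≡ N) → ∃ λ S → S ⊆ g ∷ L × (Σ⊕ S ≈²[ N ] (+ i , + j))
   locate (inj₁ empty) = ⊥-elim (none (-y c) (subst (λ r → at false (rotate (-y c) r) j ≡ true) empty new′))
    where
    none : ∀ n → at false (rotate {Bool} n []) j ≡ true → ⊥
    none zero ()
    none (suc n) ()
   locate (inj₂ len′) with at-rotate false (-y c) (at [] t k) j (subst (-y c ℕ.≤_) (sym len′) y≤)
   ... | inj₁ f with trans (sym f) new′
   ...   | ()
   locate (inj₂ len′) | inj₂ (l , el , l≈) with sound k l (trans (sym el) new′)
   ... | S , s , es , es′ = g ∷ S , refl ∷ s , shift-back {a = proj₁ g} {b = + -x c} es (subst (λ m → + k ≈[ m ] + i + + -x c) len k≈) z , shift-back {a = proj₂ g} {b = + -y c} es′ (subst (λ m → + l ≈[ m ] + j + + -y c) len′ l≈) z′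

  capacity-bound : ∀ {cs R} → Fill cs R → length R ℕ.≤ capacity cs
  capacity-bound [] = z≤n
  capacity-bound (block {B = B} _ le fill) = ℕₚ.≤-trans (ℕₚ.≤-reflexive (length-++ B)) (ℕₚ.+-mono-≤ le (capacity-bound fill))

  free-suffix : ∀ {L} B {R} → Free L (B ++ R) → Free L R
  free-suffix B free s t z = free′ B free s t z
   where
   free′ : ∀ {L} B {R} → Free L (B ++ R) → Free L R
   free′ []      free = free
   free′ (b ∷ B) free = free′ B (λ s t z → free s (b ∷ʳ t) z)

  all-available : ∀ {t L cs R} → Sound t L → Free L R → Fill cs R → Fill (available t cs) R
  all-available sound free [] = []
  all-available {t} {L} {c ∷ cs} sound free (block {B = B} ms le fill) = decide (blocked t c) refl B ms le free
   where
   decide : ∀ b → blocked t c ≡ b → ∀ B → All (Matches c) B → length B ℕ.≤ limit c → Free L (B ++ _) → Fill (if b then available t cs else c ∷ available t cs) (B ++ _)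
   decide false _ B ms le free = block ms le (all-available sound (free-suffix B free) fill)
   decide true  e [] ms le free = all-available sound free fill
   decide true  e (g ∷ B) (m ∷ ms) le free = ⊥-elim (not-blocked {t} {L} {c} sound free m e)

  ∧-true : ∀ {a b} → a ∧ b ≡ true → a ≡ true × b ≡ true
  ∧-true {true} {true} _ = refl , refl

  mutual
   -- Induction on the fuel, following the branch of the search that agrees with the first block of
   -- the filling.
   impossible-sound : ∀ fuel {t cs n L R} → impossible fuel t cs n ≡ true → Shaped t → Sound t L → Free L R → Fill cs R → length R ≡ n → ⊥
   impossible-sound (suc fuel) {t} {cs} {suc n} e shaped sound free fill len =
    impossible-from-sound fuel e shaped sound free (all-available sound free fill) len refl (s≤s z≤n)

   impossible-from-sound : ∀ fuel {t cs total n L R} → impossible-from fuel t cs total n ≡ true → Shaped t → Sound t L → Free L R → Fill cs R →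
        length R ≡ n → total ≡ capacity cs → 0 ℕ.< n → ⊥
   impossible-from-sound (suc fuel) {cs = []} e shaped sound free [] refl _ ()
   impossible-from-sound (suc fuel) {t} {c ∷ cs} {total} {n} {L} e shaped sound free (block {B = B} {R} ms le fill) len refl 0<n = decide (total <ᵇ n) refl e
    where
    decide : ∀ b → (total <ᵇ n) ≡ b → (if b then true else (impossible-with fuel t c cs (limit c) n ∧ impossible-from fuel t cs (total ∸ limit c) n)) ≡ true → ⊥
    decide true small _ = ℕₚ.<⇒≱ (ℕₚ.<ᵇ⇒< total n (subst T (sym small) tt)) (ℕₚ.≤-trans (ℕₚ.≤-reflexive (sym len)) (capacity-bound (block {c} ms le fill)))
    decide false _ both with ∧-true {impossible-with fuel t c cs (limit c) n} both
    ... | first , second = copies B ms le free len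
     where
     copies : ∀ B → All (Matches c) B → length B ℕ.≤ limit c → Free L (B ++ R) → length (B ++ R) ≡ n → ⊥
     copies [] ms le free len = impossible-from-sound fuel second shaped sound free fill len (ℕₚ.m+n∸m≡n (limit c) (capacity cs)) 0<n
     copies (g ∷ B) ms le free len = impossible-with-sound fuel first shaped sound free ms le fill len

   impossible-with-sound : ∀ fuel {t c cs k n L g B R} → impossible-with fuel t c cs k n ≡ true → Shaped t → Sound t L → Free L (g ∷ B ++ R) →
        All (Matches c) (g ∷ B) → suc (length B) ℕ.≤ k → Fill cs R → length (g ∷ B ++ R) ≡ n → ⊥
   impossible-with-sound (suc fuel) {t} {c} {cs} {suc k} {suc n} {L} {g} {B} {R} e shaped sound free (m ∷ ms) (s≤s le) fill len = decide (blocked t c) refl e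
    where
    decide : ∀ b → blocked t c ≡ b → (if b then true else impossible-next fuel (add c t) c cs k n) ≡ true → ⊥
    decide true  b _ = not-blocked {t} {L} {c} sound free m b
    decide false _ both with ∧-true {impossible fuel (add c t) cs n} both
    ... | first , second = copies B ms le (move free) (ℕₚ.suc-injective len)
     where
     copies : ∀ B → All (Matches c) B → length B ℕ.≤ k → Free (g ∷ L) (B ++ R) → length (B ++ R) ≡ n → ⊥
     copies [] ms le free len = impossible-sound fuel first (add-shaped c shaped) (add-sound {c} shaped m sound) free fill len
     copies (h ∷ B) ms le free len = impossible-with-sound fuel second (add-shaped c shaped) (add-sound {c} shaped m sound) free ms le fill len

-- Feeding a zero-sum free sequence into the search

module SearchSetup where

 open TranslationRing
 open GroupAlgebras
 open MultilinearForms
 open QuarticClassification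
 open ZeroSumSequences
 open PrimeFields
 open ThreeDistinctValues
 open PrimeModulus
 open SearchSoundness
 open ResidueVectors
 open SearchProcedure
 open SearchResults
 open import Data.Bool using (true; false; _∨_; if_then_else_; T)
 open import Data.Nat as ℕ using (ℕ; zero; suc; _∸_; s≤s; NonZero; _≤ᵇ_)
 open import Data.Nat.DivMod using (_%_; _/_; m%n<n; m≡m%n+[m/n]*n)
 open import Data.Integer using (ℤ; +_; _+_; _*_; -_; _-_; 0ℤ; 1ℤ)
 open import Data.Fin as Fin using (Fin; toℕ)
 open import Data.Fin.Properties using (toℕ<n)
 open import Data.Unit using (tt)
 open import Data.List using ([]; _∷_; _++_; map; length; replicate; reverse; allFin; cartesianProduct; filter)
 open import Data.List.Properties using (length-++; length-replicate; map-++; length-map; ++-assoc)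
 open import Data.List.Relation.Unary.All as All using (All; []; _∷_)
 open import Data.List.Relation.Unary.Any as Any using (here; there)
 open import Data.List.Relation.Unary.Any.Properties using (reverse⁺)
 open import Data.List.Membership.Propositional.Properties using (∈-++⁺ʳ; ∈-filter⁺; ∈-cartesianProduct⁺; ∈-allFin)
 open import Data.List.Relation.Binary.Sublist.Propositional using (_⊆_; []; _∷_)
 open import Data.List.Relation.Binary.Sublist.Propositional.Properties using () renaming (map⁺ to ⊆-map; ++⁺ to ⊆-++)
 open import Data.List.Relation.Binary.Permutation.Propositional using (_↭_; ↭-sym; ↭-trans; ↭-refl; ↭-reflexive)
 open import Data.List.Relation.Binary.Permutation.Propositional.Properties using (map⁺; ↭-length; ++⁺ˡ; ∈-resp-↭)
 open import Relation.Nullary.Decidable.Core using (T?)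

 %-≈ : ∀ m n .{{_ : NonZero n}} → + (m % n) ≈[ n ] + m
 %-≈ m n = ≈-sym (mod-by (+ (m / n)) (trans (cong +_ (m≡m%n+[m/n]*n m n)) (trans (ℤₚ.pos-+ (m % n) (m / n ℕ.* n)) (cong (λ z → + (m % n) + z) (ℤₚ.pos-* (m / n) n)))))

 below-sound : ∀ n f → below n f ≡ true → ∀ {k} → k ℕ.< n → f k ≡ true
 below-sound (suc n) f e {k} (s≤s k≤n) with f n in eq | ℕₚ.m≤n⇒m<n∨m≡n k≤n
 ... | true | inj₁ k<n = below-sound n f e k<n
 ... | true | inj₂ refl = eq

 module Exhaustion (N p : ℕ) .{{_ : NonZero N}} .{{_ : NonZero p}} where

  open Search N

  open Candidates N p public

  point : ∀ ok {g} → T (ok g) → g ∈ points ok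
  point ok {x , y} good = ∈-filter⁺ (λ g → T? (ok g)) (∈-cartesianProduct⁺ (reverse⁺ (∈-allFin x)) (reverse⁺ (∈-allFin y))) good

  complementary : ∀ (x : Fin N) → + toℕ x + + ((N ∸ toℕ x) % N) ≈[ N ] 0ℤ
  complementary x = ≈-trans (+-cong-≈ (≈-refl {a = + toℕ x}) (%-≈ (N ∸ toℕ x) N))
   (≈-trans (≈-reflexive (cong +_ (ℕₚ.m+[n∸m]≡n (ℕₚ.<⇒≤ (toℕ<n x))))) (m≈0 N))

  candidate-matches : ∀ m₁ m₂ g → Matches (candidate-of m₁ m₂ g) ⟪ g ⟫
  candidate-matches m₁ m₂ (x , y) = matches (ℕₚ.<⇒≤ (m%n<n (N ∸ toℕ x) N)) (ℕₚ.<⇒≤ (m%n<n (N ∸ toℕ y) N)) (complementary x , complementary y)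

  all-replicate : ∀ {P : G → Set} k (g : Zn² N) → P ⟪ g ⟫ → All P (map ⟪_⟫ (replicate k g))
  all-replicate zero    g pg = []
  all-replicate (suc k) g pg = pg ∷ all-replicate k g pg

  fill : ∀ m₁ m₂ gs R → (∀ {x} → x ∈ R → x ∈ gs) → (∀ g → count g R ℕ.≤ limit-of m₁ m₂ g) →
      ∃ λ R′ → R ↭ R′ × Fill (map (candidate-of m₁ m₂) gs) (map ⟪_⟫ R′)
  fill m₁ m₂ [] [] sub le = [] , ↭-refl , []
  fill m₁ m₂ [] (x ∷ R) sub le with sub (here refl)
  ... | ()
  fill m₁ m₂ (g ∷ gs) R sub le with gather g R
  ... | R₁ , π , ne with fill m₁ m₂ gs R₁ sub₁ (λ h → ℕₚ.≤-trans (ℕₚ.≤-trans (ℕₚ.m≤n+m (count h R₁) (count h (replicate (count g R) g))) (ℕₚ.≤-reflexive (sym (trans (count-↭ h π) (count-++ h (replicate (count g R) g) R₁))))) (le h))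
   where
   outside : ∀ {x} → x ≢ g → x ∈ g ∷ gs → x ∈ gs
   outside ne (here e) = ⊥-elim (ne e)
   outside ne (there x∈) = x∈
   sub₁ : ∀ {x} → x ∈ R₁ → x ∈ gs
   sub₁ x∈R₁ = outside (All.lookup ne x∈R₁) (sub (∈-resp-↭ (↭-sym π) (∈-++⁺ʳ (replicate (count g R) g) x∈R₁)))
  ...   | R′ , π′ , f = replicate (count g R) g ++ R′ , ↭-trans π (++⁺ˡ (replicate (count g R) g) π′)
   , subst (Fill (map (candidate-of m₁ m₂) (g ∷ gs))) (sym (map-++ ⟪_⟫ (replicate (count g R) g) R′))
    (block (all-replicate {Matches (candidate-of m₁ m₂ g)} (count g R) g (candidate-matches m₁ m₂ g))
     (ℕₚ.≤-trans (ℕₚ.≤-reflexive (trans (length-map ⟪_⟫ (replicate (count g R) g)) (length-replicate (count g R)))) (le g)) f)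

  at-cells : ∀ m n j₀ j → at false (cells m n j₀) j ≡ true → j₀ ℕ.+ j ℕ.≤ m
  at-cells m (suc n) j₀ zero    e = subst (ℕ._≤ m) (sym (ℕₚ.+-identityʳ j₀)) (ℕₚ.≤ᵇ⇒≤ j₀ m (subst T (sym e) tt))
  at-cells m (suc n) j₀ (suc j) e = subst (ℕ._≤ m) (sym (ℕₚ.+-suc j₀ j)) (at-cells m n (suc j₀) j e)

  length-cells : ∀ m n j₀ → length (cells m n j₀) ≡ n
  length-cells m zero j₀ = refl
  length-cells m (suc n) j₀ = cong suc (length-cells m n (suc j₀))

  at-blank : ∀ n j → at false (replicate n false) j ≡ true → ⊥
  at-blank (suc n) (suc j) e = at-blank n j e

  entry-rows : ∀ r m n i₀ i j → entry (rows r m n i₀) i j ≡ true → i₀ ℕ.+ i ℕ.≤ m × at false r j ≡ true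
  entry-rows r m (suc n) i₀ (suc i) j e with entry-rows r m n (suc i₀) i j e
  ... | le , e′ = subst (ℕ._≤ m) (sym (ℕₚ.+-suc i₀ i)) le , e′
  entry-rows r m (suc n) i₀ zero j e = decide (i₀ ≤ᵇ m) refl e
   where
   decide : ∀ b → (i₀ ≤ᵇ m) ≡ b → at false (if b then r else replicate (length r) false) j ≡ true → i₀ ℕ.+ 0 ℕ.≤ m × at false r j ≡ true
   decide true le e = subst (ℕ._≤ m) (sym (ℕₚ.+-identityʳ i₀)) (ℕₚ.≤ᵇ⇒≤ i₀ m (subst T (sym le) tt)) , e
   decide false _ e = ⊥-elim (at-blank (length r) j e)

  rows-shaped : ∀ r m n i₀ → length (rows r m n i₀) ≡ n × All (λ s → length s ≡ length r) (rows r m n i₀)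
  rows-shaped r m zero i₀ = refl , []
  rows-shaped r m (suc n) i₀ with rows-shaped r m n (suc i₀)
  ... | e , all = cong suc e , decide (i₀ ≤ᵇ m) ∷ all
   where
   decide : ∀ b → length (if b then r else replicate (length r) false) ≡ length r
   decide true = refl
   decide false = length-replicate (length r)

  initial-shaped : ∀ m₁ m₂ → Shaped (initial N m₁ m₂)
  initial-shaped m₁ m₂ with rows-shaped (cells m₂ N 0) m₁ N 0
  ... | e , all = e , All.map (λ e → trans e (length-cells m₂ N 0)) all

  module _ {e₁ e₂ : Zn² N} (is-e₁ : ⟪ e₁ ⟫ ≡ (1ℤ , 0ℤ)) (is-e₂ : ⟪ e₂ ⟫ ≡ (0ℤ , 1ℤ)) where

   Σ-replicate : ∀ k (g : Zn² N) → Σ⊕ (map ⟪_⟫ (replicate k g)) ≡ + k · ⟪ g ⟫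
   Σ-replicate zero    (x , y) = refl
   Σ-replicate (suc k) g@(x , y) = trans (cong (⟪ g ⟫ ⊕_) (Σ-replicate k g)) (cong₂ _,_ (lem (+ toℕ x) (+ k)) (lem (+ toℕ y) (+ k)))
    where
    lem : ∀ a n → a + n * a ≡ (1ℤ + n) * a
    lem = solve-∀

   initial-sound : ∀ m₁ m₂ → Sound (initial N m₁ m₂) (map ⟪_⟫ (replicate m₁ e₁ ++ replicate m₂ e₂))
   initial-sound m₁ m₂ i j e with entry-rows (cells m₂ N 0) m₁ N 0 i j e
   ... | i≤ , e′ = map ⟪_⟫ (replicate i e₁ ++ replicate j e₂)
    , ⊆-map ⟪_⟫ (⊆-++ (replicate-⊆ e₁ i≤) (replicate-⊆ e₂ (at-cells m₂ N 0 j e′)))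
    , ≈-reflexive (cong proj₁ total) , ≈-reflexive (cong proj₂ total)
    where
    total : Σ⊕ (map ⟪_⟫ (replicate i e₁ ++ replicate j e₂)) ≡ (+ i , + j)
    total = trans (cong Σ⊕ (map-++ ⟪_⟫ (replicate i e₁) (replicate j e₂))) (trans (Σ⊕-++ (map ⟪_⟫ (replicate i e₁)) (map ⟪_⟫ (replicate j e₂)))
     (trans (cong₂ _⊕_ (trans (Σ-replicate i e₁) (cong (+ i ·_) is-e₁)) (trans (Σ-replicate j e₂) (cong (+ j ·_) is-e₂))) (cong₂ _,_ (lem₁ (+ i) (+ j)) (lem₂ (+ i) (+ j)))))
     where
     lem₁ : ∀ i j → i * 1ℤ + j * 0ℤ ≡ i
     lem₁ = solve-∀
     lem₂ : ∀ i j → i * 0ℤ + j * 1ℤ ≡ j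
     lem₂ = solve-∀

   exhausted : ∀ fuel n ok m₁ m₂ R → verified fuel n ok m₁ m₂ ≡ true → ZeroFree N (map ⟪_⟫ (replicate m₁ e₁ ++ replicate m₂ e₂ ++ R)) →
       All (λ g → T (ok g)) R → (∀ g → count g R ℕ.≤ limit-of m₁ m₂ g) → m₁ ℕ.+ (m₂ ℕ.+ length R) ≡ n → ⊥
   exhausted fuel n ok m₁ m₂ R e free good le refl with fill m₁ m₂ (points ok) R (λ x∈R → point ok (All.lookup good x∈R)) le
   ... | R′ , π , f = impossible-sound fuel e (initial-shaped m₁ m₂) (initial-sound m₁ m₂) separated f
     (trans (length-map ⟪_⟫ R′) (trans (sym (↭-length π)) (sym (trans (cong (_∸ (m₁ ℕ.+ m₂)) (sym (ℕₚ.+-assoc m₁ m₂ (length R)))) (ℕₚ.m+n∸m≡n (m₁ ℕ.+ m₂) (length R))))))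
    where
    L = replicate m₁ e₁ ++ replicate m₂ e₂
    rearranged : map ⟪_⟫ (replicate m₁ e₁ ++ replicate m₂ e₂ ++ R) ↭ map ⟪_⟫ L ++ map ⟪_⟫ R′
    rearranged = ↭-trans (map⁺ ⟪_⟫ (↭-trans (↭-reflexive (sym (++-assoc (replicate m₁ e₁) (replicate m₂ e₂) R))) (++⁺ˡ L π))) (↭-reflexive (map-++ ⟪_⟫ L R′))
    separated : Free (map ⟪_⟫ L) (map ⟪_⟫ R′)
    separated {S} {T′} s t z with ⊆-through-↭ rearranged (⊆-++ s t)
    ... | S′ , s′ , σ with free s′ (subst (Vanishes N) (trans (sym (Σ⊕-++ S T′)) (sym (Σ⊕-↭ σ))) z)
    ...   | refl = length-zero (ℕₚ.m+n≡0⇒n≡0 (length S) (trans (sym (length-++ S)) (sym (↭-length σ))))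

-- Residue classes modulo p for sequences over (ℤ/pᵏ)², and a normal form

module PrimePowerModulus where

 open TranslationRing
 open GroupAlgebras
 open MultilinearForms
 open QuarticForm
 open QuarticClassification
 open ZeroSumSequences
 open ResidueVectors
 open PrimeFields
 open ThreeDistinctValues
 open PrimeModulus
 open SearchSoundness
 open SearchSetup
 open SearchResults
 open import Data.Bool using (Bool; true; false; if_then_else_; T)
 open import Data.Nat as ℕ using (ℕ; zero; suc; _∸_; s≤s; z≤n; NonZero; _≡ᵇ_)
 open import Data.Nat.DivMod using (_%_)
 open import Data.Nat.Divisibility using (n∣m⇒m%n≡0)
 open import Data.Integer using (ℤ; +_; _+_; _*_; -_; _-_; 0ℤ; 1ℤ)
 open import Data.Fin as Fin using (Fin; toℕ)
 open import Data.List using (List; []; _∷_; _++_; map; length; replicate; filter)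
 open import Data.List.Properties using (length-++; length-replicate; length-map; ++-identityʳ)
 open import Data.List.Relation.Unary.All as All using (All; []; _∷_)
 open import Data.List.Relation.Unary.Any as Any using (here; there)
 open import Data.List.Membership.Propositional.Properties using (∈-++⁺ʳ; ∈-filter⁺; ∈-filter⁻; ∈-map⁺; ∈-map⁻)
 open import Data.List.Relation.Binary.Sublist.Propositional using (_⊆_; []; _∷_; _∷ʳ_)
 open import Data.List.Relation.Binary.Permutation.Propositional using (_↭_; prep; swap; ↭-sym; ↭-trans; ↭-refl)
 open import Data.List.Relation.Binary.Permutation.Propositional.Properties using (map⁺; ↭-length; ++⁺ˡ; ∈-resp-↭)
 open import Relation.Nullary.Decidable using (¬?; isYes; fromWitness; decidable-stable)

 ≈-coarsen : ∀ {m n a b} → m ℕ∣.∣ n → a ≈[ n ] b → a ≈[ m ] b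
 ≈-coarsen {m} {n} {a} {b} (ℕ∣.divides k refl) (mod-by c e) = mod-by (c * + k) (trans e (cong (λ z → b + z) (trans (cong (λ z → c * z) (ℤₚ.pos-* k m)) (sym (ℤₚ.*-assoc c (+ k) (+ m))))))

 vanishes⇒multiple : ∀ {m} g → Vanishes m g → ∃ λ h → g ≡ + m · h
 vanishes⇒multiple {m} (a , b) (mod-by s e , mod-by t e′) = (s , t) , cong₂ _,_ (trans e (lem s (+ m))) (trans e′ (lem t (+ m)))
  where
  lem : ∀ s m → 0ℤ + s * m ≡ m * s
  lem = solve-∀

 -- An additive map into ℤ/m kills mℤ². Hence forms coming from (ℤ/pᵏ)² with values in ℤ/p see only
 -- classes modulo p.
 additive-vanishes : ∀ {m} {f : G → ℤ} → Additive m f → ∀ g → Vanishes m g → f g ≈[ m ] 0ℤ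
 additive-vanishes {m} {f} additive g z with vanishes⇒multiple g z
 ... | h , refl = ≈-trans (additive-multiple {f = f} additive (+ m) h) (multiple≈0 m (f h))

 module SingleClass {p : ℕ} (pp : Prime p) (k : ℕ) (A : GroupAlgebra p (p ℕ.^ k)) where
  open Functionals pp k A
  open import Algebra.Properties.Semiring.Exp semiring using (_^_; ^-homo-*)
  open Solver using (solve; _:=_; _:*_)

  private
   vs-replicate : ∀ n g → vs (replicate n g) ≋ v g ^ n
   vs-replicate zero    g = constant-1
   vs-replicate (suc n) g = *-congˡ (vs-replicate n g)

   vs-front : ∀ l g l′ → vs (l ++ g ∷ l′) ≋ v g *′ vs (l ++ l′)
   vs-front []      g l′ = ≋-refl
   vs-front (h ∷ l) g l′ = ≋-trans (*-congˡ (vs-front l g l′)) (solve 3 (λ a b c → a :* (b :* c) := b :* (a :* c)) ≋-refl (v h) (v g) (vs (l ++ l′)))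

   exchange : ∀ g h rest → top ℕ.≤ 2 ℕ.+ length rest → Vanishes p (g ⊕ - 1ℤ · h) → φ (v g *′ vs rest) ≈[ p ] φ (v h *′ vs rest)
   exchange g h rest le z = ≈-trans (unit g) (≈-trans (≈-trans (≈-reflexive (cong (linearForm rest) (decompose g h)))
    (≈-trans (linearForm-additive rest le h (g ⊕ - 1ℤ · h)) (+-vanishes-≈ (additive-vanishes {f = linearForm rest} (linearForm-additive rest le) (g ⊕ - 1ℤ · h) z)))) (≈-sym (unit h)))
    where
    unit : ∀ g → φ (v g *′ vs rest) ≈[ p ] linearForm rest g
    unit g = φ-cong (*-congˡ (≋-sym (≋-trans (*-congʳ constant-1) (*-identityˡ (vs rest)))))
    decompose : ∀ g h → g ≡ h ⊕ (g ⊕ - 1ℤ · h)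
    decompose (a , b) (c , d) = cong₂ _,_ (lem a c) (lem b d)
     where
     lem : ∀ a c → a ≡ c + (a + - 1ℤ * c)
     lem = solve-∀

   collapse : ∀ e n l → All (λ g → Vanishes p (g ⊕ - 1ℤ · e)) l → top ℕ.≤ suc (n ℕ.+ length l) → φ (vs (replicate n e ++ l)) ≈[ p ] φ (vs (replicate (n ℕ.+ length l) e))
   collapse e n [] [] le = φ-cong (≋-reflexive (cong vs (trans (++-identityʳ (replicate n e)) (cong (λ m → replicate m e) (sym (ℕₚ.+-identityʳ n))))))
   collapse e n (g ∷ l) (z ∷ zs) le = ≈-trans (φ-cong (vs-front (replicate n e) g l))
    (≈-trans (exchange g e (replicate n e ++ l) (ℕₚ.≤-trans le (ℕₚ.≤-reflexive (cong suc (trans (ℕₚ.+-suc n (length l)) (cong suc (sym (trans (length-++ (replicate n e)) (cong (ℕ._+ length l) (length-replicate n)))))))))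
      z)
     (≈-trans (collapse e (suc n) l zs (ℕₚ.≤-trans le (ℕₚ.≤-reflexive (cong suc (ℕₚ.+-suc n (length l))))))
      (≈-reflexive (cong (λ m → φ (vs (replicate m e))) (sym (ℕₚ.+-suc n (length l)))))))

  -- Replacing the elements one by one by e does not change φ, and the power (v e)^q is 0.
  single-class : ∀ e l → All (λ g → Vanishes p (g ⊕ - 1ℤ · e)) l → top ℕ.≤ suc (length l) → q ℕ.≤ length l → ZeroFree q l → 1ℤ ≈[ p ] 0ℤ
  single-class e l same le q≤l free with ℕₚ.m≤n⇒∃[o]m+o≡n q≤l
  ... | o , eq = ≈-trans (≈-sym (free-value pp k A l free)) (≈-trans (collapse e 0 l same le)
   (φ-zero (≋-trans (vs-replicate (length l) e) (≋-trans (≋-reflexive (cong (v e ^_) (sym eq))) (≋-trans (^-homo-* (v e) q o) (≋-trans (*-congʳ (v-nilpotent e)) (zeroˡ (v e ^ o))))))))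

 module ClassForms {p : ℕ} (pp : Prime p) (k : ℕ) (A : GroupAlgebra p (p ℕ.^ k)) {x y : G} {R : List G}
   (le : p ℕ.^ k ℕ.+ p ℕ.^ k ∸ 1 ℕ.≤ 2 ℕ.+ length R) (min : MinimalZeroSum (p ℕ.^ k) (x ∷ y ∷ R)) where
  open Functionals pp k A
  open PrimeField pp

  private
   additive : Additive p (linearForm R)
   additive = linearForm-additive R le
   at-x : linearForm R x ≈[ p ] 1ℤ
   at-x = linearForm-value pp k A R x (minimal⇒free (minimal-↭ (swap x y ↭-refl) min))
   at-y : linearForm R y ≈[ p ] 1ℤ
   at-y = linearForm-value pp k A R y (minimal⇒free min)

  -- The linear form built from the other terms is 1 at x and at y, yet 0 at every vector vanishing
  -- modulo p; at x + y, used for `antipodal-class`, it is 2.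
  nonzero-class : ¬ Vanishes p x
  nonzero-class z = 1≉0 (≈-trans (≈-sym at-x) (additive-vanishes {f = linearForm R} additive x z))

  antipodal-class : ¬ (+ 2 ≈[ p ] 0ℤ) → ¬ Vanishes p (x ⊕ y)
  antipodal-class 2≉0 z = 2≉0 (≈-trans (≈-sym (≈-trans (additive x y) (+-cong-≈ at-x at-y))) (additive-vanishes {f = linearForm R} additive (x ⊕ y) z))

 argmax : ∀ {A : Set} (f : A → ℕ) (x : A) l → ∃ λ u → u ∈ x ∷ l × (∀ {y} → y ∈ x ∷ l → f y ℕ.≤ f u)
 argmax f x [] = x , here refl , λ { (here refl) → ℕₚ.≤-refl }
 argmax f x (y ∷ l) with argmax f y l
 ... | u , u∈l , best with ℕₚ.≤-total (f x) (f u)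
 ...   | inj₁ x≤u = u , there u∈l , λ { (here refl) → x≤u ; (there z) → best z }
 ...   | inj₂ u≤x = x , here refl , λ { (here refl) → ℕₚ.≤-refl ; (there z) → ℕₚ.≤-trans (best z) u≤x }

 argmax-∈ : ∀ {A : Set} (f : A → ℕ) {x : A} {l} → x ∈ l → ∃ λ u → u ∈ l × (∀ {y} → y ∈ l → f y ℕ.≤ f u)
 argmax-∈ f {l = y ∷ l} _ = argmax f y l

 count-absent : ∀ {n} (x : Zn² n) l → (∀ {y} → y ∈ l → y ≢ x) → count x l ≡ 0
 count-absent x [] ne = refl
 count-absent x (y ∷ l) ne with y ≟² x
 ... | yes e = ⊥-elim (ne (here refl) e)
 ... | no _ = count-absent x l (λ z → ne (there z))

 count-present : ∀ {n} {x : Zn² n} {l} → x ∈ l → 0 ℕ.< count x l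
 count-present {x = x} {l = y ∷ l} x∈l with y ≟² x
 ... | yes _ = s≤s z≤n
 count-present {x = x} {l = y ∷ l} (here e) | no ne = ⊥-elim (ne (sym e))
 count-present {x = x} {l = y ∷ l} (there x∈l) | no ne = count-present x∈l

 count-map : ∀ {n m} (c : Zn² n → Zn² m) → (∀ {x y} → c x ≡ c y → x ≡ y) → ∀ x l → count (c x) (map c l) ≡ count x l
 count-map c inj x [] = refl
 count-map c inj x (y ∷ l) with c y ≟² c x | y ≟² x
 ... | yes _ | yes _ = cong suc (count-map c inj x l)
 ... | no _ | no _ = count-map c inj x l
 ... | yes e | no ne = ⊥-elim (ne (inj e))
 ... | no ne | yes e = ⊥-elim (ne (cong c e))

 ⊆-map⁻ : ∀ {A B : Set} (f : A → B) {S} l → S ⊆ map f l → ∃ λ S₀ → S₀ ⊆ l × S ≡ map f S₀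
 ⊆-map⁻ f [] [] = [] , [] , refl
 ⊆-map⁻ f (x ∷ l) (_ ∷ʳ s) with ⊆-map⁻ f l s
 ... | S₀ , s₀ , e = S₀ , x ∷ʳ s₀ , e
 ⊆-map⁻ f (x ∷ l) (refl ∷ s) with ⊆-map⁻ f l s
 ... | S₀ , s₀ , e = x ∷ S₀ , refl ∷ s₀ , cong (f x ∷_) e

 module ChangeBasis {q : ℕ} .{{_ : NonZero q}} (u v : Zn² q) (i : ℤ) (di : det ⟪ u ⟫ ⟪ v ⟫ * i ≈[ q ] 1ℤ) where

  open Coordinates {q} {⟪ u ⟫} {⟪ v ⟫} i di

  c : Zn² q → Zn² q
  c x = proj₁ (reduce q (α ⟪ x ⟫)) , proj₁ (reduce q (β ⟪ x ⟫))

  c-value : ∀ x → ⟪ c x ⟫ ≈²[ q ] (α ⟪ x ⟫ , β ⟪ x ⟫)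
  c-value x = proj₂ (reduce q (α ⟪ x ⟫)) , proj₂ (reduce q (β ⟪ x ⟫))

  combination-cong : ∀ {m} {a b a′ b′} x y → a ≈[ m ] a′ → b ≈[ m ] b′ → a * x + b * y ≈[ m ] a′ * x + b′ * y
  combination-cong x y e e′ = +-cong-≈ (*-cong-≈ e (≈-refl {a = x})) (*-cong-≈ e′ (≈-refl {a = y}))

  c-injective : ∀ {x y} → c x ≡ c y → x ≡ y
  c-injective {x} {y} e = ⟪⟫-injective (back (proj₁ ⟪ u ⟫) (proj₁ ⟪ v ⟫) (proj₁ (cramer ⟪ x ⟫)) (proj₁ (cramer ⟪ y ⟫))
            , back (proj₂ ⟪ u ⟫) (proj₂ ⟪ v ⟫) (proj₂ (cramer ⟪ x ⟫)) (proj₂ (cramer ⟪ y ⟫)))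
   where
   α≈ : α ⟪ x ⟫ ≈[ q ] α ⟪ y ⟫
   α≈ = ≈-trans (≈-sym (proj₁ (c-value x))) (≈-trans (≈-reflexive (cong (λ g → proj₁ ⟪ g ⟫) e)) (proj₁ (c-value y)))
   β≈ : β ⟪ x ⟫ ≈[ q ] β ⟪ y ⟫
   β≈ = ≈-trans (≈-sym (proj₂ (c-value x))) (≈-trans (≈-reflexive (cong (λ g → proj₂ ⟪ g ⟫) e)) (proj₂ (c-value y)))
   back : ∀ s t {a b} → a ≈[ q ] α ⟪ x ⟫ * s + β ⟪ x ⟫ * t → b ≈[ q ] α ⟪ y ⟫ * s + β ⟪ y ⟫ * t → a ≈[ q ] b
   back s t ea eb = ≈-trans ea (≈-trans (combination-cong s t α≈ β≈) (≈-sym eb))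

  c-sum : ∀ l → Σ⊕ (map ⟪_⟫ (map c l)) ≈²[ q ] (α (Σ⊕ (map ⟪_⟫ l)) , β (Σ⊕ (map ⟪_⟫ l)))
  c-sum [] = ≈-sym (additive-𝟎 {f = α} α-additive) , ≈-sym (additive-𝟎 {f = β} β-additive)
  c-sum (x ∷ l) = ≈-trans (+-cong-≈ (proj₁ (c-value x)) (proj₁ (c-sum l))) (≈-sym (α-additive ⟪ x ⟫ (Σ⊕ (map ⟪_⟫ l))))
          , ≈-trans (+-cong-≈ (proj₂ (c-value x)) (proj₂ (c-sum l))) (≈-sym (β-additive ⟪ x ⟫ (Σ⊕ (map ⟪_⟫ l))))

  c-free : ∀ {A} → ZeroFree q (map ⟪_⟫ A) → ZeroFree q (map ⟪_⟫ (map c A))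
  c-free {A} free {S} s (z , z′) with ⊆-map⁻ ⟪_⟫ (map c A) s
  ... | S₁ , s₁ , refl with ⊆-map⁻ c A s₁
  ...   | S₀ , s₀ , refl = cong (λ l → map ⟪_⟫ (map c l)) (map-empty S₀ (free (⊆-map₀ s₀)
    (vanishing (Σ⊕ (map ⟪_⟫ S₀)) (≈-trans (≈-sym (proj₁ (c-sum S₀))) z) (≈-trans (≈-sym (proj₂ (c-sum S₀))) z′))))
   where
   map-empty : ∀ (l : List (Zn² q)) → map ⟪_⟫ l ≡ [] → l ≡ []
   map-empty [] _ = refl
   ⊆-map₀ : ∀ {l l′ : List (Zn² q)} → l ⊆ l′ → map ⟪_⟫ l ⊆ map ⟪_⟫ l′
   ⊆-map₀ [] = []
   ⊆-map₀ (x ∷ʳ s) = ⟪ x ⟫ ∷ʳ ⊆-map₀ s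
   ⊆-map₀ (refl ∷ s) = refl ∷ ⊆-map₀ s

  bounded : ∀ A g {n} → (∀ {x} → x ∈ A → c x ≡ g → count x A ℕ.≤ n) → count g (map c A) ℕ.≤ n
  bounded A g {n} le with search (λ x → c x ≟² g) A
  ... | inj₁ (x , x∈A , refl) = subst (ℕ._≤ n) (sym (count-map c c-injective x A)) (le x∈A refl)
  ... | inj₂ none = subst (ℕ._≤ n) (sym (count-absent g (map c A) absent)) z≤n
   where
   absent : ∀ {y} → y ∈ map c A → y ≢ g
   absent y∈ refl with ∈-map⁻ c y∈
   ... | x , x∈A , e = none x∈A (sym e)

 -- Sequences over (ℤ/pᵏ)², normalised so that (1 , 0) has maximal multiplicity and (0 , 1)
 -- has maximal multiplicity outside the class of (1 , 0) modulo p

 module PrimePower {p : ℕ} (pp : Prime p) (k : ℕ) .{{_ : NonZero p}} .{{_ : NonZero (p ℕ.^ k)}} (algebra : GroupAlgebra p (p ℕ.^ k))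
   (p∣q : p ℕ∣.∣ p ℕ.^ k) (2≤q : 2 ℕ.≤ p ℕ.^ k) {e₁ e₂ : Zn² (p ℕ.^ k)} (is-e₁ : ⟪ e₁ ⟫ ≡ (1ℤ , 0ℤ)) (is-e₂ : ⟪ e₂ ⟫ ≡ (0ℤ , 1ℤ))
   (residues : ∀ (β : Fin p) → (+ toℕ β ≈[ p ] 0ℤ) ⊎ (+ toℕ β ≈[ p ] 1ℤ) ⊎ ((+ toℕ β + 1ℤ ≈[ p ] 0ℤ) × ¬ (+ 2 ≈[ p ] 0ℤ)))
   (units : ∀ (r : Fin (p ℕ.^ k)) → (+ toℕ r ≈[ p ] 0ℤ) ⊎ (∃ λ i → + toℕ r * i ≈[ p ℕ.^ k ] 1ℤ)) where

  open PrimeField pp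

  q : ℕ
  q = p ℕ.^ k

  open Exhaustion q p

  record Normal (A : List (Zn² q)) : Set where
   field
    free      : ZeroFree q (map ⟪_⟫ A)
    size      : length A ≡ q ℕ.+ q ∸ 2
    small     : count e₁ A ℕ.+ 3 ℕ.≤ q
    second    : e₂ ∈ A
    ordered   : count e₂ A ℕ.≤ count e₁ A
    limited   : ∀ g → count g A ℕ.≤ limit-of (count e₁ A) (count e₂ A) g
    nonzero   : ∀ {g} → g ∈ A → ¬ Vanishes p ⟪ g ⟫
    antipodal : ¬ (+ 2 ≈[ p ] 0ℤ) → ∀ {g h} → g ∈ A → h ∈ A → g ≢ h → ¬ Vanishes p (⟪ g ⟫ ⊕ ⟪ h ⟫)

  open Admissible e₁ e₂

  private
   e₁≢e₂ : e₁ ≢ e₂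
   e₁≢e₂ e with trans (sym is-e₁) (trans (cong ⟪_⟫ e) is-e₂)
   ... | ()

  normal-contradiction : ∀ fuel ws → Candidates.Admissible.all-verified (p ℕ.^ k) p e₁ e₂ fuel ws ≡ true → ∀ {A} → Normal A → (∀ {g} → g ∈ A → g ≢ e₁ → g ≢ e₂ → All (λ w → ¬ Vanishes p (⟪ g ⟫ ⊕ w)) ws) → ⊥
  normal-contradiction fuel ws check {A} normal admissible with gather e₁ A
  ... | A₁ , π₁ , ne₁ with gather e₂ A₁
  ...   | R , π₂ , ne₂ = exhausted is-e₁ is-e₂ fuel (q ℕ.+ q ∸ 2) (λ g → isYes (allowed? ws g)) (count e₁ A) (count e₂ A₁) R
    (subst (λ m → verified fuel _ _ (count e₁ A) m ≡ true) (sym m₂≡) (indexed (count e₁ A) (count e₂ A) m₁>0 (count-present second) ordered small))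
    (λ s z → free-π s z) (All.tabulate good) (λ g → ℕₚ.≤-trans (smaller g) (subst (λ m → count g A ℕ.≤ limit-of (count e₁ A) m g) (sym m₂≡) (limited g)))
    (trans (sym shape-size) (trans (sym (↭-length π)) size))
   where
   open Normal normal
   π : A ↭ replicate (count e₁ A) e₁ ++ replicate (count e₂ A₁) e₂ ++ R
   π = ↭-trans π₁ (++⁺ˡ (replicate (count e₁ A) e₁) π₂)
   shape-size : length (replicate (count e₁ A) e₁ ++ replicate (count e₂ A₁) e₂ ++ R) ≡ count e₁ A ℕ.+ (count e₂ A₁ ℕ.+ length R)
   shape-size = trans (length-++ (replicate (count e₁ A) e₁)) (cong₂ ℕ._+_ (length-replicate (count e₁ A)) (trans (length-++ (replicate (count e₂ A₁) e₂)) (cong (ℕ._+ length R) (length-replicate (count e₂ A₁)))))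
   in-replicate : ∀ n {y : Zn² q} → y ∈ replicate n e₁ → y ≢ e₂
   in-replicate (suc n) (here refl) = e₁≢e₂
   in-replicate (suc n) (there y∈) = in-replicate n y∈
   m₂≡ : count e₂ A₁ ≡ count e₂ A
   m₂≡ = sym (trans (count-↭ e₂ π₁) (trans (count-++ e₂ (replicate (count e₁ A) e₁) A₁) (cong (ℕ._+ count e₂ A₁) (count-absent e₂ (replicate (count e₁ A) e₁) (in-replicate (count e₁ A))))))
   m₁>0 : 0 ℕ.< count e₁ A
   m₁>0 = ℕₚ.≤-trans (count-present second) ordered
   checked : ℕ → ℕ → Bool
   checked a b = verified fuel (q ℕ.+ q ∸ 2) (λ g → isYes (allowed? ws g)) (suc a) (suc b)
   indexed : ∀ m₁ m₂ → 0 ℕ.< m₁ → 0 ℕ.< m₂ → m₂ ℕ.≤ m₁ → m₁ ℕ.+ 3 ℕ.≤ q → verified fuel (q ℕ.+ q ∸ 2) (λ g → isYes (allowed? ws g)) m₁ m₂ ≡ true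
   indexed (suc a) (suc b) _ _ (s≤s b≤a) le = below-sound (suc a) (λ b → checked a b) (below-sound (q ∸ 3) (λ a → below (suc a) (λ b → checked a b)) check (subst (ℕ._≤ q ∸ 3) (ℕₚ.m+n∸n≡m (suc a) 3) (ℕₚ.∸-monoˡ-≤ 3 le))) (s≤s b≤a)
   free-π : ZeroFree q (map ⟪_⟫ (replicate (count e₁ A) e₁ ++ replicate (count e₂ A₁) e₂ ++ R))
   free-π s z with ⊆-through-↭ (map⁺ ⟪_⟫ π) s
   ... | S′ , s′ , σ with free s′ (subst (Vanishes q) (sym (Σ⊕-↭ σ)) z)
   ...   | refl = length-zero (sym (↭-length σ))
   in-A : ∀ {g} → g ∈ R → g ∈ A
   in-A g∈R = ∈-resp-↭ (↭-sym π) (∈-++⁺ʳ (replicate (count e₁ A) e₁) (∈-++⁺ʳ (replicate (count e₂ A₁) e₂) g∈R))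
   in-A₁ : ∀ {g} → g ∈ R → g ∈ A₁
   in-A₁ g∈R = ∈-resp-↭ (↭-sym π₂) (∈-++⁺ʳ (replicate (count e₂ A₁) e₂) g∈R)
   good : ∀ {g} → g ∈ R → T (isYes (allowed? ws g))
   good {g} g∈R = fromWitness {a? = allowed? ws g} (admissible (in-A g∈R) g≢e₁ g≢e₂ , g≢e₁ , g≢e₂)
    where
    g≢e₁ = All.lookup ne₁ (in-A₁ g∈R)
    g≢e₂ = All.lookup ne₂ g∈R
   smaller : ∀ g → count g R ℕ.≤ count g A
   smaller g = subst (count g R ℕ.≤_) (sym (trans (count-↭ g π) (trans (count-++ g (replicate (count e₁ A) e₁) _) (cong (count g (replicate (count e₁ A) e₁) ℕ.+_) (count-++ g (replicate (count e₂ A₁) e₂) R)))))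
    (ℕₚ.≤-trans (ℕₚ.m≤n+m (count g R) (count g (replicate (count e₂ A₁) e₂))) (ℕₚ.m≤n+m _ (count g (replicate (count e₁ A) e₁))))

  module _ {extra : Zn² q} {A : List (Zn² q)} (size : length A ≡ q ℕ.+ q ∸ 2) (min : MinimalZeroSum q (map ⟪_⟫ (extra ∷ A)))
       (small : ∀ x → count x A ℕ.+ 3 ℕ.≤ q) where

   private
    free : ZeroFree q (map ⟪_⟫ A)
    free = minimal⇒free min

    U-size : length (extra ∷ A) ≡ q ℕ.+ q ∸ 1
    U-size = trans (cong suc size) (shifted (q ℕ.+ q) (ℕₚ.≤-trans 2≤q (ℕₚ.m≤m+n q q)))
     where
     shifted : ∀ n → 2 ℕ.≤ n → suc (n ∸ 2) ≡ n ∸ 1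
     shifted (suc (suc n)) _ = refl
     shifted (suc zero) (s≤s ())

    long : ∀ {x y R} → extra ∷ A ↭ x ∷ y ∷ R → q ℕ.+ q ∸ 1 ℕ.≤ 2 ℕ.+ length (map ⟪_⟫ R)
    long {R = R} π = ℕₚ.≤-reflexive (trans (sym U-size) (trans (↭-length π) (cong (2 ℕ.+_) (sym (length-map ⟪_⟫ R)))))

    class-nonzero : ∀ {x} → x ∈ A → ¬ Vanishes p ⟪ x ⟫
    class-nonzero {x} x∈A = front (to-front x∈A)
     where
     front : (∃ λ r → A ↭ x ∷ r) → ¬ Vanishes p ⟪ x ⟫
     front (r , π) = ClassForms.nonzero-class pp k algebra {⟪ x ⟫} {⟪ extra ⟫} {map ⟪_⟫ r} (long σ) (minimal-↭ (map⁺ ⟪_⟫ σ) min)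
      where
      σ : extra ∷ A ↭ x ∷ extra ∷ r
      σ = ↭-trans (prep extra π) (swap extra x ↭-refl)

    class-antipodal : ¬ (+ 2 ≈[ p ] 0ℤ) → ∀ {x y} → x ∈ A → y ∈ A → x ≢ y → ¬ Vanishes p (⟪ x ⟫ ⊕ ⟪ y ⟫)
    class-antipodal 2≉0 {x} {y} x∈A y∈A x≢y = front (front-pair x∈A y∈A x≢y)
     where
     front : (∃ λ r → A ↭ x ∷ y ∷ r) → ¬ Vanishes p (⟪ x ⟫ ⊕ ⟪ y ⟫)
     front (r , π) = ClassForms.antipodal-class pp k algebra {⟪ x ⟫} {⟪ y ⟫} {map ⟪_⟫ (extra ∷ r)} (long σ) (minimal-↭ (map⁺ ⟪_⟫ σ) min) 2≉0
      where
      σ : extra ∷ A ↭ x ∷ y ∷ extra ∷ r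
      σ = ↭-trans (prep extra π) (↭-trans (swap extra x ↭-refl) (prep x (swap extra y ↭-refl)))

    q≤A : q ℕ.≤ length A
    q≤A = subst (q ℕ.≤_) (sym size) (subst (ℕ._≤ q ℕ.+ q ∸ 2) (ℕₚ.m+n∸n≡m q 2) (ℕₚ.∸-monoˡ-≤ 2 (ℕₚ.+-monoʳ-≤ q 2≤q)))

    Same : Zn² q → Zn² q → Set
    Same u x = Vanishes p (⟪ x ⟫ ⊕ - 1ℤ · ⟪ u ⟫)

    same? : ∀ u x → Dec (Same u x)
    same? u x = vanishes? p (⟪ x ⟫ ⊕ - 1ℤ · ⟪ u ⟫)

    other-class : ∀ u → ∃ λ x → x ∈ A × ¬ Same u x
    other-class u = [ (λ found → found) , (λ none → ⊥-elim (1≉0 (SingleClass.single-class pp k algebra ⟪ u ⟫ (map ⟪_⟫ A) (all-same A (λ {x} x∈A → stable x (none x∈A)))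
      (ℕₚ.≤-reflexive (trans (sym U-size) (cong suc (sym (length-map ⟪_⟫ A))))) (subst (q ℕ.≤_) (sym (length-map ⟪_⟫ A)) q≤A) free))) ]′
      (search (λ x → ¬? (same? u x)) A)
     where
     stable : ∀ x → ¬ ¬ Same u x → Same u x
     stable x = decidable-stable (same? u x)
     all-same : ∀ l → (∀ {x} → x ∈ l → Same u x) → All (λ g → Vanishes p (g ⊕ - 1ℤ · ⟪ u ⟫)) (map ⟪_⟫ l)
     all-same [] _ = []
     all-same (x ∷ l) same = same (here refl) ∷ all-same l (λ z → same (there z))

    -- A vector parallel to u modulo p is β·u with β congruent to 0, 1 or -1, by `residues`: the
    -- zero class, the class of u, or its antipode. All three are excluded.
    det≉0 : ∀ {u v} → u ∈ A → v ∈ A → ¬ Same u v → ¬ (det ⟪ u ⟫ ⟪ v ⟫ ≈[ p ] 0ℤ)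
    det≉0 {u} {v} u∈A v∈A ns z = multiple (dependent ⟪ u ⟫ ⟪ v ⟫ (class-nonzero u∈A) z)
     where
     self : ∀ g → Vanishes p (g ⊕ - 1ℤ · g)
     self (a , b) = ≈-reflexive (lem a) , ≈-reflexive (lem b)
      where
      lem : ∀ a → a + - 1ℤ * a ≡ 0ℤ
      lem = solve-∀
     lem₁ : ∀ a → 1ℤ * a + - 1ℤ * a ≡ 0ℤ
     lem₁ = solve-∀
     lem₂ : ∀ a r → a + r * a ≡ (r + 1ℤ) * a
     lem₂ = solve-∀
     multiple : (∃ λ β → ⟪ v ⟫ ≈²[ p ] β · ⟪ u ⟫) → ⊥
     multiple (β , e , e′) = by-residue (reduce p β)
      where
      by-residue : (∃ λ r → + toℕ r ≈[ p ] β) → ⊥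
      by-residue (r , r≈β) = cases (residues r)
        where
        scaled : ∀ {n b} a → β ≈[ p ] n → b ≈[ p ] β * a → b ≈[ p ] n * a
        scaled a n e = ≈-trans e (*-cong-≈ n (≈-refl {a = a}))
        zero-times : ∀ a {b} → + toℕ r ≈[ p ] 0ℤ → b ≈[ p ] β * a → b ≈[ p ] 0ℤ
        zero-times a n e = ≈-trans (scaled a (≈-trans (≈-sym r≈β) n) e) (≈-reflexive (ℤₚ.*-zeroˡ a))
        one-times : ∀ a {b} → + toℕ r ≈[ p ] 1ℤ → b ≈[ p ] β * a → b + - 1ℤ * a ≈[ p ] 0ℤ
        one-times a n e = ≈-trans (+-cong-≈ (scaled a (≈-trans (≈-sym r≈β) n) e) (≈-refl {a = - 1ℤ * a})) (≈-reflexive (lem₁ a))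
        minus-times : ∀ a {b} → + toℕ r + 1ℤ ≈[ p ] 0ℤ → b ≈[ p ] β * a → a + b ≈[ p ] 0ℤ
        minus-times a n e = ≈-trans (+-cong-≈ (≈-refl {a = a}) (scaled a (≈-sym r≈β) e))
         (≈-trans (≈-reflexive (lem₂ a (+ toℕ r))) (≈-trans (*-cong-≈ n (≈-refl {a = a})) (≈-reflexive (ℤₚ.*-zeroˡ a))))
        cases : (+ toℕ r ≈[ p ] 0ℤ) ⊎ (+ toℕ r ≈[ p ] 1ℤ) ⊎ ((+ toℕ r + 1ℤ ≈[ p ] 0ℤ) × ¬ (+ 2 ≈[ p ] 0ℤ)) → ⊥
        cases (inj₁ n) = class-nonzero v∈A (zero-times (proj₁ ⟪ u ⟫) n e , zero-times (proj₂ ⟪ u ⟫) n e′)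
        cases (inj₂ (inj₁ n)) = ns (one-times (proj₁ ⟪ u ⟫) n e , one-times (proj₂ ⟪ u ⟫) n e′)
        cases (inj₂ (inj₂ (n , 2≉0))) = class-antipodal 2≉0 u∈A v∈A (λ u≡v → ns (subst (Same u) u≡v (self ⟪ u ⟫))) (minus-times (proj₁ ⟪ u ⟫) n e , minus-times (proj₂ ⟪ u ⟫) n e′)

    unit-det : ∀ d → ¬ (d ≈[ p ] 0ℤ) → ∃ λ i → d * i ≈[ q ] 1ℤ
    unit-det d d≉0 = by-residue (reduce q d)
     where
     by-residue : (∃ λ r → + toℕ r ≈[ q ] d) → ∃ λ i → d * i ≈[ q ] 1ℤ
     by-residue (r , r≈d) = [ (λ r≈0 → ⊥-elim (d≉0 (≈-trans (≈-sym (≈-coarsen p∣q r≈d)) r≈0)))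
      , (λ { (i , e) → i , ≈-trans (*-cong-≈ (≈-sym r≈d) (≈-refl {a = i})) e }) ]′ (units r)

    module Change {u v : Zn² q} (u∈A : u ∈ A) (v∈A : v ∈ A) (best : ∀ {x} → x ∈ A → count x A ℕ.≤ count u A) (ns : ¬ Same u v)
      (second-best : ∀ {x} → x ∈ A → ¬ Same u x → count x A ℕ.≤ count v A) (i : ℤ) (di : det ⟪ u ⟫ ⟪ v ⟫ * i ≈[ q ] 1ℤ) where
     open Coordinates {q} {⟪ u ⟫} {⟪ v ⟫} i di

     open ChangeBasis {q} u v i di

     vanishes-p : ∀ g → α g ≈[ p ] 0ℤ → β g ≈[ p ] 0ℤ → Vanishes p g
     vanishes-p g a b = ≈-trans (≈-coarsen p∣q (proj₁ (cramer g))) (combination-cong (proj₁ ⟪ u ⟫) (proj₁ ⟪ v ⟫) a b)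
           , ≈-trans (≈-coarsen p∣q (proj₂ (cramer g))) (combination-cong (proj₂ ⟪ u ⟫) (proj₂ ⟪ v ⟫) a b)

     cu : c u ≡ e₁
     cu = ⟪⟫-injective (≈-trans (proj₁ (c-value u)) (≈-trans αu (≈-reflexive (sym (cong proj₁ is-e₁)))) , ≈-trans (proj₂ (c-value u)) (≈-trans βu (≈-reflexive (sym (cong proj₂ is-e₁)))))

     cv : c v ≡ e₂
     cv = ⟪⟫-injective (≈-trans (proj₁ (c-value v)) (≈-trans αv (≈-reflexive (sym (cong proj₁ is-e₂)))) , ≈-trans (proj₂ (c-value v)) (≈-trans βv (≈-reflexive (sym (cong proj₂ is-e₂)))))

     m₁≡ : count e₁ (map c A) ≡ count u A
     m₁≡ = trans (cong (λ g → count g (map c A)) (sym cu)) (count-map c c-injective u A)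

     m₂≡ : count e₂ (map c A) ≡ count v A
     m₂≡ = trans (cong (λ g → count g (map c A)) (sym cv)) (count-map c c-injective v A)

     same-β : ∀ {x} → Same u x → β ⟪ x ⟫ ≈[ p ] 0ℤ
     same-β {x} (z , z′) = *-cong-≈ {d = i} (≈-trans (≈-reflexive (lem (proj₁ ⟪ u ⟫) (proj₂ ⟪ u ⟫) (proj₁ ⟪ x ⟫) (proj₂ ⟪ x ⟫)))
        (≈-trans (+-cong-≈ (*-congˡ-≈ (proj₁ ⟪ u ⟫) z′) (neg-cong-≈ (*-congˡ-≈ (proj₂ ⟪ u ⟫) z))) (≈-reflexive (lem′ (proj₁ ⟪ u ⟫) (proj₂ ⟪ u ⟫))))) (≈-refl {a = i})
      where
      lem : ∀ s t a b → s * b + - (t * a) ≡ s * (b + - 1ℤ * t) + - (t * (a + - 1ℤ * s))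
      lem = solve-∀
      lem′ : ∀ s t → s * 0ℤ + - (t * 0ℤ) ≡ 0ℤ
      lem′ = solve-∀

     limits : ∀ m₁ m₂ → m₁ ≡ count u A → m₂ ≡ count v A → ∀ g → count g (map c A) ℕ.≤ limit-of m₁ m₂ g
     limits m₁ m₂ refl refl g@(x , y) = decide ((toℕ y % p) ≡ᵇ 0) refl
      where
      decide : ∀ b → ((toℕ y % p) ≡ᵇ 0) ≡ b → count g (map c A) ℕ.≤ (if b then m₁ else m₂)
      decide true  _ = bounded A g (λ x∈A _ → best x∈A)
      decide false f = bounded A g (λ { {z} z∈A refl → second-best z∈A (contradict {z} refl) })
        where
        contradict : ∀ {z} → c z ≡ g → Same u z → ⊥
        contradict {z} refl same = false≢true (trans (sym f) (cong (_≡ᵇ 0) (n∣m⇒m%n≡0 (toℕ (proj₂ (c z))) p (≈0⇒∣ (≈-trans (≈-coarsen p∣q (proj₂ (c-value z))) (same-β {z} same))))))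
         where
         false≢true : false ≢ true
         false≢true ()

     normal : Normal (map c A)
     normal = record
      { free = c-free free
      ; size = trans (length-map c A) size
      ; small = subst (λ m → m ℕ.+ 3 ℕ.≤ q) (sym m₁≡) (small u)
      ; second = subst (_∈ map c A) cv (∈-map⁺ c v∈A)
      ; ordered = ℕₚ.≤-trans (ℕₚ.≤-reflexive m₂≡) (ℕₚ.≤-trans (best v∈A) (ℕₚ.≤-reflexive (sym m₁≡)))
      ; limited = limits _ _ m₁≡ m₂≡
      ; nonzero = λ g∈ z → nonzero′ (∈-map⁻ c g∈) z
      ; antipodal = λ 2≉0 g∈ h∈ g≢h z → antipodal′ 2≉0 (∈-map⁻ c g∈) (∈-map⁻ c h∈) g≢h z
      }
      where
      nonzero′ : ∀ {g} → (∃ λ x → x ∈ A × g ≡ c x) → ¬ Vanishes p ⟪ g ⟫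
      nonzero′ (x , x∈A , refl) (z , z′) = class-nonzero x∈A (vanishes-p ⟪ x ⟫ (≈-trans (≈-sym (≈-coarsen p∣q (proj₁ (c-value x)))) z) (≈-trans (≈-sym (≈-coarsen p∣q (proj₂ (c-value x)))) z′))
      antipodal′ : ¬ (+ 2 ≈[ p ] 0ℤ) → ∀ {g h} → (∃ λ x → x ∈ A × g ≡ c x) → (∃ λ x → x ∈ A × h ≡ c x) → g ≢ h → ¬ Vanishes p (⟪ g ⟫ ⊕ ⟪ h ⟫)
      antipodal′ 2≉0 (x , x∈A , refl) (y , y∈A , refl) ne (z , z′) = class-antipodal 2≉0 x∈A y∈A (λ e → ne (cong c e)) (vanishes-p (⟪ x ⟫ ⊕ ⟪ y ⟫)
        (≈-trans (≈-coarsen p∣q (≈-trans (α-additive ⟪ x ⟫ ⟪ y ⟫) (≈-sym (+-cong-≈ (proj₁ (c-value x)) (proj₁ (c-value y)))))) z)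
        (≈-trans (≈-coarsen p∣q (≈-trans (β-additive ⟪ x ⟫ ⟪ y ⟫) (≈-sym (+-cong-≈ (proj₂ (c-value x)) (proj₂ (c-value y)))))) z′))

   normalise : ∃ Normal
   normalise = start (first A q≤A)
    where
    first : ∀ l → q ℕ.≤ length l → ∃ λ x → x ∈ l
    first [] q≤0 = ⊥-elim (ℕₚ.<⇒≱ (ℕₚ.≤-trans (s≤s z≤n) 2≤q) q≤0)
    first (x ∷ l) _ = x , here refl
    Best : Zn² q → Set
    Best u = ∀ {x} → x ∈ A → count x A ℕ.≤ count u A
    finish : ∀ {u v} → u ∈ A → v ∈ A → Best u → ¬ Same u v → (∀ {x} → x ∈ A → ¬ Same u x → count x A ℕ.≤ count v A) → (∃ λ i → det ⟪ u ⟫ ⟪ v ⟫ * i ≈[ q ] 1ℤ) → ∃ Normal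
    finish u∈A v∈A best ns best′ (i , di) = _ , Change.normal u∈A v∈A best ns best′ i di
    choose : ∀ {u} → u ∈ A → Best u → (∃ λ v → v ∈ filter (λ x → ¬? (same? u x)) A × (∀ {y} → y ∈ filter (λ x → ¬? (same? u x)) A → count y A ℕ.≤ count v A)) → ∃ Normal
    choose {u} u∈A best (v , v∈F , best′) = finish u∈A (proj₁ found) best (proj₂ found) (λ x∈A nsx → best′ (∈-filter⁺ (λ x → ¬? (same? u x)) x∈A nsx))
      (unit-det (det ⟪ u ⟫ ⟪ v ⟫) (det≉0 u∈A (proj₁ found) (proj₂ found)))
     where
     found : v ∈ A × ¬ Same u v
     found = ∈-filter⁻ (λ x → ¬? (same? u x)) v∈F
    next : (∃ λ u → u ∈ A × Best u) → ∃ Normal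
    next (u , u∈A , best) = other (other-class u)
     where
     other : (∃ λ x → x ∈ A × ¬ Same u x) → ∃ Normal
     other (y , y∈A , ns) = choose u∈A best (argmax-∈ (λ y → count y A) (∈-filter⁺ (λ x → ¬? (same? u x)) y∈A ns))
    start : (∃ λ x → x ∈ A) → ∃ Normal
    start (x , x∈A) = next (argmax-∈ (λ y → count y A) x∈A)

-- Property B for 8 and 9

module ModuliEightNine where

 open TranslationRing
 open GroupAlgebras
 open MultilinearForms
 open QuarticForm
 open QuarticClassification
 open ZeroSumSequences
 open ResidueVectors
 open PrimeFields
 open ThreeDistinctValues
 open PrimeModulus
 open SearchSetup
 open SearchResults
 open PrimePowerModulus
 open import Data.Bool using (true; false)
 open import Data.Nat as ℕ using (ℕ; zero; suc; _∸_; s≤s; z≤n)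
 open import Data.Nat.Primality using (Prime; prime?)
 open import Data.Integer using (ℤ; +_; _+_; _*_; -_; _-_; 0ℤ; 1ℤ)
 open import Data.Fin as Fin using (Fin; toℕ)
 open import Data.Fin.Properties using (any?) renaming (all? to allFin?)
 open import Data.List using (List; []; _∷_; length; tabulate)
 open import Data.List.Properties using (length-tabulate)
 open import Data.List.Relation.Unary.All as All using (All; []; _∷_)
 open import Data.List.Relation.Unary.Any as Any using (here; there)
 open import Relation.Nullary.Decidable using (_⊎-dec_; from-yes)
 import Relation.Nullary.Decidable as Dec

 Core : ℕ → Set
 Core n = (A : Multiset n (2 ℕ.* n ∸ 2)) → ZeroSumFree A → (∀ x → mult A x ℕ.+ 3 ℕ.≤ n) → ⊥

 core⇒propertyB : ∀ n → 3 ℕ.≤ n → Core n → PropertyB n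
 core⇒propertyB n 3≤n core A free with any? (λ x → any? (λ y → n ∸ 2 ℕ.≤? mult A (x , y)))
 ... | yes (x , y , le) = (x , y) , le
 ... | no none = ⊥-elim (core A free small)
  where
  small : ∀ x → mult A x ℕ.+ 3 ℕ.≤ n
  small (x , y) = ℕₚ.≤-trans (ℕₚ.≤-reflexive (ℕₚ.+-suc (mult A (x , y)) 2)) (ℕₚ.≤-trans (ℕₚ.+-monoˡ-≤ 2 (ℕₚ.≰⇒> (λ le → none (x , y , le)))) (ℕₚ.≤-reflexive (ℕₚ.m∸n+n≡m (ℕₚ.≤-trans (s≤s (s≤s z≤n)) 3≤n))))

 counted-∈ : ∀ {n} (x : Zn² n) l → 0 ℕ.< count x l → x ∈ l
 counted-∈ x (y ∷ l) pos with y ≟² x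
 ... | yes refl = here refl
 ... | no _ = there (counted-∈ x l pos)

 few-copies : ∀ {n k} (A : Multiset n k) → (∀ x → mult A x ℕ.+ 3 ℕ.≤ n) → ∀ x → count x (tabulate A) ℕ.+ 3 ℕ.≤ n
 few-copies {n} A small x = subst (λ m → m ℕ.+ 3 ℕ.≤ n) (mult≡count A x) (small x)

 prime-2 : Prime 2
 prime-2 = from-yes (prime? 2)

 prime-3 : Prime 3
 prime-3 = from-yes (prime? 3)

 residues-2 : ∀ (β : Fin 2) → (+ toℕ β ≈[ 2 ] 0ℤ) ⊎ (+ toℕ β ≈[ 2 ] 1ℤ) ⊎ ((+ toℕ β + 1ℤ ≈[ 2 ] 0ℤ) × ¬ (+ 2 ≈[ 2 ] 0ℤ))
 residues-2 Fin.zero = inj₁ ≈-refl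
 residues-2 (Fin.suc Fin.zero) = inj₂ (inj₁ ≈-refl)

 2≉0-mod-3 : ¬ (+ 2 ≈[ 3 ] 0ℤ)
 2≉0-mod-3 = small≉0 1 ℕₚ.≤-refl

 residues-3 : ∀ (β : Fin 3) → (+ toℕ β ≈[ 3 ] 0ℤ) ⊎ (+ toℕ β ≈[ 3 ] 1ℤ) ⊎ ((+ toℕ β + 1ℤ ≈[ 3 ] 0ℤ) × ¬ (+ 2 ≈[ 3 ] 0ℤ))
 residues-3 Fin.zero = inj₁ ≈-refl
 residues-3 (Fin.suc Fin.zero) = inj₂ (inj₁ ≈-refl)
 residues-3 (Fin.suc (Fin.suc Fin.zero)) = inj₂ (inj₂ (mod-by 1ℤ refl , 2≉0-mod-3))

 units? : ∀ p n → Dec (∀ (r : Fin n) → (+ toℕ r ≈[ p ] 0ℤ) ⊎ (∃ λ (i : Fin n) → + toℕ r * + toℕ i ≈[ n ] 1ℤ))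
 units? p n = allFin? (λ r → ≈0? p (+ toℕ r) ⊎-dec any? (λ i → ≈? (+ toℕ r * + toℕ i) 1ℤ))

 units : ∀ p n → (∀ (r : Fin n) → (+ toℕ r ≈[ p ] 0ℤ) ⊎ (∃ λ (i : Fin n) → + toℕ r * + toℕ i ≈[ n ] 1ℤ)) →
     ∀ (r : Fin n) → (+ toℕ r ≈[ p ] 0ℤ) ⊎ (∃ λ i → + toℕ r * i ≈[ n ] 1ℤ)
 units p n u r with u r
 ... | inj₁ z = inj₁ z
 ... | inj₂ (i , e) = inj₂ (+ toℕ i , e)

 module Eight (algebra : GroupAlgebra 2 8) (invertible : ∀ (r : Fin 8) → (+ toℕ r ≈[ 2 ] 0ℤ) ⊎ (∃ λ i → + toℕ r * i ≈[ 8 ] 1ℤ)) where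

  open PrimePower prime-2 3 algebra (ℕ∣.divides 4 refl) (s≤s (s≤s z≤n))
   {Fin.suc Fin.zero , Fin.zero} {Fin.zero , Fin.suc Fin.zero} refl refl residues-2 invertible public

  core-8 : ∀ fuel → Candidates.Admissible.all-verified 8 2 (Fin.suc Fin.zero , Fin.zero) (Fin.zero , Fin.suc Fin.zero) fuel (𝟎 ∷ []) ≡ true → Core 8
  core-8 fuel check A free small = conclude (completion A free)
   where
   excluded-zero : ∃ Normal → ⊥
   excluded-zero (A′ , normal) = normal-contradiction fuel (𝟎 ∷ []) check normal
    (λ {g} g∈ _ _ → (λ z → Normal.nonzero normal g∈ (subst (Vanishes 2) (⊕-identityʳ ⟪ g ⟫) z)) ∷ [])
   conclude : Completion 8 14 A → ⊥
   conclude c = excluded-zero (normalise {Completion.extra c} {tabulate A} (length-tabulate A) (Completion.minimal c) (few-copies A small))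


 module Nine (algebra : GroupAlgebra 3 9) (invertible : ∀ (r : Fin 9) → (+ toℕ r ≈[ 3 ] 0ℤ) ⊎ (∃ λ i → + toℕ r * i ≈[ 9 ] 1ℤ)) where

  open PrimePower prime-3 2 algebra (ℕ∣.divides 3 refl) (s≤s (s≤s z≤n))
   {Fin.suc Fin.zero , Fin.zero} {Fin.zero , Fin.suc Fin.zero} refl refl residues-3 invertible public

  core-9 : ∀ fuel → (∀ b b′ → Candidates.Admissible.all-verified 9 3 (Fin.suc Fin.zero , Fin.zero) (Fin.zero , Fin.suc Fin.zero) fuel (excluded b b′) ≡ true) → Core 9
  core-9 fuel check A free small = conclude (completion A free)
   where
   module _ {A′ : List (Zn² 9)} (normal : Normal A′) where
    open Normal normal

    Avoids : G → Set
    Avoids w = ∀ {g} → g ∈ A′ → ¬ Vanishes 3 (⟪ g ⟫ ⊕ w)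

    -- If both classes -w and -w̄ occurred, two of their members would be antipodal; a single vector
    -- in both would be its own antipode and so vanish modulo 3.
    opposite : ∀ w w̄ → Vanishes 3 (w ⊕ w̄) → Avoids w ⊎ Avoids w̄
    opposite w w̄ z = decide (search (λ h → vanishes? 3 (⟪ h ⟫ ⊕ w̄)) A′)
     where
     sum : ∀ g h → Vanishes 3 (g ⊕ w) → Vanishes 3 (h ⊕ w̄) → Vanishes 3 (g ⊕ h)
     sum g h zg zh = vanishes-cancelˡ (w ⊕ w̄) (g ⊕ h) z (subst (Vanishes 3) (rearrange g h w w̄) (vanishes-⊕ {g = g ⊕ w} {h = h ⊕ w̄} zg zh))
      where
      lem : ∀ a b c d → a + c + (b + d) ≡ c + d + (a + b)
      lem = solve-∀
      rearrange : ∀ g h w w̄ → (g ⊕ w) ⊕ (h ⊕ w̄) ≡ (w ⊕ w̄) ⊕ (g ⊕ h)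
      rearrange (a , a′) (b , b′) (c , c′) (d , d′) = cong₂ _,_ (lem a b c d) (lem a′ b′ c′ d′)
     halve : ∀ a → a + a ≈[ 3 ] 0ℤ → a ≈[ 3 ] 0ℤ
     halve a e = ≈-trans (mod-by (- a) (lem a)) (+-cong-≈ e e)
      where
      lem : ∀ a → a ≡ a + a + (a + a) + - a * + 3
      lem = solve-∀
     clash : ∀ g h → g ∈ A′ → h ∈ A′ → Vanishes 3 (⟪ g ⟫ ⊕ w) → Vanishes 3 (⟪ h ⟫ ⊕ w̄) → Dec (g ≡ h) → ⊥
     clash g h g∈ h∈ zg zh (no g≢h) = antipodal 2≉0-mod-3 g∈ h∈ g≢h (sum ⟪ g ⟫ ⟪ h ⟫ zg zh)
     clash g .g g∈ _ zg zh (yes refl) = nonzero g∈ (halve (proj₁ ⟪ g ⟫) (proj₁ twice) , halve (proj₂ ⟪ g ⟫) (proj₂ twice))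
      where
      twice : Vanishes 3 (⟪ g ⟫ ⊕ ⟪ g ⟫)
      twice = sum ⟪ g ⟫ ⟪ g ⟫ zg zh
     decide : (∃ λ h → h ∈ A′ × Vanishes 3 (⟪ h ⟫ ⊕ w̄)) ⊎ (∀ {h} → h ∈ A′ → ¬ Vanishes 3 (⟪ h ⟫ ⊕ w̄)) → Avoids w ⊎ Avoids w̄
     decide (inj₁ (h , h∈ , zh)) = inj₁ (λ {g} g∈ zg → clash g h g∈ h∈ zg zh (g ≟² h))
     decide (inj₂ none) = inj₂ none

    avoid : ∀ b b′ {w w′} → excluded b b′ ≡ 𝟎 ∷ (1ℤ , 0ℤ) ∷ (0ℤ , 1ℤ) ∷ w ∷ w′ ∷ [] → Avoids w → Avoids w′ → ⊥
    avoid b b′ {w} {w′} eq aw aw′ = normal-contradiction fuel (excluded b b′) (check b b′) normal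
     (λ {g} g∈ g≢e₁ g≢e₂ → subst (All (λ w → ¬ Vanishes 3 (⟪ g ⟫ ⊕ w))) (sym eq)
      ((λ z → nonzero g∈ (subst (Vanishes 3) (⊕-identityʳ ⟪ g ⟫) z)) ∷ antipodal 2≉0-mod-3 g∈ (counted-∈ _ A′ (ℕₚ.≤-trans (count-present second) ordered)) g≢e₁
       ∷ antipodal 2≉0-mod-3 g∈ second g≢e₂ ∷ aw g∈ ∷ aw′ g∈ ∷ []))

    contradiction-9 : ⊥
    contradiction-9 = cases (opposite (1ℤ , 1ℤ) (+ 2 , + 2) (m≈0 3 , m≈0 3)) (opposite (1ℤ , + 2) (+ 2 , 1ℤ) (m≈0 3 , m≈0 3))
     where
     cases : Avoids (1ℤ , 1ℤ) ⊎ Avoids (+ 2 , + 2) → Avoids (1ℤ , + 2) ⊎ Avoids (+ 2 , 1ℤ) → ⊥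
     cases (inj₁ a) (inj₁ b) = avoid true  true  refl a b
     cases (inj₁ a) (inj₂ b) = avoid true  false refl a b
     cases (inj₂ a) (inj₁ b) = avoid false true  refl a b
     cases (inj₂ a) (inj₂ b) = avoid false false refl a b

   excluded-classes : ∃ Normal → ⊥
   excluded-classes (A′ , normal) = contradiction-9 normal
   conclude : Completion 9 16 A → ⊥
   conclude c = excluded-classes (normalise {Completion.extra c} {tabulate A} (length-tabulate A) (Completion.minimal c) (few-copies A small))

-- Modulus 10: partitions into blocks with even sum

module ParityBlocks where

 open TranslationRing
 open GroupAlgebras
 open MultilinearForms
 open QuarticForm
 open QuarticClassification
 open ZeroSumSequences
 open ResidueVectors
 open PrimeFields
 open ThreeDistinctValues
 open PrimeModulus
 open PrimePowerModulus
 open ModuliEightNine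
 open import Data.Bool using (Bool; true; false; _xor_; not)
 import Data.Bool.Properties as Boolₚ
 open import Data.Nat as ℕ using (ℕ; zero; suc; _∸_; s≤s; z≤n)
 open import Data.Nat.Primality using (Prime; prime?)
 open import Data.Nat.Tactic.RingSolver using () renaming (solve-∀ to ℕ-solve-∀)
 open import Data.Integer using (ℤ; +_; _+_; _*_; -_; _-_; 0ℤ; 1ℤ)
 open import Data.Fin as Fin using (toℕ)
 open import Data.List using (List; []; _∷_; _++_; map; length; concat)
 open import Data.List.Properties using (length-map; length-++; map-++; ++-assoc; ++-identityʳ)
 open import Data.List.Relation.Unary.All as All using (All; []; _∷_)
 open import Data.List.Relation.Unary.Any as Any using (here; there)
 open import Data.List.Relation.Binary.Sublist.Propositional using (_⊆_; []; _∷_; _∷ʳ_; ⊆-refl)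
 open import Data.List.Relation.Binary.Sublist.Propositional.Properties using () renaming (map⁺ to ⊆-map; ++⁺ to ⊆-++; ++⁺ˡ to ⊆-++ˡ; ++⁺ʳ to ⊆-++ʳ)
 open import Data.List.Relation.Binary.Permutation.Propositional using (_↭_; prep; swap; ↭-sym; ↭-trans; ↭-refl; ↭-reflexive)
 import Data.List.Relation.Binary.Permutation.Propositional as Perm
 open import Data.List.Relation.Binary.Permutation.Propositional.Properties using (shift; map⁺; ↭-length; ++⁺ˡ; ++⁺ʳ; ++-comm)
 open import Relation.Nullary.Decidable using (from-yes)

 -- Parity classes

 K : Set
 K = Bool × Bool

 infixr 6 _⊻_
 _⊻_ : K → K → K
 (a , b) ⊻ (c , d) = a xor c , b xor d

 even : K
 even = false , false

 ⊻-assoc : ∀ a b c → (a ⊻ b) ⊻ c ≡ a ⊻ b ⊻ c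
 ⊻-assoc (a , a′) (b , b′) (c , c′) = cong₂ _,_ (Boolₚ.xor-assoc a b c) (Boolₚ.xor-assoc a′ b′ c′)

 ⊻-comm : ∀ a b → a ⊻ b ≡ b ⊻ a
 ⊻-comm (a , a′) (b , b′) = cong₂ _,_ (Boolₚ.xor-comm a b) (Boolₚ.xor-comm a′ b′)

 ⊻-self : ∀ a → a ⊻ a ≡ even
 ⊻-self (a , b) = cong₂ _,_ (Boolₚ.xor-same a) (Boolₚ.xor-same b)

 ⊻-cancel : ∀ a b → a ⊻ a ⊻ b ≡ b
 ⊻-cancel a b = trans (sym (⊻-assoc a a b)) (cong (_⊻ b) (⊻-self a))

 odd : ℕ → Bool
 odd zero    = false
 odd (suc n) = not (odd n)

 value : Bool → ℤ
 value false = 0ℤ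
 value true  = 1ℤ

 odd-≈ : ∀ n → + n ≈[ 2 ] value (odd n)
 odd-≈ zero = ≈-refl
 odd-≈ (suc n) = ≈-trans (+-cong-≈ (≈-refl {a = 1ℤ}) (odd-≈ n)) (step (odd n))
  where
  step : ∀ b → 1ℤ + value b ≈[ 2 ] value (not b)
  step false = ≈-refl
  step true  = mod-by 1ℤ refl

 value-xor : ∀ a b → value a + value b ≈[ 2 ] value (a xor b)
 value-xor false b     = ≈-reflexive (ℤₚ.+-identityˡ (value b))
 value-xor true  false = ≈-refl
 value-xor true  true  = mod-by 1ℤ refl

 value≈0 : ∀ b → value b ≈[ 2 ] 0ℤ → b ≡ false
 value≈0 false _ = refl
 value≈0 true  z = ⊥-elim (small≉0 0 (s≤s (s≤s z≤n)) z)

 class : ∀ {n} → Zn² n → K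
 class (x , y) = odd (toℕ x) , odd (toℕ y)

 Σclass : ∀ {n} → List (Zn² n) → K
 Σclass []      = even
 Σclass (x ∷ l) = class x ⊻ Σclass l

 bump : K → ℕ → ℕ
 bump (false , false) m = suc m
 bump (false , true)  m = m
 bump (true  , _)     m = m

 module _ {n : ℕ} where

  Σ-class : (l : List (Zn² n)) → Σ⊕ (map ⟪_⟫ l) ≈²[ 2 ] (value (proj₁ (Σclass l)) , value (proj₂ (Σclass l)))
  Σ-class [] = ≈-refl , ≈-refl
  Σ-class (x ∷ l) = ≈-trans (+-cong-≈ (odd-≈ (toℕ (proj₁ x))) (proj₁ (Σ-class l))) (value-xor (odd (toℕ (proj₁ x))) (proj₁ (Σclass l)))
         , ≈-trans (+-cong-≈ (odd-≈ (toℕ (proj₂ x))) (proj₂ (Σ-class l))) (value-xor (odd (toℕ (proj₂ x))) (proj₂ (Σclass l)))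

  even⇒vanishes : (l : List (Zn² n)) → Σclass l ≡ even → Vanishes 2 (Σ⊕ (map ⟪_⟫ l))
  even⇒vanishes l e = ≈-trans (proj₁ (Σ-class l)) (≈-reflexive (cong (λ k → value (proj₁ k)) e)) , ≈-trans (proj₂ (Σ-class l)) (≈-reflexive (cong (λ k → value (proj₂ k)) e))

  vanishes⇒even : (l : List (Zn² n)) → Vanishes 2 (Σ⊕ (map ⟪_⟫ l)) → Σclass l ≡ even
  vanishes⇒even l (z , z′) = cong₂ _,_ (value≈0 _ (≈-trans (≈-sym (proj₁ (Σ-class l))) z)) (value≈0 _ (≈-trans (≈-sym (proj₂ (Σ-class l))) z′))

  Σclass-↭ : ∀ {l l′ : List (Zn² n)} → l ↭ l′ → Σclass l ≡ Σclass l′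
  Σclass-↭ Perm.refl = refl
  Σclass-↭ (prep x π) = cong (class x ⊻_) (Σclass-↭ π)
  Σclass-↭ (swap {xs = xs} {ys = ys} x y π) = trans (sym (⊻-assoc (class x) (class y) (Σclass xs))) (trans (cong₂ _⊻_ (⊻-comm (class x) (class y)) (Σclass-↭ π)) (⊻-assoc (class y) (class x) (Σclass ys)))
  Σclass-↭ (Perm.trans π π′) = trans (Σclass-↭ π) (Σclass-↭ π′)

  Σclass-++ : ∀ (l l′ : List (Zn² n)) → Σclass (l ++ l′) ≡ Σclass l ⊻ Σclass l′
  Σclass-++ [] l′ = refl
  Σclass-++ (x ∷ l) l′ = trans (cong (class x ⊻_) (Σclass-++ l l′)) (sym (⊻-assoc (class x) (Σclass l) (Σclass l′)))

  Σclass-concat : ∀ (bs : List (List (Zn² n))) → All (λ b → Σclass b ≡ even) bs → Σclass (concat bs) ≡ even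
  Σclass-concat [] [] = refl
  Σclass-concat (b ∷ bs) (e ∷ es) = trans (Σclass-++ b (concat bs)) (cong₂ _⊻_ e (Σclass-concat bs es))

  data Slot (k : K) : Set where
   vacant : Slot k
   taken  : (x : Zn² n) → class x ≡ k → Slot k

  slot : ∀ {k} → Slot k → List (Zn² n)
  slot vacant      = []
  slot (taken x _) = x ∷ []

  evens : List (Zn² n) → ℕ
  evens []      = 0
  evens (x ∷ l) = bump (class x) (evens l)

  -- An even element, or two elements of equal class, make a block, and each odd class keeps at most
  -- one unmatched element in its slot. In `size` even elements count twice because each fills a
  -- block alone.
  record Pairing (l : List (Zn² n)) : Set where
   field
    blocks   : List (List (Zn² n))
    s₁       : Slot (true , false)
    s₂       : Slot (false , true)
    s₃       : Slot (true , true)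
    covers   : l ↭ concat blocks ++ slot s₁ ++ slot s₂ ++ slot s₃
    all-even : All (λ b → Σclass b ≡ even) blocks
    nonempty : All (λ b → 0 ℕ.< length b) blocks
    size     : length l ℕ.+ evens l ≡ 2 ℕ.* length blocks ℕ.+ length (slot s₁ ++ slot s₂ ++ slot s₃)

  pairing : ∀ l → Pairing l
  pairing [] = record { blocks = [] ; s₁ = vacant ; s₂ = vacant ; s₃ = vacant ; covers = ↭-refl ; all-even = [] ; nonempty = [] ; size = refl }
  pairing (x ∷ l) with class x in eq | pairing l
  ... | false , false | record { blocks = bs ; s₁ = s₁ ; s₂ = s₂ ; s₃ = s₃ ; covers = π ; all-even = e ; nonempty = ne ; size = sz } =
   record { blocks = (x ∷ []) ∷ bs ; s₁ = s₁ ; s₂ = s₂ ; s₃ = s₃ ; covers = prep x π ; all-even = trans (cong (_⊻ even) eq) refl ∷ e ; nonempty = s≤s z≤n ∷ ne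
       ; size = trans (cong (λ c → suc (length l) ℕ.+ bump c (evens l)) eq) (trans (cong suc (ℕₚ.+-suc (length l) (evens l))) (trans (cong (2 ℕ.+_) sz) (lem (length bs) _))) }
   where
   lem : ∀ b s → 2 ℕ.+ (2 ℕ.* b ℕ.+ s) ≡ 2 ℕ.* suc b ℕ.+ s
   lem = ℕ-solve-∀
  ... | true , false | record { blocks = bs ; s₁ = vacant ; s₂ = s₂ ; s₃ = s₃ ; covers = π ; all-even = e ; nonempty = ne ; size = sz } =
   record { blocks = bs ; s₁ = taken x eq ; s₂ = s₂ ; s₃ = s₃ ; covers = ↭-trans (prep x π) (↭-sym (shift x (concat bs) _)) ; all-even = e ; nonempty = ne
       ; size = trans (cong (λ c → suc (length l) ℕ.+ bump c (evens l)) eq) (trans (cong suc sz) (sym (ℕₚ.+-suc _ _))) }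
  ... | false , true | record { blocks = bs ; s₁ = s₁ ; s₂ = vacant ; s₃ = s₃ ; covers = π ; all-even = e ; nonempty = ne ; size = sz } =
   record { blocks = bs ; s₁ = s₁ ; s₂ = taken x eq ; s₃ = s₃ ; covers = ↭-trans (prep x π) (↭-trans (↭-sym (shift x (concat bs) _)) (++⁺ˡ (concat bs) (↭-sym (shift x (slot s₁) (slot s₃))))) ; all-even = e ; nonempty = ne
       ; size = trans (cong (λ c → suc (length l) ℕ.+ bump c (evens l)) eq) (trans (cong suc sz) (trans (sym (ℕₚ.+-suc _ _)) (cong (2 ℕ.* length bs ℕ.+_) (↭-length (↭-sym (shift x (slot s₁) (slot s₃))))))) }
  ... | true , true | record { blocks = bs ; s₁ = s₁ ; s₂ = s₂ ; s₃ = vacant ; covers = π ; all-even = e ; nonempty = ne ; size = sz } =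
   record { blocks = bs ; s₁ = s₁ ; s₂ = s₂ ; s₃ = taken x eq ; covers = ↭-trans (prep x π) (↭-trans (↭-sym (shift x (concat bs) _)) (++⁺ˡ (concat bs) σ)) ; all-even = e ; nonempty = ne
       ; size = trans (cong (λ c → suc (length l) ℕ.+ bump c (evens l)) eq) (trans (cong suc sz) (trans (sym (ℕₚ.+-suc _ _)) (cong (2 ℕ.* length bs ℕ.+_) (↭-length σ)))) }
   where
   σ : x ∷ slot s₁ ++ slot s₂ ++ [] ↭ slot s₁ ++ slot s₂ ++ x ∷ []
   σ = ↭-trans (↭-sym (shift x (slot s₁) (slot s₂ ++ []))) (++⁺ˡ (slot s₁) (↭-sym (shift x (slot s₂) [])))
  ... | true , false | record { blocks = bs ; s₁ = taken y ey ; s₂ = s₂ ; s₃ = s₃ ; covers = π ; all-even = e ; nonempty = ne ; size = sz } =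
   record { blocks = (x ∷ y ∷ []) ∷ bs ; s₁ = vacant ; s₂ = s₂ ; s₃ = s₃ ; covers = prep x (↭-trans π (shift y (concat bs) _)) ; all-even = trans (cong₂ (λ a b → a ⊻ b ⊻ even) eq ey) refl ∷ e ; nonempty = s≤s z≤n ∷ ne
       ; size = trans (cong (λ c → suc (length l) ℕ.+ bump c (evens l)) eq) (trans (cong suc sz) (lem (length bs) _)) }
   where
   lem : ∀ b s → suc (2 ℕ.* b ℕ.+ suc s) ≡ 2 ℕ.* suc b ℕ.+ s
   lem = ℕ-solve-∀
  ... | false , true | record { blocks = bs ; s₁ = s₁ ; s₂ = taken y ey ; s₃ = s₃ ; covers = π ; all-even = e ; nonempty = ne ; size = sz } =
   record { blocks = (x ∷ y ∷ []) ∷ bs ; s₁ = s₁ ; s₂ = vacant ; s₃ = s₃ ; covers = prep x (↭-trans π (↭-trans (++⁺ˡ (concat bs) σ) (shift y (concat bs) _))) ; all-even = trans (cong₂ (λ a b → a ⊻ b ⊻ even) eq ey) refl ∷ e ; nonempty = s≤s z≤n ∷ ne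
       ; size = trans (cong (λ c → suc (length l) ℕ.+ bump c (evens l)) eq) (trans (cong suc (trans sz (cong (2 ℕ.* length bs ℕ.+_) (↭-length σ)))) (lem (length bs) _)) }
   where
   σ : slot s₁ ++ y ∷ slot s₃ ↭ y ∷ slot s₁ ++ slot s₃
   σ = shift y (slot s₁) (slot s₃)
   lem : ∀ b s → suc (2 ℕ.* b ℕ.+ suc s) ≡ 2 ℕ.* suc b ℕ.+ s
   lem = ℕ-solve-∀
  ... | true , true | record { blocks = bs ; s₁ = s₁ ; s₂ = s₂ ; s₃ = taken y ey ; covers = π ; all-even = e ; nonempty = ne ; size = sz } =
   record { blocks = (x ∷ y ∷ []) ∷ bs ; s₁ = s₁ ; s₂ = s₂ ; s₃ = vacant ; covers = prep x (↭-trans π (↭-trans (++⁺ˡ (concat bs) σ) (shift y (concat bs) _))) ; all-even = trans (cong₂ (λ a b → a ⊻ b ⊻ even) eq ey) refl ∷ e ; nonempty = s≤s z≤n ∷ ne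
       ; size = trans (cong (λ c → suc (length l) ℕ.+ bump c (evens l)) eq) (trans (cong suc (trans sz (cong (2 ℕ.* length bs ℕ.+_) (↭-length σ)))) (lem (length bs) _)) }
   where
   σ : slot s₁ ++ slot s₂ ++ y ∷ [] ↭ y ∷ slot s₁ ++ slot s₂ ++ []
   σ = ↭-trans (++⁺ˡ (slot s₁) (shift y (slot s₂) [])) (shift y (slot s₁) (slot s₂ ++ []))
   lem : ∀ b s → suc (2 ℕ.* b ℕ.+ suc s) ≡ 2 ℕ.* suc b ℕ.+ s
   lem = ℕ-solve-∀

  record EvenBlocks (l : List (Zn² n)) : Set where
   field
    blocks   : List (List (Zn² n))
    covers   : l ↭ concat blocks
    all-even : All (λ b → Σclass b ≡ even) blocks
    nonempty : All (λ b → 0 ℕ.< length b) blocks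
    many     : length l ℕ.+ evens l ℕ.≤ suc (2 ℕ.* length blocks)

  -- With an even total either no slot or all three slots are taken; three leftovers, one from each
  -- odd class, have even sum and form one more block.
  even-blocks : ∀ l → Σclass l ≡ even → EvenBlocks l
  even-blocks l l-even = conclude (pairing l)
   where
   conclude : Pairing l → EvenBlocks l
   conclude record { blocks = bs ; s₁ = s₁ ; s₂ = s₂ ; s₃ = s₃ ; covers = π ; all-even = e ; nonempty = ne ; size = sz } = cases s₁ s₂ s₃ π sz left-even
    where
    left-even : Σclass (slot s₁ ++ slot s₂ ++ slot s₃) ≡ even
    left-even = trans (sym (trans (Σclass-++ (concat bs) _) (cong (_⊻ Σclass (slot s₁ ++ slot s₂ ++ slot s₃)) (Σclass-concat bs e)))) (trans (sym (Σclass-↭ π)) l-even)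
    cases : ∀ (s₁ : Slot (true , false)) (s₂ : Slot (false , true)) (s₃ : Slot (true , true)) → l ↭ concat bs ++ slot s₁ ++ slot s₂ ++ slot s₃ →
        length l ℕ.+ evens l ≡ 2 ℕ.* length bs ℕ.+ length (slot s₁ ++ slot s₂ ++ slot s₃) → Σclass (slot s₁ ++ slot s₂ ++ slot s₃) ≡ even → EvenBlocks l
    cases vacant vacant vacant π sz _ = record { blocks = bs ; covers = ↭-trans π (↭-reflexive (++-identityʳ (concat bs))) ; all-even = e ; nonempty = ne
     ; many = ℕₚ.≤-trans (ℕₚ.≤-reflexive (trans sz (ℕₚ.+-identityʳ _))) (ℕₚ.n≤1+n _) }
    cases s₁@(taken x ex) s₂@(taken y ey) s₃@(taken z ez) π sz ev = record { blocks = (x ∷ y ∷ z ∷ []) ∷ bs ; covers = ↭-trans π (++-comm (concat bs) (x ∷ y ∷ z ∷ []))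
     ; all-even = ev ∷ e ; nonempty = s≤s z≤n ∷ ne ; many = ℕₚ.≤-reflexive (trans sz (lem (length bs))) }
     where
     lem : ∀ b → 2 ℕ.* b ℕ.+ 3 ≡ suc (2 ℕ.* suc b)
     lem = ℕ-solve-∀
    cases (taken x ex) vacant vacant π sz ev with trans (sym (cong (_⊻ even) ex)) ev
    ... | ()
    cases vacant (taken y ey) vacant π sz ev with trans (sym (cong (_⊻ even) ey)) ev
    ... | ()
    cases vacant vacant (taken z ez) π sz ev with trans (sym (cong (_⊻ even) ez)) ev
    ... | ()
    cases (taken x ex) (taken y ey) vacant π sz ev with trans (sym (cong₂ (λ a b → a ⊻ b ⊻ even) ex ey)) ev
    ... | ()
    cases (taken x ex) vacant (taken z ez) π sz ev with trans (sym (cong₂ (λ a b → a ⊻ b ⊻ even) ex ez)) ev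
    ... | ()
    cases vacant (taken y ey) (taken z ez) π sz ev with trans (sym (cong₂ (λ a b → a ⊻ b ⊻ even) ey ez)) ev
    ... | ()

 -- Minimal zero-sum sequences over (ℤ/10)²: a block, i.e. a subsequence with even sum, is
 -- a zero-sum as soon as its sum vanishes modulo 5.

 ≈-mod-10 : ∀ {a} → a ≈[ 2 ] 0ℤ → a ≈[ 5 ] 0ℤ → a ≈[ 10 ] 0ℤ
 ≈-mod-10 (mod-by s e) (mod-by t e′) = mod-by (s + - (+ 2 * t)) (trans (lem _ s t) (trans (cong₂ (λ x y → + 5 * x + - (+ 4 * y)) e e′) (lem′ s t)))
  where
  lem : ∀ a s t → a ≡ + 5 * a + - (+ 4 * a)
  lem = solve-∀
  lem′ : ∀ s t → + 5 * (0ℤ + s * + 2) + - (+ 4 * (0ℤ + t * + 5)) ≡ 0ℤ + (s + - (+ 2 * t)) * + 10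
  lem′ = solve-∀

 prime-5 : Prime 5
 prime-5 = from-yes (prime? 5)

 Σs : ∀ {n} → List (Zn² n) → G
 Σs b = Σ⊕ (map ⟪_⟫ b)

 module Ten (algebra : GroupAlgebra 5 5) {U : List (Zn² 10)} (U-size : length U ≡ 19) (min : MinimalZeroSum 10 (map ⟪_⟫ U)) where

  open Functionals prime-5 1 algebra using (top; vs; φ; φ-zero; φ-cong; linearForm; linearForm-additive; J-zero; 𝟙; _≋_; ≋-trans; ≋-sym; *-congʳ; *-identityˡ; constant-1)
  open MinimalZeroSum min

  U-even : Σclass U ≡ even
  U-even = vanishes⇒even U (≈-coarsen (ℕ∣.divides 5 refl) (proj₁ zero-sum) , ≈-coarsen (ℕ∣.divides 5 refl) (proj₂ zero-sum))

  even-zero-sum : ∀ {S E} → U ↭ S ++ E → 0 ℕ.< length E → Σclass S ≡ even → Vanishes 5 (Σs S) → S ≡ []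
  even-zero-sum {S} {E} π pos ev (z , z′) = conclude (MinimalZeroSum.minimal (minimal-↭ (map⁺ ⟪_⟫ π) min) (⊆-map ⟪_⟫ (⊆-++ʳ E (⊆-refl {x = S})))
    (≈-mod-10 (proj₁ (even⇒vanishes S ev)) z , ≈-mod-10 (proj₂ (even⇒vanishes S ev)) z′))
   where
   conclude : map ⟪_⟫ S ≡ [] ⊎ length (map ⟪_⟫ S) ≡ length (map ⟪_⟫ (S ++ E)) → S ≡ []
   conclude (inj₁ e) = length-zero (trans (sym (length-map ⟪_⟫ S)) (cong length e))
   conclude (inj₂ e) = ⊥-elim (ℕₚ.<⇒≢ (ℕₚ.≤-trans (s≤s (ℕₚ.≤-reflexive (trans (length-map ⟪_⟫ S) (sym (ℕₚ.+-identityʳ (length S)))))) (ℕₚ.≤-trans (ℕₚ.≤-reflexive (sym (ℕₚ.+-suc (length S) 0)))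
    (ℕₚ.≤-trans (ℕₚ.+-monoʳ-≤ (length S) pos) (ℕₚ.≤-reflexive (sym (trans (length-map ⟪_⟫ (S ++ E)) (length-++ S))))))) e)

  sublist-complement : ∀ {A : Set} {S l : List A} → S ⊆ l → ∃ λ C → l ↭ S ++ C
  sublist-complement [] = [] , ↭-refl
  sublist-complement {S = S} (x ∷ʳ s) with sublist-complement s
  ... | C , π = x ∷ C , ↭-trans (prep x π) (↭-sym (shift x S C))
  sublist-complement (_∷_ {x = x} refl s) with sublist-complement s
  ... | C , π = C , prep x π

  -- While `E` is nonempty, a union of blocks is a proper subsequence with even sum, which therefore
  -- cannot vanish modulo 5.
  blocks-free : ∀ bs {E} → U ↭ concat bs ++ E → 0 ℕ.< length E → All (λ b → Σclass b ≡ even) bs → All (λ b → 0 ℕ.< length b) bs → ZeroFree 5 (map Σs bs)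
  blocks-free bs {E} π pos evs nes s z with ⊆-map⁻ Σs bs s
  ... | bs′ , s′ , refl = cong (map Σs) (no-blocks bs′ (restrict nes s′) (even-zero-sum {concat bs′} {proj₁ rest ++ E} whole (ℕₚ.≤-trans pos (ℕₚ.≤-trans (ℕₚ.m≤n+m (length E) (length (proj₁ rest))) (ℕₚ.≤-reflexive (sym (length-++ (proj₁ rest))))))
    (Σclass-concat bs′ (restrict evs s′)) (subst (Vanishes 5) (sum-concat bs′) z)))
   where
   restrict : ∀ {P : List (Zn² 10) → Set} {bs bs′} → All P bs → bs′ ⊆ bs → All P bs′
   restrict [] [] = []
   restrict (_ ∷ ps) (_ ∷ʳ s) = restrict ps s
   restrict (p ∷ ps) (refl ∷ s) = p ∷ restrict ps s
   concat-⊆ : ∀ {bs bs′ : List (List (Zn² 10))} → bs′ ⊆ bs → concat bs′ ⊆ concat bs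
   concat-⊆ [] = []
   concat-⊆ (b ∷ʳ s) = ⊆-++ˡ b (concat-⊆ s)
   concat-⊆ (refl ∷ s) = ⊆-++ ⊆-refl (concat-⊆ s)
   rest : ∃ λ C → concat bs ↭ concat bs′ ++ C
   rest = sublist-complement (concat-⊆ s′)
   whole : U ↭ concat bs′ ++ proj₁ rest ++ E
   whole = ↭-trans π (↭-trans (++⁺ʳ E (proj₂ rest)) (↭-reflexive (++-assoc (concat bs′) (proj₁ rest) E)))
   sum-concat : ∀ bs → Σ⊕ (map Σs bs) ≡ Σs (concat bs)
   sum-concat [] = refl
   sum-concat (b ∷ bs) = trans (cong (Σs b ⊕_) (sum-concat bs)) (trans (sym (Σ⊕-++ (map ⟪_⟫ b) (map ⟪_⟫ (concat bs)))) (cong Σ⊕ (sym (map-++ ⟪_⟫ b (concat bs)))))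
   no-blocks : ∀ bs → All (λ b → 0 ℕ.< length b) bs → concat bs ≡ [] → bs ≡ []
   no-blocks [] _ _ = refl
   no-blocks ((x ∷ b) ∷ bs) (_ ∷ _) ()
   no-blocks ([] ∷ bs) (() ∷ _) _

  -- Nine is `top` for q = 5: the product of that many differences is zero, whereas zero-sum
  -- freeness makes its identity coefficient 1.
  free-short : ∀ R → ZeroFree 5 R → 9 ℕ.≤ length R → ⊥
  free-short R free long = PrimeField.1≉0 prime-5 (≈-trans (≈-sym (free-value prime-5 1 algebra R free))
   (φ-zero (≋-trans (≋-sym (≋-trans (*-congʳ constant-1) (*-identityˡ (vs R)))) (J-zero 𝟙 R long))))

  -- An even element is a block by itself, which raises the number of blocks to at least ten.
  -- Setting one aside leaves nine, too many for `free-short`.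
  no-even : ∀ {x} → x ∈ U → class x ≢ even
  no-even {x} x∈U x-even = conclude (even-blocks U U-even)
   where
   bump-≥ : ∀ c m → m ℕ.≤ bump c m
   bump-≥ (false , false) m = ℕₚ.n≤1+n m
   bump-≥ (false , true)  m = ℕₚ.≤-refl
   bump-≥ (true  , _)     m = ℕₚ.≤-refl
   some-even : ∀ l → x ∈ l → 0 ℕ.< evens l
   some-even (y ∷ l) (here refl) = subst (λ c → 0 ℕ.< bump c (evens l)) (sym x-even) (s≤s z≤n)
   some-even (y ∷ l) (there x∈l) = ℕₚ.≤-trans (some-even l x∈l) (bump-≥ (class y) (evens l))
   conclude : EvenBlocks U → ⊥
   conclude record { blocks = bs ; covers = π ; all-even = e ; nonempty = ne ; many = many } = split-off bs π e ne (halve bound)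
    where
    bound : 20 ℕ.≤ suc (2 ℕ.* length bs)
    bound = ℕₚ.≤-trans (ℕₚ.+-mono-≤ (ℕₚ.≤-reflexive (sym U-size)) (some-even U x∈U)) many
    halve : 20 ℕ.≤ suc (2 ℕ.* length bs) → 9 ℕ.< length bs
    halve le = ℕₚ.*-cancelˡ-< 2 9 (length bs) (ℕₚ.≤-pred le)
    split-off : ∀ bs → U ↭ concat bs → All (λ b → Σclass b ≡ even) bs → All (λ b → 0 ℕ.< length b) bs → 9 ℕ.< length bs → ⊥
    split-off (b ∷ bs) π (_ ∷ e) (pos ∷ ne) (s≤s long) = free-short (map Σs bs) (blocks-free bs {b} (↭-trans π (++-comm b (concat bs))) pos e ne) (subst (9 ℕ.≤_) (sym (length-map Σs bs)) long)

  record Affine (x₁ x₂ x₃ t₂ t₃ : Zn² 10) : Set where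
   field
    Λ        : G → ℤ
    additive : Additive 5 Λ
    at₁      : Λ ⟪ x₁ ⟫ ≈[ 5 ] 1ℤ
    at₂      : Λ ⟪ x₂ ⟫ ≈[ 5 ] 1ℤ
    at₃      : Λ ⟪ x₃ ⟫ ≈[ 5 ] 1ℤ
    at₂₃     : Λ ⟪ t₂ ⟫ + Λ ⟪ t₃ ⟫ ≈[ 5 ] 1ℤ

  -- The other 14 terms contain at least seven even blocks, enough for a linear form over (ℤ/5)². It
  -- takes the value 1 at the three pairs of x's, so its double is 1 at each x, and 1 at x₁ + t₂ +
  -- t₃, which yields the last condition.
  affine : ∀ {x₁ x₂ x₃ t₂ t₃ rest i j k} → U ↭ x₁ ∷ x₂ ∷ x₃ ∷ t₂ ∷ t₃ ∷ rest → class x₁ ≡ i → class x₂ ≡ i → class x₃ ≡ i → class t₂ ≡ j → class t₃ ≡ k →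
       i ⊻ j ⊻ k ≡ even → Affine x₁ x₂ x₃ t₂ t₃
  affine {x₁} {x₂} {x₃} {t₂} {t₃} {rest} {i} {j} {k} π e₁ e₂ e₃ e₄ e₅ ijk = conclude (even-blocks rest rest-even)
   where
   rest-even : Σclass rest ≡ even
   rest-even = trans (sym (trans (cong (_⊻ Σclass rest) ijk) refl)) (trans (⊻-assoc i (j ⊻ k) (Σclass rest)) (trans (cong (i ⊻_) (⊻-assoc j k (Σclass rest)))
    (trans (sym (⊻-cancel i _)) (trans (sym total) (trans (sym (Σclass-↭ π)) U-even)))))
    where
    total : Σclass (x₁ ∷ x₂ ∷ x₃ ∷ t₂ ∷ t₃ ∷ rest) ≡ i ⊻ i ⊻ i ⊻ j ⊻ k ⊻ Σclass rest
    total = cong₂ _⊻_ e₁ (cong₂ _⊻_ e₂ (cong₂ _⊻_ e₃ (cong₂ _⊻_ e₄ (cong (_⊻ Σclass rest) e₅))))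
   conclude : EvenBlocks rest → Affine x₁ x₂ x₃ t₂ t₃
   conclude record { blocks = bs ; covers = σ ; all-even = evs ; nonempty = nes ; many = many } = record
    { Λ = λ g → + 2 * form g
    ; additive = λ g h → ≈-trans (*-congˡ-≈ (+ 2) (additive g h)) (≈-reflexive (ℤₚ.*-distribˡ-+ (+ 2) (form g) (form h)))
    ; at₁ = half f₁ f₂ f₃ v₁₂ v₁₃ v₂₃
    ; at₂ = half f₂ f₁ f₃ (≈-trans (≈-reflexive (ℤₚ.+-comm f₂ f₁)) v₁₂) v₂₃ v₁₃
    ; at₃ = half f₃ f₁ f₂ (≈-trans (≈-reflexive (ℤₚ.+-comm f₃ f₁)) v₁₃) (≈-trans (≈-reflexive (ℤₚ.+-comm f₃ f₂)) v₂₃) v₁₂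
    ; at₂₃ = pair f₁ (form ⟪ t₂ ⟫) (form ⟪ t₃ ⟫) (half f₁ f₂ f₃ v₁₂ v₁₃ v₂₃) v₁tt
    }
    where
    R = map Σs bs
    7≤bs : 7 ℕ.≤ length bs
    7≤bs = ℕₚ.*-cancelˡ-< 2 6 (length bs) (ℕₚ.≤-pred (ℕₚ.≤-trans (ℕₚ.≤-trans (ℕₚ.≤-reflexive (cong (_∸ 5) (trans (sym U-size) (↭-length π)))) (ℕₚ.m≤m+n (length rest) (evens rest))) many))
    form : G → ℤ
    form = linearForm R
    additive : Additive 5 form
    additive = linearForm-additive R (ℕₚ.≤-trans (ℕₚ.+-monoʳ-≤ 2 7≤bs) (ℕₚ.≤-reflexive (cong (2 ℕ.+_) (sym (length-map Σs bs)))))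
    f₁ = form ⟪ x₁ ⟫
    f₂ = form ⟪ x₂ ⟫
    f₃ = form ⟪ x₃ ⟫
    block-value : ∀ X {E} → U ↭ X ++ E ++ rest → 0 ℕ.< length X → 0 ℕ.< length E → Σclass X ≡ even → form (Σs X) ≈[ 5 ] 1ℤ
    block-value X {E} ρ posX posE ev = linearForm-value prime-5 1 algebra R (Σs X) (blocks-free (X ∷ bs) {E}
     (↭-trans ρ (↭-trans (++⁺ˡ X (↭-trans (++-comm E rest) (++⁺ʳ E σ))) (↭-reflexive (sym (++-assoc X (concat bs) E))))) posE (ev ∷ evs) (posX ∷ nes))
    two-even : ∀ {x y} → class x ≡ i → class y ≡ i → Σclass (x ∷ y ∷ []) ≡ even
    two-even {x} {y} ex ey = trans (cong₂ (λ a b → a ⊻ b ⊻ even) ex ey) (⊻-cancel i even)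
    two : ∀ x y → form (Σs (x ∷ y ∷ [])) ≈[ 5 ] form ⟪ x ⟫ + form ⟪ y ⟫
    two x y = ≈-trans (≈-reflexive (cong (λ g → form (⟪ x ⟫ ⊕ g)) (⊕-identityʳ ⟪ y ⟫))) (additive ⟪ x ⟫ ⟪ y ⟫)
    v₁₂ : f₁ + f₂ ≈[ 5 ] 1ℤ
    v₁₂ = ≈-trans (≈-sym (two x₁ x₂)) (block-value (x₁ ∷ x₂ ∷ []) {x₃ ∷ t₂ ∷ t₃ ∷ []} π (s≤s z≤n) (s≤s z≤n) (two-even {x₁} {x₂} e₁ e₂))
    v₁₃ : f₁ + f₃ ≈[ 5 ] 1ℤ
    v₁₃ = ≈-trans (≈-sym (two x₁ x₃)) (block-value (x₁ ∷ x₃ ∷ []) {x₂ ∷ t₂ ∷ t₃ ∷ []} (↭-trans π (prep x₁ (swap x₂ x₃ ↭-refl))) (s≤s z≤n) (s≤s z≤n) (two-even {x₁} {x₃} e₁ e₃))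
    v₂₃ : f₂ + f₃ ≈[ 5 ] 1ℤ
    v₂₃ = ≈-trans (≈-sym (two x₂ x₃)) (block-value (x₂ ∷ x₃ ∷ []) {x₁ ∷ t₂ ∷ t₃ ∷ []} (↭-trans π (↭-trans (swap x₁ x₂ ↭-refl) (prep x₂ (swap x₁ x₃ ↭-refl)))) (s≤s z≤n) (s≤s z≤n) (two-even {x₂} {x₃} e₂ e₃))
    v₁tt : f₁ + (form ⟪ t₂ ⟫ + form ⟪ t₃ ⟫) ≈[ 5 ] 1ℤ
    v₁tt = ≈-trans (≈-sym (≈-trans (additive ⟪ x₁ ⟫ (Σs (t₂ ∷ t₃ ∷ []))) (+-cong-≈ (≈-refl {a = f₁}) (two t₂ t₃))))
     (block-value (x₁ ∷ t₂ ∷ t₃ ∷ []) {x₂ ∷ x₃ ∷ []} (↭-trans π (prep x₁ (shifted x₂ x₃))) (s≤s z≤n) (s≤s z≤n)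
      (trans (cong₂ (λ a b → a ⊻ b ⊻ class t₃ ⊻ even) e₁ e₄) (trans (cong (λ c → i ⊻ j ⊻ c) (trans (⊻-comm (class t₃) even) e₅)) ijk)))
     where
     shifted : ∀ x y → x ∷ y ∷ t₂ ∷ t₃ ∷ rest ↭ t₂ ∷ t₃ ∷ x ∷ y ∷ rest
     shifted x y = ↭-trans (prep x (swap y t₂ ↭-refl)) (↭-trans (swap x t₂ ↭-refl) (prep t₂ (↭-trans (prep x (swap y t₃ ↭-refl)) (swap x t₃ ↭-refl))))
    half : ∀ a b c → a + b ≈[ 5 ] 1ℤ → a + c ≈[ 5 ] 1ℤ → b + c ≈[ 5 ] 1ℤ → + 2 * a ≈[ 5 ] 1ℤ
    half a b c ab ac bc = ≈-trans (≈-reflexive (lem a b c)) (+-cong-≈ (+-cong-≈ ab ac) (neg-cong-≈ bc))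
     where
     lem : ∀ a b c → + 2 * a ≡ a + b + (a + c) + - (b + c)
     lem = solve-∀
    pair : ∀ a b c → + 2 * a ≈[ 5 ] 1ℤ → a + (b + c) ≈[ 5 ] 1ℤ → + 2 * b + + 2 * c ≈[ 5 ] 1ℤ
    pair a b c e e′ = ≈-trans (≈-reflexive (lem a b c)) (+-cong-≈ (*-congˡ-≈ (+ 2) e′) (neg-cong-≈ e))
     where
     lem : ∀ a b c → + 2 * b + + 2 * c ≡ + 2 * (a + (b + c)) + - (+ 2 * a)
     lem = solve-∀

-- Modulus 10: affine lines carried by the parity classes

module ParityLinesTen where

 open TranslationRing
 open GroupAlgebras
 open MultilinearForms
 open QuarticForm
 open QuarticClassification
 open ZeroSumSequences
 open ResidueVectors
 open PrimeFields
 open ThreeDistinctValues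
 open PrimeModulus
 open PrimePowerModulus
 open ModuliEightNine
 open ParityBlocks
 open import Data.Bool using (Bool; true; false; not)
 import Data.Bool.Properties as Boolₚ
 open import Data.Nat as ℕ using (ℕ; zero; suc; s≤s; z≤n)
 open import Data.Integer using (ℤ; +_; _+_; _*_; -_; _-_; 0ℤ; 1ℤ)
 open import Data.List using (List; []; _∷_; _++_; map; length; concat)
 open import Data.List.Relation.Unary.All as All using ([]; _∷_)
 open import Data.List.Relation.Unary.Any as Any using (here; there)
 open import Data.List.Membership.Propositional.Properties using (∈-++⁺ʳ)
 open import Data.List.Relation.Binary.Sublist.Propositional using ([]; _∷_)
 open import Data.List.Relation.Binary.Permutation.Propositional using (_↭_; prep; swap; ↭-sym; ↭-trans; ↭-refl)
 open import Data.List.Relation.Binary.Permutation.Propositional.Properties using (↭-length; ++⁺ʳ; ∈-resp-↭)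

 additive-cong : ∀ {m} {f : G → ℤ} → Additive m f → ∀ {g h} → g ≈²[ m ] h → f g ≈[ m ] f h
 additive-cong {m} {f} additive {g} {h} (e , e′) = ≈-trans (≈-reflexive (cong f (split₂ g h)))
  (≈-trans (additive h (g ⊕ - 1ℤ · h)) (+-vanishes-≈ (additive-vanishes {f = f} additive (g ⊕ - 1ℤ · h) (difference e , difference e′))))
  where
  split₂ : ∀ g h → g ≡ h ⊕ (g ⊕ - 1ℤ · h)
  split₂ (a , b) (c , d) = cong₂ _,_ (lem a c) (lem b d)
   where
   lem : ∀ a c → a ≡ c + (a + - 1ℤ * c)
   lem = solve-∀
  difference : ∀ {a c} → a ≈[ m ] c → a + - 1ℤ * c ≈[ m ] 0ℤ
  difference {a} {c} e = ≈-trans (+-cong-≈ e (≈-refl {a = - 1ℤ * c})) (≈-reflexive (lem c))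
   where
   lem : ∀ c → c + - 1ℤ * c ≡ 0ℤ
   lem = solve-∀

 additive-scaled : ∀ {m} {f : G → ℤ} → Additive m f → ∀ a → Additive m (λ g → a * f g)
 additive-scaled {f = f} additive a g h = ≈-trans (*-congˡ-≈ a (additive g h)) (≈-reflexive (ℤₚ.*-distribˡ-+ a (f g) (f h)))

 additive-agree : ∀ {p} → Prime p → ∀ {f f′ : G → ℤ} → Additive p f → Additive p f′ → ∀ x y → ¬ (det x y ≈[ p ] 0ℤ) → f x ≈[ p ] f′ x → f y ≈[ p ] f′ y → ∀ g → f g ≈[ p ] f′ g
 additive-agree {p} pp {f} {f′} add add′ x y d≉0 ex ey g = conclude (PrimeField.inverse pp (det x y) d≉0)
  where
  conclude : (∃ λ i → det x y * i ≈[ p ] 1ℤ) → f g ≈[ p ] f′ g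
  conclude (i , di) = ≈-trans (additive-cong {f = f} add (cramer g)) (≈-trans (additive-combination {f = f} add (α g) (β g) x y)
   (≈-trans (+-cong-≈ (*-congˡ-≈ (α g) ex) (*-congˡ-≈ (β g) ey)) (≈-sym (≈-trans (additive-cong {f = f′} add′ (cramer g)) (additive-combination {f = f′} add′ (α g) (β g) x y)))))
   where open Coordinates {p} {x} {y} i di

 -- The orderings of the three odd classes, so that an argument about one class serves for all.
 data Triple : K → K → K → Set where
  t₁₂₃ : Triple (true , false) (false , true) (true , true)
  t₁₃₂ : Triple (true , false) (true , true) (false , true)
  t₂₁₃ : Triple (false , true) (true , false) (true , true)
  t₂₃₁ : Triple (false , true) (true , true) (true , false)
  t₃₁₂ : Triple (true , true) (true , false) (false , true)
  t₃₂₁ : Triple (true , true) (false , true) (true , false)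

 swap₂₃ : ∀ {i j k} → Triple i j k → Triple i k j
 swap₂₃ t₁₂₃ = t₁₃₂
 swap₂₃ t₁₃₂ = t₁₂₃
 swap₂₃ t₂₁₃ = t₂₃₁
 swap₂₃ t₂₃₁ = t₂₁₃
 swap₂₃ t₃₁₂ = t₃₂₁
 swap₂₃ t₃₂₁ = t₃₁₂

 swap₁₂ : ∀ {i j k} → Triple i j k → Triple j i k
 swap₁₂ t₁₂₃ = t₂₁₃
 swap₁₂ t₁₃₂ = t₃₁₂
 swap₁₂ t₂₁₃ = t₁₂₃
 swap₁₂ t₂₃₁ = t₃₂₁
 swap₁₂ t₃₁₂ = t₁₃₂
 swap₁₂ t₃₂₁ = t₂₃₁

 triple-even : ∀ {i j k} → Triple i j k → i ⊻ j ⊻ k ≡ even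
 triple-even t₁₂₃ = refl
 triple-even t₁₃₂ = refl
 triple-even t₂₁₃ = refl
 triple-even t₂₃₁ = refl
 triple-even t₃₁₂ = refl
 triple-even t₃₂₁ = refl

 triple-≢ : ∀ {i j k} → Triple i j k → i ≢ j
 triple-≢ t₁₂₃ ()
 triple-≢ t₁₃₂ ()
 triple-≢ t₂₁₃ ()
 triple-≢ t₂₃₁ ()
 triple-≢ t₃₁₂ ()
 triple-≢ t₃₂₁ ()

 standard-cases : ∀ c → c ≢ even → (c ≡ (true , false)) ⊎ (c ≡ (false , true)) ⊎ (c ≡ (true , true))
 standard-cases (false , false) ne = ⊥-elim (ne refl)
 standard-cases (true  , false) ne = inj₁ refl
 standard-cases (false , true)  ne = inj₂ (inj₁ refl)
 standard-cases (true  , true)  ne = inj₂ (inj₂ refl)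

 triple-cases : ∀ {i j k} → Triple i j k → ∀ c → c ≢ even → (c ≡ i) ⊎ (c ≡ j) ⊎ (c ≡ k)
 triple-cases t c ne = arrange t (standard-cases c ne)
  where
  arrange : ∀ {i j k} → Triple i j k → (c ≡ (true , false)) ⊎ (c ≡ (false , true)) ⊎ (c ≡ (true , true)) → (c ≡ i) ⊎ (c ≡ j) ⊎ (c ≡ k)
  arrange t₁₂₃ e = e
  arrange t₁₃₂ (inj₁ e) = inj₁ e
  arrange t₁₃₂ (inj₂ (inj₁ e)) = inj₂ (inj₂ e)
  arrange t₁₃₂ (inj₂ (inj₂ e)) = inj₂ (inj₁ e)
  arrange t₂₁₃ (inj₁ e) = inj₂ (inj₁ e)
  arrange t₂₁₃ (inj₂ (inj₁ e)) = inj₁ e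
  arrange t₂₁₃ (inj₂ (inj₂ e)) = inj₂ (inj₂ e)
  arrange t₂₃₁ (inj₁ e) = inj₂ (inj₂ e)
  arrange t₂₃₁ (inj₂ (inj₁ e)) = inj₁ e
  arrange t₂₃₁ (inj₂ (inj₂ e)) = inj₂ (inj₁ e)
  arrange t₃₁₂ (inj₁ e) = inj₂ (inj₁ e)
  arrange t₃₁₂ (inj₂ (inj₁ e)) = inj₂ (inj₂ e)
  arrange t₃₁₂ (inj₂ (inj₂ e)) = inj₁ e
  arrange t₃₂₁ (inj₁ e) = inj₂ (inj₂ e)
  arrange t₃₂₁ (inj₂ (inj₁ e)) = inj₂ (inj₁ e)
  arrange t₃₂₁ (inj₂ (inj₂ e)) = inj₁ e

 odd-double : ∀ n → odd (2 ℕ.* n) ≡ false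
 odd-double zero = refl
 odd-double (suc n) = trans (cong (λ m → not (odd m)) (ℕₚ.+-suc n (n ℕ.+ 0))) (trans (Boolₚ.not-involutive _) (odd-double n))

 -- In a sequence of odd length with even sum and without even elements, the pairing leaves one element of each class.
 all-classes : ∀ {n} (l : List (Zn² n)) → odd (length l) ≡ true → Σclass l ≡ even → (∀ {x} → x ∈ l → class x ≢ even) →
           ∀ {i j k} → Triple i j k → ∃ λ x → x ∈ l × class x ≡ i
 all-classes {n} l len ev ne t = by-slots (pairing l) t
  where
  no-evens : ∀ l → (∀ {x : Zn² n} → x ∈ l → class x ≢ even) → evens l ≡ 0
  no-evens [] _ = refl
  no-evens (x ∷ l) ne = trans (cong (λ m → bump (class x) m) (no-evens l (λ z → ne (there z)))) (zero-bump (class x) (ne (here refl)))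
   where
   zero-bump : ∀ c → c ≢ even → bump c 0 ≡ 0
   zero-bump (false , false) ne = ⊥-elim (ne refl)
   zero-bump (false , true)  _ = refl
   zero-bump (true  , _)     _ = refl
  by-slots : Pairing l → ∀ {i j k} → Triple i j k → ∃ λ x → x ∈ l × class x ≡ i
  by-slots record { blocks = bs ; s₁ = s₁ ; s₂ = s₂ ; s₃ = s₃ ; covers = π ; all-even = e ; size = sz } = cases s₁ s₂ s₃ π left-odd left-even
   where
   left-even : Σclass (slot s₁ ++ slot s₂ ++ slot s₃) ≡ even
   left-even = trans (sym (trans (Σclass-++ (concat bs) _) (cong (_⊻ Σclass (slot s₁ ++ slot s₂ ++ slot s₃)) (Σclass-concat bs e)))) (trans (sym (Σclass-↭ π)) ev)
   odd-+ : ∀ m k → odd m ≡ false → odd (m ℕ.+ k) ≡ odd k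
   odd-+ zero k e = refl
   odd-+ (suc (suc m)) k e = trans (Boolₚ.not-involutive _) (odd-+ m k (trans (sym (Boolₚ.not-involutive _)) e))
   left-odd : odd (length (slot s₁ ++ slot s₂ ++ slot s₃)) ≡ true
   left-odd = trans (sym (odd-+ (2 ℕ.* length bs) _ (odd-double (length bs)))) (trans (cong odd (trans (sym sz) (trans (cong (length l ℕ.+_) (no-evens l ne)) (ℕₚ.+-identityʳ _)))) len)
   cases : ∀ (s₁ : Slot (true , false)) (s₂ : Slot (false , true)) (s₃ : Slot (true , true)) → l ↭ concat bs ++ slot s₁ ++ slot s₂ ++ slot s₃ →
         odd (length (slot s₁ ++ slot s₂ ++ slot s₃)) ≡ true → Σclass (slot s₁ ++ slot s₂ ++ slot s₃) ≡ even → ∀ {i j k} → Triple i j k → ∃ λ x → x ∈ l × class x ≡ i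
   cases (taken x ex) (taken y ey) (taken z ez) π _ _ t = pick t
    where
    in-l : ∀ {w} → w ∈ x ∷ y ∷ z ∷ [] → w ∈ l
    in-l w∈ = ∈-resp-↭ (↭-sym π) (∈-++⁺ʳ (concat bs) w∈)
    pick : ∀ {i j k} → Triple i j k → ∃ λ x → x ∈ l × class x ≡ i
    pick t₁₂₃ = x , in-l (here refl) , ex
    pick t₁₃₂ = x , in-l (here refl) , ex
    pick t₂₁₃ = y , in-l (there (here refl)) , ey
    pick t₂₃₁ = y , in-l (there (here refl)) , ey
    pick t₃₁₂ = z , in-l (there (there (here refl))) , ez
    pick t₃₂₁ = z , in-l (there (there (here refl))) , ez
   cases vacant vacant vacant π () ev t
   cases (taken x ex) (taken y ey) vacant π () ev t
   cases (taken x ex) vacant (taken z ez) π () ev t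
   cases vacant (taken y ey) (taken z ez) π () ev t
   cases (taken x ex) vacant vacant π od ev t with trans (sym (cong (_⊻ even) ex)) ev
   ... | ()
   cases vacant (taken y ey) vacant π od ev t with trans (sym (cong (_⊻ even) ey)) ev
   ... | ()
   cases vacant vacant (taken z ez) π od ev t with trans (sym (cong (_⊻ even) ez)) ev
   ... | ()

 front-triple : ∀ {A : Set} {x y z : A} {l} → x ∈ l → y ∈ l → z ∈ l → x ≢ y → x ≢ z → y ≢ z → ∃ λ r → l ↭ x ∷ y ∷ z ∷ r
 front-triple x∈l y∈l z∈l x≢y x≢z y≢z with front-pair x∈l y∈l x≢y
 ... | r , π with to-front (remaining ↭-refl (remaining π z∈l (λ e → x≢z (sym e))) (λ e → y≢z (sym e)))
 ...   | r′ , π′ = r′ , ↭-trans π (prep _ (prep _ π′))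

 module TenLines (algebra : GroupAlgebra 5 5) {U : List (Zn² 10)} (U-size : length U ≡ 19) (min : MinimalZeroSum 10 (map ⟪_⟫ U)) where

  open Ten algebra U-size min
  open PrimeField prime-5

  equal-mod-10 : ∀ {x y : Zn² 10} → class x ≡ class y → ⟪ x ⟫ ≈²[ 5 ] ⟪ y ⟫ → x ≡ y
  equal-mod-10 {x} {y} ec (e , e′) = ⟪⟫-injective (part (cong proj₁ ec) e , part (cong proj₂ ec) e′)
   where
   difference : ∀ {m a b} → a ≈[ m ] b → a + - b ≈[ m ] 0ℤ
   difference {b = b} e = ≈-trans (+-cong-≈ e (≈-refl {a = - b})) (≈-reflexive (ℤₚ.+-inverseʳ b))
   lem : ∀ a b → a ≡ b + (a + - b)
   lem = solve-∀
   part : ∀ {a b : ℕ} → odd a ≡ odd b → + a ≈[ 5 ] + b → + a ≈[ 10 ] + b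
   part {a} {b} eo e = ≈-trans (≈-reflexive (lem (+ a) (+ b))) (+-vanishes-≈ (≈-mod-10 (difference (≈-trans (odd-≈ a) (≈-trans (≈-reflexive (cong value eo)) (≈-sym (odd-≈ b))))) (difference e)))

  -- Parallel vectors with the same nonzero value of `Λ` agree modulo 5; as they share their parity
  -- class they would be equal.
  independent : ∀ {Λ : G → ℤ} {x y : Zn² 10} → Additive 5 Λ → class x ≡ class y → x ≢ y → Λ ⟪ x ⟫ ≈[ 5 ] 1ℤ → Λ ⟪ y ⟫ ≈[ 5 ] 1ℤ → ¬ (det ⟪ x ⟫ ⟪ y ⟫ ≈[ 5 ] 0ℤ)
  independent {Λ} {x} {y} additive ec x≢y λx λy z = multiple (dependent ⟪ x ⟫ ⟪ y ⟫ (λ v → 1≉0 (≈-trans (≈-sym λx) (additive-vanishes {f = Λ} additive ⟪ x ⟫ v))) z)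
   where
   multiple : (∃ λ β → ⟪ y ⟫ ≈²[ 5 ] β · ⟪ x ⟫) → ⊥
   multiple (β , e , e′) = x≢y (equal-mod-10 ec (≈-sym (≈-trans e (unit (proj₁ ⟪ x ⟫))) , ≈-sym (≈-trans e′ (unit (proj₂ ⟪ x ⟫)))))
    where
    β≈1 : β ≈[ 5 ] 1ℤ
    β≈1 = ≈-trans (≈-sym (≈-trans (additive-multiple {f = Λ} additive β ⟪ x ⟫) (≈-trans (*-congˡ-≈ β λx) (≈-reflexive (ℤₚ.*-identityʳ β))))) (≈-trans (≈-sym (additive-cong {f = Λ} additive {⟪ y ⟫} {β · ⟪ x ⟫} (e , e′))) λy)
    unit : ∀ a → β * a ≈[ 5 ] a
    unit a = ≈-trans (*-cong-≈ β≈1 (≈-refl {a = a})) (≈-reflexive (ℤₚ.*-identityˡ a))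

  record Line (i j k : K) (x x′ : Zn² 10) : Set where
   field
    Λ        : G → ℤ
    additive : Additive 5 Λ
    on-line  : ∀ {y} → y ∈ U → class y ≡ i → Λ ⟪ y ⟫ ≈[ 5 ] 1ℤ
    opposite : ∀ {t s} → t ∈ U → s ∈ U → class t ≡ j → class s ≡ k → Λ ⟪ t ⟫ + Λ ⟪ s ⟫ ≈[ 5 ] 1ℤ

  -- `affine` treats five terms at a time, but all its forms agree at the independent vectors x and
  -- x′, hence everywhere; one form therefore serves the whole of U.
  line : ∀ {i j k} → Triple i j k → ∀ {x x′} → x ∈ U → x′ ∈ U → class x ≡ i → class x′ ≡ i → x ≢ x′ → Line i j k x x′
  line {i} {j} {k} t {x} {x′} x∈U x′∈U ex ex′ x≢x′ = from (front-pair x∈U x′∈U x≢x′)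
   where
   from : (∃ λ r → U ↭ x ∷ x′ ∷ r) → Line i j k x x′
   from (r , π) = conclude (all-classes r r-odd r-even (λ w∈r → no-even (in-U w∈r)) t) (all-classes r r-odd r-even (λ w∈r → no-even (in-U w∈r)) (swap₁₂ t))
     (all-classes r r-odd r-even (λ w∈r → no-even (in-U w∈r)) (swap₁₂ (swap₂₃ t)))
    where
    in-U : ∀ {w} → w ∈ r → w ∈ U
    in-U w∈r = ∈-resp-↭ (↭-sym π) (there (there w∈r))
    r-odd : odd (length r) ≡ true
    r-odd = cong odd (ℕₚ.suc-injective (ℕₚ.suc-injective (trans (sym (↭-length π)) U-size)))
    r-even : Σclass r ≡ even
    r-even = trans (sym (trans (cong₂ (λ a b → a ⊻ b ⊻ Σclass r) ex ex′) (⊻-cancel i (Σclass r)))) (trans (sym (Σclass-↭ π)) U-even)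
    classes-≢ : ∀ {a b} {y z : Zn² 10} → a ≢ b → class y ≡ a → class z ≡ b → y ≢ z
    classes-≢ ne ea eb refl = ne (trans (sym ea) eb)
    affine-at : ∀ {y u v} → y ∈ r → u ∈ r → v ∈ r → class y ≡ i → class u ≡ j → class v ≡ k → Affine x x′ y u v
    affine-at y∈r u∈r v∈r ey eu ev = finish (front-triple y∈r u∈r v∈r (classes-≢ (triple-≢ t) ey eu) (classes-≢ (triple-≢ (swap₂₃ t)) ey ev) (classes-≢ (triple-≢ (swap₂₃ (swap₁₂ t))) eu ev))
     where
     finish : (∃ λ rest → r ↭ _ ∷ _ ∷ _ ∷ rest) → Affine x x′ _ _ _
     finish (rest , σ) = affine (↭-trans π (prep x (prep x′ σ))) ex ex′ ey eu ev (triple-even t)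
    conclude : (∃ λ w → w ∈ r × class w ≡ i) → (∃ λ w → w ∈ r × class w ≡ j) → (∃ λ w → w ∈ r × class w ≡ k) → Line i j k x x′
    conclude (y₀ , y₀∈ , ey₀) (u₀ , u₀∈ , eu₀) (v₀ , v₀∈ , ev₀) = from-affine (affine-at y₀∈ u₀∈ v₀∈ ey₀ eu₀ ev₀)
     where
     from-affine : Affine x x′ y₀ u₀ v₀ → Line i j k x x′
     from-affine a₀ = record { Λ = Λ₀ ; additive = Affine.additive a₀ ; on-line = on-line ; opposite = opposite }
      where
      Λ₀ : G → ℤ
      Λ₀ = Affine.Λ a₀
      agree : ∀ {y u v} (a : Affine x x′ y u v) g → Λ₀ g ≈[ 5 ] Affine.Λ a g
      agree a = additive-agree prime-5 {Λ₀} {Affine.Λ a} (Affine.additive a₀) (Affine.additive a) ⟪ x ⟫ ⟪ x′ ⟫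
        (independent {Λ₀} (Affine.additive a₀) (trans ex (sym ex′)) x≢x′ (Affine.at₁ a₀) (Affine.at₂ a₀))
        (≈-trans (Affine.at₁ a₀) (≈-sym (Affine.at₁ a))) (≈-trans (Affine.at₂ a₀) (≈-sym (Affine.at₂ a)))
      inner : ∀ {w} → w ∈ U → w ≢ x → w ≢ x′ → w ∈ r
      inner w∈U w≢x w≢x′ = remaining ↭-refl (remaining π w∈U w≢x) w≢x′
      on-line : ∀ {y} → y ∈ U → class y ≡ i → Λ₀ ⟪ y ⟫ ≈[ 5 ] 1ℤ
      on-line {y} y∈U ey = decide (y ≟² x) (y ≟² x′)
        where
        decide : Dec (y ≡ x) → Dec (y ≡ x′) → Λ₀ ⟪ y ⟫ ≈[ 5 ] 1ℤ
        decide (yes e) _ = subst (λ w → Λ₀ ⟪ w ⟫ ≈[ 5 ] 1ℤ) (sym e) (Affine.at₁ a₀)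
        decide (no _) (yes e) = subst (λ w → Λ₀ ⟪ w ⟫ ≈[ 5 ] 1ℤ) (sym e) (Affine.at₂ a₀)
        decide (no y≢x) (no y≢x′) = read (affine-at (inner y∈U y≢x y≢x′) u₀∈ v₀∈ ey eu₀ ev₀)
          where
          read : Affine x x′ y u₀ v₀ → Λ₀ ⟪ y ⟫ ≈[ 5 ] 1ℤ
          read a = ≈-trans (agree a ⟪ y ⟫) (Affine.at₃ a)
      opposite : ∀ {t s} → t ∈ U → s ∈ U → class t ≡ j → class s ≡ k → Λ₀ ⟪ t ⟫ + Λ₀ ⟪ s ⟫ ≈[ 5 ] 1ℤ
      opposite {u} {v} u∈U v∈U eu ev = read (affine-at y₀∈ (inner u∈U (λ e → classes-≢ i≢j ex eu (sym e)) (λ e → classes-≢ i≢j ex′ eu (sym e)))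
          (inner v∈U (λ e → classes-≢ i≢k ex ev (sym e)) (λ e → classes-≢ i≢k ex′ ev (sym e))) ey₀ eu ev)
        where
        i≢j = triple-≢ t
        i≢k = triple-≢ (swap₂₃ t)
        read : Affine x x′ y₀ u v → Λ₀ ⟪ u ⟫ + Λ₀ ⟪ v ⟫ ≈[ 5 ] 1ℤ
        read a = ≈-trans (+-cong-≈ (agree a ⟪ u ⟫) (agree a ⟪ v ⟫)) (Affine.at₂₃ a)

  present : ∀ {i j k} → Triple i j k → ∃ λ x → x ∈ U × class x ≡ i
  present = all-classes U (cong odd U-size) U-even no-even

  -- Comparing the two forms shows that they agree.
  two-lines : ∀ {i j k x x′ y y′} → Triple i j k → y ∈ U → y′ ∈ U → class y ≡ j → class y′ ≡ j → y ≢ y′ → x ∈ U → class x ≡ i →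
           (l : Line i j k x x′) → Line.Λ l ⟪ y ⟫ ≈[ 5 ] 1ℤ
  two-lines {i} {j} {k} {x} {x′} {y} {y′} t y∈U y′∈U ey ey′ y≢y′ x∈U ex l = with-third (line (swap₁₂ t) y∈U y′∈U ey ey′ y≢y′) (present (swap₁₂ (swap₂₃ t)))
   where
   open Line l
   a : ℤ
   a = Λ ⟪ y ⟫
   with-third : Line j i k y y′ → (∃ λ s → s ∈ U × class s ≡ k) → Λ ⟪ y ⟫ ≈[ 5 ] 1ℤ
   with-third m (s , s∈U , es) = PrimeField.cancel-≈ prime-5 (+ 2) (small≉0 1 (s≤s (s≤s (s≤s z≤n)))) (≈-trans (≈-reflexive (lem a (Λ ⟪ s ⟫)))
     (≈-trans (+-cong-≈ (opposite y∈U s∈U ey es) a-s) ≈-refl))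
    where
    module M = Line m
    same : Λ ⟪ y′ ⟫ ≈[ 5 ] a
    same = ≈-trans (≈-reflexive (isolate (Λ ⟪ y′ ⟫) (Λ ⟪ s ⟫))) (≈-trans (+-cong-≈ (≈-trans (opposite y′∈U s∈U ey′ es) (≈-sym (opposite y∈U s∈U ey es))) (≈-refl {a = - Λ ⟪ s ⟫})) (≈-reflexive (sym (isolate a (Λ ⟪ s ⟫)))))
     where
     isolate : ∀ a b → a ≡ a + b + - b
     isolate = solve-∀
    -- `Λ` has the value a at both y and y′. Evaluating the proportionality at x and s gives 1 +
    -- Λ(s) = a, while `opposite` gives a + Λ(s) = 1; so 2a = 2.
    scaled : ∀ g → Λ g ≈[ 5 ] a * M.Λ g
    scaled = additive-agree prime-5 {Λ} {λ g → a * M.Λ g} additive (additive-scaled {f = M.Λ} M.additive a) ⟪ y ⟫ ⟪ y′ ⟫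
     (independent {M.Λ} M.additive (trans ey (sym ey′)) y≢y′ (M.on-line y∈U ey) (M.on-line y′∈U ey′))
     (≈-sym (one (M.on-line y∈U ey))) (≈-trans same (≈-sym (one (M.on-line y′∈U ey′))))
     where
     one : ∀ {z} → z ≈[ 5 ] 1ℤ → a * z ≈[ 5 ] a
     one e = ≈-trans (*-congˡ-≈ a e) (≈-reflexive (ℤₚ.*-identityʳ a))
    a-s : a + - Λ ⟪ s ⟫ ≈[ 5 ] 1ℤ
    a-s = ≈-trans (+-cong-≈ (≈-sym a≈) (≈-refl {a = - Λ ⟪ s ⟫})) (≈-reflexive (lem′ (Λ ⟪ s ⟫)))
     where
     lem′ : ∀ s → 1ℤ + s + - s ≡ 1ℤ
     lem′ = solve-∀
     a≈ : 1ℤ + Λ ⟪ s ⟫ ≈[ 5 ] a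
     a≈ = ≈-trans (+-cong-≈ (≈-trans (≈-sym (on-line x∈U ex)) (scaled ⟪ x ⟫)) (scaled ⟪ s ⟫))
       (≈-trans (≈-reflexive (sym (ℤₚ.*-distribˡ-+ a (M.Λ ⟪ x ⟫) (M.Λ ⟪ s ⟫)))) (≈-trans (*-congˡ-≈ a (M.opposite x∈U s∈U ex es)) (≈-reflexive (ℤₚ.*-identityʳ a))))
    lem : ∀ a s → + 2 * a ≡ a + s + (a + - s)
    lem = solve-∀

-- Modulus 10: the remaining search and the case distinction on constant classes

module ModulusTen where

 open TranslationRing
 open GroupAlgebras
 open MultilinearForms
 open QuarticForm
 open QuarticClassification
 open ZeroSumSequences
 open ResidueVectors
 open PrimeFields
 open ThreeDistinctValues
 open PrimeModulus
 open SearchSoundness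
 open SearchSetup
 open SearchProcedure
 open SearchResults
 open PrimePowerModulus
 open ModuliEightNine
 open ParityBlocks
 open ParityLinesTen
 open import Data.Bool using (Bool; true; false; not; _∧_; _∨_; if_then_else_; T)
 import Data.Bool.Properties as Boolₚ
 open import Data.Nat as ℕ using (ℕ; zero; suc; _∸_; s≤s; z≤n; NonZero; _≡ᵇ_)
 open import Data.Nat.DivMod using (_%_; m%n<n)
 open import Data.Integer using (ℤ; +_; _+_; _*_; -_; _-_; 0ℤ; 1ℤ)
 open import Data.Fin as Fin using (Fin; toℕ)
 open import Data.Fin.Properties using (any?; toℕ<n) renaming (all? to allFin?)
 open import Data.Product.Properties using (≡-dec)
 open import Data.Unit using (tt)
 open import Data.List using (List; []; _∷_; _++_; map; length; replicate; tabulate)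
 open import Data.List.Properties using (length-map; length-++; length-replicate; map-++; ++-assoc; map-replicate)
 open import Data.List.Relation.Unary.All as All using (All; []; _∷_)
 open import Data.List.Relation.Unary.Any as Any using (here; there)
 open import Data.List.Membership.Propositional.Properties using (∈-++⁺ʳ; ∈-map⁻)
 open import Data.List.Relation.Binary.Sublist.Propositional using (_⊆_; []; _∷_)
 open import Data.List.Relation.Binary.Sublist.Propositional.Properties using () renaming (++⁺ to ⊆-++)
 open import Data.List.Relation.Binary.Permutation.Propositional using (_↭_; prep; swap; ↭-sym; ↭-trans; ↭-refl; ↭-reflexive)
 open import Data.List.Relation.Binary.Permutation.Propositional.Properties using (shift; shifts; map⁺; ↭-length; ++⁺ˡ; ++⁺ʳ; ++-comm; ∈-resp-↭)
 open import Relation.Nullary.Decidable using (from-yes; from-no; _⊎-dec_; _×-dec_; ¬?; decidable-stable)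

 -- A prescribed number of copies is entered before the search goes on; a blocked copy settles the
 -- claim at once.
 place : ℕ → Candidate → Table → (Table → Bool) → Bool
 place zero    c t f = f t
 place (suc n) c t f = if blocked t c then true else place n c (add c t) f

 module _ {N : ℕ} where
  open Search N

  place-sound : ∀ n {c t f L B R} → place n c t f ≡ true → Shaped t → Sound t L → Free L (B ++ R) → All (Matches c) B → length B ≡ n →
         (∀ {t L} → f t ≡ true → Shaped t → Sound t L → Free L R → ⊥) → ⊥
  place-sound zero {B = []} e shaped sound free ms len k = k e shaped sound free
  place-sound (suc n) {c} {t} {f} {L} {g ∷ B} e shaped sound free (m ∷ ms) len k = decide (blocked t c) refl e
   where
   decide : ∀ b → blocked t c ≡ b → (if b then true else place n c (add c t) f) ≡ true → ⊥
   decide true  b _ = not-blocked {t} {L} {c} sound free m b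
   decide false _ e = place-sound n e (add-shaped c shaped) (add-sound {c} shaped m sound) (move free) ms (ℕₚ.suc-injective len) k

 all-true : ∀ {A : Set} → (A → Bool) → List A → Bool
 all-true f []      = true
 all-true f (x ∷ l) = f x ∧ all-true f l

 all-true-sound : ∀ {A : Set} (f : A → Bool) l → all-true f l ≡ true → ∀ {x} → x ∈ l → f x ≡ true
 all-true-sound f (x ∷ l) e x∈l with f x in eq
 all-true-sound f (x ∷ l) e (here refl) | true = eq
 all-true-sound f (x ∷ l) e (there x∈l) | true = all-true-sound f l e x∈l

 -- Coordinates (x , y) with respect to u in the first class and v, the value of the second
 -- class; the form Λ is x + b y.

 first-class third-class : ℕ → Zn² 10 → Bool
 first-class b (x , y) = (toℕ x % 2 ≡ᵇ 1) ∧ (toℕ y % 2 ≡ᵇ 0) ∧ ((toℕ x ℕ.+ b ℕ.* toℕ y) % 5 ≡ᵇ 1)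
 third-class b (x , y) = (toℕ x % 2 ≡ᵇ 1) ∧ (toℕ y % 2 ≡ᵇ 1) ∧ ((toℕ x ℕ.+ b ℕ.* toℕ y ℕ.+ b) % 5 ≡ᵇ 1)

 -- The total of U has Λ = 0, where Λ is b at v, 1 - b, that is 6 - b modulo 5, at the third value,
 -- and 1 at the other 19 - (c₂ + c₃) terms. Both multiplicities are odd.
 admissible : ℕ → ℕ → ℕ → Bool
 admissible b c₂ c₃ = odd c₂ ∧ odd c₃ ∧ ((c₂ ℕ.* b ℕ.+ c₃ ℕ.* (6 ∸ b) ℕ.+ (19 ∸ (c₂ ℕ.+ c₃))) % 5 ≡ᵇ 0)

 module E10 = Exhaustion 10 2

 -- One copy of v is left out, since U becomes zero-sum free only after a term is removed.
 no-completion : ℕ → ℕ → ℕ → ℕ → Zn² 10 → Bool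
 no-completion fuel b c₂ c₃ g = place c₃ (E10.candidate-of 8 8 g) (initial 10 0 (c₂ ∸ 1))
  (λ t → impossible fuel t (map (E10.candidate-of 8 8) (E10.points (first-class b))) (19 ∸ (c₂ ℕ.+ c₃)))

 excluded-or-verified : ℕ → ℕ → ℕ → ℕ → Bool
 excluded-or-verified fuel b c₂ c₃ = not (admissible b c₂ c₃) ∨ all-true (no-completion fuel b c₂ c₃) (E10.points (third-class b))

 verified-10 : ℕ → Bool
 verified-10 fuel = below 5 (λ b → below 8 (λ c₂ → below 8 (excluded-or-verified fuel b c₂)))

 excluded-0 : ℕ → ℕ → Bool
 excluded-0 c₂ c₃ = not (admissible 0 c₂ c₃)

 -- For b = 0 the congruence says that c₂ is 4 modulo 5, which no odd number below 8 satisfies.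
 nonzero-value : below 8 (λ c₂ → below 8 (excluded-0 c₂)) ≡ true
 nonzero-value = refl

 units-10? : Dec (∀ (r : Fin 10) → (+ toℕ r ≈[ 2 ] 0ℤ) ⊎ (+ toℕ r ≈[ 5 ] 0ℤ) ⊎ (∃ λ (i : Fin 10) → + toℕ r * + toℕ i ≈[ 10 ] 1ℤ))
 units-10? = allFin? (λ r → ≈0? 2 (+ toℕ r) ⊎-dec (≈0? 5 (+ toℕ r) ⊎-dec any? (λ i → ≈? (+ toℕ r * + toℕ i) 1ℤ)))

 units-10 : ∀ (r : Fin 10) → (+ toℕ r ≈[ 2 ] 0ℤ) ⊎ (+ toℕ r ≈[ 5 ] 0ℤ) ⊎ (∃ λ (i : Fin 10) → + toℕ r * + toℕ i ≈[ 10 ] 1ℤ)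
 units-10 = from-yes units-10?

 odd-+ : ∀ m k → odd m ≡ false → odd (m ℕ.+ k) ≡ odd k
 odd-+ zero k e = refl
 odd-+ (suc (suc m)) k e = trans (Boolₚ.not-involutive _) (odd-+ m k (trans (sym (Boolₚ.not-involutive _)) e))

 Σclass-replicate : ∀ {n} (x : Zn² n) m → odd m ≡ false → Σclass (replicate m x) ≡ even
 Σclass-replicate x zero e = refl
 Σclass-replicate x (suc (suc m)) e = trans (⊻-cancel (class x) _) (Σclass-replicate x m (trans (sym (Boolₚ.not-involutive _)) e))

 odd<8 : ∀ {m} → m ℕ.+ 2 ℕ.≤ 10 → odd m ≡ true → m ℕ.< 8
 odd<8 {m} le o with ℕₚ.m≤n⇒m<n∨m≡n (ℕₚ.+-cancelʳ-≤ 2 m 8 le)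
 ... | inj₁ lt = lt
 odd<8 {.8} le () | inj₂ refl

 %-value : ∀ {n m r} .{{_ : NonZero n}} → r ℕ.< n → + m ≈[ n ] + r → (m % n ≡ᵇ r) ≡ true
 %-value {n} {m} {r} r<n e = trans (cong (_≡ᵇ r) (residue-unique (m%n<n m n) r<n (≈-trans (%-≈ m n) e))) (self r)
  where
  self : ∀ r → (r ≡ᵇ r) ≡ true
  self zero = refl
  self (suc r) = self r

 ∧-intro : ∀ {a b} → a ≡ true → b ≡ true → a ∧ b ≡ true
 ∧-intro refl refl = refl

 e₁-10 e₂-10 : Zn² 10
 e₁-10 = Fin.suc Fin.zero , Fin.zero
 e₂-10 = Fin.zero , Fin.suc Fin.zero

 completion-impossible : ∀ fuel b c₂ c₃ g C → no-completion fuel b c₂ c₃ g ≡ true → ZeroFree 10 (map ⟪_⟫ (replicate (c₂ ∸ 1) e₂-10 ++ replicate c₃ g ++ C)) →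
          (∀ {h} → h ∈ C → first-class b h ≡ true) → (∀ h → count h C ℕ.≤ 8) → length C ≡ 19 ∸ (c₂ ℕ.+ c₃) → ⊥
 completion-impossible fuel b c₂ c₃ g C check free good few size = finish (E10.fill 8 8 (E10.points (first-class b)) C
   (λ {h} h∈ → E10.point (first-class b) {h} (subst T (sym (good h∈)) tt)) (λ { h@(_ , y) → ℕₚ.≤-trans (few h) (ℕₚ.≤-reflexive (sym (constant-limit (toℕ y % 2 ≡ᵇ 0)))) }))
  where
  open Search 10 using (Free; Fill; impossible-sound)
  n = c₂ ∸ 1
  constant-limit : ∀ b → (if b then 8 else 8) ≡ 8
  constant-limit true = refl
  constant-limit false = refl
  finish : (∃ λ C′ → C ↭ C′ × Fill (map (E10.candidate-of 8 8) (E10.points (first-class b))) (map ⟪_⟫ C′)) → ⊥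
  finish (C′ , π′ , filled) = place-sound c₃ {c = E10.candidate-of 8 8 g} {t = initial 10 0 (c₂ ∸ 1)}
    {f = λ t → impossible fuel t (map (E10.candidate-of 8 8) (E10.points (first-class b))) (19 ∸ (c₂ ℕ.+ c₃))}
    {L = map ⟪_⟫ (replicate n e₂-10)} {B = map ⟪_⟫ (replicate c₃ g)} {R = map ⟪_⟫ C′}
    check (E10.initial-shaped 0 n) (E10.initial-sound {e₁-10} {e₂-10} refl refl 0 n) separated (E10.all-replicate c₃ g (E10.candidate-matches 8 8 g)) (trans (length-map ⟪_⟫ (replicate c₃ g)) (length-replicate c₃))
    (λ e shaped sound free → impossible-sound fuel e shaped sound free filled (trans (length-map ⟪_⟫ C′) (trans (sym (↭-length π′)) size)))
   where
   rearranged : map ⟪_⟫ (replicate n e₂-10 ++ replicate c₃ g ++ C) ↭ map ⟪_⟫ (replicate n e₂-10) ++ map ⟪_⟫ (replicate c₃ g) ++ map ⟪_⟫ C′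
   rearranged = ↭-trans (map⁺ ⟪_⟫ (++⁺ˡ (replicate n e₂-10) (++⁺ˡ (replicate c₃ g) π′)))
    (↭-reflexive (trans (map-++ ⟪_⟫ (replicate n e₂-10) _) (cong (map ⟪_⟫ (replicate n e₂-10) ++_) (map-++ ⟪_⟫ (replicate c₃ g) C′))))
   separated : Free (map ⟪_⟫ (replicate n e₂-10)) (map ⟪_⟫ (replicate c₃ g) ++ map ⟪_⟫ C′)
   separated {S} {T′} s t z = from (⊆-through-↭ rearranged (⊆-++ s t))
    where
    empty : ∀ {S′} → S′ ≡ [] → S′ ↭ S ++ T′ → T′ ≡ []
    empty refl σ = length-zero (ℕₚ.m+n≡0⇒n≡0 (length S) (trans (sym (length-++ S)) (sym (↭-length σ))))
    from : (∃ λ S′ → S′ ⊆ map ⟪_⟫ (replicate n e₂-10 ++ replicate c₃ g ++ C) × S′ ↭ S ++ T′) → T′ ≡ []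
    from (S′ , s′ , σ) = empty (free s′ (subst (Vanishes 10) (trans (sym (Σ⊕-++ S T′)) (sym (Σ⊕-↭ σ))) z)) σ

 module TenCore (algebra : GroupAlgebra 5 5) {U : List (Zn² 10)} (U-size : length U ≡ 19) (min : MinimalZeroSum 10 (map ⟪_⟫ U))
   (few : ∀ x → count x U ℕ.+ 2 ℕ.≤ 10) where

  open Ten algebra U-size min
  open TenLines algebra U-size min
  open PrimeField prime-5

  Constant : K → Zn² 10 → Set
  Constant j v = ∀ {y} → y ∈ U → class y ≡ j → y ≡ v

  -- Removing an even number of copies would keep the length odd and the sum even, and such a
  -- sequence meets all three odd classes.
  odd-multiplicity : ∀ {i j k v r} m → Triple j i k → U ↭ replicate m v ++ r → (∀ {y} → y ∈ r → class y ≢ j) → odd m ≡ true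
  odd-multiplicity {j = j} {v = v} {r} m t π none = decide (odd m) refl
   where
   decide : ∀ b → odd m ≡ b → odd m ≡ true
   decide true  e = e
   decide false e = absurd (all-classes r (trans (sym (odd-+ m (length r) e)) (trans (cong odd (trans (cong (ℕ._+ length r) (sym (length-replicate m))) (trans (sym (length-++ (replicate m v))) (sym (↭-length π))))) (cong odd U-size)))
     (trans (sym (trans (Σclass-++ (replicate m v) r) (cong (_⊻ Σclass r) (Σclass-replicate v m e)))) (trans (sym (Σclass-↭ π)) U-even))
     (λ y∈r → no-even (∈-resp-↭ (↭-sym π) (∈-++⁺ʳ (replicate m v) y∈r))) t)
    where
    absurd : (∃ λ x → x ∈ r × class x ≡ j) → odd m ≡ true
    absurd (x , x∈r , ex) = ⊥-elim (none x∈r ex)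

  sum-ones : ∀ {Λ : G → ℤ} → Additive 5 Λ → ∀ l → (∀ {y : Zn² 10} → y ∈ l → Λ ⟪ y ⟫ ≈[ 5 ] 1ℤ) → Λ (Σs l) ≈[ 5 ] + length l
  sum-ones {Λ} additive [] one = additive-𝟎 {f = Λ} additive
  sum-ones {Λ} additive (y ∷ l) one = ≈-trans (additive ⟪ y ⟫ (Σs l)) (+-cong-≈ (one (here refl)) (sum-ones {Λ} additive l (λ z → one (there z))))

  Λ-++ : ∀ {Λ : G → ℤ} → Additive 5 Λ → ∀ l l′ → Λ (Σs {10} (l ++ l′)) ≈[ 5 ] Λ (Σs l) + Λ (Σs l′)
  Λ-++ {Λ} additive l l′ = ≈-trans (≈-reflexive (cong Λ (trans (cong Σ⊕ (map-++ ⟪_⟫ l l′)) (Σ⊕-++ (map ⟪_⟫ l) (map ⟪_⟫ l′))))) (additive (Σs l) (Σs l′))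

  Λ-total : ∀ {Λ : G → ℤ} → Additive 5 Λ → ∀ {l} → U ↭ l → Λ (Σs l) ≈[ 5 ] 0ℤ
  Λ-total {Λ} additive {l} π = additive-vanishes {f = Λ} additive (Σs l) (subst (Vanishes 5) (Σ⊕-↭ (map⁺ ⟪_⟫ π))
   (≈-coarsen (ℕ∣.divides 2 refl) (proj₁ (MinimalZeroSum.zero-sum min)) , ≈-coarsen (ℕ∣.divides 2 refl) (proj₂ (MinimalZeroSum.zero-sum min))))

  count-suffix : ∀ {l r} → U ↭ l ++ r → ∀ x → count x r ℕ.+ 2 ℕ.≤ 10
  count-suffix {l} {r} π x = ℕₚ.≤-trans (ℕₚ.+-monoˡ-≤ 2 (ℕₚ.≤-trans (ℕₚ.m≤n+m (count x r) (count x l)) (ℕₚ.≤-reflexive (sym (trans (count-↭ x π) (count-++ x l r)))))) (few x)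

  -- Two classes constant, with values v and g

  record Split (i j k : K) (v g : Zn² 10) : Set where
   field
    c₂ c₃   : ℕ
    C       : List (Zn² 10)
    covers  : U ↭ replicate c₂ v ++ replicate c₃ g ++ C
    in-C    : ∀ {y} → y ∈ C → y ∈ U × class y ≡ i
    c₂-odd  : odd c₂ ≡ true
    c₃-odd  : odd c₃ ≡ true
    c₂<8    : c₂ ℕ.< 8
    c₃<8    : c₃ ℕ.< 8
    C-size  : length C ≡ 19 ∸ (c₂ ℕ.+ c₃)
    total   : c₂ ℕ.+ (c₃ ℕ.+ length C) ≡ 19

  split-classes : ∀ {i j k v g} → Triple i j k → Constant j v → Constant k g → class v ≡ j → class g ≡ k → Split i j k v g
  split-classes {i} {j} {k} {v} {g} t const-v const-g ev eg = from (gather v U)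
   where
   from : (∃ λ r → U ↭ replicate (count v U) v ++ r × All (_≢ v) r) → Split i j k v g
   from (r₁ , π₁ , ne₁) = from₂ (gather g r₁)
    where
    from₂ : (∃ λ r → r₁ ↭ replicate (count g r₁) g ++ r × All (_≢ g) r) → Split i j k v g
    from₂ (C , π₂ , ne₂) = record
     { c₂ = c₂ ; c₃ = c₃ ; C = C ; covers = π ; in-C = in-C ; c₂-odd = c₂-odd ; c₃-odd = c₃-odd
     ; c₂<8 = odd<8 (few v) c₂-odd ; c₃<8 = odd<8 (count-suffix {replicate c₂ v} π₁ g) c₃-odd
     ; C-size = sym (trans (cong (_∸ (c₂ ℕ.+ c₃)) (trans (sym total) (sym (ℕₚ.+-assoc c₂ c₃ (length C))))) (ℕₚ.m+n∸m≡n (c₂ ℕ.+ c₃) (length C)))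
     ; total = total }
     where
     c₂ = count v U
     c₃ = count g r₁
     π : U ↭ replicate c₂ v ++ replicate c₃ g ++ C
     π = ↭-trans π₁ (++⁺ˡ (replicate c₂ v) π₂)
     total : c₂ ℕ.+ (c₃ ℕ.+ length C) ≡ 19
     total = trans (sym (trans (length-++ (replicate c₂ v)) (cong₂ ℕ._+_ (length-replicate c₂) (trans (length-++ (replicate c₃ g)) (cong (ℕ._+ length C) (length-replicate c₃)))))) (trans (sym (↭-length π)) U-size)
     in-r₁ : ∀ {y} → y ∈ r₁ → y ∈ U
     in-r₁ y∈ = ∈-resp-↭ (↭-sym π₁) (∈-++⁺ʳ (replicate c₂ v) y∈)
     C-r₁ : ∀ {y} → y ∈ C → y ∈ r₁
     C-r₁ y∈ = ∈-resp-↭ (↭-sym π₂) (∈-++⁺ʳ (replicate c₃ g) y∈)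
     not-j : ∀ {y} → y ∈ r₁ → class y ≢ j
     not-j y∈ e = All.lookup ne₁ y∈ (const-v (in-r₁ y∈) e)
     not-k : ∀ {y} → y ∈ C → class y ≢ k
     not-k y∈ e = All.lookup ne₂ y∈ (const-g (in-r₁ (C-r₁ y∈)) e)
     in-C : ∀ {y} → y ∈ C → y ∈ U × class y ≡ i
     in-C {y} y∈ = in-r₁ (C-r₁ y∈) , [ (λ e → e) , [ (λ e → ⊥-elim (not-j (C-r₁ y∈) e)) , (λ e → ⊥-elim (not-k y∈ e)) ]′ ]′ (triple-cases t (class y) (no-even (in-r₁ (C-r₁ y∈))))
     c₂-odd : odd c₂ ≡ true
     c₂-odd = odd-multiplicity c₂ (swap₁₂ t) π₁ not-j
     σ : U ↭ replicate c₃ g ++ replicate c₂ v ++ C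
     σ = ↭-trans π (shifts (replicate c₂ v) (replicate c₃ g))
     replicate-v : ∀ n {y} → y ∈ replicate n v → class y ≢ k
     replicate-v (suc n) (here refl) e = triple-≢ (swap₂₃ (swap₁₂ t)) (trans (sym ev) e)
     replicate-v (suc n) (there y∈) = replicate-v n y∈
     outside : ∀ n {y} → y ∈ replicate n v ++ C → class y ≢ k
     outside zero y∈ = not-k y∈
     outside (suc n) (here refl) = replicate-v 1 (here refl)
     outside (suc n) (there y∈) = outside n y∈
     c₃-odd : odd c₃ ≡ true
     c₃-odd = odd-multiplicity c₃ (swap₁₂ (swap₂₃ t)) σ (outside c₂)

  -- Three odd multiplicities below 8 with sum 19 are 7, 7 and 5 in some order.
  constant-split : ∀ {i j k w v g} → Triple i j k → Constant i w → class v ≡ j → class g ≡ k → Split i j k v g → ⊥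
  constant-split {i} {j} {k} {w} {v} {g} t const-w ev eg sp = decide (five-or-seven c₂ c₂<8 c₂-odd 5≤c₂) (five-or-seven c₃ c₃<8 c₃-odd 5≤c₃) (five-or-seven c₁ c₁<8 c₁-odd 5≤c₁)
   where
   open Split sp
   c₁ = length C
   C≡ : C ≡ replicate c₁ w
   C≡ = constant-list w C (All.tabulate (λ y∈ → const-w (proj₁ (in-C y∈)) (proj₂ (in-C y∈))))
   c₁≤ : c₁ ℕ.+ 2 ℕ.≤ 10
   c₁≤ = subst (λ n → n ℕ.+ 2 ℕ.≤ 10) (trans (cong (count w) C≡) (count-replicate w c₁))
    (count-suffix {replicate c₂ v ++ replicate c₃ g} (↭-trans covers (↭-reflexive (sym (++-assoc (replicate c₂ v) (replicate c₃ g) C)))) w)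
   other : ∀ n m {y} → y ∈ replicate n v ++ replicate m g → class y ≢ i
   other zero (suc m) (here refl) e = triple-≢ (swap₂₃ t) (trans (sym e) eg)
   other zero (suc m) (there y∈) = other zero m y∈
   other (suc n) m (here refl) e = triple-≢ t (trans (sym e) ev)
   other (suc n) m (there y∈) = other n m y∈
   σ : U ↭ replicate c₁ w ++ replicate c₂ v ++ replicate c₃ g
   σ = ↭-trans covers (↭-trans (↭-reflexive (sym (++-assoc (replicate c₂ v) (replicate c₃ g) C))) (↭-trans (++-comm (replicate c₂ v ++ replicate c₃ g) C) (↭-reflexive (cong (_++ (replicate c₂ v ++ replicate c₃ g)) C≡))))
   c₁-odd : odd c₁ ≡ true
   c₁-odd = odd-multiplicity c₁ t σ (other c₂ c₃)
   c₁<8 = odd<8 c₁≤ c₁-odd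
   bound : ∀ a b c → a ℕ.+ (b ℕ.+ c) ≡ 19 → b ℕ.< 8 → c ℕ.< 8 → 5 ℕ.≤ a
   bound a b c e (s≤s b≤) (s≤s c≤) = ℕₚ.+-cancelʳ-≤ 14 5 a (ℕₚ.≤-trans (ℕₚ.≤-reflexive (sym e)) (ℕₚ.+-monoʳ-≤ a (ℕₚ.+-mono-≤ b≤ c≤)))
   5≤c₂ = bound c₂ c₃ c₁ total c₃<8 c₁<8
   5≤c₃ = bound c₃ c₂ c₁ (trans (swap-sum c₃ c₂ c₁) total) c₂<8 c₁<8
    where
    swap-sum : ∀ a b c → a ℕ.+ (b ℕ.+ c) ≡ b ℕ.+ (a ℕ.+ c)
    swap-sum a b c = trans (sym (ℕₚ.+-assoc a b c)) (trans (cong (ℕ._+ c) (ℕₚ.+-comm a b)) (ℕₚ.+-assoc b a c))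
   5≤c₁ = bound c₁ c₂ c₃ (trans (ℕₚ.+-comm c₁ (c₂ ℕ.+ c₃)) (trans (ℕₚ.+-assoc c₂ c₃ c₁) total)) c₂<8 c₃<8
   five-or-seven : ∀ m → m ℕ.< 8 → odd m ≡ true → 5 ℕ.≤ m → m ≡ 5 ⊎ m ≡ 7
   five-or-seven 5 _ _ _ = inj₁ refl
   five-or-seven 7 _ _ _ = inj₂ refl
   five-or-seven 6 _ () _
   five-or-seven 0 _ _ ()
   five-or-seven 1 _ _ (s≤s ())
   five-or-seven 2 _ _ (s≤s (s≤s ()))
   five-or-seven 3 _ _ (s≤s (s≤s (s≤s ())))
   five-or-seven 4 _ _ (s≤s (s≤s (s≤s (s≤s ()))))
   five-or-seven (suc (suc (suc (suc (suc (suc (suc (suc m)))))))) (s≤s (s≤s (s≤s (s≤s (s≤s (s≤s (s≤s (s≤s ())))))))) _ _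
   -- twice the sum of the two elements of multiplicity 7
   seven-seven : ∀ {a b c : Zn² 10} → U ↭ replicate 7 a ++ replicate 7 b ++ replicate 5 c → ⊥
   seven-seven {a} {b} {c} ρ = nonempty (even-zero-sum {a ∷ a ∷ b ∷ b ∷ []} {replicate 5 a ++ replicate 5 b ++ replicate 5 c} (↭-trans ρ rearranged) (s≤s z≤n)
     (trans (⊻-cancel (class a) _) (⊻-cancel (class b) even)) (part (λ x → proj₁ ⟪ x ⟫) (≈-trans (≈-reflexive (sums₁ a b c)) (proj₁ whole)) , part (λ x → proj₂ ⟪ x ⟫) (≈-trans (≈-reflexive (sums₂ a b c)) (proj₂ whole))))
    where
    nonempty : a ∷ a ∷ b ∷ b ∷ [] ≡ [] → ⊥
    nonempty ()
    rearranged : replicate 7 a ++ replicate 7 b ++ replicate 5 c ↭ (a ∷ a ∷ b ∷ b ∷ []) ++ replicate 5 a ++ replicate 5 b ++ replicate 5 c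
    rearranged = prep a (prep a (shifts (replicate 5 a) (b ∷ b ∷ [])))
    whole : Vanishes 5 (Σs (replicate 7 a ++ replicate 7 b ++ replicate 5 c))
    whole = subst (Vanishes 5) (Σ⊕-↭ (map⁺ ⟪_⟫ ρ)) (≈-coarsen (ℕ∣.divides 2 refl) (proj₁ (MinimalZeroSum.zero-sum min)) , ≈-coarsen (ℕ∣.divides 2 refl) (proj₂ (MinimalZeroSum.zero-sum min)))
    sum-lem : ∀ x y z → + 7 * x + (+ 7 * y + + 5 * z) ≡ x + (x + (x + (x + (x + (x + (x + (y + (y + (y + (y + (y + (y + (y + (z + (z + (z + (z + (z + 0ℤ))))))))))))))))))
    sum-lem = solve-∀
    sums₁ : ∀ a b c → + 7 * proj₁ ⟪ a ⟫ + (+ 7 * proj₁ ⟪ b ⟫ + + 5 * proj₁ ⟪ c ⟫) ≡ proj₁ (Σs {10} (replicate 7 a ++ replicate 7 b ++ replicate 5 c))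
    sums₁ a b c = sum-lem (proj₁ ⟪ a ⟫) (proj₁ ⟪ b ⟫) (proj₁ ⟪ c ⟫)
    sums₂ : ∀ a b c → + 7 * proj₂ ⟪ a ⟫ + (+ 7 * proj₂ ⟪ b ⟫ + + 5 * proj₂ ⟪ c ⟫) ≡ proj₂ (Σs {10} (replicate 7 a ++ replicate 7 b ++ replicate 5 c))
    sums₂ a b c = sum-lem (proj₂ ⟪ a ⟫) (proj₂ ⟪ b ⟫) (proj₂ ⟪ c ⟫)
    part : (f : Zn² 10 → ℤ) → + 7 * f a + (+ 7 * f b + + 5 * f c) ≈[ 5 ] 0ℤ → f a + (f a + (f b + (f b + 0ℤ))) ≈[ 5 ] 0ℤ
    part f e = ≈-trans (≈-sym (mod-by (f a + f b + f c) (lem (f a) (f b) (f c)))) e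
     where
     lem : ∀ x y z → + 7 * x + (+ 7 * y + + 5 * z) ≡ x + (x + (y + (y + 0ℤ))) + (x + y + z) * + 5
     lem = solve-∀
   shape : ∀ {a b c} → c₂ ≡ a → c₃ ≡ b → c₁ ≡ c → U ↭ replicate c w ++ replicate a v ++ replicate b g
   shape refl refl refl = σ
   not-15 : 15 ≢ 19
   not-15 ()
   not-17 : 17 ≢ 19
   not-17 ()
   not-21 : 21 ≢ 19
   not-21 ()
   decide : c₂ ≡ 5 ⊎ c₂ ≡ 7 → c₃ ≡ 5 ⊎ c₃ ≡ 7 → c₁ ≡ 5 ⊎ c₁ ≡ 7 → ⊥
   decide (inj₂ a) (inj₁ b) (inj₂ c) = seven-seven (shape a b c)
   decide (inj₁ a) (inj₂ b) (inj₂ c) = seven-seven (↭-trans (shape a b c) (++⁺ˡ (replicate 7 w) (++-comm (replicate 5 v) (replicate 7 g))))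
   decide (inj₂ a) (inj₂ b) (inj₁ c) = seven-seven (↭-trans (shape a b c) (↭-trans (++-comm (replicate 5 w) (replicate 7 v ++ replicate 7 g)) (↭-reflexive (++-assoc (replicate 7 v) (replicate 7 g) (replicate 5 w)))))
   decide (inj₁ a) (inj₁ b) (inj₁ c) = not-15 (trans (sym (cong₂ ℕ._+_ a (cong₂ ℕ._+_ b c))) total)
   decide (inj₁ a) (inj₁ b) (inj₂ c) = not-17 (trans (sym (cong₂ ℕ._+_ a (cong₂ ℕ._+_ b c))) total)
   decide (inj₁ a) (inj₂ b) (inj₁ c) = not-17 (trans (sym (cong₂ ℕ._+_ a (cong₂ ℕ._+_ b c))) total)
   decide (inj₂ a) (inj₁ b) (inj₁ c) = not-17 (trans (sym (cong₂ ℕ._+_ a (cong₂ ℕ._+_ b c))) total)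
   decide (inj₂ a) (inj₂ b) (inj₂ c) = not-21 (trans (sym (cong₂ ℕ._+_ a (cong₂ ℕ._+_ b c))) total)

  NonConstant : K → Set
  NonConstant i = ∃₂ λ x x′ → x ∈ U × x′ ∈ U × class x ≡ i × class x′ ≡ i × x ≢ x′

  -- With Λ = 1 on two classes, `opposite` gives Λ = 0 on the third. If the third class is not
  -- constant, `two-lines` gives 1 there as well; if it is, with odd multiplicity m below 8, then 5
  -- would have to divide 19 - m.
  two-nonconstant-line : ∀ {i j k x x′ y y′} → Triple i j k → x ∈ U → class x ≡ i → y ∈ U → y′ ∈ U → class y ≡ j → class y′ ≡ j → y ≢ y′ → (l : Line i j k x x′) →
           NonConstant k ⊎ (∃ λ g → g ∈ U × class g ≡ k × Constant k g) → Line.Λ l ⟪ y ⟫ ≈[ 5 ] 1ℤ → ⊥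
  two-nonconstant-line {i} {j} {k} {x} {x′} {y} {y′} t x∈ ex y∈ y′∈ ey ey′ y≢y′ l third λy = cases third
   where
   open Line l
   zero-at : ∀ {s} → s ∈ U → class s ≡ k → Λ ⟪ s ⟫ ≈[ 5 ] 0ℤ
   zero-at {s} s∈ es = ≈-trans (≈-reflexive (lem (Λ ⟪ y ⟫) (Λ ⟪ s ⟫))) (≈-trans (+-cong-≈ (opposite y∈ s∈ ey es) (neg-cong-≈ λy)) ≈-refl)
    where
    lem : ∀ y s → s ≡ y + s + - y
    lem = solve-∀
   cases : NonConstant k ⊎ (∃ λ g → g ∈ U × class g ≡ k × Constant k g) → ⊥
   cases (inj₁ (z , z′ , z∈ , z′∈ , ez , ez′ , z≢z′)) = 1≉0 (≈-trans (≈-sym (two-lines (swap₂₃ t) z∈ z′∈ ez ez′ z≢z′ x∈ ex l′)) (zero-at z∈ ez))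
    where
    l′ : Line i k j x x′
    l′ = record { Λ = Λ ; additive = additive ; on-line = on-line ; opposite = λ {a} {b} a∈ b∈ ea eb → ≈-trans (≈-reflexive (ℤₚ.+-comm (Λ ⟪ a ⟫) (Λ ⟪ b ⟫))) (opposite b∈ a∈ eb ea) }
   cases (inj₂ (g , g∈ , eg , const)) = from (gather g U)
    where
    from : (∃ λ r → U ↭ replicate (count g U) g ++ r × All (_≢ g) r) → ⊥
    from (r , π , ne) = impossible-count (count g U) (length r) (odd<8 (few g) m-odd) m-odd
      (trans (cong (ℕ._+ length r) (sym (length-replicate (count g U)))) (trans (sym (length-++ (replicate (count g U) g))) (trans (sym (↭-length π)) U-size)))
      (≈0⇒∣ (≈-trans (≈-sym (≈-trans (Λ-++ {Λ} additive (replicate (count g U) g) r) (≈-trans (+-cong-≈ (≈-trans (additive-replicate {f = Λ} additive (count g U) g) (≈-trans (*-congˡ-≈ (+ count g U) (zero-at g∈ eg)) (≈-reflexive (ℤₚ.*-zeroʳ (+ count g U)))))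
       (sum-ones {Λ} additive r ones)) (≈-reflexive (ℤₚ.+-identityˡ (+ length r)))))) (Λ-total {Λ} additive π)))
     where
     in-U : ∀ {w} → w ∈ r → w ∈ U
     in-U w∈ = ∈-resp-↭ (↭-sym π) (∈-++⁺ʳ (replicate (count g U) g) w∈)
     not-k : ∀ {w} → w ∈ r → class w ≢ k
     not-k w∈ e = All.lookup ne w∈ (const (in-U w∈) e)
     m-odd : odd (count g U) ≡ true
     m-odd = odd-multiplicity (count g U) (swap₁₂ (swap₂₃ t)) π not-k
     λj : ∀ {w} → w ∈ U → class w ≡ j → Λ ⟪ w ⟫ ≈[ 5 ] 1ℤ
     λj {w} w∈ ew = ≈-trans (≈-reflexive (lem (Λ ⟪ w ⟫) (Λ ⟪ g ⟫))) (+-cong-≈ (opposite w∈ g∈ ew eg) (neg-cong-≈ (zero-at g∈ eg)))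
      where
      lem : ∀ w g → w ≡ w + g + - g
      lem = solve-∀
     ones : ∀ {w} → w ∈ r → Λ ⟪ w ⟫ ≈[ 5 ] 1ℤ
     ones {w} w∈ = [ on-line (in-U w∈) , [ λj (in-U w∈) , (λ e → ⊥-elim (not-k w∈ e)) ]′ ]′ (triple-cases t (class w) (no-even (in-U w∈)))
     impossible-count : ∀ m n → m ℕ.< 8 → odd m ≡ true → m ℕ.+ n ≡ 19 → 5 ℕ∣.∣ n → ⊥
     impossible-count 1 .18 _ _ refl d = from-no (5 ℕ∣.∣? 18) d
     impossible-count 3 .16 _ _ refl d = from-no (5 ℕ∣.∣? 16) d
     impossible-count 5 .14 _ _ refl d = from-no (5 ℕ∣.∣? 14) d
     impossible-count 7 .12 _ _ refl d = from-no (5 ℕ∣.∣? 12) d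
     impossible-count 0 _ _ () _ _
     impossible-count 2 _ _ () _ _
     impossible-count 4 _ _ () _ _
     impossible-count 6 _ _ () _ _
     impossible-count (suc (suc (suc (suc (suc (suc (suc (suc m)))))))) _ (s≤s (s≤s (s≤s (s≤s (s≤s (s≤s (s≤s (s≤s ())))))))) _ _ _

  two-nonconstant : ∀ {i j k} → Triple i j k → NonConstant i → NonConstant j → NonConstant k ⊎ (∃ λ g → g ∈ U × class g ≡ k × Constant k g) → ⊥
  two-nonconstant t (x , x′ , x∈ , x′∈ , ex , ex′ , x≢x′) (y , y′ , y∈ , y′∈ , ey , ey′ , y≢y′) third = with-line (line t x∈ x′∈ ex ex′ x≢x′)
   where
   with-line : Line _ _ _ x x′ → ⊥
   with-line l = two-nonconstant-line t x∈ ex y∈ y′∈ ey ey′ y≢y′ l third (two-lines t y∈ y′∈ ey ey′ y≢y′ x∈ ex l)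

  -- The search needs a basis invertible modulo 10. The determinant is odd because the classes
  -- differ, and since Λ(v) is nonzero at most one of x, x′ is parallel to v modulo 5; the other one
  -- serves as u.
  one-line : ∀ fuel → verified-10 fuel ≡ true → ∀ {i j k v g x x′} → Triple i j k → x ∈ U → x′ ∈ U → class x ≡ i → class x′ ≡ i → x ≢ x′ → v ∈ U → g ∈ U → class v ≡ j → class g ≡ k →
        (l : Line i j k x x′) → Split i j k v g → ∀ b → b ℕ.< 5 → + b ≈[ 5 ] Line.Λ l ⟪ v ⟫ → ⊥
  one-line fuel check {i} {j} {k} {v} {g} {x} {x′} t x∈ x′∈ ex ex′ x≢x′ v∈ g∈ ev eg l sp b b<5 b≈ = choose (≈0? 5 (det ⟪ x ⟫ ⟪ v ⟫))
   where
   open Line l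
   open Split sp
   λg : Λ ⟪ g ⟫ ≈[ 5 ] + (6 ∸ b)
   λg = ≈-trans (≈-reflexive (lem (Λ ⟪ v ⟫) (Λ ⟪ g ⟫))) (≈-trans (+-cong-≈ (opposite v∈ g∈ ev eg) (neg-cong-≈ (≈-sym b≈)))
     (≈-trans (≈-sym (mod-by 1ℤ (lem′ (+ b)))) (≈-reflexive (trans (ℤₚ.m-n≡m⊖n 6 b) (ℤₚ.⊖-≥ (ℕₚ.≤-trans (ℕₚ.<⇒≤ b<5) (ℕₚ.n≤1+n 5)))))))
    where
    lem : ∀ v g → g ≡ v + g + - v
    lem = solve-∀
    lem′ : ∀ b → + 6 + - b ≡ 1ℤ + - b + 1ℤ * + 5
    lem′ = solve-∀
   is-admissible : admissible b c₂ c₃ ≡ true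
   is-admissible = ∧-intro c₂-odd (∧-intro c₃-odd (%-value {5} {_} {0} (s≤s z≤n) (≈-trans (≈-reflexive cast) (≈-trans (≈-sym weights) (Λ-total {Λ} additive covers)))))
    where
    cast : + (c₂ ℕ.* b ℕ.+ c₃ ℕ.* (6 ∸ b) ℕ.+ (19 ∸ (c₂ ℕ.+ c₃))) ≡ + c₂ * + b + + c₃ * + (6 ∸ b) + + length C
    cast = trans (ℤₚ.pos-+ (c₂ ℕ.* b ℕ.+ c₃ ℕ.* (6 ∸ b)) _) (cong₂ _+_ (trans (ℤₚ.pos-+ (c₂ ℕ.* b) _) (cong₂ _+_ (ℤₚ.pos-* c₂ b) (ℤₚ.pos-* c₃ (6 ∸ b)))) (cong +_ (sym C-size)))
    weights : Λ (Σs (replicate c₂ v ++ replicate c₃ g ++ C)) ≈[ 5 ] + c₂ * + b + + c₃ * + (6 ∸ b) + + length C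
    weights = ≈-trans (Λ-++ {Λ} additive (replicate c₂ v) (replicate c₃ g ++ C)) (≈-trans (+-cong-≈ (≈-trans (additive-replicate {f = Λ} additive c₂ v) (*-congˡ-≈ (+ c₂) (≈-sym b≈)))
     (≈-trans (Λ-++ {Λ} additive (replicate c₃ g) C) (+-cong-≈ (≈-trans (additive-replicate {f = Λ} additive c₃ g) (*-congˡ-≈ (+ c₃) λg)) (sum-ones {Λ} additive C (λ y∈ → on-line (proj₁ (in-C y∈)) (proj₂ (in-C y∈)))))))
     (≈-reflexive (sym (ℤₚ.+-assoc (+ c₂ * + b) (+ c₃ * + (6 ∸ b)) (+ length C)))))
   λv≉0 : ¬ (Λ ⟪ v ⟫ ≈[ 5 ] 0ℤ)
   λv≉0 z = clash (residue-unique b<5 (s≤s z≤n) (≈-trans b≈ z))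
    where
    absurd : ∀ {a} → not a ≡ true → a ≡ true → ⊥
    absurd {true} () _
    clash : b ≡ 0 → ⊥
    clash b≡0 = absurd (below-sound 8 (excluded-0 c₂) (below-sound 8 (λ c₂ → below 8 (excluded-0 c₂)) nonzero-value c₂<8) c₃<8) (subst (λ b → admissible b c₂ c₃ ≡ true) b≡0 is-admissible)
   completions : all-true (no-completion fuel b c₂ c₃) (E10.points (third-class b)) ≡ true
   completions = implied (admissible b c₂ c₃) is-admissible (below-sound 8 (excluded-or-verified fuel b c₂) (below-sound 8 (λ c₂ → below 8 (excluded-or-verified fuel b c₂)) (below-sound 5 (λ b → below 8 (λ c₂ → below 8 (excluded-or-verified fuel b c₂))) check b<5) c₂<8) c₃<8)
    where
    implied : ∀ a {d} → a ≡ true → not a ∨ d ≡ true → d ≡ true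
    implied true _ e = e
   multiple-of-v : ∀ {y} → det ⟪ y ⟫ ⟪ v ⟫ ≈[ 5 ] 0ℤ → ∃ λ β → ⟪ y ⟫ ≈²[ 5 ] β · ⟪ v ⟫
   multiple-of-v {y} z = dependent ⟪ v ⟫ ⟪ y ⟫ (λ w → λv≉0 (additive-vanishes {f = Λ} additive ⟪ v ⟫ w)) (≈-trans (≈-reflexive (antisymmetric (proj₁ ⟪ v ⟫) (proj₂ ⟪ v ⟫) (proj₁ ⟪ y ⟫) (proj₂ ⟪ y ⟫))) (neg-cong-≈ z))
    where
    antisymmetric : ∀ a b c d → a * d + - (b * c) ≡ - (c * b + - (d * a))
    antisymmetric = solve-∀
   not-both : det ⟪ x ⟫ ⟪ v ⟫ ≈[ 5 ] 0ℤ → det ⟪ x′ ⟫ ⟪ v ⟫ ≈[ 5 ] 0ℤ → ⊥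
   not-both z z′ = compare (multiple-of-v {x} z) (multiple-of-v {x′} z′)
    where
    multiplier : ∀ {y} β → ⟪ y ⟫ ≈²[ 5 ] β · ⟪ v ⟫ → y ∈ U → class y ≡ i → Λ ⟪ v ⟫ * β ≈[ 5 ] 1ℤ
    multiplier {y} β e y∈ ey = ≈-trans (≈-reflexive (ℤₚ.*-comm (Λ ⟪ v ⟫) β)) (≈-trans (≈-sym (additive-multiple {f = Λ} additive β ⟪ v ⟫)) (≈-trans (≈-sym (additive-cong {f = Λ} additive {⟪ y ⟫} {β · ⟪ v ⟫} e)) (on-line y∈ ey)))
    compare : (∃ λ β → ⟪ x ⟫ ≈²[ 5 ] β · ⟪ v ⟫) → (∃ λ β → ⟪ x′ ⟫ ≈²[ 5 ] β · ⟪ v ⟫) → ⊥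
    compare (β , e) (β′ , e′) = x≢x′ (equal-mod-10 (trans ex (sym ex′)) (transfer (proj₁ ⟪ v ⟫) (proj₁ e) (proj₁ e′) , transfer (proj₂ ⟪ v ⟫) (proj₂ e) (proj₂ e′)))
     where
     β≈ : β ≈[ 5 ] β′
     β≈ = cancel-≈ (Λ ⟪ v ⟫) λv≉0 (≈-trans (multiplier {x} β e x∈ ex) (≈-sym (multiplier {x′} β′ e′ x′∈ ex′)))
     transfer : ∀ {a b} w → a ≈[ 5 ] β * w → b ≈[ 5 ] β′ * w → a ≈[ 5 ] b
     transfer w ea eb = ≈-trans ea (≈-trans (*-cong-≈ β≈ (≈-refl {a = w})) (≈-sym eb))

   module WithUnit {u : Zn² 10} (u∈ : u ∈ U) (eu : class u ≡ i) (i₀ : ℤ) (di : det ⟪ u ⟫ ⟪ v ⟫ * i₀ ≈[ 10 ] 1ℤ) where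
    open Coordinates {10} {⟪ u ⟫} {⟪ v ⟫} i₀ di
    module C₂ = Coordinates {2} {⟪ u ⟫} {⟪ v ⟫} i₀ (≈-coarsen (ℕ∣.divides 5 refl) di)
    open ChangeBasis {10} u v i₀ di

    cv : c v ≡ e₂-10
    cv = ⟪⟫-injective (≈-trans (proj₁ (c-value v)) αv , ≈-trans (proj₂ (c-value v)) βv)

    value-of : ∀ y → + toℕ (proj₁ (c y)) + + b * + toℕ (proj₂ (c y)) ≈[ 5 ] Λ ⟪ y ⟫
    value-of y = ≈-trans (+-cong-≈ (≈-coarsen (ℕ∣.divides 2 refl) (proj₁ (c-value y))) (*-cong-≈ b≈ (≈-coarsen (ℕ∣.divides 2 refl) (proj₂ (c-value y)))))
     (≈-sym (≈-trans (additive-cong {f = Λ} additive {⟪ y ⟫} (≈-coarsen (ℕ∣.divides 2 refl) (proj₁ (cramer ⟪ y ⟫)) , ≈-coarsen (ℕ∣.divides 2 refl) (proj₂ (cramer ⟪ y ⟫))))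
      (≈-trans (additive-combination {f = Λ} additive (α ⟪ y ⟫) (β ⟪ y ⟫) ⟪ u ⟫ ⟪ v ⟫) (+-cong-≈ (≈-trans (*-congˡ-≈ (α ⟪ y ⟫) (on-line u∈ eu)) (≈-reflexive (ℤₚ.*-identityʳ (α ⟪ y ⟫)))) (≈-reflexive (ℤₚ.*-comm (β ⟪ y ⟫) (Λ ⟪ v ⟫)))))))

    coordinate-cast : ∀ y → + (toℕ (proj₁ (c y)) ℕ.+ b ℕ.* toℕ (proj₂ (c y))) ≡ + toℕ (proj₁ (c y)) + + b * + toℕ (proj₂ (c y))
    coordinate-cast y = trans (ℤₚ.pos-+ (toℕ (proj₁ (c y))) _) (cong (λ z → + toℕ (proj₁ (c y)) + z) (ℤₚ.pos-* b (toℕ (proj₂ (c y)))))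

    parity : ∀ {y} → class y ≡ i → (α ⟪ y ⟫ ≈[ 2 ] 1ℤ) × (β ⟪ y ⟫ ≈[ 2 ] 0ℤ)
    parity {y} ey = ≈-trans (C₂.α-cong same) C₂.αu , ≈-trans (C₂.β-cong same) C₂.βu
     where
     same : ⟪ y ⟫ ≈²[ 2 ] ⟪ u ⟫
     same = ≈-trans (odd-≈ (toℕ (proj₁ y))) (≈-trans (≈-reflexive (cong (λ k → value (proj₁ k)) (trans ey (sym eu)))) (≈-sym (odd-≈ (toℕ (proj₁ u)))))
        , ≈-trans (odd-≈ (toℕ (proj₂ y))) (≈-trans (≈-reflexive (cong (λ k → value (proj₂ k)) (trans ey (sym eu)))) (≈-sym (odd-≈ (toℕ (proj₂ u)))))

    parity-g : (α ⟪ g ⟫ ≈[ 2 ] 1ℤ) × (β ⟪ g ⟫ ≈[ 2 ] 1ℤ)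
    parity-g = ≈-trans (C₂.α-cong same) (≈-trans (C₂.α-additive ⟪ u ⟫ ⟪ v ⟫) (+-cong-≈ C₂.αu C₂.αv)) , ≈-trans (C₂.β-cong same) (≈-trans (C₂.β-additive ⟪ u ⟫ ⟪ v ⟫) (+-cong-≈ C₂.βu C₂.βv))
     where
     third : ∀ {i j k} → Triple i j k → k ≡ i ⊻ j
     third t₁₂₃ = refl
     third t₁₃₂ = refl
     third t₂₁₃ = refl
     third t₂₃₁ = refl
     third t₃₁₂ = refl
     third t₃₂₁ = refl
     class-g : class g ≡ class u ⊻ class v
     class-g = trans eg (trans (third t) (sym (cong₂ _⊻_ eu ev)))
     same : ⟪ g ⟫ ≈²[ 2 ] ⟪ u ⟫ ⊕ ⟪ v ⟫
     same = ≈-trans (odd-≈ (toℕ (proj₁ g))) (≈-trans (≈-reflexive (cong (λ k → value (proj₁ k)) class-g)) (≈-sym (≈-trans (+-cong-≈ (odd-≈ (toℕ (proj₁ u))) (odd-≈ (toℕ (proj₁ v)))) (value-xor (odd (toℕ (proj₁ u))) (odd (toℕ (proj₁ v)))))))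
        , ≈-trans (odd-≈ (toℕ (proj₂ g))) (≈-trans (≈-reflexive (cong (λ k → value (proj₂ k)) class-g)) (≈-sym (≈-trans (+-cong-≈ (odd-≈ (toℕ (proj₂ u))) (odd-≈ (toℕ (proj₂ v)))) (value-xor (odd (toℕ (proj₂ u))) (odd (toℕ (proj₂ v)))))))

    residue-2 : ∀ y {n a} (f : G → ℤ) → n ℕ.< 2 → + a ≈[ 10 ] f ⟪ y ⟫ → f ⟪ y ⟫ ≈[ 2 ] + n → (a % 2 ≡ᵇ n) ≡ true
    residue-2 y f n<2 e e′ = %-value n<2 (≈-trans (≈-coarsen (ℕ∣.divides 5 refl) e) e′)

    in-first : ∀ {y} → y ∈ U → class y ≡ i → first-class b (c y) ≡ true
    in-first {y} y∈ ey = ∧-intro (residue-2 y α (s≤s (s≤s z≤n)) (proj₁ (c-value y)) (proj₁ (parity {y} ey))) (∧-intro (residue-2 y β (s≤s z≤n) (proj₂ (c-value y)) (proj₂ (parity {y} ey)))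
     (%-value {5} {_} {1} (s≤s (s≤s z≤n)) (≈-trans (≈-reflexive (coordinate-cast y)) (≈-trans (value-of y) (on-line y∈ ey)))))

    in-third : third-class b (c g) ≡ true
    in-third = ∧-intro (residue-2 g α (s≤s (s≤s z≤n)) (proj₁ (c-value g)) (proj₁ parity-g)) (∧-intro (residue-2 g β (s≤s (s≤s z≤n)) (proj₂ (c-value g)) (proj₂ parity-g))
     (%-value {5} {_} {1} (s≤s (s≤s z≤n)) (≈-trans (≈-reflexive (trans (ℤₚ.pos-+ (toℕ (proj₁ (c g)) ℕ.+ b ℕ.* toℕ (proj₂ (c g))) b) (cong (_+ + b) (coordinate-cast g))))
      (≈-trans (+-cong-≈ (value-of g) b≈) (≈-trans (≈-reflexive (ℤₚ.+-comm (Λ ⟪ g ⟫) (Λ ⟪ v ⟫))) (opposite v∈ g∈ ev eg))))))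

    n : ℕ
    n = c₂ ∸ 1

    W : List (Zn² 10)
    W = replicate n v ++ replicate c₃ g ++ C

    all-of-U : U ↭ v ∷ W
    all-of-U = ↭-trans covers (↭-reflexive (cong (λ m → replicate m v ++ replicate c₃ g ++ C) (predecessor c₂ c₂-odd)))
     where
     predecessor : ∀ m → odd m ≡ true → m ≡ suc (m ∸ 1)
     predecessor (suc m) _ = refl

    free : ZeroFree 10 (map ⟪_⟫ (map c W))
    free = c-free {W} (minimal⇒free (minimal-↭ (map⁺ ⟪_⟫ all-of-U) min))

    image-W : map c W ≡ replicate n e₂-10 ++ replicate c₃ (c g) ++ map c C
    image-W = trans (map-++ c (replicate n v) (replicate c₃ g ++ C)) (cong₂ _++_ (trans (map-replicate c n v) (cong (replicate n) cv))
     (trans (map-++ c (replicate c₃ g) C) (cong (_++ map c C) (map-replicate c c₃ g))))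

    count-C : ∀ h → count h (map c C) ℕ.≤ 8
    count-C h = bounded C h (λ {w} _ _ → ℕₚ.+-cancelʳ-≤ 2 (count w C) 8 (count-suffix {replicate c₂ v ++ replicate c₃ g} (↭-trans covers (↭-reflexive (sym (++-assoc (replicate c₂ v) (replicate c₃ g) C)))) w))

    good-C : ∀ {h} → h ∈ map c C → first-class b h ≡ true
    good-C h∈ = from (∈-map⁻ c h∈)
     where
     from : ∀ {h} → (∃ λ y → y ∈ C × h ≡ c y) → first-class b h ≡ true
     from (y , y∈ , refl) = in-first (proj₁ (in-C y∈)) (proj₂ (in-C y∈))

    contradiction : ⊥
    contradiction = completion-impossible fuel b c₂ c₃ (c g) (map c C)
     (all-true-sound (no-completion fuel b c₂ c₃) (E10.points (third-class b)) completions {c g} (E10.point (third-class b) {c g} (subst T (sym in-third) tt)))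
     (subst (λ l → ZeroFree 10 (map ⟪_⟫ l)) image-W (λ {S} → free {S})) good-C count-C (trans (length-map c C) C-size)

   det-odd : ∀ {u} → class u ≡ i → ¬ (det ⟪ u ⟫ ⟪ v ⟫ ≈[ 2 ] 0ℤ)
   det-odd {u} eu z = table t (≈-trans (≈-sym (+-cong-≈ (*-cong-≈ (at₁ u eu) (at₂ v ev)) (neg-cong-≈ (*-cong-≈ (at₂ u eu) (at₁ v ev))))) z)
    where
    at₁ : ∀ y {k} → class y ≡ k → proj₁ ⟪ y ⟫ ≈[ 2 ] value (proj₁ k)
    at₁ y e = ≈-trans (odd-≈ (toℕ (proj₁ y))) (≈-reflexive (cong (λ k → value (proj₁ k)) e))
    at₂ : ∀ y {k} → class y ≡ k → proj₂ ⟪ y ⟫ ≈[ 2 ] value (proj₂ k)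
    at₂ y e = ≈-trans (odd-≈ (toℕ (proj₂ y))) (≈-reflexive (cong (λ k → value (proj₂ k)) e))
    table : ∀ {i j k} → Triple i j k → ¬ (value (proj₁ i) * value (proj₂ j) + - (value (proj₂ i) * value (proj₁ j)) ≈[ 2 ] 0ℤ)
    table t₁₂₃ = from-no (≈0? 2 1ℤ)
    table t₁₃₂ = from-no (≈0? 2 1ℤ)
    table t₂₁₃ = from-no (≈0? 2 (- 1ℤ))
    table t₂₃₁ = from-no (≈0? 2 (- 1ℤ))
    table t₃₁₂ = from-no (≈0? 2 (- 1ℤ))
    table t₃₂₁ = from-no (≈0? 2 1ℤ)
   with-u : ∀ {u} → u ∈ U → class u ≡ i → ¬ (det ⟪ u ⟫ ⟪ v ⟫ ≈[ 5 ] 0ℤ) → ⊥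
   with-u {u} u∈ eu d≉0 = by-residue (reduce 10 (det ⟪ u ⟫ ⟪ v ⟫))
    where
    by-residue : (∃ λ r → + toℕ r ≈[ 10 ] det ⟪ u ⟫ ⟪ v ⟫) → ⊥
    by-residue (r , r≈d) = [ (λ z → det-odd {u} eu (≈-trans (≈-sym (≈-coarsen (ℕ∣.divides 5 refl) r≈d)) z))
     , [ (λ z → d≉0 (≈-trans (≈-sym (≈-coarsen (ℕ∣.divides 2 refl) r≈d)) z))
      , (λ { (i₀ , e) → WithUnit.contradiction u∈ eu (+ toℕ i₀) (≈-trans (*-cong-≈ (≈-sym r≈d) (≈-refl {a = + toℕ i₀})) e) }) ]′ ]′ (units-10 r)
   choose : Dec (det ⟪ x ⟫ ⟪ v ⟫ ≈[ 5 ] 0ℤ) → ⊥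
   choose (no d≉0) = with-u x∈ ex d≉0
   choose (yes z) = with-u x′∈ ex′ (not-both z)

  one-nonconstant : ∀ fuel → verified-10 fuel ≡ true → ∀ {i j k v g} → Triple i j k → NonConstant i → v ∈ U → g ∈ U → class v ≡ j → class g ≡ k → Constant j v → Constant k g → ⊥
  one-nonconstant fuel check {v = v} t (x , x′ , x∈ , x′∈ , ex , ex′ , x≢x′) v∈ g∈ ev eg const-v const-g = with-line (line t x∈ x′∈ ex ex′ x≢x′)
   where
   with-line : Line _ _ _ x x′ → ⊥
   with-line l = with-residue (reduce 5 (Line.Λ l ⟪ v ⟫))
    where
    with-residue : (∃ λ r → + toℕ r ≈[ 5 ] Line.Λ l ⟪ v ⟫) → ⊥
    with-residue (r , r≈) = one-line fuel check t x∈ x′∈ ex ex′ x≢x′ v∈ g∈ ev eg l (split-classes t const-v const-g ev eg) (toℕ r) (toℕ<n r) r≈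

  class? : ∀ (k k′ : K) → Dec (k ≡ k′)
  class? = ≡-dec Boolₚ._≟_ Boolₚ._≟_

  Values : K → Set
  Values i = NonConstant i ⊎ (∃ λ g → g ∈ U × class g ≡ i × Constant i g)

  values : ∀ {i j k} → Triple i j k → Values i
  values {i} t = from (present t)
   where
   from : (∃ λ x → x ∈ U × class x ≡ i) → Values i
   from (x , x∈ , ex) = [ (λ { (y , y∈ , ey , y≢x) → inj₁ (y , x , y∈ , x∈ , ey , ex , y≢x) })
    , (λ none → inj₂ (x , x∈ , ex , (λ {y} y∈ ey → decidable-stable (y ≟² x) (λ y≢x → none y∈ (ey , y≢x))))) ]′ (search (λ y → class? (class y) i ×-dec ¬? (y ≟² x)) U)

  ten-contradiction : ∀ fuel → verified-10 fuel ≡ true → ⊥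
  ten-contradiction fuel check = cases (values t₁₂₃) (values t₂₁₃) (values t₃₁₂)
   where
   cases : Values (true , false) → Values (false , true) → Values (true , true) → ⊥
   cases (inj₁ n₁) (inj₁ n₂) v₃ = two-nonconstant t₁₂₃ n₁ n₂ v₃
   cases (inj₁ n₁) (inj₂ v₂) (inj₁ n₃) = two-nonconstant t₁₃₂ n₁ n₃ (inj₂ v₂)
   cases (inj₂ v₁) (inj₁ n₂) (inj₁ n₃) = two-nonconstant t₂₃₁ n₂ n₃ (inj₂ v₁)
   cases (inj₁ n₁) (inj₂ (v , v∈ , ev , cv)) (inj₂ (g , g∈ , eg , cg)) = one-nonconstant fuel check t₁₂₃ n₁ v∈ g∈ ev eg cv cg
   cases (inj₂ (v , v∈ , ev , cv)) (inj₁ n₂) (inj₂ (g , g∈ , eg , cg)) = one-nonconstant fuel check t₂₁₃ n₂ v∈ g∈ ev eg cv cg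
   cases (inj₂ (v , v∈ , ev , cv)) (inj₂ (g , g∈ , eg , cg)) (inj₁ n₃) = one-nonconstant fuel check t₃₁₂ n₃ v∈ g∈ ev eg cv cg
   cases (inj₂ (w , w∈ , ew , cw)) (inj₂ (v , v∈ , ev , cv)) (inj₂ (g , g∈ , eg , cg)) = constant-split t₁₂₃ cw ev eg (split-classes t₁₂₃ cv cg ev eg)

-- Assembling the prime case and the three moduli

module Conclusion where

 open TranslationRing
 open GroupAlgebras
 open MultilinearForms
 open QuarticForm
 open QuarticClassification
 open ZeroSumSequences
 open ResidueVectors
 open PrimeFields
 open ThreeDistinctValues
 open PrimeModulus
 open SearchSoundness
 open SearchSetup
 open SearchResults
 open PrimePowerModulus
 open ModuliEightNine
 open ParityBlocks
 open ParityLinesTen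
 open ModulusTen
 open import Data.Bool using (true; T)
 open import Data.Nat as ℕ using (ℕ; zero; suc; _∸_; s≤s; z≤n)
 open import Data.Integer using (ℤ; +_; _+_; _*_; -_; _-_; 0ℤ; 1ℤ)
 open import Data.Fin as Fin using (Fin; toℕ)
 open import Data.List using (_∷_; length; tabulate)
 open import Data.List.Properties using (length-tabulate)
 open import Data.List.Relation.Unary.All as All using (_∷_)
 open import Data.List.Relation.Unary.Any as Any using (here)
 open import Data.List.Relation.Binary.Sublist.Propositional using (_∷_)
 open import Data.List.Relation.Binary.Permutation.Propositional.Properties using (shift)
 open import Relation.Nullary.Decidable using (from-yes; from-no; decidable-stable)
 open import Data.Nat.Primality using (Prime; prime?; prime⇒nonZero)

 few-with-extra : ∀ {n k} (A : Multiset n k) → (∀ x → mult A x ℕ.+ 3 ℕ.≤ n) → ∀ e x → count x (e ∷ tabulate A) ℕ.+ 2 ℕ.≤ n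
 few-with-extra {n} A small e x = ℕₚ.≤-trans (ℕₚ.+-monoˡ-≤ 2 (one-more (e ≟² x))) (ℕₚ.≤-trans (ℕₚ.≤-reflexive (sym (ℕₚ.+-suc (count x (tabulate A)) 2))) (few-copies A small x))
  where
  one-more : ∀ {B : Set} (d : Dec B) {m} → increment d m ℕ.≤ suc m
  one-more (yes _) = ℕₚ.≤-refl
  one-more (no _)  = ℕₚ.n≤1+n _

 core-10 : ∀ fuel → verified-10 fuel ≡ true → Core 10
 core-10 fuel check A free small = conclude (completion A free)
  where
  conclude : Completion 10 18 A → ⊥
  conclude c = TenCore.ten-contradiction (groupAlgebra 5 5) {extra ∷ tabulate A} (cong suc (length-tabulate A)) minimal (few-with-extra A small extra) fuel check
   where open Completion c

 core-prime : ∀ {p} → Prime p → 5 ℕ.≤ p → Core p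
 core-prime {p} pp 5≤p A free small = conclude (completion {{prime⇒nonZero pp}} A free)
  where
  size : suc (2 ℕ.* p ∸ 2) ≡ p ℕ.+ p ∸ 1
  size = trans (shifted (2 ℕ.* p) (ℕₚ.≤-trans (s≤s (s≤s z≤n)) (ℕₚ.≤-trans 5≤p (ℕₚ.m≤m+n p _)))) (cong (λ m → p ℕ.+ m ∸ 1) (ℕₚ.+-identityʳ p))
   where
   shifted : ∀ n → 2 ℕ.≤ n → suc (n ∸ 2) ≡ n ∸ 1
   shifted (suc (suc n)) _ = refl
   shifted (suc zero) (s≤s ())
  conclude : Completion p (2 ℕ.* p ∸ 2) A → ⊥
  conclude c = PrimeCore.prime-contradiction pp (groupAlgebra p (p ℕ.^ 1)) 5≤p (extra ∷ tabulate A) (trans (cong suc (length-tabulate A)) size) minimal (few-with-extra A small extra)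
   where open Completion c

 -- For p = 2 the bound on multiplicities is absurd, for p = 3 it makes all of them zero although
 -- the sequence is nonempty, and 4 is not prime.
 five-or-more : ∀ {p} → Prime p → (A : Multiset p (2 ℕ.* p ∸ 2)) → (∀ x → mult A x ℕ.+ 3 ℕ.≤ p) → (Fin p × Fin p) → 5 ℕ.≤ p
 five-or-more {0} pp A small (() , _)
 five-or-more {1} pp A small a with ℕₚ.≤-trans (ℕₚ.m≤n+m 3 (mult A a)) (small a)
 ... | s≤s ()
 five-or-more {2} pp A small a with ℕₚ.≤-trans (ℕₚ.m≤n+m 3 (mult A a)) (small a)
 ... | s≤s (s≤s ())
 five-or-more {3} pp A small a = ⊥-elim (ℕₚ.<⇒≱ (count-present {x = A Fin.zero} {l = tabulate A} (here refl)) (ℕₚ.+-cancelʳ-≤ 3 (count (A Fin.zero) (tabulate A)) 0 (few-copies A small (A Fin.zero))))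
 five-or-more {4} pp A small a = ⊥-elim (from-no (prime? 4) pp)
 five-or-more {suc (suc (suc (suc (suc p))))} pp A small a = s≤s (s≤s (s≤s (s≤s (s≤s z≤n))))

 check-10 : verified-10 1000 ≡ true
 check-10 = refl

 units-8 : ∀ (r : Fin 8) → (+ toℕ r ≈[ 2 ] 0ℤ) ⊎ (∃ λ i → + toℕ r * i ≈[ 8 ] 1ℤ)
 units-8 = units 2 8 (from-yes (units? 2 8))

 units-9 : ∀ (r : Fin 9) → (+ toℕ r ≈[ 3 ] 0ℤ) ⊎ (∃ λ i → + toℕ r * i ≈[ 9 ] 1ℤ)
 units-9 = units 3 9 (from-yes (units? 3 9))

 theorem3 :
   ((p : ℕ) → Prime p → (A : Multiset p (2 ℕ.* p ∸ 2)) →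
    (a b c : Zn² p) → a ≢ b → a ≢ c → b ≢ c →
    (∀ x → mult A x ℕ.≤ mult A a) →
    (∀ x → x ≢ a → mult A x ℕ.≤ mult A b) →
    (∀ x → x ≢ a → x ≢ b → mult A x ℕ.≤ mult A c) →
    mult A a ℕ.+ 3 ℕ.≤ p →
    (p ℕ.≤ 23
     ⊎ (2 ℕ.* p ℕ.≤ 3 ℕ.* mult A b × 2 ℕ.* p ℕ.≤ mult A a ℕ.+ mult A b ℕ.+ 14)
     ⊎ (p ℕ.≤ 37 × 2 ℕ.* p ℕ.≤ mult A a ℕ.+ mult A b ℕ.+ mult A c ℕ.+ 5)) →
    HasZeroSum A)
   × PropertyB 8 × PropertyB 9 × PropertyB 10
 theorem3 = prime-case
  , core⇒propertyB 8 (s≤s (s≤s (s≤s z≤n))) (Eight.core-8 (groupAlgebra 2 8) units-8 1000 check-8)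
  , core⇒propertyB 9 (s≤s (s≤s (s≤s z≤n))) (Nine.core-9 (groupAlgebra 3 9) units-9 1000 check-9)
  , core⇒propertyB 10 (s≤s (s≤s (s≤s z≤n))) (core-10 1000 check-10)
  where
  prime-case : (p : ℕ) → Prime p → (A : Multiset p (2 ℕ.* p ∸ 2)) → (a b c : Zn² p) → a ≢ b → a ≢ c → b ≢ c →
    (∀ x → mult A x ℕ.≤ mult A a) → (∀ x → x ≢ a → mult A x ℕ.≤ mult A b) → (∀ x → x ≢ a → x ≢ b → mult A x ℕ.≤ mult A c) → mult A a ℕ.+ 3 ℕ.≤ p →
    (p ℕ.≤ 23 ⊎ (2 ℕ.* p ℕ.≤ 3 ℕ.* mult A b × 2 ℕ.* p ℕ.≤ mult A a ℕ.+ mult A b ℕ.+ 14) ⊎ (p ℕ.≤ 37 × 2 ℕ.* p ℕ.≤ mult A a ℕ.+ mult A b ℕ.+ mult A c ℕ.+ 5)) →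
    HasZeroSum A
  -- The bound on the largest multiplicity passes to every element, and decidability turns the
  -- refutation of zero-sum freeness into a zero-sum.
  prime-case p pp A a b c _ _ _ largest _ _ small _ = decidable-stable (hasZeroSum? A) (λ free → core-prime pp (five-or-more pp A bounded-all a) A free bounded-all)
   where
   bounded-all : ∀ x → mult A x ℕ.+ 3 ℕ.≤ p
   bounded-all x = ℕₚ.≤-trans (ℕₚ.+-monoˡ-≤ 3 (largest x)) small

open import Data.Nat using (ℕ; _+_; _∸_; _*_; _≤_)
open import Data.Nat.Primality using (Prime)
open import Data.Product using (_×_)
open import Data.Sum using (_⊎_)
open import Relation.Binary.PropositionalEquality using (_≢_)

theorem3 :
  ((p : ℕ) → Prime p → (A : Multiset p (2 * p ∸ 2)) →
    (a b c : Zn² p) → a ≢ b → a ≢ c → b ≢ c →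
    (∀ x → mult A x ≤ mult A a) →
    (∀ x → x ≢ a → mult A x ≤ mult A b) →
    (∀ x → x ≢ a → x ≢ b → mult A x ≤ mult A c) →
    mult A a + 3 ≤ p →
    (p ≤ 23
      ⊎ (2 * p ≤ 3 * mult A b × 2 * p ≤ mult A a + mult A b + 14)
      ⊎ (p ≤ 37 × 2 * p ≤ mult A a + mult A b + mult A c + 5)) →
    HasZeroSum A)
  × PropertyB 8 × PropertyB 9 × PropertyB 10
theorem3 = Conclusion.theorem3
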